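{- For every fixed constant $\epsilon\in(0,1]$, both Green Bin Packing (GBP) and Constrained Green Bin Packing (CGBP), with $\beta$, $G$ (and $U$ for CGBP) being part of the input, admit an APTAS. More precisely, for each of the two problems there is an algorithm, running in time polynomial in the input size, that on every instance $\mathcal{I}$ produces a set of polynomially many packings of $\mathcal{I}$ containing a packing $\sigma$ with $$b(\sigma)\le(1+\epsilon)\,b(\sigma^*)+1\quad\text{and}\quad E(\sigma)\le E(\sigma^*),$$ where $\sigma^*$ is an optimal packing of the instance having minimum energy consumption among all optimal packings. Consequently, for GBP, returning a produced packing of minimum objective value $b+E$ gives a packing of objective value at most $(1+\epsilon)\,OPT(\mathcal{I})+1$; and for CGBP, returning a produced packing with the fewest bins among those of energy at most $U$ gives a feasible packing using at most $(1+\epsilon)\,OPT(\mathcal{I})+1$ bins. Here $OPT(\mathcal{I})$ is the optimal objective value of the respective problem.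
   Context: Items and packings. There are $n$ items $\mathcal{I}=\{1,\dots,n\}$ with sizes $s_i\in(0,1]$, and parameters $\beta\ge 0$, $G\in[0,1]$. A packing $\sigma$ assigns every item to one of finitely many bins of capacity $1$ so that the load (total size of the items) of each bin is at most $1$. The energy consumed by a bin of load $x$ is $f_{\beta,G}(x)=\max\{0,\beta(x-G)\}$. Write $b(\sigma)$ for the number of bins used by $\sigma$ and $E(\sigma)$ for its total energy consumption, summed over all bins. GBP: given $\mathcal{I},\beta,G$, find a packing minimizing $b(\sigma)+E(\sigma)$. CGBP: given $\mathcal{I},\beta,G$ and $U\ge\sum_{i=1}^n f_{\beta,G}(s_i)$, find a packing minimizing $b(\sigma)$ subject to $E(\sigma)\le U$. An APTAS for a minimization problem is a family of algorithms such that for each fixed $0<\epsilon\le 1$ it contains an algorithm $A$, running in time polynomial in the input size, with $A(I)\le(1+\epsilon)OPT(I)+\gamma$ for all instances $I$, for some $\gamma\ge 0$ independent of the instance; $A(I)$ is the objective value of the output.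
   Formalization: The item sizes, β, G and U of an instance are rational numbers (encoded in binary) rather than arbitrary reals, and ε is rational, which loses nothing since the bounds are monotone in ε. -}

module Defs where

open import Data.Nat as ℕ using (ℕ; zero; suc)
open import Data.Nat.Binary using (ℕᵇ; 2[1+_]; 1+[2_])
import Data.Nat.Binary as ℕᵇ
open import Data.Integer using (ℤ; +_; -[1+_])
open import Data.Rational using (ℚ; 0ℚ; 1ℚ; _+_; _-_; _*_; _⊔_; _≤_; _<_; _/_; ↥_; ↧ₙ_)
open import Data.Rational.Properties using (+-0-commutativeMonoid)
open import Algebra.Properties.CommutativeMonoid.Sum +-0-commutativeMonoid using (sum)
open import Data.Fin using (Fin; toℕ)
open import Data.Fin.Properties using (_≟_; any?)
open import Data.Bool using (if_then_else_)
open import Data.List using (List; []; _∷_; length; filter; allFin)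
open import Data.List.Membership.Propositional using (_∈_)
import Data.Vec.Functional as Vector
open import Data.Product using (Σ; Σ-syntax; ∃; ∃-syntax; _×_; _,_)
open import Data.Unit using (⊤)
open import Relation.Nullary using (does)
open import Relation.Binary.PropositionalEquality using (_≡_)

-- Model of computation: a point-free form of Jones's WHILE language over
-- binary trees.  Every evaluation step costs one more than the size of its
-- argument, so copying is paid for, the size of an output is at most the cost
-- of computing it, and polynomial cost agrees with polynomial time on Turing
-- machines.

infixr 5 _∙_

data Tree : Set where
  leaf : Tree
  _∙_  : Tree → Tree → Tree

size : Tree → ℕ
size leaf    = 1
size (x ∙ y) = suc (size x ℕ.+ size y)

-- A test succeeds when it evaluates to something other than a leaf.
data Program : Set where
  skip hd tl mkLeaf : Program
  ⟨_,_⟩             : Program → Program → Program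
  _⨾_               : Program → Program → Program
  ifP_then_else_    : Program → Program → Program → Program
  while_loop_       : Program → Program → Program

left right : Tree → Tree
left leaf     = leaf
left (x ∙ _)  = x
right leaf    = leaf
right (_ ∙ y) = y

step : Tree → ℕ
step x = suc (size x)

infix 4 _⊢_⇓_cost_

-- p ⊢ x ⇓ y cost t : on input x, program p halts with output y at cost t.
data _⊢_⇓_cost_ : Program → Tree → Tree → ℕ → Set where
  ⇓skip : ∀ {x} → skip ⊢ x ⇓ x cost step x
  ⇓hd   : ∀ {x} → hd ⊢ x ⇓ left x cost step x
  ⇓tl   : ∀ {x} → tl ⊢ x ⇓ right x cost step x
  ⇓leaf : ∀ {x} → mkLeaf ⊢ x ⇓ leaf cost step x
  ⇓pair : ∀ {p q x y z s t} →
          p ⊢ x ⇓ y cost s → q ⊢ x ⇓ z cost t →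
          ⟨ p , q ⟩ ⊢ x ⇓ y ∙ z cost step x ℕ.+ s ℕ.+ t
  ⇓seq  : ∀ {p q x y z s t} →
          p ⊢ x ⇓ y cost s → q ⊢ y ⇓ z cost t →
          p ⨾ q ⊢ x ⇓ z cost step x ℕ.+ s ℕ.+ t
  ⇓then : ∀ {c p q x a b y s t} →
          c ⊢ x ⇓ a ∙ b cost s → p ⊢ x ⇓ y cost t →
          ifP c then p else q ⊢ x ⇓ y cost step x ℕ.+ s ℕ.+ t
  ⇓else : ∀ {c p q x y s t} →
          c ⊢ x ⇓ leaf cost s → q ⊢ x ⇓ y cost t →
          ifP c then p else q ⊢ x ⇓ y cost step x ℕ.+ s ℕ.+ t
  ⇓stop : ∀ {c p x s} →
          c ⊢ x ⇓ leaf cost s →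
          while c loop p ⊢ x ⇓ x cost step x ℕ.+ s
  ⇓loop : ∀ {c p x a b y z s t u} →
          c ⊢ x ⇓ a ∙ b cost s → p ⊢ x ⇓ y cost t →
          while c loop p ⊢ y ⇓ z cost u →
          while c loop p ⊢ x ⇓ z cost step x ℕ.+ s ℕ.+ t ℕ.+ u

PolynomiallyBounded : {A : Set} → (A → Tree) → (A → ℕ) → Set
PolynomiallyBounded {A} encode f =
  ∃[ c ] ∃[ k ] ((a : A) → f a ℕ.≤ c ℕ.* size (encode a) ℕ.^ k)

record PolyTime {A : Set} {B : A → Set} (encodeA : A → Tree)
                (encodeB : ∀ {a} → B a → Tree) (run : (a : A) → B a) : Set where
  field
    program    : Program
    time       : A → ℕ
    computes   : ∀ a → program ⊢ encodeA a ⇓ encodeB (run a) cost time a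
    polynomial : PolynomiallyBounded encodeA time

-- Bijective base-2 numerals, least significant digit first, so that the
-- encoding of n has size O(log n).
encodeℕᵇ : ℕᵇ → Tree
encodeℕᵇ ℕᵇ.zero  = leaf
encodeℕᵇ 2[1+ n ] = leaf ∙ encodeℕᵇ n
encodeℕᵇ 1+[2 n ] = (leaf ∙ leaf) ∙ encodeℕᵇ n

encodeℕ : ℕ → Tree
encodeℕ n = encodeℕᵇ (ℕᵇ.fromℕ n)

encodeℤ : ℤ → Tree
encodeℤ (+ n)    = leaf ∙ encodeℕ n
encodeℤ -[1+ n ] = (leaf ∙ leaf) ∙ encodeℕ (suc n)

encodeℚ : ℚ → Tree
encodeℚ q = encodeℤ (↥ q) ∙ encodeℕ (↧ₙ q)

encodeList : {A : Set} → (A → Tree) → List A → Tree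
encodeList encode []       = leaf
encodeList encode (x ∷ xs) = encode x ∙ encodeList encode xs

fromℕ : ℕ → ℚ
fromℕ n = (+ n) / 1

energy : (β G x : ℚ) → ℚ
energy β G x = 0ℚ ⊔ β * (x - G)

record GreenInstance : Set where
  field
    n   : ℕ
    s   : Fin n → ℚ
    β G : ℚ
    s>0 : ∀ i → 0ℚ < s i
    s≤1 : ∀ i → s i ≤ 1ℚ
    β≥0 : 0ℚ ≤ β
    G≥0 : 0ℚ ≤ G
    G≤1 : G ≤ 1ℚ

encodeGreen : GreenInstance → Tree
encodeGreen I = encodeList encodeℚ (Vector.toList s) ∙ encodeℚ β ∙ encodeℚ G
  where open GreenInstance I

module _ (I : GreenInstance) where
  open GreenInstance I

  load : ∀ {m} → (Fin n → Fin m) → Fin m → ℚ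
  load assign j = sum λ i → if does (assign i ≟ j) then s i else 0ℚ

  -- Bins of a packing may be empty; only nonempty ones count as used.  An
  -- empty bin consumes no energy, since β and G are nonnegative.
  record Packing : Set where
    field
      bins   : ℕ
      assign : Fin n → Fin bins
      load≤1 : ∀ j → load assign j ≤ 1ℚ

module _ {I : GreenInstance} (σ : Packing I) where
  open GreenInstance I
  open Packing σ

  b : ℕ
  b = length (filter (λ j → any? λ i → assign i ≟ j) (allFin bins))

  E : ℚ
  E = sum λ j → energy β G (load I assign j)

  encodePacking : Tree
  encodePacking = encodeℕ bins ∙ encodeList encodeℕ (Vector.toList (λ i → toℕ (assign i)))

record PackingProblem : Set₁ where
  field
    Instance : Set
    green    : Instance → GreenInstance
    encode   : Instance → Tree
    Feasible : (I : Instance) → Packing (green I) → Set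
    value    : (I : Instance) → Packing (green I) → ℚ

  PackingOf : Instance → Set
  PackingOf I = Packing (green I)

GBP : PackingProblem
GBP = record
  { Instance = GreenInstance
  ; green    = λ I → I
  ; encode   = encodeGreen
  ; Feasible = λ _ _ → ⊤
  ; value    = λ _ σ → fromℕ (b σ) + E σ
  }

record ConstrainedInstance : Set where
  field
    green : GreenInstance
  open GreenInstance green
  field
    U  : ℚ
    U≥ : sum (λ i → energy β G (s i)) ≤ U

CGBP : PackingProblem
CGBP = record
  { Instance = ConstrainedInstance
  ; green    = green
  ; encode   = λ I → encodeGreen (green I) ∙ encodeℚ (U I)
  ; Feasible = λ I σ → E σ ≤ U I
  ; value    = λ _ σ → fromℕ (b σ)
  }
  where open ConstrainedInstance

module _ (P : PackingProblem) where
  open PackingProblem P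

  Optimal : (I : Instance) → PackingOf I → Set
  Optimal I σ = Feasible I σ × (∀ τ → Feasible I τ → value I σ ≤ value I τ)

  MinEnergyOptimal : (I : Instance) → PackingOf I → Set
  MinEnergyOptimal I σ = Optimal I σ × (∀ τ → Optimal I τ → E σ ≤ E τ)

  IsOPT : Instance → ℚ → Set
  IsOPT I v = ∃[ σ ] (Optimal I σ × value I σ ≡ v)

  BestAmong : (I : Instance) → List (PackingOf I) → PackingOf I → Set
  BestAmong I σs σ =
    σ ∈ σs × Feasible I σ × (∀ τ → τ ∈ σs → Feasible I τ → value I σ ≤ value I τ)

  APTAS : Set
  APTAS = ∀ ε → 0ℚ < ε → ε ≤ 1ℚ →
    Σ[ A ∈ ((I : Instance) → PackingOf I) ]
      PolyTime encode encodePacking A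
      × (∀ I → Feasible I (A I))
      × ∃[ γ ] (0ℚ ≤ γ × (∀ I v → IsOPT I v → value I (A I) ≤ (1ℚ + ε) * v + γ))

  -- The existence clause is what "where σ* is an optimal packing of minimum
  -- energy" presupposes.
  ProducesGoodPackings : (ε : ℚ) → ((I : Instance) → List (PackingOf I)) → Set
  ProducesGoodPackings ε A =
    PolyTime encode (encodeList encodePacking) A
    × PolynomiallyBounded encode (λ I → length (A I))
    × (∀ I → ∃ (MinEnergyOptimal I))
    × (∀ I σ* → MinEnergyOptimal I σ* →
         ∃[ σ ] (σ ∈ A I
                 × fromℕ (b σ) ≤ (1ℚ + ε) * fromℕ (b σ*) + 1ℚ
                 × E σ ≤ E σ*))

  BestProducedIsGood : (ε : ℚ) → ((I : Instance) → List (PackingOf I)) → Set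
  BestProducedIsGood ε A =
    (∀ I σ v → BestAmong I (A I) σ → IsOPT I v → value I σ ≤ (1ℚ + ε) * v + 1ℚ)
    × Σ[ B ∈ ((I : Instance) → PackingOf I) ]
        (PolyTime encode encodePacking B × (∀ I → BestAmong I (A I) (B I)))

{-# OPTIONS --safe #-}
-- Multiply all sizes by a common denominator, and let g stand for G and
-- f x = max(0, x - g) for the overload of a load x, so that the energy is a
-- constant multiple of the total overload.  The algorithm ignores β and U: for
-- every packing τ, with b nonempty bins, it produces a packing with at most
-- (1 + 1/q) b + 1 bins and no more overload.
--
-- Let K = ⌊b/q⌋ + 1 (all b and K are tried).  In decreasing order of size, the
-- first K items get bins of their own, and the next d = q (q + 1) groups of K
-- items are rounded up to the largest size in their group.  As d is constant,
-- a dynamic program over vectors of counts finds a packing of the rounded items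
-- into b bins of least overload.  The rest is placed greedily, if possible
-- without exceeding g, else within the capacity, else in a new bin.
--
-- Capacity.  The rest has sizes at most t, where t (q + 1) ≤ 1, since all d K
-- grouped items are larger; so a new bin is opened only when the other bins are
-- nearly full.
--
-- Overload.  Putting every rounded item in the place that τ gives to the item K
-- ranks before it gives a packing of the rounded items.  By convexity of f,
-- replacing sizes a by b ≤ a lowers the overload by at least the sum of the
-- f a - f b, and these differences telescope along the two roundings, up and
-- down, to the overload of the K separate items.  This settles the case that
-- the rest causes no overload.  Otherwise all b + K bins end up above g - t.  If
-- t ≤ g / (q + 1), the total filling below g is at least b g, and no packing
-- into b bins can have more.  If not, the grouped items are so many and so large
-- compared with g that an optimal packing of the rounded items fills each of the
-- b bins up to g, and the same estimate of the rounding gives the claim.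

module Submission where

open import Defs
open import Data.Bool using (Bool; true; false; if_then_else_; _∧_; not; T)
import Data.Bool.Properties as Boolₚ
open import Data.Empty using (⊥; ⊥-elim)
open import Data.Fin as Fin using (Fin; toℕ; fromℕ<)
import Data.Fin.Properties as Finₚ
import Data.Integer as ℤ
import Data.Integer.Properties as ℤₚ
open import Data.List using (List; []; _∷_; _++_; map; foldl; foldr; length; reverse; replicate; concatMap; filterᵇ; downFrom; upTo; applyUpTo; zip; take; drop; tabulate; allFin; filter)
open import Data.List.Membership.Propositional using (_∈_)
import Data.List.Membership.Propositional.Properties as Membershipₚ
open import Data.List.Properties using (length-++; length-map; map-++; ++-assoc; ++-identityʳ; reverse-involutive; unfold-reverse; length-replicate; map-∘; take++drop≡id)
import Data.List.Properties as Listₚ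
open import Data.List.Relation.Binary.Permutation.Propositional using (_↭_; prep; swap; ↭-refl; ↭-sym; ↭-trans; ↭-reflexive)
import Data.List.Relation.Binary.Permutation.Propositional as Perm
import Data.List.Relation.Binary.Permutation.Propositional.Properties as Permₚ
open import Data.List.Relation.Unary.All as All using (All; []; _∷_)
import Data.List.Relation.Unary.All.Properties as Allₚ
open import Data.List.Relation.Unary.AllPairs using (AllPairs; []; _∷_)
import Data.List.Relation.Unary.AllPairs.Properties as AllPairsₚ
open import Data.List.Relation.Unary.Any using (here; there)
open import Data.Nat using (ℕ; zero; suc; pred; _+_; _*_; _∸_; _^_; _≤_; _<_; z≤n; s≤s; _⊔_; _≤ᵇ_; _≡ᵇ_; >-nonZero)
open import Data.Nat.Binary as ℕᵇ using (ℕᵇ; 2[1+_]; 1+[2_])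
import Data.Nat.Binary.Properties as ℕᵇₚ
import Data.Nat.DivMod as DivMod
open import Data.Nat.GeneralisedArithmetic using (fold)
open import Data.Nat.ListAction using (sum)
import Data.Nat.ListAction.Properties as ListActionₚ
open import Data.Nat.Properties
open import Data.Nat.Tactic.RingSolver using (solve-∀)
open import Data.Product using (Σ-syntax; ∃; ∃-syntax; _×_; _,_; proj₁; proj₂)
open import Data.Rational using (ℚ; 0ℚ; 1ℚ; ↥_; ↧ₙ_)
import Data.Rational as ℚ
import Data.Rational.Properties as ℚₚ
import Data.Rational.Solver as ℚSolver
import Data.Rational.Unnormalised as ℚᵘ
import Data.Rational.Unnormalised.Properties as ℚᵘₚ
open import Data.Sum using (_⊎_; inj₁; inj₂)
open import Data.Unit using (⊤; tt)
import Data.Vec.Functional as Vector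
open import Function using (_∘_; id; case_of_)
open import Function.Definitions using (Injective)
open import Relation.Binary.PropositionalEquality using (_≡_; _≢_; refl; sym; trans; cong; cong₂; subst; subst₂; module ≡-Reasoning)
open import Relation.Nullary using (¬_; Dec; yes; no; does)
open import Algebra.Properties.CommutativeMonoid.Sum ℚₚ.+-0-commutativeMonoid using () renaming (sum to sumFin)

-- The obstacle is that the energy may not grow at all, since an optimum of CGBP may exhaust its
-- budget; only the number of bins has slack. Hence the overload estimates must lose nothing, and
-- the K additional bins have to pay for whatever rounding and greedy placement cost.
--
-- Here q is the denominator of ε, so that 1/q ≤ ε, and K is the least integer with b < q K. The
-- constant d = q (q + 1) enters twice. The d K grouped items have size at least t and total size at
-- most b, which is less than q K, whence t (q + 1) ≤ 1. Moreover d K exceeds (q + 1) b, so some bin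
-- holds at least q + 2 rounded items; if t (q + 1) > g, it stays above g after giving its smallest
-- item to a bin not yet filled up to g.
--
-- Polynomial time is shown for concrete programs on trees, whose arithmetic on large numbers is
-- confined to addition, multiplication and comparison of binary naturals. Rational comparisons are
-- therefore cleared of denominators, and of subtraction: the maximum of load and g replaces the
-- overload, and multiples of g move to the other side.

-- Polynomial expressions as bounds

data Pol : Set where
  X       : Pol
  #_      : ℕ → Pol
  _⊕_ _⊛_ : Pol → Pol → Pol

infixl 6 _⊕_
infixl 7 _⊛_
infix  8 #_
infixr 9 _∘ₚ_

⟦_⟧ : Pol → ℕ → ℕ
⟦ X     ⟧ n = n
⟦ # k   ⟧ n = k
⟦ p ⊕ q ⟧ n = ⟦ p ⟧ n + ⟦ q ⟧ n
⟦ p ⊛ q ⟧ n = ⟦ p ⟧ n * ⟦ q ⟧ n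

⟦⟧-mono : ∀ p {m n} → m ≤ n → ⟦ p ⟧ m ≤ ⟦ p ⟧ n
⟦⟧-mono X       m≤n = m≤n
⟦⟧-mono (# k)   m≤n = ≤-refl
⟦⟧-mono (p ⊕ q) m≤n = +-mono-≤ (⟦⟧-mono p m≤n) (⟦⟧-mono q m≤n)
⟦⟧-mono (p ⊛ q) m≤n = *-mono-≤ (⟦⟧-mono p m≤n) (⟦⟧-mono q m≤n)

_∘ₚ_ : Pol → Pol → Pol
X       ∘ₚ r = r
(# k)   ∘ₚ r = # k
(p ⊕ q) ∘ₚ r = (p ∘ₚ r) ⊕ (q ∘ₚ r)
(p ⊛ q) ∘ₚ r = (p ∘ₚ r) ⊛ (q ∘ₚ r)

⟦⟧-∘ : ∀ p r n → ⟦ p ∘ₚ r ⟧ n ≡ ⟦ p ⟧ (⟦ r ⟧ n)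
⟦⟧-∘ X       r n = refl
⟦⟧-∘ (# k)   r n = refl
⟦⟧-∘ (p ⊕ q) r n = cong₂ _+_ (⟦⟧-∘ p r n) (⟦⟧-∘ q r n)
⟦⟧-∘ (p ⊛ q) r n = cong₂ _*_ (⟦⟧-∘ p r n) (⟦⟧-∘ q r n)

⟦⟧-mono-∘ : ∀ p r {m} n → m ≤ ⟦ r ⟧ n → ⟦ p ⟧ m ≤ ⟦ p ∘ₚ r ⟧ n
⟦⟧-mono-∘ p r n m≤ = ≤-trans (⟦⟧-mono p m≤) (≤-reflexive (sym (⟦⟧-∘ p r n)))

-- Bounds stay expressions, which compose by substitution, until the single place where the form
-- `c * n ^ k` is required. For `n ≥ 1` exponents may be raised, so a sum is bounded with the common
-- exponent `k + k′`.
monomial-bound : ∀ p → ∃[ c ] ∃[ k ] (∀ n → 1 ≤ n → ⟦ p ⟧ n ≤ c * n ^ k)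
monomial-bound X     = 1 , 1 , λ n _ →
  ≤-reflexive (sym (trans (+-identityʳ (n * 1)) (*-identityʳ n)))
monomial-bound (# k) = k , 0 , λ n _ → ≤-reflexive (sym (*-identityʳ k))
monomial-bound (p ⊕ q) with monomial-bound p | monomial-bound q
... | c , k , hp | c′ , k′ , hq = c + c′ , k + k′ , bound
  where
  bound : ∀ n → 1 ≤ n → ⟦ p ⊕ q ⟧ n ≤ (c + c′) * n ^ (k + k′)
  bound n@(suc _) 1≤n = begin
    ⟦ p ⟧ n + ⟦ q ⟧ n                        ≤⟨ +-mono-≤ (hp n 1≤n) (hq n 1≤n) ⟩
    c * n ^ k + c′ * n ^ k′                  ≤⟨ +-mono-≤ (*-monoʳ-≤ c (^-monoʳ-≤ n (m≤m+n k k′)))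
                                                         (*-monoʳ-≤ c′ (^-monoʳ-≤ n (m≤n+m k′ k))) ⟩
    c * n ^ (k + k′) + c′ * n ^ (k + k′)     ≡⟨ *-distribʳ-+ (n ^ (k + k′)) c c′ ⟨
    (c + c′) * n ^ (k + k′)                  ∎
    where open ≤-Reasoning
monomial-bound (p ⊛ q) with monomial-bound p | monomial-bound q
... | c , k , hp | c′ , k′ , hq = c * c′ , k + k′ , bound
  where
  interchange : ∀ a b x y → (a * x) * (b * y) ≡ (a * b) * (x * y)
  interchange = solve-∀
  bound : ∀ n → 1 ≤ n → ⟦ p ⊛ q ⟧ n ≤ c * c′ * n ^ (k + k′)
  bound n 1≤n = begin
    ⟦ p ⟧ n * ⟦ q ⟧ n              ≤⟨ *-mono-≤ (hp n 1≤n) (hq n 1≤n) ⟩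
    (c * n ^ k) * (c′ * n ^ k′)    ≡⟨ interchange c c′ (n ^ k) (n ^ k′) ⟩
    c * c′ * (n ^ k * n ^ k′)      ≡⟨ cong (c * c′ *_) (^-distribˡ-+-* n k k′) ⟨
    c * c′ * n ^ (k + k′)          ∎
    where open ≤-Reasoning

-- Costs and sizes of outputs

1≤size : ∀ x → 1 ≤ size x
1≤size leaf    = ≤-refl
1≤size (_ ∙ _) = s≤s z≤n

size-left : ∀ x → size (left x) ≤ size x
size-left leaf    = ≤-refl
size-left (x ∙ y) = m≤n⇒m≤1+n (m≤m+n (size x) (size y))

size-right : ∀ x → size (right x) ≤ size x
size-right leaf    = ≤-refl
size-right (x ∙ y) = m≤n⇒m≤1+n (m≤n+m (size y) (size x))

-- This closes polynomial cost under composition: the argument of the second program is no larger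
-- than the cost of the first.
size≤cost : ∀ {p x y t} → p ⊢ x ⇓ y cost t → size y ≤ t
size≤cost ⇓skip            = n≤1+n _
size≤cost (⇓hd {x})        = m≤n⇒m≤1+n (size-left x)
size≤cost (⇓tl {x})        = m≤n⇒m≤1+n (size-right x)
size≤cost ⇓leaf            = s≤s z≤n
size≤cost (⇓pair {x = x} p q) =
  s≤s (+-mono-≤ (≤-trans (size≤cost p) (m≤n+m _ (size x))) (size≤cost q))
size≤cost (⇓seq p q)       = ≤-trans (size≤cost q) (m≤n+m _ _)
size≤cost (⇓then c p)      = ≤-trans (size≤cost p) (m≤n+m _ _)
size≤cost (⇓else c q)      = ≤-trans (size≤cost q) (m≤n+m _ _)
size≤cost (⇓stop {x = x} c) = ≤-trans (n≤1+n _) (m≤m+n (step x) _)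
size≤cost (⇓loop c p w)    = ≤-trans (size≤cost w) (m≤n+m _ _)

-- An upper bound replaces the exact cost, so that the two branches of a test, or the rounds of a
-- loop, can share one bound.
Runs : Program → Tree → Tree → ℕ → Set
Runs p x y n = ∃[ t ] (p ⊢ x ⇓ y cost t × t ≤ n)

module _ {N : ℕ} {x : Tree} (x≤N : size x ≤ N) where

  runs-skip : Runs skip x x (1 + N)
  runs-skip = _ , ⇓skip , s≤s x≤N

  runs-hd : Runs hd x (left x) (1 + N)
  runs-hd = _ , ⇓hd , s≤s x≤N

  runs-tl : Runs tl x (right x) (1 + N)
  runs-tl = _ , ⇓tl , s≤s x≤N

  runs-leaf : Runs mkLeaf x leaf (1 + N)
  runs-leaf = _ , ⇓leaf , s≤s x≤N

  runs-pair : ∀ {p q y z m n} → Runs p x y m → Runs q x z n → Runs ⟨ p , q ⟩ x (y ∙ z) (1 + N + m + n)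
  runs-pair (_ , p , s≤) (_ , q , t≤) = _ , ⇓pair p q , +-mono-≤ (+-mono-≤ (s≤s x≤N) s≤) t≤

  runs-seq : ∀ {p q y z m n} → Runs p x y m → Runs q y z n → Runs (p ⨾ q) x z (1 + N + m + n)
  runs-seq (_ , p , s≤) (_ , q , t≤) = _ , ⇓seq p q , +-mono-≤ (+-mono-≤ (s≤s x≤N) s≤) t≤

  runs-then : ∀ {c p q a b y m n} → Runs c x (a ∙ b) m → Runs p x y n →
              Runs (ifP c then p else q) x y (1 + N + m + n)
  runs-then (_ , p , s≤) (_ , q , t≤) = _ , ⇓then p q , +-mono-≤ (+-mono-≤ (s≤s x≤N) s≤) t≤

  runs-else : ∀ {c p q y m n} → Runs c x leaf m → Runs q x y n →
              Runs (ifP c then p else q) x y (1 + N + m + n)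
  runs-else (_ , p , s≤) (_ , q , t≤) = _ , ⇓else p q , +-mono-≤ (+-mono-≤ (s≤s x≤N) s≤) t≤

  runs-stop : ∀ {c p m} → Runs c x leaf m → Runs (while c loop p) x x (1 + N + m)
  runs-stop (_ , p , s≤) = _ , ⇓stop p , +-mono-≤ (s≤s x≤N) s≤

  runs-loop : ∀ {c p a b y z m n k} → Runs c x (a ∙ b) m → Runs p x y n →
              Runs (while c loop p) y z k → Runs (while c loop p) x z (1 + N + m + n + k)
  runs-loop (_ , p , s≤) (_ , q , t≤) (_ , w , u≤) =
    _ , ⇓loop p q w , +-mono-≤ (+-mono-≤ (+-mono-≤ (s≤s x≤N) s≤) t≤) u≤

runs-≤ : ∀ {p x y m n} → Runs p x y m → m ≤ n → Runs p x y n
runs-≤ (_ , p , s≤) m≤n = _ , p , ≤-trans s≤ m≤n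

-- Codes and polynomial-time functions

record Code : Set₁ where
  constructor code
  field
    Carrier : Set
    enc     : Carrier → Tree

open Code public using (enc) renaming (Carrier to ⌞_⌟)

sz : (A : Code) → ⌞ A ⌟ → ℕ
sz A a = size (enc A a)

infixr 4 _⊗_

_⊗_ : Code → Code → Code
A ⊗ B = code (⌞ A ⌟ × ⌞ B ⌟) λ (a , b) → enc A a ∙ enc B b

Lst : Code → Code
Lst A = code (List ⌞ A ⌟) (encodeList (enc A))

Unit : Code
Unit = code ⊤ λ _ → leaf

Bol : Code
Bol = code Bool λ b → if b then leaf ∙ leaf else leaf

-- Indices, counts and numbers of bins are polynomial in the number of items, so they can be unary
-- and drive loops. Scaled sizes may be exponentially large and use the binary code `Nat`.
unary : ℕ → Tree
unary zero    = leaf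
unary (suc n) = leaf ∙ unary n

Una : Code
Una = code ℕ unary

-- The suffix ᴾ marks closure of polynomial time under the operation named. A context `Γ` plays the
-- role of the free variables, so programs are assembled as in a point-free functional language.
record PT (A B : Code) (f : ⌞ A ⌟ → ⌞ B ⌟) : Set where
  field
    prog : Program
    pol  : Pol
    runs : ∀ a → Runs prog (enc A a) (enc B (f a)) (⟦ pol ⟧ (sz A a))

  output-size : ∀ a → sz B (f a) ≤ ⟦ pol ⟧ (sz A a)
  output-size a with runs a
  ... | _ , p , t≤ = ≤-trans (size≤cost p) t≤

open PT public

congᴾ : ∀ {A B f g} → (∀ a → f a ≡ g a) → PT A B f → PT A B g
congᴾ {A} {B} f≡g p = record
  { prog = prog p
  ; pol  = pol p
  ; runs = λ a → subst (λ y → Runs (prog p) (enc A a) (enc B y) (⟦ pol p ⟧ (sz A a))) (f≡g a) (runs p a)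
  }

-- Several types share their trees: a list cell is a pair, `true` a pair of leaves, a unary number a
-- list of units, a binary numeral a list of Booleans. Programs pass between them unchanged.
recodeᴾ : ∀ {A B C D f} {g : ⌞ C ⌟ → ⌞ D ⌟} (h : ⌞ C ⌟ → ⌞ A ⌟) →
          (∀ c → enc A (h c) ≡ enc C c) → (∀ c → enc B (f (h c)) ≡ enc D (g c)) →
          PT A B f → PT C D g
recodeᴾ {A} {B} {C} {D} {f} {g} h eC eD p = record
  { prog = prog p
  ; pol  = pol p
  ; runs = λ c → subst₂ (λ x y → Runs (prog p) x y (⟦ pol p ⟧ (size x))) (eC c) (eD c) (runs p (h c))
  }

idᴾ : ∀ {A} → PT A A id
idᴾ = record { prog = skip ; pol = # 1 ⊕ X ; runs = λ a → runs-skip ≤-refl }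

fstᴾ : ∀ {A B} → PT (A ⊗ B) A proj₁
fstᴾ = record { prog = hd ; pol = # 1 ⊕ X ; runs = λ a → runs-hd ≤-refl }

sndᴾ : ∀ {A B} → PT (A ⊗ B) B proj₂
sndᴾ = record { prog = tl ; pol = # 1 ⊕ X ; runs = λ a → runs-tl ≤-refl }

infixr 9 _∘ᴾ_

_∘ᴾ_ : ∀ {A B C f g} → PT B C g → PT A B f → PT A C (λ a → g (f a))
_∘ᴾ_ {A} q p = record
  { prog = prog p ⨾ prog q
  ; pol  = # 1 ⊕ X ⊕ pol p ⊕ (pol q ∘ₚ pol p)
  ; runs = λ a → runs-seq ≤-refl (runs p a)
             (runs-≤ (runs q _) (⟦⟧-mono-∘ (pol q) (pol p) (sz A a) (output-size p a)))
  }

pairᴾ : ∀ {A B C f g} → PT A B f → PT A C g → PT A (B ⊗ C) (λ a → f a , g a)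
pairᴾ p q = record
  { prog = ⟨ prog p , prog q ⟩
  ; pol  = # 1 ⊕ X ⊕ pol p ⊕ pol q
  ; runs = λ a → runs-pair ≤-refl (runs p a) (runs q a)
  }

leafᴾ : ∀ {A B} {y : ⌞ B ⌟} → enc B y ≡ leaf → PT A B (λ _ → y)
leafᴾ {A} e = record
  { prog = mkLeaf
  ; pol  = # 1 ⊕ X
  ; runs = λ a → subst (λ y → Runs mkLeaf (enc A a) y _) (sym e) (runs-leaf ≤-refl)
  }

nilᴾ : ∀ {A B} → PT A (Lst B) (λ _ → [])
nilᴾ {A} {B} = leafᴾ {A} {Lst B} refl

consᴾ : ∀ {A B f g} → PT A B f → PT A (Lst B) g → PT A (Lst B) (λ a → f a ∷ g a)
consᴾ {A} {B} {f} {g} p q =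
  recodeᴾ {A} {B ⊗ Lst B} {A} {Lst B} id (λ _ → refl) (λ _ → refl) (pairᴾ p q)

falseᴾ : ∀ {A} → PT A Bol (λ _ → false)
falseᴾ {A} = leafᴾ {A} {Bol} refl

trueᴾ : ∀ {A} → PT A Bol (λ _ → true)
trueᴾ {A} = recodeᴾ {A} {Unit ⊗ Unit} {A} {Bol} id (λ _ → refl) (λ _ → refl)
  (pairᴾ (leafᴾ {A} {Unit} refl) (leafᴾ {A} {Unit} {tt} refl))

zeroᴾ : ∀ {A} → PT A Una (λ _ → zero)
zeroᴾ {A} = leafᴾ {A} {Una} refl

sucᴾ : ∀ {A f} → PT A Una f → PT A Una (λ a → suc (f a))
sucᴾ {A} p = recodeᴾ {A} {Unit ⊗ Una} {A} {Una} id (λ _ → refl) (λ _ → refl)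
  (pairᴾ (leafᴾ {A} {Unit} {tt} refl) p)

predᴾ : ∀ {A f} → PT A Una f → PT A Una (λ a → pred (f a))
predᴾ {A} p = prim ∘ᴾ p
  where
  enc-pred : ∀ n → right (unary n) ≡ unary (pred n)
  enc-pred zero    = refl
  enc-pred (suc n) = refl
  prim : PT Una Una pred
  prim = record
    { prog = tl
    ; pol  = # 1 ⊕ X
    ; runs = λ n → subst (λ y → Runs tl (unary n) y (1 + sz Una n)) (enc-pred n) (runs-tl ≤-refl)
    }

ifᴾ : ∀ {A B c f g} → PT A Bol c → PT A B f → PT A B g → PT A B (λ a → if c a then f a else g a)
ifᴾ {A} {B} {c} {f} {g} t p q = record
  { prog = ifP prog t then prog p else prog q
  ; pol  = # 1 ⊕ X ⊕ pol t ⊕ (pol p ⊕ pol q)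
  ; runs = λ a → go a (c a) (runs t a)
  }
  where
  go : ∀ a b → Runs (prog t) (enc A a) (enc Bol b) (⟦ pol t ⟧ (sz A a)) →
       Runs (ifP prog t then prog p else prog q) (enc A a) (enc B (if b then f a else g a)) _
  go a true  r = runs-then ≤-refl r (runs-≤ (runs p a) (m≤m+n _ _))
  go a false r = runs-else ≤-refl r (runs-≤ (runs q a) (m≤n+m _ _))

caseList : {A B : Set} → List A → B → (A → List A → B) → B
caseList []       n c = n
caseList (x ∷ xs) n c = c x xs

caseᴾ : ∀ {A B C l n c} → PT A (Lst C) l → PT A B n → PT (A ⊗ (C ⊗ Lst C)) B c →
        PT A B (λ a → caseList (l a) (n a) (λ x xs → c (a , x , xs)))
caseᴾ {A} {B} {C} {l} {n} {c} pl pn pc = record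
  -- The test succeeds on a list cell, which is a pair, and fails on the empty list, a leaf. As a
  -- test discards its value, the list is computed again inside the branch.
  { prog = ifP prog pl then (⟨ skip , prog pl ⟩ ⨾ prog pc) else prog pn
  ; pol  = # 1 ⊕ X ⊕ pol pl ⊕ ((# 1 ⊕ X ⊕ (# 1 ⊕ X ⊕ (# 1 ⊕ X) ⊕ pol pl) ⊕ (pol pc ∘ₚ (# 1 ⊕ X ⊕ pol pl))) ⊕ pol pn)
  ; runs = λ a → go a (l a) (runs pl a) (output-size pl a)
  }
  where
  go : ∀ a xs → Runs (prog pl) (enc A a) (enc (Lst C) xs) (⟦ pol pl ⟧ (sz A a)) →
       sz (Lst C) xs ≤ ⟦ pol pl ⟧ (sz A a) → Runs _ (enc A a) (enc B (caseList xs (n a) _)) _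
  go a []       r s = runs-else ≤-refl r (runs-≤ (runs pn a) (m≤n+m _ _))
  go a (x ∷ xs) r s = runs-then ≤-refl r (runs-≤ (runs-seq ≤-refl (runs-pair ≤-refl (runs-skip ≤-refl) r)
    (runs-≤ (runs pc (a , x , xs)) (⟦⟧-mono-∘ (pol pc) (# 1 ⊕ X ⊕ pol pl) (sz A a) (s≤s (+-monoʳ-≤ (sz A a) s))))) (m≤m+n _ _))

-- Loops over lists

sz-prefix : ∀ C xs ys → sz (Lst C) xs ≤ sz (Lst C) (xs ++ ys)
sz-prefix C []       ys = 1≤size (enc (Lst C) ys)
sz-prefix C (x ∷ xs) ys = s≤s (+-monoʳ-≤ (sz C x) (sz-prefix C xs ys))

length<sz : ∀ C xs → length xs < sz (Lst C) xs
length<sz C []       = ≤-refl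
length<sz C (x ∷ xs) = s≤s (≤-trans (length<sz C xs) (m≤n+m _ (sz C x)))

sz-cons : ∀ C x xs → sz (Lst C) (x ∷ xs) ≡ sz (Lst C) xs + suc (sz C x)
sz-cons C x xs = trans (cong suc (+-comm (sz C x) _)) (sym (+-suc _ (sz C x)))

module _ {Γ A C : Code} {f : ⌞ (Γ ⊗ A) ⊗ C ⌟ → ⌞ A ⌟} (pf : PT ((Γ ⊗ A) ⊗ C) A f) where

  private
    iterate : ⌞ Γ ⌟ → ⌞ A ⌟ → List ⌞ C ⌟ → ⌞ A ⌟
    iterate γ = foldl (λ a x → f ((γ , a) , x))

    test body : Program
    -- A state is `γ ∙ (a ∙ xs)`, so the loop runs until the remaining list is a leaf.
    test = tl ⨾ tl
    body = ⟨ hd , ⟨ ⟨ ⟨ hd , tl ⨾ hd ⟩ , tl ⨾ (tl ⨾ hd) ⟩ ⨾ prog pf , tl ⨾ (tl ⨾ tl) ⟩ ⟩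

    S args testPol bodyPol roundPol : Pol
    S        = # 1 ⊕ X
    args     = S ⊕ (S ⊕ S ⊕ (S ⊕ S ⊕ S)) ⊕ (S ⊕ S ⊕ (S ⊕ S ⊕ S))
    testPol  = S ⊕ S ⊕ S
    bodyPol  = S ⊕ S ⊕ (S ⊕ (S ⊕ args ⊕ pol pf) ⊕ (S ⊕ S ⊕ (S ⊕ S ⊕ S)))
    roundPol = S ⊕ testPol ⊕ bodyPol

    encState : ⌞ Γ ⌟ → ⌞ A ⌟ → List ⌞ C ⌟ → Tree
    encState γ a xs = enc Γ γ ∙ (enc A a ∙ enc (Lst C) xs)

    -- `M` bounds the accumulator after every prefix of the list, so `N` bounds every state and
    -- every argument of the body, and each round costs at most `roundPol` at `N`. The summand 3
    -- covers the inner nodes of the tree that encodes a state.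
    runs-while : ∀ N M γ a xs → 3 + (sz Γ γ + (M + sz (Lst C) xs)) ≤ N →
                 (∀ ys zs → xs ≡ ys ++ zs → sz A (iterate γ a ys) ≤ M) →
                 Runs (while test loop body) (encState γ a xs) (encState γ (iterate γ a xs) [])
                      (suc (length xs) * ⟦ roundPol ⟧ N)
    runs-while N M γ a [] ≤N bounded =
      runs-≤ (runs-stop st (runs-seq st (runs-tl st) (runs-tl rt)))
             (≤-trans (m≤m+n _ _) (≤-reflexive (sym (+-identityʳ _))))
      where
      shuffle : ∀ g a → 3 + (g + (a + 1)) ≡ suc (suc (g + suc (a + 1)))
      shuffle = solve-∀
      st : size (encState γ a []) ≤ N
      st = ≤-trans (≤-trans (n≤1+n _) (≤-reflexive (sym (shuffle (sz Γ γ) (sz A a)))))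
                   (≤-trans (+-monoʳ-≤ 3 (+-monoʳ-≤ (sz Γ γ) (+-monoˡ-≤ _ (bounded [] [] refl)))) ≤N)
      rt : size (enc A a ∙ leaf) ≤ N
      rt = ≤-trans (size-right (encState γ a [])) st
    runs-while N M γ a (x ∷ xs) ≤N bounded =
      runs-loop st
        (runs-seq st (runs-tl st) (runs-tl rt))
        (runs-pair st (runs-hd st)
          (runs-pair st
            (runs-seq st
              (runs-pair st (runs-pair st (runs-hd st) (runs-seq st (runs-tl st) (runs-hd rt)))
                            (runs-seq st (runs-tl st) (runs-seq rt (runs-tl rt) (runs-hd lt))))
              (runs-≤ (runs pf ((γ , a) , x)) (⟦⟧-mono (pol pf) at)))
            (runs-seq st (runs-tl st) (runs-seq rt (runs-tl rt) (runs-tl lt)))))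
        (runs-while N M γ (f ((γ , a) , x)) xs
          (≤-trans (+-monoʳ-≤ 3 (+-monoʳ-≤ (sz Γ γ) (+-monoʳ-≤ M (size-right (enc (Lst C) (x ∷ xs)))))) ≤N)
          (λ ys zs e → bounded (x ∷ ys) zs (cong (x ∷_) e)))
      where
      shuffle : ∀ g a x y → 3 + (g + (a + suc (x + y))) ≡ suc (suc (g + suc (a + suc (x + y))))
      shuffle = solve-∀
      shuffle′ : ∀ g a x y → 3 + (g + (a + suc (x + y))) ≡ suc (suc (g + a) + x) + (2 + y)
      shuffle′ = solve-∀
      st₀ : 3 + (sz Γ γ + (sz A a + sz (Lst C) (x ∷ xs))) ≤ N
      st₀ = ≤-trans (+-monoʳ-≤ 3 (+-monoʳ-≤ (sz Γ γ) (+-monoˡ-≤ _ (bounded [] (x ∷ xs) refl)))) ≤N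
      st : size (encState γ a (x ∷ xs)) ≤ N
      st = ≤-trans (≤-trans (n≤1+n _) (≤-reflexive (sym (shuffle (sz Γ γ) (sz A a) (sz C x) _)))) st₀
      rt : size (enc A a ∙ enc (Lst C) (x ∷ xs)) ≤ N
      rt = ≤-trans (size-right (encState γ a (x ∷ xs))) st
      lt : sz (Lst C) (x ∷ xs) ≤ N
      lt = ≤-trans (size-right (enc A a ∙ enc (Lst C) (x ∷ xs))) rt
      at : sz ((Γ ⊗ A) ⊗ C) ((γ , a) , x) ≤ N
      at = ≤-trans (≤-trans (m≤m+n _ _) (≤-reflexive (sym (shuffle′ (sz Γ γ) (sz A a) (sz C x) _)))) st₀

  -- Bounding the final results is enough: an intermediate result is the final
  -- result for a prefix of the list.
  foldlᴾ : ∀ {i l} → PT Γ A i → PT Γ (Lst C) l → (q : Pol) →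
           (∀ γ xs → sz A (foldl (λ a x → f ((γ , a) , x)) (i γ) xs) ≤ ⟦ q ⟧ (sz Γ γ + sz (Lst C) xs)) →
           PT Γ A (λ γ → foldl (λ a x → f ((γ , a) , x)) (i γ) (l γ))
  foldlᴾ {i} {l} pi pl q bounded = record
    { prog = ⟨ skip , ⟨ prog pi , prog pl ⟩ ⟩ ⨾ ((while test loop body) ⨾ (tl ⨾ hd))
    ; pol  = # 1 ⊕ X ⊕ (# 1 ⊕ X ⊕ (# 1 ⊕ X) ⊕ (# 1 ⊕ X ⊕ pol pi ⊕ pol pl))
               ⊕ (# 1 ⊕ NPol ⊕ pol pl ⊛ (roundPol ∘ₚ NPol) ⊕ (# 1 ⊕ NPol ⊕ (# 1 ⊕ NPol) ⊕ (# 1 ⊕ NPol)))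
    ; runs = λ γ → runs-seq ≤-refl (runs-pair ≤-refl (runs-skip ≤-refl) (runs-pair ≤-refl (runs pi γ) (runs pl γ)))
                     (runs-seq (st γ (i γ) (l γ) (first γ) ≤-refl)
                        (runs-≤ (runs-while (N γ) (M γ) γ (i γ) (l γ) (large γ) (inter γ)) (rounds γ))
                        (runs-seq (st γ (result γ) [] (last γ) (1≤size (enc (Lst C) (l γ))))
                           (runs-tl (st γ (result γ) [] (last γ) (1≤size (enc (Lst C) (l γ)))))
                           (runs-hd (≤-trans (size-right (encState γ (result γ) []))
                             (st γ (result γ) [] (last γ) (1≤size (enc (Lst C) (l γ))))))))
    }
    where
    MPol NPol : Pol
    MPol = q ∘ₚ (X ⊕ pol pl)
    NPol = # 3 ⊕ (X ⊕ (MPol ⊕ pol pl))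
    M N : ⌞ Γ ⌟ → ℕ
    M γ = ⟦ MPol ⟧ (sz Γ γ)
    N γ = ⟦ NPol ⟧ (sz Γ γ)
    result : ⌞ Γ ⌟ → ⌞ A ⌟
    result γ = iterate γ (i γ) (l γ)
    large : ∀ γ → 3 + (sz Γ γ + (M γ + sz (Lst C) (l γ))) ≤ N γ
    large γ = +-monoʳ-≤ 3 (+-monoʳ-≤ (sz Γ γ) (+-monoʳ-≤ (M γ) (output-size pl γ)))
    inter : ∀ γ ys zs → l γ ≡ ys ++ zs → sz A (iterate γ (i γ) ys) ≤ M γ
    inter γ ys zs e = ≤-trans (bounded γ ys) (⟦⟧-mono-∘ q (X ⊕ pol pl) (sz Γ γ) (+-monoʳ-≤ (sz Γ γ)
      (≤-trans (sz-prefix C ys zs) (≤-trans (≤-reflexive (cong (sz (Lst C)) (sym e))) (output-size pl γ)))))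
    first : ∀ γ → sz A (i γ) ≤ M γ
    first γ = inter γ [] (l γ) refl
    last : ∀ γ → sz A (result γ) ≤ M γ
    last γ = inter γ (l γ) [] (sym (++-identityʳ (l γ)))
    st : ∀ γ a xs → sz A a ≤ M γ → sz (Lst C) xs ≤ sz (Lst C) (l γ) → size (encState γ a xs) ≤ N γ
    st γ a xs a≤M xs≤ = begin
      suc (sz Γ γ + suc (sz A a + sz (Lst C) xs))       ≤⟨ n≤1+n _ ⟩
      suc (suc (sz Γ γ + suc (sz A a + sz (Lst C) xs))) ≡⟨ shuffle (sz Γ γ) (sz A a) (sz (Lst C) xs) ⟨
      3 + (sz Γ γ + (sz A a + sz (Lst C) xs))           ≤⟨ +-monoʳ-≤ 3 (+-monoʳ-≤ (sz Γ γ) (+-mono-≤ a≤M xs≤)) ⟩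
      3 + (sz Γ γ + (M γ + sz (Lst C) (l γ)))           ≤⟨ large γ ⟩
      N γ                                               ∎
      where
      open ≤-Reasoning
      shuffle : ∀ g a x → 3 + (g + (a + x)) ≡ suc (suc (g + suc (a + x)))
      shuffle = solve-∀
    rounds : ∀ γ → suc (length (l γ)) * ⟦ roundPol ⟧ (N γ) ≤ ⟦ pol pl ⊛ (roundPol ∘ₚ NPol) ⟧ (sz Γ γ)
    rounds γ = *-mono-≤ (≤-trans (length<sz C (l γ)) (output-size pl γ))
                        (≤-reflexive (sym (⟦⟧-∘ roundPol NPol (sz Γ γ))))

  -- If a round adds at most a polynomial in context and element, the accumulator grows linearly in
  -- the number of rounds. A body that doubles its accumulator falls outside this scheme and needs
  -- `foldlᴾ` with an explicit bound on the results.
  foldl-additiveᴾ : ∀ {i l} → PT Γ A i → PT Γ (Lst C) l → (q : Pol) →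
                    (∀ γ a x → sz A (f ((γ , a) , x)) ≤ sz A a + ⟦ q ⟧ (sz Γ γ + sz C x)) →
                    PT Γ A (λ γ → foldl (λ a x → f ((γ , a) , x)) (i γ) (l γ))
  foldl-additiveᴾ {i} {l} pi pl q additive = foldlᴾ pi pl (pol pi ⊕ X ⊛ q) λ γ xs → begin
      sz A (iterate γ (i γ) xs)                     ≤⟨ growth γ (i γ) xs (sz Γ γ + sz (Lst C) xs)
                                                         (All.map (+-monoʳ-≤ (sz Γ γ)) (elements xs)) ⟩
      sz A (i γ) + length xs * ⟦ q ⟧ (sz Γ γ + sz (Lst C) xs)
        ≤⟨ +-mono-≤ (≤-trans (output-size pi γ) (⟦⟧-mono (pol pi) (m≤m+n _ _)))
                    (*-monoˡ-≤ _ (≤-trans (<⇒≤ (length<sz C xs)) (m≤n+m _ (sz Γ γ)))) ⟩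
      ⟦ pol pi ⊕ X ⊛ q ⟧ (sz Γ γ + sz (Lst C) xs)  ∎
    where
    open ≤-Reasoning
    elements : ∀ xs → All (λ x → sz C x ≤ sz (Lst C) xs) xs
    elements []       = []
    elements (x ∷ xs) = m≤n⇒m≤1+n (m≤m+n _ _) ∷ All.map (λ le → m≤n⇒m≤1+n (m≤n⇒m≤o+n (sz C x) le)) (elements xs)
    growth : ∀ γ a xs m → All (λ x → sz Γ γ + sz C x ≤ m) xs → sz A (iterate γ a xs) ≤ sz A a + length xs * ⟦ q ⟧ m
    growth γ a []       m []         = m≤m+n _ _
    growth γ a (x ∷ xs) m (le ∷ les) = begin
      sz A (iterate γ (f ((γ , a) , x)) xs)                     ≤⟨ growth γ _ xs m les ⟩
      sz A (f ((γ , a) , x)) + length xs * ⟦ q ⟧ m              ≤⟨ +-monoˡ-≤ _ (additive γ a x) ⟩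
      sz A a + ⟦ q ⟧ (sz Γ γ + sz C x) + length xs * ⟦ q ⟧ m    ≤⟨ +-monoˡ-≤ _ (+-monoʳ-≤ (sz A a) (⟦⟧-mono q le)) ⟩
      sz A a + ⟦ q ⟧ m + length xs * ⟦ q ⟧ m                    ≡⟨ +-assoc (sz A a) _ _ ⟩
      sz A a + (⟦ q ⟧ m + length xs * ⟦ q ⟧ m)                  ∎

-- List and Boolean functions

T-ext : ∀ {a b} → (T a → T b) → (T b → T a) → a ≡ b
T-ext {true}  {true}  _ _ = refl
T-ext {true}  {false} f _ = ⊥-elim (f tt)
T-ext {false} {true}  _ g = ⊥-elim (g tt)
T-ext {false} {false} _ _ = refl

sz-++ : ∀ C xs ys → suc (sz (Lst C) (xs ++ ys)) ≡ sz (Lst C) xs + sz (Lst C) ys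
sz-++ C []       ys = refl
sz-++ C (x ∷ xs) ys = cong suc (begin
  suc (sz C x + sz (Lst C) (xs ++ ys))   ≡⟨ +-suc (sz C x) _ ⟨
  sz C x + suc (sz (Lst C) (xs ++ ys))   ≡⟨ cong (sz C x +_) (sz-++ C xs ys) ⟩
  sz C x + (sz (Lst C) xs + sz (Lst C) ys) ≡⟨ +-assoc (sz C x) _ _ ⟨
  sz C x + sz (Lst C) xs + sz (Lst C) ys ∎)
  where open ≡-Reasoning

sz-reverse : ∀ C xs → sz (Lst C) (reverse xs) ≡ sz (Lst C) xs
sz-reverse C []       = refl
sz-reverse C (x ∷ xs) = suc-injective (begin
  suc (sz (Lst C) (reverse (x ∷ xs)))             ≡⟨ cong (suc ∘ sz (Lst C)) (unfold-reverse x xs) ⟩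
  suc (sz (Lst C) (reverse xs ++ x ∷ []))         ≡⟨ sz-++ C (reverse xs) (x ∷ []) ⟩
  sz (Lst C) (reverse xs) + suc (sz C x + 1)      ≡⟨ cong (_+ suc (sz C x + 1)) (sz-reverse C xs) ⟩
  sz (Lst C) xs + suc (sz C x + 1)                ≡⟨ rearrange (sz (Lst C) xs) (sz C x) ⟩
  suc (suc (sz C x + sz (Lst C) xs))              ∎)
  where
  open ≡-Reasoning
  rearrange : ∀ a b → a + suc (b + 1) ≡ suc (suc (b + a))
  rearrange = solve-∀

sz-list : ∀ C {B} xs → All (λ x → sz C x ≤ B) xs → sz (Lst C) xs ≤ 1 + length xs * (1 + B)
sz-list C []       []         = ≤-refl
sz-list C (x ∷ xs) (le ∷ les) = s≤s (≤-trans (+-mono-≤ le (sz-list C xs les)) (≤-reflexive (+-suc _ _)))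

reverseᴾ : ∀ {A} → PT (Lst A) (Lst A) reverse
reverseᴾ {A} = foldl-additiveᴾ {Lst A} {Lst A} {A} {λ ((_ , a) , x) → x ∷ a}
  (consᴾ sndᴾ (sndᴾ ∘ᴾ fstᴾ)) nilᴾ idᴾ (# 1 ⊕ X)
  λ γ a x → ≤-trans (≤-reflexive (sz-cons A x a))
                    (+-monoʳ-≤ (sz (Lst A) a) (s≤s (m≤n+m (sz A x) (sz (Lst A) γ))))

module _ {Γ A C : Code} {f : ⌞ (Γ ⊗ A) ⊗ C ⌟ → ⌞ A ⌟} (pf : PT ((Γ ⊗ A) ⊗ C) A f) where

  foldrᴾ : ∀ {i l} → PT Γ A i → PT Γ (Lst C) l → (q : Pol) →
           (∀ γ xs → sz A (foldr (λ x a → f ((γ , a) , x)) (i γ) xs) ≤ ⟦ q ⟧ (sz Γ γ + sz (Lst C) xs)) →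
           PT Γ A (λ γ → foldr (λ x a → f ((γ , a) , x)) (i γ) (l γ))
  foldrᴾ {i} {l} pi pl q bounded =
    congᴾ (λ γ → trans (sym (Listₚ.reverse-foldr _ (i γ) (reverse (l γ))))
                       (cong (foldr _ (i γ)) (reverse-involutive (l γ))))
      (foldlᴾ pf pi (reverseᴾ ∘ᴾ pl) q λ γ xs →
        subst₂ _≤_ (cong (sz A) (Listₚ.reverse-foldr _ (i γ) xs))
                   (cong (λ s → ⟦ q ⟧ (sz Γ γ + s)) (sz-reverse C xs))
                   (bounded γ (reverse xs)))

  foldr-additiveᴾ : ∀ {i l} → PT Γ A i → PT Γ (Lst C) l → (q : Pol) →
                    (∀ γ a x → sz A (f ((γ , a) , x)) ≤ sz A a + ⟦ q ⟧ (sz Γ γ + sz C x)) →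
                    PT Γ A (λ γ → foldr (λ x a → f ((γ , a) , x)) (i γ) (l γ))
  foldr-additiveᴾ {i} {l} pi pl q additive =
    congᴾ (λ γ → trans (sym (Listₚ.reverse-foldr _ (i γ) (reverse (l γ))))
                       (cong (foldr _ (i γ)) (reverse-involutive (l γ))))
      (foldl-additiveᴾ pf pi (reverseᴾ ∘ᴾ pl) q additive)

appendᴾ : ∀ {Γ A f g} → PT Γ (Lst A) f → PT Γ (Lst A) g → PT Γ (Lst A) (λ γ → f γ ++ g γ)
appendᴾ {Γ} {A} pf pg =
  congᴾ (λ (xs , ys) → lemma xs ys)
    (foldr-additiveᴾ {Lst A ⊗ Lst A} {Lst A} {A} {λ ((_ , a) , x) → x ∷ a} (consᴾ sndᴾ (sndᴾ ∘ᴾ fstᴾ)) sndᴾ fstᴾ (# 1 ⊕ X)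
      λ γ a x → ≤-trans (≤-reflexive (sz-cons A x a))
                        (+-monoʳ-≤ (sz (Lst A) a) (s≤s (m≤n+m (sz A x) (sz (Lst A ⊗ Lst A) γ)))))
  ∘ᴾ pairᴾ pf pg
  where
  lemma : ∀ {B : Set} (xs ys : List B) → foldr _∷_ ys xs ≡ xs ++ ys
  lemma []       ys = refl
  lemma (x ∷ xs) ys = cong (x ∷_) (lemma xs ys)

mapᴾ : ∀ {Γ A B f l} → PT (Γ ⊗ A) B f → PT Γ (Lst A) l → PT Γ (Lst B) (λ γ → map (λ x → f (γ , x)) (l γ))
mapᴾ {Γ} {A} {B} {f} {l} pf pl =
  congᴾ (λ γ → sym (Listₚ.map-is-foldr (l γ)))
    (foldr-additiveᴾ {Γ} {Lst B} {A} {λ ((γ , a) , x) → f (γ , x) ∷ a}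
      (consᴾ (pf ∘ᴾ pairᴾ (fstᴾ ∘ᴾ fstᴾ) sndᴾ) (sndᴾ ∘ᴾ fstᴾ)) nilᴾ pl (# 1 ⊕ (pol pf ∘ₚ (# 1 ⊕ X)))
      λ γ a x → ≤-trans (≤-reflexive (sz-cons B (f (γ , x)) a))
        (+-monoʳ-≤ (sz (Lst B) a) (s≤s (≤-trans (output-size pf (γ , x))
          (≤-reflexive (sym (⟦⟧-∘ (pol pf) (# 1 ⊕ X) (sz Γ γ + sz A x))))))))

concatMapᴾ : ∀ {Γ A B f l} → PT (Γ ⊗ A) (Lst B) f → PT Γ (Lst A) l →
             PT Γ (Lst B) (λ γ → concatMap (λ x → f (γ , x)) (l γ))
concatMapᴾ {Γ} {A} {B} {f} {l} pf pl =
  congᴾ (λ γ → concatMap-is-foldr (λ x → f (γ , x)) (l γ))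
    (foldr-additiveᴾ {Γ} {Lst B} {A} {λ ((γ , a) , x) → f (γ , x) ++ a}
      (appendᴾ (pf ∘ᴾ pairᴾ (fstᴾ ∘ᴾ fstᴾ) sndᴾ) (sndᴾ ∘ᴾ fstᴾ)) nilᴾ pl (pol pf ∘ₚ (# 1 ⊕ X))
      λ γ a x → ≤-trans (n≤1+n _) (≤-trans (≤-reflexive (sz-++ B (f (γ , x)) a))
        (≤-trans (≤-reflexive (+-comm (sz (Lst B) (f (γ , x))) _))
          (+-monoʳ-≤ (sz (Lst B) a) (≤-trans (output-size pf (γ , x))
          (≤-reflexive (sym (⟦⟧-∘ (pol pf) (# 1 ⊕ X) (sz Γ γ + sz A x)))))))))
  where
  concatMap-is-foldr : ∀ (g : ⌞ A ⌟ → List ⌞ B ⌟) xs → foldr (λ x a → g x ++ a) [] xs ≡ concatMap g xs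
  concatMap-is-foldr g []       = refl
  concatMap-is-foldr g (x ∷ xs) = cong (g x ++_) (concatMap-is-foldr g xs)

filterᴾ : ∀ {Γ A f l} → PT (Γ ⊗ A) Bol f → PT Γ (Lst A) l → PT Γ (Lst A) (λ γ → filterᵇ (λ x → f (γ , x)) (l γ))
filterᴾ {Γ} {A} {f} {l} pf pl =
  congᴾ (λ γ → filter-is-concatMap (λ x → f (γ , x)) (l γ))
    (concatMapᴾ (ifᴾ pf (consᴾ sndᴾ nilᴾ) nilᴾ) pl)
  where
  filter-is-concatMap : ∀ (g : ⌞ A ⌟ → Bool) xs → concatMap (λ x → if g x then x ∷ [] else []) xs ≡ filterᵇ g xs
  filter-is-concatMap g []       = refl
  filter-is-concatMap g (x ∷ xs) with g x
  ... | true  = cong (x ∷_) (filter-is-concatMap g xs)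
  ... | false = filter-is-concatMap g xs

andᴾ : ∀ {Γ f g} → PT Γ Bol f → PT Γ Bol g → PT Γ Bol (λ γ → f γ ∧ g γ)
andᴾ {Γ} {f} {g} pf pg = congᴾ (λ γ → lemma (f γ) (g γ)) (ifᴾ pf pg falseᴾ)
  where
  lemma : ∀ a b → (if a then b else false) ≡ a ∧ b
  lemma true  b = refl
  lemma false b = refl

notᴾ : ∀ {Γ f} → PT Γ Bol f → PT Γ Bol (λ γ → not (f γ))
notᴾ {Γ} {f} pf = congᴾ (λ γ → lemma (f γ)) (ifᴾ pf falseᴾ trueᴾ)
  where
  lemma : ∀ a → (if a then false else true) ≡ not a
  lemma true  = refl
  lemma false = refl

-- Unary numbers

sz-unary : ∀ n → sz Una n ≡ 1 + 2 * n
sz-unary zero    = refl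
sz-unary (suc n) = cong suc (cong suc (trans (sz-unary n) (sym (+-suc n (n + 0)))))

sz-unary-mono : ∀ {m n} → m ≤ n → sz Una m ≤ sz Una n
sz-unary-mono {m} {n} m≤n = subst₂ _≤_ (sym (sz-unary m)) (sym (sz-unary n)) (s≤s (*-monoʳ-≤ 2 m≤n))

n≤sz-unary : ∀ n → n ≤ sz Una n
n≤sz-unary n = ≤-trans (≤-trans (m≤m+n n (n + 0)) (n≤1+n _)) (≤-reflexive (sym (sz-unary n)))

unary-list : ∀ n → enc (Lst Unit) (replicate n tt) ≡ unary n
unary-list zero    = refl
unary-list (suc n) = cong (leaf ∙_) (unary-list n)

fold-is-foldr : ∀ {A : Set} (z : A) (s : A → A) n → foldr (λ (_ : ⊤) a → s a) z (replicate n tt) ≡ fold z s n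
fold-is-foldr z s zero    = refl
fold-is-foldr z s (suc n) = cong s (fold-is-foldr z s n)

unitsᴾ : PT Una (Lst Unit) (λ n → replicate n tt)
unitsᴾ = recodeᴾ {Una} {Una} {Una} {Lst Unit} id (λ _ → refl) (λ n → sym (unary-list n)) idᴾ

module _ {Γ A : Code} {f : ⌞ Γ ⊗ A ⌟ → ⌞ A ⌟} (pf : PT (Γ ⊗ A) A f) where

  foldᴾ : ∀ {i n} → PT Γ A i → PT Γ Una n → (q : Pol) →
          (∀ γ n → sz A (fold (i γ) (λ a → f (γ , a)) n) ≤ ⟦ q ⟧ (sz Γ γ + n)) →
          PT Γ A (λ γ → fold (i γ) (λ a → f (γ , a)) (n γ))
  foldᴾ {i} {n} pi pn q bounded =
    congᴾ (λ γ → fold-is-foldr (i γ) _ (n γ))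
      (foldrᴾ {Γ} {A} {Unit} (pf ∘ᴾ fstᴾ) pi (unitsᴾ ∘ᴾ pn) q λ γ xs →
        ≤-trans (≤-reflexive (cong (sz A) (trans (cong (foldr _ (i γ)) (units xs)) (fold-is-foldr (i γ) _ (length xs)))))
          (≤-trans (bounded γ (length xs)) (⟦⟧-mono q (+-monoʳ-≤ (sz Γ γ) (<⇒≤ (length<sz Unit xs))))))
    where
    units : ∀ (xs : List ⊤) → xs ≡ replicate (length xs) tt
    units []       = refl
    units (tt ∷ xs) = cong (tt ∷_) (units xs)

  fold-additiveᴾ : ∀ {i n} → PT Γ A i → PT Γ Una n → (q : Pol) →
                   (∀ γ a → sz A (f (γ , a)) ≤ sz A a + ⟦ q ⟧ (sz Γ γ)) →
                   PT Γ A (λ γ → fold (i γ) (λ a → f (γ , a)) (n γ))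
  fold-additiveᴾ {i} {n} pi pn q additive = foldᴾ pi pn (pol pi ⊕ X ⊛ q) bounded
    where
    open ≤-Reasoning
    growth : ∀ γ n → sz A (fold (i γ) (λ a → f (γ , a)) n) ≤ sz A (i γ) + n * ⟦ q ⟧ (sz Γ γ)
    growth γ zero    = m≤m+n _ _
    growth γ (suc n) = begin
      sz A (f (γ , fold (i γ) (λ a → f (γ , a)) n))             ≤⟨ additive γ _ ⟩
      sz A (fold (i γ) (λ a → f (γ , a)) n) + ⟦ q ⟧ (sz Γ γ)    ≤⟨ +-monoˡ-≤ _ (growth γ n) ⟩
      sz A (i γ) + n * ⟦ q ⟧ (sz Γ γ) + ⟦ q ⟧ (sz Γ γ)          ≡⟨ +-assoc (sz A (i γ)) _ _ ⟩
      sz A (i γ) + (n * ⟦ q ⟧ (sz Γ γ) + ⟦ q ⟧ (sz Γ γ))        ≡⟨ cong (sz A (i γ) +_) (+-comm (n * ⟦ q ⟧ (sz Γ γ)) _) ⟩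
      sz A (i γ) + (⟦ q ⟧ (sz Γ γ) + n * ⟦ q ⟧ (sz Γ γ))        ∎
    bounded : ∀ γ n → sz A (fold (i γ) (λ a → f (γ , a)) n) ≤ ⟦ pol pi ⊕ X ⊛ q ⟧ (sz Γ γ + n)
    bounded γ n = ≤-trans (growth γ n) (+-mono-≤
      (≤-trans (output-size pi γ) (⟦⟧-mono (pol pi) (m≤m+n _ n)))
      (*-mono-≤ (m≤n+m n (sz Γ γ)) (⟦⟧-mono q (m≤m+n _ n))))

addUᴾ : ∀ {Γ f g} → PT Γ Una f → PT Γ Una g → PT Γ Una (λ γ → f γ + g γ)
addUᴾ pf pg = congᴾ (λ (m , n) → lemma m n)
    (fold-additiveᴾ {Una ⊗ Una} {Una} {λ (_ , a) → suc a} (sucᴾ sndᴾ) sndᴾ fstᴾ (# 2)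
      λ γ a → ≤-reflexive (+-comm 2 (sz Una a)))
  ∘ᴾ pairᴾ pf pg
  where
  lemma : ∀ m n → fold n suc m ≡ m + n
  lemma zero    n = refl
  lemma (suc m) n = cong suc (lemma m n)

monusUᴾ : ∀ {Γ f g} → PT Γ Una f → PT Γ Una g → PT Γ Una (λ γ → f γ ∸ g γ)
monusUᴾ pf pg = congᴾ (λ (m , n) → lemma m n)
    (fold-additiveᴾ {Una ⊗ Una} {Una} {λ (_ , a) → pred a} (predᴾ sndᴾ) fstᴾ sndᴾ (# 0)
      λ γ a → ≤-trans (pred≤ a) (m≤m+n _ 0))
  ∘ᴾ pairᴾ pf pg
  where
  lemma : ∀ m n → fold m pred n ≡ m ∸ n
  lemma m zero    = refl
  lemma m (suc n) = trans (cong pred (lemma m n)) (pred[m∸n]≡m∸[1+n] m n)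
  pred≤ : ∀ a → sz Una (pred a) ≤ sz Una a
  pred≤ zero    = ≤-refl
  pred≤ (suc a) = ≤-trans (n≤1+n _) (n≤1+n _)

isZeroᴾ : ∀ {Γ f} → PT Γ Una f → PT Γ Bol (λ γ → f γ ≡ᵇ 0)
isZeroᴾ {Γ} {f} pf = congᴾ (λ γ → lemma (f γ)) (caseᴾ (unitsᴾ ∘ᴾ pf) trueᴾ falseᴾ)
  where
  lemma : ∀ n → caseList (replicate n tt) true (λ _ _ → false) ≡ (n ≡ᵇ 0)
  lemma zero    = refl
  lemma (suc n) = refl

leUᴾ : ∀ {Γ f g} → PT Γ Una f → PT Γ Una g → PT Γ Bol (λ γ → f γ ≤ᵇ g γ)
leUᴾ {Γ} {f} {g} pf pg = congᴾ (λ γ → lemma (f γ) (g γ)) (isZeroᴾ (monusUᴾ pf pg))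
  where
  lemma : ∀ m n → (m ∸ n ≡ᵇ 0) ≡ (m ≤ᵇ n)
  lemma m n = T-ext (λ t → ≤⇒≤ᵇ {m} {n} (m∸n≡0⇒m≤n {m} {n} (≡ᵇ⇒≡ (m ∸ n) 0 t)))
                    (λ t → ≡⇒≡ᵇ (m ∸ n) 0 (m≤n⇒m∸n≡0 (≤ᵇ⇒≤ m n t)))

eqUᴾ : ∀ {Γ f g} → PT Γ Una f → PT Γ Una g → PT Γ Bol (λ γ → f γ ≡ᵇ g γ)
eqUᴾ {Γ} {f} {g} pf pg = congᴾ (λ γ → lemma (f γ) (g γ)) (andᴾ (leUᴾ pf pg) (leUᴾ pg pf))
  where
  lemma : ∀ m n → ((m ≤ᵇ n) ∧ (n ≤ᵇ m)) ≡ (m ≡ᵇ n)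
  lemma m n = T-ext both (λ t → backwards (≡ᵇ⇒≡ m n t))
    where
    both : T ((m ≤ᵇ n) ∧ (n ≤ᵇ m)) → T (m ≡ᵇ n)
    both t with m ≤ᵇ n in eq | n ≤ᵇ m in eq′
    ... | true | true = ≡⇒≡ᵇ m n (≤-antisym (≤ᵇ⇒≤ m n (subst T (sym eq) tt)) (≤ᵇ⇒≤ n m (subst T (sym eq′) tt)))
    backwards : m ≡ n → T ((m ≤ᵇ n) ∧ (n ≤ᵇ m))
    backwards refl with m ≤ᵇ m in eq
    ... | true  = tt
    ... | false = subst T eq (≤⇒≤ᵇ (≤-refl {m}))

lengthᴾ : ∀ {Γ A l} → PT Γ (Lst A) l → PT Γ Una (λ γ → length (l γ))
lengthᴾ {Γ} {A} {l} pl = congᴾ (λ γ → lemma (l γ))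
    (foldr-additiveᴾ {Γ} {Una} {A} {λ ((_ , a) , _) → suc a} (sucᴾ (sndᴾ ∘ᴾ fstᴾ)) zeroᴾ pl (# 2)
      λ γ a x → ≤-reflexive (+-comm 2 (sz Una a)))
  where
  lemma : ∀ {B : Set} (xs : List B) → foldr (λ _ → suc) 0 xs ≡ length xs
  lemma []       = refl
  lemma (x ∷ xs) = cong suc (lemma xs)

replicateᴾ : ∀ {Γ A n x} → PT Γ Una n → PT Γ A x → PT Γ (Lst A) (λ γ → replicate (n γ) (x γ))
replicateᴾ {Γ} {A} pn px = congᴾ (λ (n , x) → lemma n x)
    (fold-additiveᴾ {Una ⊗ A} {Lst A} {λ ((_ , x) , a) → x ∷ a} (consᴾ (sndᴾ ∘ᴾ fstᴾ) sndᴾ) nilᴾ fstᴾ (# 1 ⊕ X)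
      λ (n , x) a → ≤-trans (≤-reflexive (sz-cons A x a))
        (+-monoʳ-≤ (sz (Lst A) a) (s≤s (m≤n⇒m≤1+n (m≤n+m (sz A x) (sz Una n))))))
  ∘ᴾ pairᴾ pn px
  where
  lemma : ∀ {B : Set} n (x : B) → fold [] (x ∷_) n ≡ replicate n x
  lemma zero    x = refl
  lemma (suc n) x = cong (x ∷_) (lemma n x)

upToᴾ : ∀ {Γ n} → PT Γ Una n → PT Γ (Lst Una) (λ γ → upTo (n γ))
upToᴾ {Γ} {n} pn = congᴾ (λ γ → trans (cong (reverse ∘ proj₂) (lemma (n γ))) (Listₚ.reverse-downFrom (n γ)))
  (reverseᴾ ∘ᴾ sndᴾ ∘ᴾ
    foldᴾ {Γ} {Una ⊗ Lst Una} {λ (_ , k , xs) → suc k , k ∷ xs}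
      (pairᴾ (sucᴾ (fstᴾ ∘ᴾ sndᴾ)) (consᴾ (fstᴾ ∘ᴾ sndᴾ) (sndᴾ ∘ᴾ sndᴾ)))
      (pairᴾ zeroᴾ nilᴾ) pn (# 1 ⊕ ((# 1 ⊕ # 2 ⊛ X) ⊕ (# 1 ⊕ X ⊛ (# 1 ⊕ (# 1 ⊕ # 2 ⊛ X)))))
      λ γ n → ≤-trans (≤-reflexive (cong (sz (Una ⊗ Lst Una)) (lemma n)))
        (≤-trans (size-pair n) (⟦⟧-mono (# 1 ⊕ ((# 1 ⊕ # 2 ⊛ X) ⊕ (# 1 ⊕ X ⊛ (# 1 ⊕ (# 1 ⊕ # 2 ⊛ X))))) (m≤n+m n (sz Γ γ)))))
  where
  lemma : ∀ n → fold (0 , []) (λ (k , xs) → suc k , k ∷ xs) n ≡ (n , downFrom n)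
  lemma zero    = refl
  lemma (suc n) = cong (λ (k , xs) → suc k , k ∷ xs) (lemma n)
  small : ∀ m n → n ≤ m → All (λ k → sz Una k ≤ 1 + 2 * m) (downFrom n)
  small m zero    _   = []
  small m (suc n) n<m = ≤-trans (≤-reflexive (sz-unary n)) (s≤s (*-monoʳ-≤ 2 (<⇒≤ n<m))) ∷ small m n (<⇒≤ n<m)
  size-pair : ∀ n → sz (Una ⊗ Lst Una) (n , downFrom n) ≤ 1 + ((1 + 2 * n) + (1 + n * (1 + (1 + 2 * n))))
  size-pair n = s≤s (+-mono-≤ (≤-reflexive (sz-unary n))
    (≤-trans (sz-list Una (downFrom n) (small n n ≤-refl))
      (≤-reflexive (cong (λ l → 1 + l * (1 + (1 + 2 * n))) (Listₚ.length-downFrom n)))))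

zipᴾ : ∀ {Γ A B f g} → PT Γ (Lst A) f → PT Γ (Lst B) g → PT Γ (Lst (A ⊗ B)) (λ γ → zip (f γ) (g γ))
zipᴾ {Γ} {A} {B} pf pg =
  congᴾ {g = λ (xs , ys) → zip xs ys}
    (λ (xs , ys) → trans (cong reverse (trans (lemma xs ys []) (++-identityʳ (reverse (zip xs ys))))) (reverse-involutive (zip xs ys)))
    (reverseᴾ ∘ᴾ sndᴾ ∘ᴾ
      foldl-additiveᴾ {Lst A ⊗ Lst B} {State} {A} {λ ((_ , a) , x) → next a x}
        (caseᴾ (fstᴾ ∘ᴾ sndᴾ ∘ᴾ fstᴾ) (pairᴾ nilᴾ (sndᴾ ∘ᴾ sndᴾ ∘ᴾ fstᴾ))
          (pairᴾ (sndᴾ ∘ᴾ sndᴾ) (consᴾ (pairᴾ (sndᴾ ∘ᴾ fstᴾ) (fstᴾ ∘ᴾ sndᴾ)) (sndᴾ ∘ᴾ sndᴾ ∘ᴾ fstᴾ ∘ᴾ fstᴾ))))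
        (pairᴾ sndᴾ nilᴾ) fstᴾ (# 1 ⊕ X)
        λ γ (ys , out) x → additive γ ys out x)
  ∘ᴾ pairᴾ pf pg
  where
  State : Code
  State = Lst B ⊗ Lst (A ⊗ B)
  next : ⌞ State ⌟ → ⌞ A ⌟ → ⌞ State ⌟
  next (ys , out) x = caseList ys ([] , out) (λ y ys′ → ys′ , (x , y) ∷ out)
  exhausted : ∀ xs out → foldl next ([] , out) xs ≡ ([] , out)
  exhausted []       out = refl
  exhausted (x ∷ xs) out = exhausted xs out
  lemma : ∀ xs ys out → proj₂ (foldl next (ys , out) xs) ≡ reverse (zip xs ys) ++ out
  lemma []       ys       out = refl
  lemma (x ∷ xs) []       out = cong proj₂ (exhausted xs out)
  lemma (x ∷ xs) (y ∷ ys) out = begin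
    proj₂ (foldl next (ys , (x , y) ∷ out) xs)        ≡⟨ lemma xs ys ((x , y) ∷ out) ⟩
    reverse (zip xs ys) ++ (x , y) ∷ out              ≡⟨ ++-assoc (reverse (zip xs ys)) ((x , y) ∷ []) out ⟨
    (reverse (zip xs ys) ++ (x , y) ∷ []) ++ out      ≡⟨ cong (_++ out) (unfold-reverse (x , y) (zip xs ys)) ⟨
    reverse ((x , y) ∷ zip xs ys) ++ out              ∎
    where open ≡-Reasoning
  rearrange : ∀ x y ys out → suc (ys + suc (suc (x + y) + out)) ≡ suc (suc (y + ys) + out) + (1 + x)
  rearrange = solve-∀
  additive : ∀ γ ys out x → sz State (next (ys , out) x) ≤ sz State (ys , out) + (1 + (sz (Lst A ⊗ Lst B) γ + sz A x))
  additive γ []       out x = m≤m+n _ _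
  additive γ (y ∷ ys) out x = ≤-trans
    (≤-reflexive (rearrange (sz A x) (sz B y) (sz (Lst B) ys) (sz (Lst (A ⊗ B)) out)))
    (+-monoʳ-≤ (sz State (y ∷ ys , out)) (s≤s (m≤n+m (sz A x) (sz (Lst A ⊗ Lst B) γ))))

takeᴾ : ∀ {Γ A n l} → PT Γ Una n → PT Γ (Lst A) l → PT Γ (Lst A) (λ γ → take (n γ) (l γ))
takeᴾ {n = n} {l} pn pl = congᴾ (λ γ → lemma (n γ) (l γ)) (mapᴾ (fstᴾ ∘ᴾ sndᴾ) (zipᴾ pl (unitsᴾ ∘ᴾ pn)))
  where
  lemma : ∀ {A : Set} n (xs : List A) → map proj₁ (zip xs (replicate n tt)) ≡ take n xs
  lemma zero    []       = refl
  lemma zero    (x ∷ xs) = refl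
  lemma (suc n) []       = refl
  lemma (suc n) (x ∷ xs) = cong (x ∷_) (lemma n xs)

dropᴾ : ∀ {Γ A n l} → PT Γ Una n → PT Γ (Lst A) l → PT Γ (Lst A) (λ γ → drop (n γ) (l γ))
dropᴾ {A = A} pn pl = congᴾ (λ (n , xs) → lemma n xs)
    (fold-additiveᴾ {Una ⊗ Lst A} {Lst A} {λ (_ , a) → caseList a [] (λ _ ys → ys)}
      (caseᴾ sndᴾ nilᴾ (sndᴾ ∘ᴾ sndᴾ)) sndᴾ fstᴾ (# 0)
      λ γ a → ≤-trans (tail≤ a) (m≤m+n _ 0))
  ∘ᴾ pairᴾ pn pl
  where
  tail≤ : ∀ xs → sz (Lst A) (caseList xs [] (λ _ ys → ys)) ≤ sz (Lst A) xs
  tail≤ []       = ≤-refl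
  tail≤ (x ∷ xs) = size-right (enc (Lst A) (x ∷ xs))
  drop-suc : ∀ {B : Set} n (xs : List B) → caseList (drop n xs) [] (λ _ ys → ys) ≡ drop (suc n) xs
  drop-suc zero    []       = refl
  drop-suc zero    (x ∷ xs) = refl
  drop-suc (suc n) []       = refl
  drop-suc (suc n) (x ∷ xs) = drop-suc n xs
  lemma : ∀ {B : Set} n (xs : List B) → fold xs (λ a → caseList a [] (λ _ ys → ys)) n ≡ drop n xs
  lemma zero    xs = refl
  lemma (suc n) xs = trans (cong (λ ys → caseList ys [] (λ _ zs → zs)) (lemma n xs)) (drop-suc n xs)

-- Binary numbers

-- Bijective base-2 digits, least significant first; true is the digit 1 and
-- false the digit 2, so that encodeℕ n is literally the encoding of digits n.
bits : ℕᵇ → List Bool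
bits ℕᵇ.zero  = []
bits 2[1+ x ] = false ∷ bits x
bits 1+[2 x ] = true ∷ bits x

unbits : List Bool → ℕᵇ
unbits []           = ℕᵇ.zero
unbits (false ∷ ds) = 2[1+ unbits ds ]
unbits (true ∷ ds)  = 1+[2 unbits ds ]

bits-unbits : ∀ ds → bits (unbits ds) ≡ ds
bits-unbits []           = refl
bits-unbits (false ∷ ds) = cong (false ∷_) (bits-unbits ds)
bits-unbits (true ∷ ds)  = cong (true ∷_) (bits-unbits ds)

Digits : Code
Digits = Lst Bol

Nat : Code
Nat = code ℕ encodeℕ

enc-bits : ∀ x → enc Digits (bits x) ≡ encodeℕᵇ x
enc-bits ℕᵇ.zero  = refl
enc-bits 2[1+ x ] = cong (leaf ∙_) (enc-bits x)
enc-bits 1+[2 x ] = cong ((leaf ∙ leaf) ∙_) (enc-bits x)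

val : List Bool → ℕ
val []           = 0
val (false ∷ ds) = 2 * suc (val ds)
val (true ∷ ds)  = suc (2 * val ds)

val-bits : ∀ x → val (bits x) ≡ ℕᵇ.toℕ x
val-bits ℕᵇ.zero  = refl
val-bits 2[1+ x ] = cong (λ n → 2 * suc n) (val-bits x)
val-bits 1+[2 x ] = cong (λ n → suc (2 * n)) (val-bits x)

digits : ℕ → List Bool
digits n = bits (ℕᵇ.fromℕ n)

val-digits : ∀ n → val (digits n) ≡ n
val-digits n = trans (val-bits (ℕᵇ.fromℕ n)) (ℕᵇₚ.toℕ-fromℕ n)

-- In bijective numerals every list of digits is canonical, so the digit algorithms below never have
-- to normalise their results.
digits-val : ∀ ds → digits (val ds) ≡ ds
digits-val ds = begin
  bits (ℕᵇ.fromℕ (val ds))                    ≡⟨ cong (bits ∘ ℕᵇ.fromℕ ∘ val) (bits-unbits ds) ⟨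
  bits (ℕᵇ.fromℕ (val (bits (unbits ds))))    ≡⟨ cong (bits ∘ ℕᵇ.fromℕ) (val-bits (unbits ds)) ⟩
  bits (ℕᵇ.fromℕ (ℕᵇ.toℕ (unbits ds)))        ≡⟨ cong bits (ℕᵇₚ.fromℕ-toℕ (unbits ds)) ⟩
  bits (unbits ds)                            ≡⟨ bits-unbits ds ⟩
  ds                                          ∎
  where open ≡-Reasoning

enc-digits : ∀ n → enc Digits (digits n) ≡ encodeℕ n
enc-digits n = enc-bits (ℕᵇ.fromℕ n)

enc-val : ∀ ds → enc Digits ds ≡ encodeℕ (val ds)
enc-val ds = trans (cong (enc Digits) (sym (digits-val ds))) (enc-digits (val ds))

digitsᴾ : ∀ {Γ f} → PT Γ Nat f → PT Γ Digits (λ γ → digits (f γ))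
digitsᴾ pf = recodeᴾ {Nat} {Nat} {Nat} {Digits} {g = digits} id (λ _ → refl) (λ n → sym (enc-digits n)) idᴾ ∘ᴾ pf

valᴾ : ∀ {Γ f} → PT Γ Digits f → PT Γ Nat (λ γ → val (f γ))
valᴾ pf = recodeᴾ {Digits} {Digits} {Digits} {Nat} {g = val} id (λ _ → refl) enc-val idᴾ ∘ᴾ pf

len : ℕ → ℕ
len n = length (digits n)

-- A digit takes at most 3 nodes and its list cell one more.
sz-digits : ∀ ds → sz Digits ds ≤ 1 + 4 * length ds
sz-digits ds = ≤-trans (sz-list Bol ds (All.universal small ds)) (s≤s (≤-reflexive (*-comm (length ds) 4)))
  where
  small : ∀ d → sz Bol d ≤ 3
  small true  = ≤-refl
  small false = s≤s z≤n

sz-len : ∀ n → sz Nat n ≤ 1 + 4 * len n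
sz-len n = subst (λ t → size t ≤ 1 + 4 * len n) (enc-digits n) (sz-digits (digits n))

len<sz : ∀ n → suc (len n) ≤ sz Nat n
len<sz n = subst (λ t → suc (len n) ≤ size t) (enc-digits n) (length<sz Bol (digits n))

sz-len≤ : ∀ {m k} → suc (len m) ≤ k → sz Nat m ≤ 4 * k
sz-len≤ {m} {k} le = begin
  sz Nat m             ≤⟨ sz-len m ⟩
  1 + 4 * len m        ≤⟨ +-monoˡ-≤ (4 * len m) (s≤s {n = 3} z≤n) ⟩
  4 + 4 * len m        ≡⟨ *-suc 4 (len m) ⟨
  4 * suc (len m)      ≤⟨ *-monoʳ-≤ 4 le ⟩
  4 * k                ∎
  where open ≤-Reasoning

2^len≤ : ∀ n → 2 ^ len n ≤ suc n
2^len≤ n = subst (λ m → 2 ^ len n ≤ suc m) (val-digits n) (go (digits n))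
  where
  go : ∀ ds → 2 ^ length ds ≤ suc (val ds)
  go []           = ≤-refl
  go (false ∷ ds) = m≤n⇒m≤1+n (*-monoʳ-≤ 2 (go ds))
  go (true ∷ ds)  = ≤-trans (*-monoʳ-≤ 2 (go ds)) (≤-reflexive (*-suc 2 (val ds)))

<2^len : ∀ n → suc n < 2 ^ suc (len n)
<2^len n = subst (λ m → suc m < 2 ^ suc (len n)) (val-digits n) (go (digits n))
  where
  even : ∀ v → 2 * suc (suc v) ≡ suc (suc (2 * suc v))
  even = solve-∀
  odd : ∀ v → 2 * suc (suc v) ≡ suc (suc (suc (2 * v))) + 1
  odd = solve-∀
  go : ∀ ds → suc (val ds) < 2 ^ suc (length ds)
  go []           = ≤-refl
  go (false ∷ ds) = ≤-trans (≤-reflexive (sym (even (val ds)))) (*-monoʳ-≤ 2 (go ds))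
  go (true ∷ ds)  = ≤-trans (≤-trans (m≤m+n _ 1) (≤-reflexive (sym (odd (val ds))))) (*-monoʳ-≤ 2 (go ds))

2^-cancel-< : ∀ {m n} → 2 ^ m < 2 ^ n → m < n
2^-cancel-< {m} {n} lt with m <? n
... | yes m<n = m<n
... | no  m≮n = ⊥-elim (<⇒≱ lt (^-monoʳ-≤ 2 (≮⇒≥ m≮n)))

-- Since `suc n` lies between `2 ^ len n` and `2 ^ suc (len n)`, lengths add under multiplication of
-- successors. Both `m + n` and `m * n` satisfy the hypothesis.
len-product : ∀ {m n k} → suc k ≤ suc m * suc n → len k ≤ suc (len m + len n)
len-product {m} {n} {k} le = ≤-pred (2^-cancel-< (begin-strict
  2 ^ len k                              ≤⟨ 2^len≤ k ⟩
  suc k                                  ≤⟨ le ⟩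
  suc m * suc n                          <⟨ *-mono-< (<2^len m) (<2^len n) ⟩
  2 ^ suc (len m) * 2 ^ suc (len n)      ≡⟨ ^-distribˡ-+-* 2 (suc (len m)) (suc (len n)) ⟨
  2 ^ (suc (len m) + suc (len n))        ≡⟨ cong (2 ^_) (+-suc (suc (len m)) (len n)) ⟩
  2 ^ suc (suc (len m + len n))          ∎))
  where open ≤-Reasoning

len-* : ∀ m n → len (m * n) ≤ suc (len m + len n)
len-* m n = len-product {m} {n} {m * n} (≤-trans (m≤m+n _ (m + n)) (≤-reflexive (expand m n)))
  where
  expand : ∀ m n → suc (m * n) + (m + n) ≡ suc m * suc n
  expand = solve-∀

len-+ : ∀ m n → len (m + n) ≤ suc (len m + len n)
len-+ m n = len-product {m} {n} {m + n} (≤-trans (m≤m+n _ (m * n)) (≤-reflexive (expand m n)))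
  where
  expand : ∀ m n → suc (m + n) + m * n ≡ suc m * suc n
  expand = solve-∀

sz-* : ∀ m n → sz Nat (m * n) ≤ 4 * (sz Nat m + sz Nat n)
sz-* m n = sz-len≤ {m * n} (≤-trans (s≤s (len-* m n))
  (≤-trans (≤-reflexive (cong suc (sym (+-suc (len m) (len n))))) (+-mono-≤ (len<sz m) (len<sz n))))

sz-sum : ∀ xs → sz Nat (sum xs) ≤ 4 * sz (Lst Nat) xs
sz-sum xs = sz-len≤ {sum xs} (go xs)
  where
  go : ∀ xs → suc (len (sum xs)) ≤ sz (Lst Nat) xs
  go []       = ≤-refl
  go (x ∷ xs) = s≤s (begin
    len (x + sum xs)                    ≤⟨ len-+ x (sum xs) ⟩
    suc (len x + len (sum xs))          ≤⟨ +-mono-≤ (len<sz x) (≤-trans (n≤1+n _) (go xs)) ⟩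
    sz Nat x + sz (Lst Nat) xs          ∎)
    where open ≤-Reasoning

incList : List Bool → List Bool
incList []           = true ∷ []
incList (true ∷ ds)  = false ∷ ds
incList (false ∷ ds) = true ∷ incList ds

val-inc : ∀ ds → val (incList ds) ≡ suc (val ds)
val-inc []           = refl
val-inc (true ∷ ds)  = *-suc 2 (val ds)
val-inc (false ∷ ds) = cong (λ v → suc (2 * v)) (val-inc ds)

length-inc : ∀ ds → length (incList ds) ≤ suc (length ds)
length-inc []           = ≤-refl
length-inc (true ∷ ds)  = n≤1+n _
length-inc (false ∷ ds) = s≤s (length-inc ds)

-- Primitive recursion on lists, obtained by also returning the list itself.
incListᴾ : ∀ {Γ f} → PT Γ Digits f → PT Γ Digits (λ γ → incList (f γ))
incListᴾ pf = congᴾ (λ ds → cong proj₂ (lemma ds))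
  (sndᴾ ∘ᴾ foldrᴾ {Digits} {Digits ⊗ Digits} {Bol}
    {λ ((_ , ds , ids) , d) → d ∷ ds , (if d then false ∷ ds else true ∷ ids)}
    (pairᴾ (consᴾ sndᴾ (fstᴾ ∘ᴾ sndᴾ ∘ᴾ fstᴾ))
      (ifᴾ sndᴾ (consᴾ falseᴾ (fstᴾ ∘ᴾ sndᴾ ∘ᴾ fstᴾ)) (consᴾ trueᴾ (sndᴾ ∘ᴾ sndᴾ ∘ᴾ fstᴾ))))
    (pairᴾ nilᴾ (consᴾ trueᴾ nilᴾ)) idᴾ (# 1 ⊕ (X ⊕ # 4 ⊛ (# 1 ⊕ X))) bounded)
  ∘ᴾ pf
  where
  lemma : ∀ ds → foldr (λ d (ds , ids) → d ∷ ds , (if d then false ∷ ds else true ∷ ids)) ([] , true ∷ []) ds ≡ (ds , incList ds)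
  lemma []           = refl
  lemma (true ∷ ds)  = cong (λ (ds , ids) → true ∷ ds , false ∷ ds) (lemma ds)
  lemma (false ∷ ds) = cong (λ (ds , ids) → false ∷ ds , true ∷ ids) (lemma ds)
  bounded : ∀ γ ds → _
  bounded γ ds = ≤-trans (≤-reflexive (cong (sz (Digits ⊗ Digits)) (lemma ds))) (s≤s (+-mono-≤
    (m≤n+m (sz Digits ds) (sz Digits γ))
    (≤-trans (sz-digits (incList ds)) (begin
      1 + 4 * length (incList ds)             ≤⟨ +-mono-≤ (s≤s {n = 3} z≤n) (*-monoʳ-≤ 4 (≤-trans (length-inc ds) (length<sz Bol ds))) ⟩
      4 + 4 * sz Digits ds                    ≡⟨ *-suc 4 _ ⟨
      4 * suc (sz Digits ds)                  ≤⟨ *-monoʳ-≤ 4 (s≤s (m≤n+m _ (sz Digits γ))) ⟩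
      4 * suc (sz Digits γ + sz Digits ds)    ∎))))
    where open ≤-Reasoning

-- With the digits 1 and 2: 1 + 1 = 2 has no carry, 1 + 2 = 3 leaves the digit 1 and 2 + 2 = 4
-- leaves the digit 2, each with a carry that increments the sum of the higher digits.
addList : List Bool → List Bool → List Bool
addList []           ys           = ys
addList (x ∷ xs)     []           = x ∷ addList xs []
addList (true ∷ xs)  (true ∷ ys)  = false ∷ addList xs ys
addList (true ∷ xs)  (false ∷ ys) = true ∷ incList (addList xs ys)
addList (false ∷ xs) (true ∷ ys)  = true ∷ incList (addList xs ys)
addList (false ∷ xs) (false ∷ ys) = false ∷ incList (addList xs ys)

val-addList : ∀ xs ys → val (addList xs ys) ≡ val xs + val ys
val-addList []           ys           = refl
val-addList (true ∷ xs)  []           = trans (cong (λ v → suc (2 * v)) (val-addList xs [])) (algebra (val xs))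
  where
  algebra : ∀ x → suc (2 * (x + 0)) ≡ suc (2 * x) + 0
  algebra = solve-∀
val-addList (false ∷ xs) []           = trans (cong (λ v → 2 * suc v) (val-addList xs [])) (algebra (val xs))
  where
  algebra : ∀ x → 2 * suc (x + 0) ≡ 2 * suc x + 0
  algebra = solve-∀
val-addList (true ∷ xs)  (true ∷ ys)  = trans (cong (λ v → 2 * suc v) (val-addList xs ys)) (algebra (val xs) (val ys))
  where
  algebra : ∀ x y → 2 * suc (x + y) ≡ suc (2 * x) + suc (2 * y)
  algebra = solve-∀
val-addList (true ∷ xs)  (false ∷ ys) =
  trans (cong (λ v → suc (2 * v)) (trans (val-inc (addList xs ys)) (cong suc (val-addList xs ys)))) (algebra (val xs) (val ys))
  where
  algebra : ∀ x y → suc (2 * suc (x + y)) ≡ suc (2 * x) + 2 * suc y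
  algebra = solve-∀
val-addList (false ∷ xs) (true ∷ ys)  =
  trans (cong (λ v → suc (2 * v)) (trans (val-inc (addList xs ys)) (cong suc (val-addList xs ys)))) (algebra (val xs) (val ys))
  where
  algebra : ∀ x y → suc (2 * suc (x + y)) ≡ 2 * suc x + suc (2 * y)
  algebra = solve-∀
val-addList (false ∷ xs) (false ∷ ys) =
  trans (cong (λ v → 2 * suc v) (trans (val-inc (addList xs ys)) (cong suc (val-addList xs ys)))) (algebra (val xs) (val ys))
  where
  algebra : ∀ x y → 2 * suc (suc (x + y)) ≡ 2 * suc x + 2 * suc y
  algebra = solve-∀

-- A first pass collects (carry , digit) pairs, most significant first, and a
-- second pass inserts the carries.
addListᴾ : ∀ {Γ f g} → PT Γ Digits f → PT Γ Digits g → PT Γ Digits (λ γ → addList (f γ) (g γ))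
addListᴾ pf pg = congᴾ (λ (xs , ys) → passes xs ys [])
    (foldlᴾ {Digits ⊗ Lst (Bol ⊗ Bol)} {Digits} {Bol ⊗ Bol} {λ ((_ , a) , p) → insert a p}
        (consᴾ (sndᴾ ∘ᴾ sndᴾ) (ifᴾ (fstᴾ ∘ᴾ sndᴾ) (incListᴾ (sndᴾ ∘ᴾ fstᴾ)) (sndᴾ ∘ᴾ fstᴾ)))
        fstᴾ sndᴾ (# 4 ⊛ (X ⊕ # 2 ⊛ X)) insert-bounded
      ∘ᴾ foldl-additiveᴾ {Digits ⊗ Digits} {Digits ⊗ Lst (Bol ⊗ Bol)} {Bol} {λ ((_ , s) , d) → collect s d}
        (caseᴾ (fstᴾ ∘ᴾ sndᴾ ∘ᴾ fstᴾ)
          (pairᴾ nilᴾ (consᴾ (pairᴾ falseᴾ sndᴾ) (sndᴾ ∘ᴾ sndᴾ ∘ᴾ fstᴾ)))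
          (pairᴾ (sndᴾ ∘ᴾ sndᴾ) (consᴾ
            (ifᴾ (sndᴾ ∘ᴾ fstᴾ)
              (ifᴾ (fstᴾ ∘ᴾ sndᴾ) (pairᴾ falseᴾ falseᴾ) (pairᴾ trueᴾ trueᴾ))
              (ifᴾ (fstᴾ ∘ᴾ sndᴾ) (pairᴾ trueᴾ trueᴾ) (pairᴾ trueᴾ falseᴾ)))
            (sndᴾ ∘ᴾ sndᴾ ∘ᴾ fstᴾ ∘ᴾ fstᴾ))))
        (pairᴾ sndᴾ nilᴾ) fstᴾ (# 8) λ γ (ys , out) x → collect-additive ys out x)
  ∘ᴾ pairᴾ pf pg
  where
  open ≤-Reasoning
  insert : List Bool → Bool × Bool → List Bool
  insert a (c , d) = d ∷ (if c then incList a else a)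
  digit : Bool → Bool → Bool × Bool
  digit d e = if d then (if e then (false , false) else (true , true)) else (if e then (true , true) else (true , false))
  State : Code
  State = Digits ⊗ Lst (Bol ⊗ Bol)
  collect : ⌞ State ⌟ → Bool → ⌞ State ⌟
  collect (ys , out) d = caseList ys ([] , (false , d) ∷ out) (λ e ys′ → ys′ , digit d e ∷ out)
  passes : ∀ xs ys out → foldl insert (proj₁ (foldl collect (ys , out) xs)) (proj₂ (foldl collect (ys , out) xs))
             ≡ foldl insert (addList xs ys) out
  passes []           ys           out = refl
  passes (x ∷ xs)     []           out = passes xs [] ((false , x) ∷ out)
  passes (true ∷ xs)  (true ∷ ys)  out = passes xs ys _
  passes (true ∷ xs)  (false ∷ ys) out = passes xs ys _
  passes (false ∷ xs) (true ∷ ys)  out = passes xs ys _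
  passes (false ∷ xs) (false ∷ ys) out = passes xs ys _
  insert-length : ∀ a p → length (insert a p) ≤ 2 + length a
  insert-length a (true  , d) = s≤s (length-inc a)
  insert-length a (false , d) = s≤s (n≤1+n _)
  fold-length : ∀ a ps → length (foldl insert a ps) ≤ length a + 2 * length ps
  fold-length a []       = m≤m+n _ _
  fold-length a (p ∷ ps) = begin
    length (foldl insert (insert a p) ps)        ≤⟨ fold-length (insert a p) ps ⟩
    length (insert a p) + 2 * length ps          ≤⟨ +-monoˡ-≤ _ (insert-length a p) ⟩
    2 + length a + 2 * length ps                 ≡⟨ algebra (length a) (length ps) ⟩
    length a + 2 * suc (length ps)               ∎
    where
    algebra : ∀ a p → 2 + a + 2 * p ≡ a + 2 * suc p
    algebra = solve-∀
  insert-bounded : ∀ (γ : ⌞ State ⌟) ps → sz Digits (foldl insert (proj₁ γ) ps)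
                     ≤ 4 * ((sz State γ + sz (Lst (Bol ⊗ Bol)) ps) + 2 * (sz State γ + sz (Lst (Bol ⊗ Bol)) ps))
  insert-bounded γ@(a , _) ps = begin
    sz Digits (foldl insert a ps)                ≤⟨ sz-digits (foldl insert a ps) ⟩
    1 + 4 * length (foldl insert a ps)           ≤⟨ +-mono-≤ (s≤s {n = 3} z≤n) (*-monoʳ-≤ 4 (fold-length a ps)) ⟩
    4 + 4 * (length a + 2 * length ps)           ≡⟨ *-suc 4 _ ⟨
    4 * (suc (length a) + 2 * length ps)         ≤⟨ *-monoʳ-≤ 4 (+-mono-≤
        (≤-trans (length<sz Bol a) (≤-trans (m≤n⇒m≤1+n (m≤m+n (sz Digits a) _)) (m≤m+n (sz State γ) _)))
        (*-monoʳ-≤ 2 (≤-trans (<⇒≤ (length<sz (Bol ⊗ Bol) ps)) (m≤n+m _ (sz State γ))))) ⟩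
    _                                            ∎
  small : ∀ d e → sz (Bol ⊗ Bol) (digit d e) ≤ 7
  small true  true  = s≤s (s≤s (s≤s z≤n))
  small true  false = ≤-refl
  small false true  = ≤-refl
  small false false = s≤s (s≤s (s≤s (s≤s (s≤s z≤n))))
  small′ : ∀ d → sz (Bol ⊗ Bol) (false , d) ≤ 7
  small′ true  = s≤s (s≤s (s≤s (s≤s (s≤s z≤n))))
  small′ false = s≤s (s≤s (s≤s z≤n))
  grow : ∀ {ys ys′ p out} → ys′ ≤ ys → p ≤ 7 → suc (ys′ + suc (p + out)) ≤ suc (ys + out) + 8
  grow {ys} {ys′} {p} {out} ys′≤ p≤ = ≤-trans (s≤s (+-mono-≤ ys′≤ (s≤s (+-monoˡ-≤ out p≤)))) (≤-reflexive (algebra ys out))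
    where
    algebra : ∀ y o → suc (y + suc (7 + o)) ≡ suc (y + o) + 8
    algebra = solve-∀
  collect-additive : ∀ ys out x → sz State (collect (ys , out) x) ≤ sz State (ys , out) + 8
  collect-additive []       out x = grow {1} ≤-refl (small′ x)
  collect-additive (y ∷ ys) out x = grow {sz Digits (y ∷ ys)} (size-right (enc Digits (y ∷ ys))) (small x y)

addᴾ : ∀ {Γ f g} → PT Γ Nat f → PT Γ Nat g → PT Γ Nat (λ γ → f γ + g γ)
addᴾ {f = f} {g} pf pg =
  congᴾ (λ γ → trans (val-addList (digits (f γ)) (digits (g γ))) (cong₂ _+_ (val-digits (f γ)) (val-digits (g γ))))
    (valᴾ (addListᴾ (digitsᴾ pf) (digitsᴾ pg)))

zeroNᴾ : ∀ {Γ} → PT Γ Nat (λ _ → 0)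
zeroNᴾ {Γ} = leafᴾ {Γ} {Nat} refl

sumᴾ : ∀ {Γ l} → PT Γ (Lst Nat) l → PT Γ Nat (λ γ → sum (l γ))
sumᴾ pl = foldrᴾ {Lst Nat} {Nat} {Nat} {λ ((_ , a) , x) → x + a} (addᴾ sndᴾ (sndᴾ ∘ᴾ fstᴾ)) zeroNᴾ idᴾ (# 4 ⊛ X)
  (λ γ xs → ≤-trans (sz-sum xs) (*-monoʳ-≤ 4 (m≤n+m _ (sz (Lst Nat) γ))))
  ∘ᴾ pl

binaryᴾ : ∀ {Γ f} → PT Γ Una f → PT Γ Nat f
binaryᴾ {Γ} {f} pf = congᴾ (λ γ → lemma (f γ))
  (valᴾ (foldᴾ {Γ} {Digits} {λ (_ , ds) → incList ds} (incListᴾ sndᴾ) nilᴾ pf (# 1 ⊕ # 4 ⊛ X)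
    λ γ n → ≤-trans (sz-digits (fold [] incList n)) (s≤s (*-monoʳ-≤ 4 (≤-trans (short n) (m≤n+m n (sz Γ γ)))))))
  where
  lemma : ∀ n → val (fold [] incList n) ≡ n
  lemma zero    = refl
  lemma (suc n) = trans (val-inc (fold [] incList n)) (cong suc (lemma n))
  short : ∀ n → length (fold [] incList n) ≤ n
  short zero    = z≤n
  short (suc n) = ≤-trans (length-inc (fold [] incList n)) (s≤s (short n))

-- Horner's scheme: the accumulator is always `m` times the value of a list of digits, so `sz-*`
-- bounds it although every round doubles it.
mulᴾ : ∀ {Γ f g} → PT Γ Nat f → PT Γ Nat g → PT Γ Nat (λ γ → f γ * g γ)
mulᴾ pf pg = congᴾ (λ (m , n) → trans (horner m (digits n)) (cong (m *_) (val-digits n)))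
    (foldrᴾ {Nat ⊗ Nat} {Nat} {Bol} {λ (((m , _) , a) , d) → if d then m + (a + a) else (m + m) + (a + a)}
      (ifᴾ sndᴾ (addᴾ (fstᴾ ∘ᴾ fstᴾ ∘ᴾ fstᴾ) (addᴾ (sndᴾ ∘ᴾ fstᴾ) (sndᴾ ∘ᴾ fstᴾ)))
                (addᴾ (addᴾ (fstᴾ ∘ᴾ fstᴾ ∘ᴾ fstᴾ) (fstᴾ ∘ᴾ fstᴾ ∘ᴾ fstᴾ)) (addᴾ (sndᴾ ∘ᴾ fstᴾ) (sndᴾ ∘ᴾ fstᴾ))))
      zeroNᴾ (digitsᴾ sndᴾ) (# 4 ⊛ X)
      λ (m , n) ds → ≤-trans (≤-reflexive (cong (sz Nat) (horner m ds))) (≤-trans (sz-* m (val ds))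
        (*-monoʳ-≤ 4 (+-mono-≤ (m≤n⇒m≤1+n (m≤m+n (sz Nat m) (sz Nat n))) (≤-reflexive (cong size (sym (enc-val ds))))))))
  ∘ᴾ pairᴾ pf pg
  where
  odd : ∀ m v → m + (m * v + m * v) ≡ m * suc (2 * v)
  odd = solve-∀
  even : ∀ m v → (m + m) + (m * v + m * v) ≡ m * (2 * suc v)
  even = solve-∀
  horner : ∀ m ds → foldr (λ d a → if d then m + (a + a) else (m + m) + (a + a)) 0 ds ≡ m * val ds
  horner m []           = sym (*-zeroʳ m)
  horner m (true ∷ ds)  = trans (cong (λ a → m + (a + a)) (horner m ds)) (odd m (val ds))
  horner m (false ∷ ds) = trans (cong (λ a → (m + m) + (a + a)) (horner m ds)) (even m (val ds))

-- Compares digit by digit; b is the verdict on the lower digits, overruled by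
-- every higher position at which the digits differ.
compareList : Bool → List Bool → List Bool → Bool
compareList b []           []           = b
compareList b []           (y ∷ ys)     = true
compareList b (x ∷ xs)     []           = compareList false xs []
compareList b (true ∷ xs)  (true ∷ ys)  = compareList b xs ys
compareList b (true ∷ xs)  (false ∷ ys) = compareList true xs ys
compareList b (false ∷ xs) (true ∷ ys)  = compareList false xs ys
compareList b (false ∷ xs) (false ∷ ys) = compareList b xs ys

Below : Bool → ℕ → ℕ → Set
Below true  m n = m ≤ n
Below false m n = m < n

compare-sound : ∀ b xs ys → T (compareList b xs ys) → Below b (val xs) (val ys)
compare-complete : ∀ b xs ys → Below b (val xs) (val ys) → T (compareList b xs ys)

private
  0<val : ∀ d ds → 0 < val (d ∷ ds)
  0<val true  ds = s≤s z≤n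
  0<val false ds = s≤s z≤n

  not-below : ∀ b d ds → ¬ Below b (val (d ∷ ds)) 0
  not-below true  d ds le = <⇒≱ (0<val d ds) le
  not-below false d ds ()

  odd-even : ∀ v → 2 * suc v ≡ suc (suc (2 * v))
  odd-even = solve-∀

  dbl-cancel-≤ : ∀ {m n} → 2 * m ≤ 2 * n → m ≤ n
  dbl-cancel-≤ = *-cancelˡ-≤ 2

  dbl-cancel-< : ∀ {m n} → 2 * m < 2 * n → m < n
  dbl-cancel-< {m} {n} = *-cancelˡ-< 2 m n

compare-sound b     []           []           t = lemma b t
  where
  lemma : ∀ b → T b → Below b 0 0
  lemma true _ = z≤n
compare-sound true  []           (y ∷ ys)     t = z≤n
compare-sound false []           (y ∷ ys)     t = 0<val y ys
compare-sound b     (x ∷ xs)     []           t = ⊥-elim (impossible xs t)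
  where
  impossible : ∀ xs → ¬ T (compareList false xs [])
  impossible (x ∷ xs) = impossible xs
compare-sound true  (true ∷ xs)  (true ∷ ys)  t = s≤s (*-monoʳ-≤ 2 (compare-sound true xs ys t))
compare-sound false (true ∷ xs)  (true ∷ ys)  t = s≤s (*-monoʳ-< 2 (compare-sound false xs ys t))
compare-sound true  (false ∷ xs) (false ∷ ys) t = *-monoʳ-≤ 2 (s≤s (compare-sound true xs ys t))
compare-sound false (false ∷ xs) (false ∷ ys) t = *-monoʳ-< 2 (s≤s (compare-sound false xs ys t))
compare-sound b     (true ∷ xs)  (false ∷ ys) t = lemma b
  where
  le : 2 * val xs ≤ 2 * val ys
  le = *-monoʳ-≤ 2 (compare-sound true xs ys t)
  lemma : ∀ b → Below b (suc (2 * val xs)) (2 * suc (val ys))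
  lemma true  = ≤-trans (s≤s le) (≤-trans (n≤1+n _) (≤-reflexive (sym (odd-even (val ys)))))
  lemma false = ≤-trans (s≤s (s≤s le)) (≤-reflexive (sym (odd-even (val ys))))
compare-sound b     (false ∷ xs) (true ∷ ys)  t = lemma b
  where
  le : 2 * suc (val xs) ≤ 2 * val ys
  le = *-monoʳ-≤ 2 (compare-sound false xs ys t)
  lemma : ∀ b → Below b (2 * suc (val xs)) (suc (2 * val ys))
  lemma true  = m≤n⇒m≤1+n le
  lemma false = s≤s le

compare-complete true  []           []           le = tt
compare-complete false []           []           ()
compare-complete b     []           (y ∷ ys)     le = tt
compare-complete b     (x ∷ xs)     []           le = ⊥-elim (not-below b x xs le)
compare-complete true  (true ∷ xs)  (true ∷ ys)  (s≤s le) = compare-complete true xs ys (dbl-cancel-≤ le)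
compare-complete false (true ∷ xs)  (true ∷ ys)  (s≤s le) = compare-complete false xs ys (dbl-cancel-< le)
compare-complete true  (false ∷ xs) (false ∷ ys) le = compare-complete true xs ys (≤-pred (dbl-cancel-≤ {suc (val xs)} le))
compare-complete false (false ∷ xs) (false ∷ ys) le = compare-complete false xs ys (≤-pred (dbl-cancel-< {suc (val xs)} le))
compare-complete true  (true ∷ xs)  (false ∷ ys) le =
  compare-complete true xs ys (≤-pred (dbl-cancel-< {val xs} le))
compare-complete false (true ∷ xs)  (false ∷ ys) le =
  compare-complete true xs ys (≤-pred (dbl-cancel-< {val xs} (<⇒≤ le)))
compare-complete true  (false ∷ xs) (true ∷ ys)  le =
  compare-complete false xs ys (dbl-cancel-< {val xs} (≤-pred (subst (_≤ suc (2 * val ys)) (odd-even (val xs)) le)))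
compare-complete false (false ∷ xs) (true ∷ ys)  le =
  compare-complete false xs ys (dbl-cancel-≤ {suc (val xs)} (≤-pred le))

compareListᴾ : ∀ {Γ f g} → PT Γ Digits f → PT Γ Digits g → PT Γ Bol (λ γ → compareList true (f γ) (g γ))
compareListᴾ pf pg = congᴾ (λ (xs , ys) → passes true xs ys)
    (caseᴾ fstᴾ sndᴾ trueᴾ ∘ᴾ
      foldl-additiveᴾ {Digits ⊗ Digits} {State} {Bol} {λ ((_ , s) , d) → next s d}
        (caseᴾ (fstᴾ ∘ᴾ sndᴾ ∘ᴾ fstᴾ)
          (pairᴾ nilᴾ falseᴾ)
          (pairᴾ (sndᴾ ∘ᴾ sndᴾ)
            (ifᴾ (sndᴾ ∘ᴾ fstᴾ)
              (ifᴾ (fstᴾ ∘ᴾ sndᴾ) (sndᴾ ∘ᴾ sndᴾ ∘ᴾ fstᴾ ∘ᴾ fstᴾ) trueᴾ)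
              (ifᴾ (fstᴾ ∘ᴾ sndᴾ) falseᴾ (sndᴾ ∘ᴾ sndᴾ ∘ᴾ fstᴾ ∘ᴾ fstᴾ)))))
        (pairᴾ sndᴾ trueᴾ) fstᴾ (# 3) λ γ (ys , b) x → additive ys b x)
  ∘ᴾ pairᴾ pf pg
  where
  State : Code
  State = Digits ⊗ Bol
  verdict : Bool → Bool → Bool → Bool
  verdict b d e = if d then (if e then b else true) else (if e then false else b)
  next : ⌞ State ⌟ → Bool → ⌞ State ⌟
  next (ys , b) d = caseList ys ([] , false) (λ e ys′ → ys′ , verdict b d e)
  finish : ⌞ State ⌟ → Bool
  finish (ys , b) = caseList ys b (λ _ _ → true)
  passes : ∀ b xs ys → finish (foldl next (ys , b) xs) ≡ compareList b xs ys
  passes b []           []           = refl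
  passes b []           (y ∷ ys)     = refl
  passes b (x ∷ xs)     []           = passes false xs []
  passes b (true ∷ xs)  (true ∷ ys)  = passes b xs ys
  passes b (true ∷ xs)  (false ∷ ys) = passes true xs ys
  passes b (false ∷ xs) (true ∷ ys)  = passes false xs ys
  passes b (false ∷ xs) (false ∷ ys) = passes b xs ys
  sz-Bol : ∀ b → sz Bol b ≤ 3
  sz-Bol true  = ≤-refl
  sz-Bol false = s≤s z≤n
  grow : ∀ {ys ys′ p} b → ys′ ≤ ys → p ≤ 3 → suc (ys′ + p) ≤ suc (ys + sz Bol b) + 3
  grow {ys} b ys′≤ p≤ = ≤-trans (s≤s (+-mono-≤ ys′≤ p≤)) (+-monoˡ-≤ 3 (s≤s (m≤m+n ys (sz Bol b))))
  additive : ∀ ys b x → sz State (next (ys , b) x) ≤ sz State (ys , b) + 3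
  additive []       b x = grow {1} b ≤-refl (sz-Bol false)
  additive (y ∷ ys) b x = grow {sz Digits (y ∷ ys)} b (size-right (enc Digits (y ∷ ys))) (sz-Bol (verdict b x y))

leᴾ : ∀ {Γ f g} → PT Γ Nat f → PT Γ Nat g → PT Γ Bol (λ γ → f γ ≤ᵇ g γ)
leᴾ {f = f} {g} pf pg = congᴾ (λ γ → lemma (f γ) (g γ)) (compareListᴾ (digitsᴾ pf) (digitsᴾ pg))
  where
  lemma : ∀ m n → compareList true (digits m) (digits n) ≡ (m ≤ᵇ n)
  lemma m n = T-ext
    (λ t → ≤⇒≤ᵇ {m} {n} (subst₂ _≤_ (val-digits m) (val-digits n) (compare-sound true (digits m) (digits n) t)))
    (λ t → compare-complete true (digits m) (digits n) (subst₂ _≤_ (sym (val-digits m)) (sym (val-digits n)) (≤ᵇ⇒≤ m n t)))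

maxᴾ : ∀ {Γ f g} → PT Γ Nat f → PT Γ Nat g → PT Γ Nat (λ γ → f γ ⊔ g γ)
maxᴾ {f = f} {g} pf pg = congᴾ (λ γ → lemma (f γ) (g γ)) (ifᴾ (leᴾ pf pg) pg pf)
  where
  lemma : ∀ m n → (if m ≤ᵇ n then n else m) ≡ m ⊔ n
  lemma m n with m ≤ᵇ n in eq
  ... | true  = sym (m≤n⇒m⊔n≡n (≤ᵇ⇒≤ m n (subst T (sym eq) tt)))
  ... | false = sym (m≥n⇒m⊔n≡m (≰⇒≥ λ m≤n → subst T eq (≤⇒≤ᵇ m≤n)))

-- Sums over bins

Σ< : ℕ → (ℕ → ℕ) → ℕ
Σ< m h = sum (applyUpTo h m)

Σ<-mono : ∀ m {h k} → (∀ j → j < m → h j ≤ k j) → Σ< m h ≤ Σ< m k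
Σ<-mono zero    h≤k = z≤n
Σ<-mono (suc m) h≤k = +-mono-≤ (h≤k 0 (s≤s z≤n)) (Σ<-mono m (λ j j<m → h≤k (suc j) (s≤s j<m)))

Σ<-cong : ∀ m {h k} → (∀ j → j < m → h j ≡ k j) → Σ< m h ≡ Σ< m k
Σ<-cong m h≡k = ≤-antisym (Σ<-mono m (λ j j<m → ≤-reflexive (h≡k j j<m)))
                          (Σ<-mono m (λ j j<m → ≤-reflexive (sym (h≡k j j<m))))

Σ<-strict : ∀ m {h k} j → j < m → (∀ j → j < m → h j ≤ k j) → h j < k j → Σ< m h < Σ< m k
Σ<-strict (suc m) zero    _         h≤k lt = +-mono-<-≤ lt (Σ<-mono m (λ j j<m → h≤k (suc j) (s≤s j<m)))
Σ<-strict (suc m) (suc j) (s≤s j<m) h≤k lt =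
  +-mono-≤-< (h≤k 0 (s≤s z≤n)) (Σ<-strict m j j<m (λ j j<m → h≤k (suc j) (s≤s j<m)) lt)

Σ<-+ : ∀ m h k → Σ< m (λ j → h j + k j) ≡ Σ< m h + Σ< m k
Σ<-+ zero    h k = refl
Σ<-+ (suc m) h k = trans (cong (h 0 + k 0 +_) (Σ<-+ m (h ∘ suc) (k ∘ suc)))
                         (interchange (h 0) (k 0) (Σ< m (h ∘ suc)) (Σ< m (k ∘ suc)))
  where
  interchange : ∀ a b c d → a + b + (c + d) ≡ a + c + (b + d)
  interchange = solve-∀

Σ<-const : ∀ m c → Σ< m (λ _ → c) ≡ m * c
Σ<-const zero    c = refl
Σ<-const (suc m) c = cong (c +_) (Σ<-const m c)

Σ<-split : ∀ m n h → Σ< (m + n) h ≡ Σ< m h + Σ< n (λ j → h (m + j))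
Σ<-split zero    n h = refl
Σ<-split (suc m) n h = trans (cong (h 0 +_) (Σ<-split m n (h ∘ suc))) (sym (+-assoc (h 0) _ _))

sum-ones : ∀ {A : Set} (xs : List A) → sum (map (λ _ → 1) xs) ≡ length xs
sum-ones []       = refl
sum-ones (x ∷ xs) = cong suc (sum-ones xs)

at : ℕ → ℕ → ℕ → ℕ
at k j w = if k ≡ᵇ j then w else 0

at-≡ : ∀ k w → at k k w ≡ w
at-≡ zero    w = refl
at-≡ (suc k) w = at-≡ k w

at-≢ : ∀ {k j} w → k ≢ j → at k j w ≡ 0
at-≢ {zero}  {zero}  w k≢j = ⊥-elim (k≢j refl)
at-≢ {zero}  {suc j} w k≢j = refl
at-≢ {suc k} {zero}  w k≢j = refl
at-≢ {suc k} {suc j} w k≢j = at-≢ {k} {j} w (k≢j ∘ cong suc)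

at-≤ : ∀ k j w → at k j w ≤ w
at-≤ k j w with k ≡ᵇ j
... | true  = ≤-refl
... | false = z≤n

Σ<-zero : ∀ m → Σ< m (λ _ → 0) ≡ 0
Σ<-zero m = trans (Σ<-const m 0) (*-zeroʳ m)

Σ<-at : ∀ m k w → k < m → Σ< m (λ j → at k j w) ≡ w
Σ<-at (suc m) zero    w _         = trans (cong (w +_) (Σ<-zero m)) (+-identityʳ w)
Σ<-at (suc m) (suc k) w (s≤s k<m) = Σ<-at m k w k<m

∸-superadditive : ∀ g x y → (x ∸ g) + (y ∸ g) ≤ (x + y) ∸ g
∸-superadditive g x y with ≤-total g y
... | inj₁ g≤y = ≤-trans (+-monoˡ-≤ (y ∸ g) (m∸n≤m x g)) (≤-reflexive (sym (+-∸-assoc x g≤y)))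
... | inj₂ y≤g = ≤-trans (≤-reflexive (trans (cong (x ∸ g +_) (m≤n⇒m∸n≡0 y≤g)) (+-identityʳ _)))
                         (∸-monoˡ-≤ g (m≤m+n x y))

-- The increment of a convex function over a step `y` grows with the base point. Units are removed
-- from `g`, `x` and `x′` together until `g` or `x` vanishes; at `x = 0` superadditivity remains.
∸-convex : ∀ g {x x′} y → x ≤ x′ → ((x + y) ∸ g) + (x′ ∸ g) ≤ ((x′ + y) ∸ g) + (x ∸ g)
∸-convex zero    {x} {x′} y x≤x′ = ≤-reflexive (algebra x x′ y)
  where
  algebra : ∀ x x′ y → x + y + x′ ≡ x′ + y + x
  algebra = solve-∀
∸-convex (suc g) {zero} {x′} y z≤n = ≤-trans (∸-superadditive (suc g) y x′)
  (≤-reflexive (trans (cong (_∸ suc g) (+-comm y x′)) (sym (+-identityʳ _))))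
∸-convex (suc g) {suc x} {suc x′} y (s≤s x≤x′) = ∸-convex g y x≤x′

-- Two uses of `∸-convex`, lowering one summand at a time through the intermediate value at `a + B`.
∸-convex₂ : ∀ g {a b A B} → b ≤ a → B ≤ A →
            ((b + B) ∸ g) + ((a ∸ g) + (A ∸ g)) ≤ ((a + A) ∸ g) + ((b ∸ g) + (B ∸ g))
∸-convex₂ g {a} {b} {A} {B} b≤a B≤A = +-cancelˡ-≤ ((a + B) ∸ g) _ _ (begin
  ((a + B) ∸ g) + (((b + B) ∸ g) + ((a ∸ g) + (A ∸ g)))   ≡⟨ left-side ((a + B) ∸ g) ((b + B) ∸ g) (a ∸ g) (A ∸ g) ⟩
  (((b + B) ∸ g) + (a ∸ g)) + (((a + B) ∸ g) + (A ∸ g))   ≤⟨ +-mono-≤ (∸-convex g B b≤a) second ⟩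
  (((a + B) ∸ g) + (b ∸ g)) + (((a + A) ∸ g) + (B ∸ g))   ≡⟨ right-side ((a + B) ∸ g) (b ∸ g) ((a + A) ∸ g) (B ∸ g) ⟩
  ((a + B) ∸ g) + (((a + A) ∸ g) + ((b ∸ g) + (B ∸ g)))   ∎)
  where
  open ≤-Reasoning
  left-side : ∀ p q r s → p + (q + (r + s)) ≡ (q + r) + (p + s)
  left-side = solve-∀
  right-side : ∀ p q r s → (p + q) + (r + s) ≡ p + (r + (q + s))
  right-side = solve-∀
  second : ((a + B) ∸ g) + (A ∸ g) ≤ ((a + A) ∸ g) + (B ∸ g)
  second = subst₂ (λ s t → (s ∸ g) + (A ∸ g) ≤ (t ∸ g) + (B ∸ g)) (+-comm B a) (+-comm A a) (∸-convex g a B≤A)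

-- mass w bin j ts is the load of bin j when t has size w t and lies in bin t.
module _ {T : Set} where

  mass : (w bin : T → ℕ) → ℕ → List T → ℕ
  mass w bin j ts = sum (map (λ t → at (bin t) j (w t)) ts)

  module _ (w bin : T → ℕ) where

    mass-++ : ∀ j ts us → mass w bin j (ts ++ us) ≡ mass w bin j ts + mass w bin j us
    mass-++ j []       us = refl
    mass-++ j (t ∷ ts) us = trans (cong (at (bin t) j (w t) +_) (mass-++ j ts us)) (sym (+-assoc (at (bin t) j (w t)) _ _))

    mass-↭ : ∀ j {ts us} → ts ↭ us → mass w bin j ts ≡ mass w bin j us
    mass-↭ j ts↭us = ListActionₚ.sum-↭ (Permₚ.map⁺ _ ts↭us)

    mass-absent : ∀ j ts → All (λ t → bin t ≢ j) ts → mass w bin j ts ≡ 0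
    mass-absent j []       []        = refl
    mass-absent j (t ∷ ts) (ne ∷ nes) = cong₂ _+_ (at-≢ (w t) ne) (mass-absent j ts nes)

    Σ-mass : ∀ m ts → All (λ t → bin t < m) ts → Σ< m (λ j → mass w bin j ts) ≡ sum (map w ts)
    Σ-mass m []       []         = Σ<-zero m
    Σ-mass m (t ∷ ts) (lt ∷ lts) = trans (Σ<-+ m (λ j → at (bin t) j (w t)) (λ j → mass w bin j ts))
      (cong₂ _+_ (Σ<-at m (bin t) (w t) lt) (Σ-mass m ts lts))

  mass-mono : ∀ {w w′ : T → ℕ} bin j {ts} → All (λ t → w′ t ≤ w t) ts → mass w′ bin j ts ≤ mass w bin j ts
  mass-mono bin j []         = z≤n
  mass-mono {w} {w′} bin j (_∷_ {t} le les) = +-mono-≤ at≤ (mass-mono bin j les)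
    where
    at≤ : at (bin t) j (w′ t) ≤ at (bin t) j (w t)
    at≤ with bin t ≡ᵇ j
    ... | true  = le
    ... | false = z≤n

  -- By convexity of x ↦ x ∸ g, and with both sides moved to avoid subtraction:
  -- lowering the sizes lowers the overload at least as much as it would if
  -- every item were alone in its bin.
  overload-convex : ∀ g m {w w′ : T → ℕ} (bin : T → ℕ) ts →
    All (λ t → bin t < m) ts → All (λ t → w′ t ≤ w t) ts →
    Σ< m (λ j → mass w′ bin j ts ∸ g) + sum (map (λ t → w t ∸ g) ts)
      ≤ Σ< m (λ j → mass w bin j ts ∸ g) + sum (map (λ t → w′ t ∸ g) ts)
  overload-convex g m {w} {w′} bin ts bins les = begin
    Σ< m (λ j → mass w′ bin j ts ∸ g) + sum (map f ts)                       ≡⟨ cong₂ _+_ refl (Σ-mass f bin m ts bins) ⟨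
    Σ< m (λ j → mass w′ bin j ts ∸ g) + Σ< m (λ j → mass f bin j ts)         ≡⟨ Σ<-+ m _ _ ⟨
    Σ< m (λ j → (mass w′ bin j ts ∸ g) + mass f bin j ts)                    ≤⟨ Σ<-mono m (λ j _ → bin-convex j les) ⟩
    Σ< m (λ j → (mass w bin j ts ∸ g) + mass f′ bin j ts)                    ≡⟨ Σ<-+ m _ _ ⟩
    Σ< m (λ j → mass w bin j ts ∸ g) + Σ< m (λ j → mass f′ bin j ts)         ≡⟨ cong₂ _+_ refl (Σ-mass f′ bin m ts bins) ⟩
    Σ< m (λ j → mass w bin j ts ∸ g) + sum (map f′ ts)                       ∎
    where
    open ≤-Reasoning
    f f′ : T → ℕ
    f t  = w t ∸ g
    f′ t = w′ t ∸ g
    bin-convex : ∀ j {ts} → All (λ t → w′ t ≤ w t) ts →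
                 (mass w′ bin j ts ∸ g) + mass f bin j ts ≤ (mass w bin j ts ∸ g) + mass f′ bin j ts
    bin-convex j []                  = ≤-refl
    bin-convex j (_∷_ {t} {ts} le les) with bin t ≡ᵇ j
    ... | false = bin-convex j les
    ... | true  = +-cancelʳ-≤ ((mass w bin j ts ∸ g) + (mass w′ bin j ts ∸ g)) _ _ (begin
        (B₁ + (f t + Sf)) + (FA + FB)        ≡⟨ left-side B₁ (f t) Sf FA FB ⟩
        (B₁ + (f t + FA)) + (FB + Sf)        ≤⟨ +-mono-≤ (∸-convex₂ g le (mass-mono bin j les)) (bin-convex j les) ⟩
        (A₁ + (f′ t + FB)) + (FA + Sf′)      ≡⟨ right-side A₁ (f′ t) FB FA Sf′ ⟩
        (A₁ + (f′ t + Sf′)) + (FA + FB)      ∎)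
      where
      A₁ B₁ FA FB Sf Sf′ : ℕ
      A₁  = (w t + mass w bin j ts) ∸ g
      B₁  = (w′ t + mass w′ bin j ts) ∸ g
      FA  = mass w bin j ts ∸ g
      FB  = mass w′ bin j ts ∸ g
      Sf  = mass f bin j ts
      Sf′ = mass f′ bin j ts
      left-side : ∀ a b c d e → (a + (b + c)) + (d + e) ≡ (a + (b + d)) + (e + c)
      left-side = solve-∀
      right-side : ∀ a b c d e → (a + (b + c)) + (d + e) ≡ (a + (b + e)) + (d + c)
      right-side = solve-∀

m≤m∸n+n : ∀ m n → m ≤ (m ∸ n) + n
m≤m∸n+n m n = ≤-trans (m≤n+m∸n m n) (≤-reflexive (+-comm n (m ∸ n)))

-- Apart from its overload a bin holds at most `g`. This bounds the overload of any packing into `m`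
-- bins from below, with equality precisely when every bin is filled up to `g`.
total≤overload : ∀ {T : Set} g m (w bin : T → ℕ) ts → All (λ t → bin t < m) ts →
                 sum (map w ts) ≤ Σ< m (λ j → mass w bin j ts ∸ g) + m * g
total≤overload g m w bin ts bins = begin
  sum (map w ts)                                    ≡⟨ Σ-mass w bin m ts bins ⟨
  Σ< m (λ j → mass w bin j ts)                      ≤⟨ Σ<-mono m (λ j _ → m≤m∸n+n _ g) ⟩
  Σ< m (λ j → (mass w bin j ts ∸ g) + g)            ≡⟨ Σ<-+ m _ _ ⟩
  Σ< m (λ j → mass w bin j ts ∸ g) + Σ< m (λ _ → g) ≡⟨ cong₂ _+_ refl (Σ<-const m g) ⟩
  Σ< m (λ j → mass w bin j ts ∸ g) + m * g          ∎
  where open ≤-Reasoning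

-- Saturation of an optimal packing, by an exchange argument

module _ where
  private
    W : List (ℕ × ℕ) → ℕ → ℕ
    W ts j = mass proj₁ proj₂ j ts
    count : List (ℕ × ℕ) → ℕ → ℕ
    count ts j = mass (λ _ → 1) proj₂ j ts

  -- The witness is the smallest item of bin `A`: the number of items times the minimum is at most
  -- their sum.
  small-item : ∀ A ts → 0 < mass (λ _ → 1) proj₂ A ts →
    ∃[ us ] ∃[ x ] ∃[ vs ] (ts ≡ us ++ (x , A) ∷ vs × mass (λ _ → 1) proj₂ A ts * x ≤ mass proj₁ proj₂ A ts)
  small-item A ((y , k) ∷ ts) pos with k ≡ᵇ A in eq
  ... | false = let us , x , vs , e , le = small-item A ts pos in (y , k) ∷ us , x , vs , cong ((y , k) ∷_) e , le
  ... | true  with ≡ᵇ⇒≡ k A (subst T (sym eq) tt)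
  ... | refl  with mass (λ _ → 1) proj₂ A ts in none
  ... | zero  = [] , y , ts , refl , +-monoʳ-≤ y z≤n
  ... | suc c with small-item A ts (subst (0 <_) (sym none) (s≤s z≤n))
  ... | us , x , vs , e , le with ≤-total y x
  ... | inj₁ y≤x = [] , y , ts , refl , +-monoʳ-≤ y (≤-trans (*-monoʳ-≤ (suc c) y≤x) le′)
    where
    le′ : suc c * x ≤ mass proj₁ proj₂ A ts
    le′ = subst (λ c → c * x ≤ mass proj₁ proj₂ A ts) none le
  ... | inj₂ x≤y = (y , k) ∷ us , x , vs , cong ((y , k) ∷_) e ,
    +-mono-≤ x≤y (subst (λ c → c * x ≤ mass proj₁ proj₂ A ts) none le)

  crowded : ∀ b c {ts : List (ℕ × ℕ)} → All (λ t → proj₂ t < b) ts → c * b < length ts →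
            ∃[ j ] (j < b × c < mass (λ _ → 1) proj₂ j ts)
  crowded b c {ts} bins lt = search b refl
    where
    search : ∀ m → m ≡ b → ∃[ j ] (j < m × c < mass (λ _ → 1) proj₂ j ts)
    search m refl with anyUpTo? (λ j → c <? count ts j) m
    ... | yes (j , j<m , lt′) = j , j<m , lt′
    ... | no none = ⊥-elim (<⇒≱ lt (begin
      length ts                  ≡⟨ sum-ones ts ⟨
      sum (map (λ _ → 1) ts)     ≡⟨ Σ-mass (λ _ → 1) proj₂ m ts bins ⟨
      Σ< m (count ts)                ≤⟨ Σ<-mono m (λ j j<m → ≮⇒≥ (λ lt → none (j , j<m , lt))) ⟩
      Σ< m (λ _ → c)             ≡⟨ Σ<-const m c ⟩
      m * c                      ≡⟨ *-comm m c ⟩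
      c * m                      ∎))
      where open ≤-Reasoning

  -- An unsaturated bin could receive the smallest item of a crowded one, which
  -- would stay saturated: a strict improvement.
  optimal-saturates : ∀ g cap q t b ts → 0 < t → g < suc q * t → suc q * b < length ts →
    All (λ u → proj₂ u < b) ts → All (λ u → t ≤ proj₁ u) ts → (∀ j → j < b → mass proj₁ proj₂ j ts ≤ cap) →
    (∀ ts′ → map proj₁ ts′ ≡ map proj₁ ts → All (λ u → proj₂ u < b) ts′ →
      (∀ j → j < b → mass proj₁ proj₂ j ts′ ≤ cap) →
      Σ< b (λ j → mass proj₁ proj₂ j ts ∸ g) ≤ Σ< b (λ j → mass proj₁ proj₂ j ts′ ∸ g)) →
    ∀ j → j < b → g ≤ mass proj₁ proj₂ j ts
  optimal-saturates g cap q t b ts 0<t g<qt many bins large loads optimal B B<b with g ≤? W ts B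
  ... | yes g≤ = g≤
  ... | no  g≰ with crowded b (suc q) bins many
  ... | A , A<b , crowd with small-item A ts (≤-trans (s≤s z≤n) crowd)
  ... | us , x , vs , refl , small = ⊥-elim (<⇒≱ improvement
        (optimal ts′ (trans (Listₚ.map-++ proj₁ us ((x , B) ∷ vs)) (sym (Listₚ.map-++ proj₁ us ((x , A) ∷ vs))))
          (Allₚ.++⁺ us-bins (B<b ∷ vs-bins)) loads′))
    where
    open ≤-Reasoning
    ts′ R : List (ℕ × ℕ)
    ts′ = us ++ (x , B) ∷ vs
    R   = us ++ vs
    us-bins : All (λ u → proj₂ u < b) us
    us-bins = Allₚ.++⁻ˡ us bins
    vs-bins : All (λ u → proj₂ u < b) vs
    vs-bins = All.tail (Allₚ.++⁻ʳ us bins)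
    t≤x : t ≤ x
    t≤x = All.head (Allₚ.++⁻ʳ us large)
    split : ∀ k j → W (us ++ (x , k) ∷ vs) j ≡ at k j x + W R j
    split k j = mass-↭ proj₁ proj₂ j (Permₚ.shift (x , k) us vs)
    loadA : W ts A ≡ x + W R A
    loadA = trans (split A A) (cong (_+ W R A) (at-≡ A x))
    -- `A` holds at least `2 + q` items of average size at least `x`; without `x` there remains
    -- `suc q * x`, which is at least `suc q * t` and hence above `g`.
    crowdR : (2 + q) * x ≤ x + W R A
    crowdR = ≤-trans (*-monoˡ-≤ x crowd) (≤-trans small (≤-reflexive loadA))
    RA≥ : suc q * x ≤ W R A
    RA≥ = +-cancelˡ-≤ x _ _ crowdR
    g≤RA : g ≤ W R A
    g≤RA = ≤-trans (<⇒≤ g<qt) (≤-trans (*-monoʳ-≤ (suc q) t≤x) RA≥)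
    A≢B : A ≢ B
    A≢B refl = g≰ (≤-trans g≤RA (≤-trans (m≤n+m _ x) (≤-reflexive (sym loadA))))
    loadB : W ts B ≡ W R B
    loadB = trans (split A B) (cong (_+ W R B) (at-≢ x A≢B))
    RB<g : W R B < g
    RB<g = subst (_< g) loadB (≰⇒> g≰)
    -- The receiving bin stays within the capacity because it was lighter than what `A` holds
    -- without `x`.
    loads′ : ∀ j → j < b → W ts′ j ≤ cap
    loads′ j j<b with B ≟ j
    ... | yes refl = begin
      W ts′ B              ≡⟨ trans (split B B) (cong (_+ W R B) (at-≡ B x)) ⟩
      x + W R B            ≤⟨ +-monoʳ-≤ x (<⇒≤ (<-≤-trans RB<g g≤RA)) ⟩
      x + W R A            ≡⟨ loadA ⟨
      W ts A               ≤⟨ loads A A<b ⟩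
      cap                  ∎
    ... | no B≢j = begin
      W ts′ j              ≡⟨ trans (split B j) (cong (_+ W R j) (at-≢ x B≢j)) ⟩
      W R j                ≤⟨ m≤n+m _ (at A j x) ⟩
      at A j x + W R j     ≡⟨ split A j ⟨
      W ts j               ≤⟨ loads j j<b ⟩
      cap                  ∎
    pointwise : ∀ j → j < b → (W ts′ j ∸ g) ≤ at B j x + (W R j ∸ g)
    pointwise j _ = ≤-trans (≤-reflexive (cong (_∸ g) (split B j))) (m+n∸o≤m+[n∸o] (at B j x) (W R j))
      where
      m+n∸o≤m+[n∸o] : ∀ m n → (m + n) ∸ g ≤ m + (n ∸ g)
      m+n∸o≤m+[n∸o] m n = ≤-trans (∸-monoˡ-≤ g (+-monoʳ-≤ m (m≤m∸n+n n g)))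
        (≤-reflexive (trans (cong (_∸ g) (sym (+-assoc m (n ∸ g) g))) (m+n∸n≡m (m + (n ∸ g)) g)))
    -- Part of `x` disappears in the room that `B` has below `g`, so `B` gains less overload than
    -- `x`, whereas `A` loses exactly `x`.
    strictAtB : (W ts′ B ∸ g) < at B B x + (W R B ∸ g)
    strictAtB = begin-strict
      W ts′ B ∸ g                ≡⟨ cong (_∸ g) (trans (split B B) (cong (_+ W R B) (at-≡ B x))) ⟩
      (x + W R B) ∸ g            <⟨ below (W R B) g RB<g ⟩
      x                          ≡⟨ at-≡ B x ⟨
      at B B x                   ≤⟨ m≤m+n _ _ ⟩
      at B B x + (W R B ∸ g)     ∎
      where
      smaller : ∀ {x} g → 0 < x → x ∸ suc g < x
      smaller g (s≤s {n = x} _) = s≤s (m∸n≤m x g)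
      below : ∀ r g → r < g → (x + r) ∸ g < x
      below zero    (suc g) _         = subst (λ y → y ∸ suc g < x) (sym (+-identityʳ x)) (smaller g (≤-trans 0<t t≤x))
      below (suc r) (suc g) (s≤s r<g) = subst (λ s → s ∸ suc g < x) (sym (+-suc x r)) (below r g r<g)
    improvement : Σ< b (λ j → W ts′ j ∸ g) < Σ< b (λ j → W ts j ∸ g)
    improvement = begin-strict
      Σ< b (λ j → W ts′ j ∸ g)                    <⟨ Σ<-strict b B B<b pointwise strictAtB ⟩
      Σ< b (λ j → at B j x + (W R j ∸ g))         ≡⟨ Σ<-+ b _ _ ⟩
      Σ< b (λ j → at B j x) + Σ< b (λ j → W R j ∸ g)   ≡⟨ cong₂ _+_ (trans (Σ<-at b B x B<b) (sym (Σ<-at b A x A<b))) refl ⟩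
      Σ< b (λ j → at A j x) + Σ< b (λ j → W R j ∸ g)   ≡⟨ Σ<-+ b _ _ ⟨
      Σ< b (λ j → at A j x + (W R j ∸ g))         ≡⟨ Σ<-cong b (λ j _ → same j) ⟩
      Σ< b (λ j → W ts j ∸ g)                     ∎
      where
      same : ∀ j → at A j x + (W R j ∸ g) ≡ W ts j ∸ g
      same j with A ≟ j
      ... | yes refl = trans (sym (+-∸-assoc (at A A x) g≤RA)) (cong (_∸ g) (sym (split A A)))
      ... | no A≢j   = trans (cong (_+ (W R j ∸ g)) (at-≢ x A≢j)) (cong (_∸ g) (sym (trans (split A j) (cong (_+ W R j) (at-≢ x A≢j)))))

-- Vectors of fixed length

-- The dimension is fixed outside the machine: every `d` has programs of its own, built by recursion
-- on `d`, and their polynomial bounds depend on `d`.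
V : ℕ → Set
V zero    = ⊤
V (suc d) = ℕ × V d

encV : (ℕ → Tree) → ∀ d → V d → Tree
encV e zero    = λ _ → leaf
encV e (suc d) = λ (x , v) → e x ∙ encV e d v

VU VN : ℕ → Code
VU d = code (V d) (encV unary d)
VN d = code (V d) (encV encodeℕ d)

zeros : ∀ d → V d
zeros zero    = tt
zeros (suc d) = 0 , zeros d

plusV minusV : ∀ d → V d → V d → V d
plusV zero    _       _       = tt
plusV (suc d) (x , u) (y , v) = x + y , plusV d u v
minusV zero    _       _       = tt
minusV (suc d) (x , u) (y , v) = x ∸ y , minusV d u v

leV : ∀ d → V d → V d → Bool
leV zero    _       _       = true
leV (suc d) (x , u) (y , v) = (x ≤ᵇ y) ∧ leV d u v

dot : ∀ d → V d → V d → ℕ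
dot zero    _       _       = 0
dot (suc d) (x , u) (y , v) = x * y + dot d u v

states : ∀ d → V d → List (V d)
states zero    _       = tt ∷ []
states (suc d) (c , v) = concatMap (λ i → map (i ,_) (states d v)) (upTo (suc c))

total : ∀ d → List (V d) → V d
total d = foldr (plusV d) (zeros d)

zerosᴾ : ∀ {Γ} d → PT Γ (VU d) (λ _ → zeros d)
zerosᴾ {Γ} zero    = leafᴾ {Γ} {VU zero} refl
zerosᴾ     (suc d) = pairᴾ zeroᴾ (zerosᴾ d)

private
  xᴾ : ∀ {A B C D} → PT ((A ⊗ B) ⊗ (C ⊗ D)) A (λ p → proj₁ (proj₁ p))
  xᴾ = fstᴾ ∘ᴾ fstᴾ

  yᴾ : ∀ {A B C D} → PT ((A ⊗ B) ⊗ (C ⊗ D)) C (λ p → proj₁ (proj₂ p))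
  yᴾ = fstᴾ ∘ᴾ sndᴾ

  uvᴾ : ∀ {A B C D} → PT ((A ⊗ B) ⊗ (C ⊗ D)) (B ⊗ D) (λ p → proj₂ (proj₁ p) , proj₂ (proj₂ p))
  uvᴾ = pairᴾ (sndᴾ ∘ᴾ fstᴾ) (sndᴾ ∘ᴾ sndᴾ)

plusVᴾ : ∀ d → PT (VU d ⊗ VU d) (VU d) (λ p → plusV d (proj₁ p) (proj₂ p))
plusVᴾ zero    = leafᴾ {VU zero ⊗ VU zero} {VU zero} refl
plusVᴾ (suc d) = pairᴾ (addUᴾ xᴾ yᴾ) (plusVᴾ d ∘ᴾ uvᴾ)

minusVᴾ : ∀ d → PT (VU d ⊗ VU d) (VU d) (λ p → minusV d (proj₁ p) (proj₂ p))
minusVᴾ zero    = leafᴾ {VU zero ⊗ VU zero} {VU zero} refl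
minusVᴾ (suc d) = pairᴾ (monusUᴾ xᴾ yᴾ) (minusVᴾ d ∘ᴾ uvᴾ)

leVᴾ : ∀ d → PT (VU d ⊗ VU d) Bol (λ p → leV d (proj₁ p) (proj₂ p))
leVᴾ zero    = trueᴾ
leVᴾ (suc d) = andᴾ (leUᴾ xᴾ yᴾ) (leVᴾ d ∘ᴾ uvᴾ)

dotᴾ : ∀ d → PT (VU d ⊗ VN d) Nat (λ p → dot d (proj₁ p) (proj₂ p))
dotᴾ zero    = zeroNᴾ
dotᴾ (suc d) = addᴾ (mulᴾ (binaryᴾ xᴾ) yᴾ) (dotᴾ d ∘ᴾ uvᴾ)

statesᴾ : ∀ d → PT (VU d) (Lst (VU d)) (states d)
statesᴾ zero    = consᴾ idᴾ nilᴾ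
statesᴾ (suc d) = concatMapᴾ (mapᴾ (pairᴾ (sndᴾ ∘ᴾ fstᴾ) sndᴾ) (statesᴾ d ∘ᴾ sndᴾ ∘ᴾ fstᴾ)) (upToᴾ (sucᴾ fstᴾ))

sz-plusV : ∀ d u v → sz (VU d) (plusV d u v) ≤ sz (VU d) u + sz (VU d) v
sz-plusV zero    _       _       = s≤s z≤n
sz-plusV (suc d) (x , u) (y , v) = ≤-trans (s≤s (+-mono-≤ (sz-+ x y) (sz-plusV d u v)))
  (≤-trans (n≤1+n _) (≤-reflexive (rearrange (sz Una x) (sz Una y) (sz (VU d) u) (sz (VU d) v))))
  where
  rearrange : ∀ x y u v → 2 + (x + y + (u + v)) ≡ suc (x + u) + suc (y + v)
  rearrange = solve-∀
  sz-+ : ∀ x y → sz Una (x + y) ≤ sz Una x + sz Una y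
  sz-+ zero    y = n≤1+n _
  sz-+ (suc x) y = s≤s (s≤s (sz-+ x y))

sz-minusV : ∀ d u v → sz (VU d) (minusV d u v) ≤ sz (VU d) u
sz-minusV zero    _       _       = ≤-refl
sz-minusV (suc d) (x , u) (y , v) = s≤s (+-mono-≤ (sz-unary-mono (m∸n≤m x y)) (sz-minusV d u v))

upTo-< : ∀ n → All (_< n) (upTo n)
upTo-< n = Allₚ.applyUpTo⁺₁ id n id

sz-states : ∀ d c → All (λ v → sz (VU d) v ≤ sz (VU d) c) (states d c)
sz-states zero    c       = ≤-refl ∷ []
sz-states (suc d) (c , v) = Allₚ.concat⁺ (Allₚ.map⁺ (All.map
  (λ {i} i<1+c → Allₚ.map⁺ (All.map (λ le → s≤s (+-mono-≤ (sz-unary-mono (≤-pred i<1+c)) le)) (sz-states d v)))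
  (upTo-< (suc c))))

totalᴾ : ∀ d {Γ l} → PT Γ (Lst (VU d)) l → PT Γ (VU d) (λ γ → total d (l γ))
totalᴾ d {Γ} pl = foldr-additiveᴾ {Γ} {VU d} {VU d} {λ ((_ , a) , x) → plusV d x a}
  (plusVᴾ d ∘ᴾ pairᴾ sndᴾ (sndᴾ ∘ᴾ fstᴾ)) (zerosᴾ d) pl X
  λ γ a x → ≤-trans (sz-plusV d x a) (≤-trans (≤-reflexive (+-comm (sz (VU d) x) _))
    (+-monoʳ-≤ (sz (VU d) a) (m≤n+m _ (sz Γ γ))))

-- The dynamic program: bins are vectors counting the items of each of d
-- types, and for every vector of total counts a cheapest packing is kept.

module DP (d : ℕ) where

  Packings : Code
  Packings = Lst (Lst (VU d))

  -- For a fixed number of bins this exceeds the overload by the constant number of bins times `g`,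
  -- so it has the same minimisers and needs no subtraction.
  cost : V d → ℕ → List (V d) → ℕ
  cost tops g p = sum (map (λ v → dot d v tops ⊔ g) p)

  costᴾ : PT ((VN d ⊗ Nat) ⊗ Lst (VU d)) Nat (λ ((tops , g) , p) → cost tops g p)
  costᴾ = sumᴾ (mapᴾ (maxᴾ (dotᴾ d ∘ᴾ pairᴾ sndᴾ (fstᴾ ∘ᴾ fstᴾ ∘ᴾ fstᴾ)) (sndᴾ ∘ᴾ fstᴾ ∘ᴾ fstᴾ)) sndᴾ)

  -- Once the new total `v` is prescribed, the content of the additional bin is forced. The empty
  -- list signals that it is impossible or too heavy.
  extend : V d → ℕ → V d → List (V d) → List (List (V d))
  extend tops cap v p =
    if leV d (total d p) v ∧ (dot d (minusV d v (total d p)) tops ≤ᵇ cap)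
    then (minusV d v (total d p) ∷ p) ∷ []
    else []

  extendᴾ : PT ((VN d ⊗ Nat) ⊗ (VU d ⊗ Lst (VU d))) Packings (λ ((tops , cap) , v , p) → extend tops cap v p)
  extendᴾ = ifᴾ
      (andᴾ (leVᴾ d ∘ᴾ pairᴾ totalp (fstᴾ ∘ᴾ sndᴾ)) (leᴾ (dotᴾ d ∘ᴾ pairᴾ diff (fstᴾ ∘ᴾ fstᴾ)) (sndᴾ ∘ᴾ fstᴾ)))
      (consᴾ (consᴾ diff (sndᴾ ∘ᴾ sndᴾ)) nilᴾ)
      nilᴾ
    where
    totalp : PT ((VN d ⊗ Nat) ⊗ (VU d ⊗ Lst (VU d))) (VU d) _
    totalp = totalᴾ d (sndᴾ ∘ᴾ sndᴾ)
    diff : PT ((VN d ⊗ Nat) ⊗ (VU d ⊗ Lst (VU d))) (VU d) _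
    diff = minusVᴾ d ∘ᴾ pairᴾ (fstᴾ ∘ᴾ sndᴾ) totalp

  -- The accumulator is a list of length at most one and stands for an optional packing.
  cheaper : V d → ℕ → List (V d) → List (List (V d)) → List (List (V d))
  cheaper tops g p acc = caseList acc (p ∷ []) (λ q _ → if cost tops g p ≤ᵇ cost tops g q then p ∷ [] else acc)

  cheapest : V d → ℕ → List (List (V d)) → List (List (V d))
  cheapest tops g = foldr (cheaper tops g) []

  cheapestᴾ : ∀ {Γ tops g l} → PT Γ (VN d) tops → PT Γ Nat g → PT Γ Packings l →
              PT Γ Packings (λ γ → cheapest (tops γ) (g γ) (l γ))
  cheapestᴾ pt pg pl = foldr-additiveᴾ {(VN d ⊗ Nat) ⊗ Packings} {Packings} {Lst (VU d)}
      {λ ((((tops , g) , _) , acc) , p) → cheaper tops g p acc}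
      (caseᴾ (sndᴾ ∘ᴾ fstᴾ) (consᴾ sndᴾ nilᴾ)
        (ifᴾ (leᴾ (costᴾ ∘ᴾ pairᴾ (fstᴾ ∘ᴾ fstᴾ ∘ᴾ fstᴾ ∘ᴾ fstᴾ) (sndᴾ ∘ᴾ fstᴾ))
                  (costᴾ ∘ᴾ pairᴾ (fstᴾ ∘ᴾ fstᴾ ∘ᴾ fstᴾ ∘ᴾ fstᴾ) (fstᴾ ∘ᴾ sndᴾ)))
             (consᴾ (sndᴾ ∘ᴾ fstᴾ) nilᴾ) (sndᴾ ∘ᴾ fstᴾ ∘ᴾ fstᴾ)))
      nilᴾ sndᴾ (# 2 ⊕ X) (λ ((tops , g) , l) acc p → additive tops g l acc p)
    ∘ᴾ pairᴾ (pairᴾ pt pg) pl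
    where
    single : ∀ γ a p → suc (sz (Lst (VU d)) p + 1) ≤ suc a + (2 + (γ + sz (Lst (VU d)) p))
    single γ a p = ≤-trans (≤-reflexive (cong suc (+-comm (sz (Lst (VU d)) p) 1)))
      (≤-trans (s≤s (s≤s (m≤n+m _ γ))) (m≤n+m _ (suc a)))
    additive : ∀ tops g l acc p → sz Packings (cheaper tops g p acc)
                 ≤ sz Packings acc + (2 + (sz ((VN d ⊗ Nat) ⊗ Packings) ((tops , g) , l) + sz (Lst (VU d)) p))
    additive tops g l []        p = single (sz ((VN d ⊗ Nat) ⊗ Packings) ((tops , g) , l)) 0 p
    additive tops g l (q ∷ acc) p with cost tops g p ≤ᵇ cost tops g q
    ... | true  = single (sz ((VN d ⊗ Nat) ⊗ Packings) ((tops , g) , l)) _ p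
    ... | false = m≤m+n _ _

  Params : Code
  Params = (VU d ⊗ VN d) ⊗ (Nat ⊗ Nat)

  -- The table is a plain list; the total of an entry is recomputed instead of stored. One entry at
  -- most survives for each vector in `states`, which keeps the table polynomial however many bins
  -- are added.
  addBin : ⌞ Params ⌟ → List (List (V d)) → List (List (V d))
  addBin ((counts , tops) , (cap , g)) table =
    concatMap (λ v → cheapest tops g (concatMap (extend tops cap v) table)) (states d counts)

  addBinᴾ : PT (Params ⊗ Packings) Packings (λ (γ , t) → addBin γ t)
  addBinᴾ = concatMapᴾ
    (cheapestᴾ (sndᴾ ∘ᴾ fstᴾ ∘ᴾ fstᴾ ∘ᴾ fstᴾ) (sndᴾ ∘ᴾ sndᴾ ∘ᴾ fstᴾ ∘ᴾ fstᴾ)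
      (concatMapᴾ
        (extendᴾ ∘ᴾ pairᴾ (pairᴾ (sndᴾ ∘ᴾ fstᴾ ∘ᴾ fstᴾ ∘ᴾ fstᴾ ∘ᴾ fstᴾ) (fstᴾ ∘ᴾ sndᴾ ∘ᴾ fstᴾ ∘ᴾ fstᴾ ∘ᴾ fstᴾ))
                          (pairᴾ (sndᴾ ∘ᴾ fstᴾ) sndᴾ))
        (sndᴾ ∘ᴾ fstᴾ)))
    (statesᴾ d ∘ᴾ fstᴾ ∘ᴾ fstᴾ ∘ᴾ fstᴾ)

  table : ⌞ Params ⌟ → ℕ → List (List (V d))
  table γ = fold ([] ∷ []) (addBin γ)

  All-concatMap : ∀ {A B : Set} {P : A → Set} {Q : B → Set} {f : A → List B} →
                  (∀ {x} → P x → All Q (f x)) → ∀ {xs} → All P xs → All Q (concatMap f xs)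
  All-concatMap h pxs = Allₚ.concat⁺ (Allₚ.map⁺ (All.map h pxs))

  All-cheapest : ∀ {P : List (V d) → Set} tops g {ps} → All P ps → All P (cheapest tops g ps)
  All-cheapest tops g []                  = []
  All-cheapest tops g {p ∷ ps} (pp ∷ pps) with cheapest tops g ps | All-cheapest tops g pps
  ... | []      | _    = pp ∷ []
  ... | q ∷ acc | pacc with cost tops g p ≤ᵇ cost tops g q
  ... | true  = pp ∷ []
  ... | false = pacc

  length-cheapest : ∀ tops g ps → length (cheapest tops g ps) ≤ 1
  length-cheapest tops g []       = z≤n
  length-cheapest tops g (p ∷ ps) with cheapest tops g ps | length-cheapest tops g ps
  ... | []      | _  = ≤-refl
  ... | q ∷ acc | le with cost tops g p ≤ᵇ cost tops g q
  ... | true  = ≤-refl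
  ... | false = le

  All-extend : ∀ {P : List (V d) → Set} tops cap v p →
    (T (leV d (total d p) v) → dot d (minusV d v (total d p)) tops ≤ cap → P (minusV d v (total d p) ∷ p)) →
    All P (extend tops cap v p)
  All-extend tops cap v p h with leV d (total d p) v | dot d (minusV d v (total d p)) tops ≤ᵇ cap in eq
  ... | true  | true  = h tt (≤ᵇ⇒≤ _ _ (subst T (sym eq) tt)) ∷ []
  ... | true  | false = []
  ... | false | _     = []

  private
    Small : ⌞ Params ⌟ → ℕ → List (V d) → Set
    Small ((counts , _) , _) n p = length p ≡ n × All (λ v → sz (VU d) v ≤ sz (VU d) counts) p

    table-small : ∀ γ n → All (Small γ n) (table γ n)
    table-small γ zero    = (refl , []) ∷ []
    table-small γ@((counts , tops) , (cap , g)) (suc n) = All-concatMap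
      (λ {v} small-v → All-cheapest tops g {concatMap (extend tops cap v) (table γ n)} (All-concatMap (λ {p} (len-p , small-p) → All-extend tops cap v p
        (λ _ _ → cong suc len-p , ≤-trans (sz-minusV d v (total d p)) small-v ∷ small-p)) (table-small γ n)))
      (sz-states d counts)

    length-concatMap : ∀ {A B : Set} (f : A → List B) → (∀ x → length (f x) ≤ 1) → ∀ xs → length (concatMap f xs) ≤ length xs
    length-concatMap f short []       = z≤n
    length-concatMap f short (x ∷ xs) = ≤-trans (≤-reflexive (Listₚ.length-++ (f x))) (+-mono-≤ (short x) (length-concatMap f short xs))

    length-table : ∀ γ n → length (table γ n) ≤ suc (length (states d (proj₁ (proj₁ γ))))
    length-table γ zero    = s≤s z≤n
    length-table ((counts , tops) , (cap , g)) (suc n) =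
      m≤n⇒m≤1+n (length-concatMap _ (λ v → length-cheapest tops g (concatMap (extend tops cap v) (table ((counts , tops) , (cap , g)) n))) (states d counts))

    boundPol : Pol
    boundPol = # 1 ⊕ pol (statesᴾ d) ⊛ (# 1 ⊕ (# 1 ⊕ X ⊛ (# 1 ⊕ X)))

    table-bounded : ∀ γ n → sz Packings (table γ n) ≤ ⟦ boundPol ⟧ (sz Params γ + n)
    table-bounded γ@((counts , tops) , (cap , g)) n = ≤-trans
      (sz-list (Lst (VU d)) (table γ n) (All.map (λ {p} (len-p , small-p) →
        ≤-trans (sz-list (VU d) p small-p) (≤-reflexive (cong (λ l → 1 + l * (1 + sz (VU d) counts)) len-p))) (table-small γ n)))
      (s≤s (*-mono-≤
        (≤-trans (length-table γ n) (≤-trans (length<sz (VU d) (states d counts))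
          (≤-trans (output-size (statesᴾ d) counts) (⟦⟧-mono (pol (statesᴾ d)) counts≤))))
        (s≤s (s≤s (*-mono-≤ (m≤n+m n (sz Params γ)) (s≤s counts≤))))))
      where
      counts≤ : sz (VU d) counts ≤ sz Params γ + n
      counts≤ = ≤-trans (≤-trans (size-left (enc (VU d) counts ∙ enc (VN d) tops)) (size-left (enc Params γ))) (m≤m+n _ n)

  tableᴾ : ∀ {Γ γ n} → PT Γ Params γ → PT Γ Una n → PT Γ Packings (λ e → table (γ e) (n e))
  tableᴾ pγ pn = foldᴾ {Params ⊗ Una} {Packings} {λ ((γ , _) , t) → addBin γ t}
      (addBinᴾ ∘ᴾ pairᴾ (fstᴾ ∘ᴾ fstᴾ) sndᴾ) (consᴾ nilᴾ nilᴾ) sndᴾ boundPol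
      (λ (γ , m) n → ≤-trans (table-bounded γ n) (⟦⟧-mono boundPol (+-monoˡ-≤ n
        (size-left (enc Params γ ∙ unary m)))))
    ∘ᴾ pairᴾ pγ pn

  -- Only one inequality is tested; the other one, that totals never exceed the counts, is an
  -- invariant of the table.
  solutions : ⌞ Params ⌟ → ℕ → List (List (V d))
  solutions γ b = filterᵇ (λ p → leV d (proj₁ (proj₁ γ)) (total d p)) (table γ b)

  solutionsᴾ : PT (Params ⊗ Una) Packings (λ (γ , b) → solutions γ b)
  solutionsᴾ = filterᴾ (leVᴾ d ∘ᴾ pairᴾ (fstᴾ ∘ᴾ fstᴾ ∘ᴾ fstᴾ ∘ᴾ fstᴾ) (totalᴾ d sndᴾ)) (tableᴾ fstᴾ sndᴾ)

-- The packing algorithm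

-- An item is its scaled size with its index in the instance, which survives sorting; a placed item
-- adds the number of its bin; a packing is a number of bins with the list of placed items.
Item Placed Bins : Code
Item   = Nat ⊗ Una
Placed = Item ⊗ Una
Bins   = Una ⊗ Lst Placed

itemSize : ⌞ Item ⌟ → ℕ
itemSize = proj₁

placedSize placedBin : ⌞ Placed ⌟ → ℕ
placedSize = itemSize ∘ proj₁
placedBin  = proj₂

load′ : ℕ → List ⌞ Placed ⌟ → ℕ
load′ = mass placedSize placedBin

loadᴾ : ∀ {Γ j ps} → PT Γ Una j → PT Γ (Lst Placed) ps → PT Γ Nat (λ γ → load′ (j γ) (ps γ))
loadᴾ pj pps = sumᴾ (mapᴾ (ifᴾ (eqUᴾ (sndᴾ ∘ᴾ sndᴾ) (fstᴾ ∘ᴾ fstᴾ)) (fstᴾ ∘ᴾ fstᴾ ∘ᴾ sndᴾ) zeroNᴾ) sndᴾ)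
  ∘ᴾ pairᴾ pj pps

fits : ℕ → ℕ → ⌞ Bins ⌟ → List ℕ
fits limit x (m , ps) = filterᵇ (λ j → load′ j ps + x ≤ᵇ limit) (upTo m)

fitsᴾ : ∀ {Γ l x s} → PT Γ Nat l → PT Γ Nat x → PT Γ Bins s → PT Γ (Lst Una) (λ γ → fits (l γ) (x γ) (s γ))
fitsᴾ pl px ps = filterᴾ {Γ = (Nat ⊗ Nat) ⊗ Bins}
    (leᴾ (addᴾ (loadᴾ sndᴾ (sndᴾ ∘ᴾ sndᴾ ∘ᴾ fstᴾ)) (sndᴾ ∘ᴾ fstᴾ ∘ᴾ fstᴾ)) (fstᴾ ∘ᴾ fstᴾ ∘ᴾ fstᴾ))
    (upToᴾ (fstᴾ ∘ᴾ sndᴾ))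
  ∘ᴾ pairᴾ (pairᴾ pl px) ps

-- The first choice causes no overload; when it is impossible, all bins are
-- nearly filled up to g.
place : (cap g : ℕ) → ⌞ Bins ⌟ → ⌞ Item ⌟ → ⌞ Bins ⌟
place cap g s@(m , ps) x =
  caseList (fits g (itemSize x) s)
    (caseList (fits cap (itemSize x) s) (suc m , (x , m) ∷ ps) (λ j _ → m , (x , j) ∷ ps))
    (λ j _ → m , (x , j) ∷ ps)

placeᴾ : PT (((Nat ⊗ Nat) ⊗ Bins) ⊗ Item) Bins (λ (((cap , g) , s) , x) → place cap g s x)
placeᴾ = caseᴾ (fitsᴾ (sndᴾ ∘ᴾ fstᴾ ∘ᴾ fstᴾ) (fstᴾ ∘ᴾ sndᴾ) (sndᴾ ∘ᴾ fstᴾ))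
  (caseᴾ (fitsᴾ (fstᴾ ∘ᴾ fstᴾ ∘ᴾ fstᴾ) (fstᴾ ∘ᴾ sndᴾ) (sndᴾ ∘ᴾ fstᴾ))
    (pairᴾ (sucᴾ (fstᴾ ∘ᴾ sndᴾ ∘ᴾ fstᴾ)) (consᴾ (pairᴾ sndᴾ (fstᴾ ∘ᴾ sndᴾ ∘ᴾ fstᴾ)) (sndᴾ ∘ᴾ sndᴾ ∘ᴾ fstᴾ)))
    into)
  into
  where
  into : PT ((((Nat ⊗ Nat) ⊗ Bins) ⊗ Item) ⊗ (Una ⊗ Lst Una)) Bins
           (λ ((((cap , g) , (m , ps)) , x) , (j , _)) → m , (x , j) ∷ ps)
  into = pairᴾ (fstᴾ ∘ᴾ sndᴾ ∘ᴾ fstᴾ ∘ᴾ fstᴾ)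
    (consᴾ (pairᴾ (sndᴾ ∘ᴾ fstᴾ) (fstᴾ ∘ᴾ sndᴾ)) (sndᴾ ∘ᴾ sndᴾ ∘ᴾ fstᴾ ∘ᴾ fstᴾ))

-- The possible results of `place` together with what the failed searches reveal: in every bin the
-- item would have exceeded the limit in question.
data Placement (cap g : ℕ) (m : ℕ) (ps : List ⌞ Placed ⌟) (x : ⌞ Item ⌟) : ⌞ Bins ⌟ → Set where
  harmless : ∀ {j} → j < m → load′ j ps + itemSize x ≤ g → Placement cap g m ps x (m , (x , j) ∷ ps)
  fitting  : ∀ {j} → j < m → load′ j ps + itemSize x ≤ cap → (∀ i → i < m → g < load′ i ps + itemSize x) →
             Placement cap g m ps x (m , (x , j) ∷ ps)
  fresh    : (∀ i → i < m → g < load′ i ps + itemSize x) → (∀ i → i < m → cap < load′ i ps + itemSize x) →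
             Placement cap g m ps x (suc m , (x , m) ∷ ps)

fits-sound : ∀ l x s {j js} → fits l x s ≡ j ∷ js → j < proj₁ s × load′ j (proj₂ s) + x ≤ l
fits-sound l x (m , ps) {j} eq = head-< , ≤ᵇ⇒≤ _ _ head-fits
  where
  all< : All (_< m) (fits l x (m , ps))
  all< = Allₚ.filter⁺ (Boolₚ.T? ∘ _) (upTo-< m)
  allT : All (λ j → T (load′ j ps + x ≤ᵇ l)) (fits l x (m , ps))
  allT = Allₚ.all-filter (Boolₚ.T? ∘ _) (upTo m)
  head-< : j < m
  head-< = All.head (subst (All (_< m)) eq all<)
  head-fits : T (load′ j ps + x ≤ᵇ l)
  head-fits = All.head (subst (All _) eq allT)

fits-complete : ∀ l x s → fits l x s ≡ [] → ∀ i → i < proj₁ s → l < load′ i (proj₂ s) + x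
fits-complete l x (m , ps) none i i<m = ≰⇒> λ le → ¬Any[] (subst (i ∈_) none
    (Membershipₚ.∈-filter⁺ (Boolₚ.T? ∘ _) (Membershipₚ.∈-upTo⁺ i<m) (≤⇒≤ᵇ le)))
  where
  ¬Any[] : ¬ (i ∈ [])
  ¬Any[] ()

placement : ∀ cap g m ps x → Placement cap g m ps x (place cap g (m , ps) x)
placement cap g m ps x with fits g (itemSize x) (m , ps) in eq
... | j ∷ js = let j<m , le = fits-sound g (itemSize x) (m , ps) eq in harmless j<m le
... | [] with fits cap (itemSize x) (m , ps) in eq′
... | j ∷ js = let j<m , le = fits-sound cap (itemSize x) (m , ps) eq′ in
               fitting j<m le (fits-complete g (itemSize x) (m , ps) eq)
... | []     = fresh (fits-complete g (itemSize x) (m , ps) eq) (fits-complete cap (itemSize x) (m , ps) eq′)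

fill : (cap g : ℕ) → ⌞ Bins ⌟ → List ⌞ Item ⌟ → ⌞ Bins ⌟
fill cap g = foldl (place cap g)

fillᴾ : ∀ {Γ c g s l} → PT Γ Nat c → PT Γ Nat g → PT Γ Bins s → PT Γ (Lst Item) l →
        PT Γ Bins (λ γ → fill (c γ) (g γ) (s γ) (l γ))
fillᴾ pc pg ps pl = foldlᴾ {Env} {Bins} {Item} {λ ((((c , g) , _) , s) , x) → place c g s x}
    (placeᴾ ∘ᴾ pairᴾ (pairᴾ (fstᴾ ∘ᴾ fstᴾ ∘ᴾ fstᴾ) (sndᴾ ∘ᴾ fstᴾ)) sndᴾ)
    (fstᴾ ∘ᴾ sndᴾ) (sndᴾ ∘ᴾ sndᴾ) (X ⊕ X ⊛ (# 3 ⊕ # 2 ⊛ X))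
    (λ ((c , g) , (s , l)) xs → bounded c g s l xs)
  ∘ᴾ pairᴾ (pairᴾ pc pg) (pairᴾ ps pl)
  where
  open ≤-Reasoning
  Env : Code
  Env = (Nat ⊗ Nat) ⊗ (Bins ⊗ Lst Item)
  grow : ∀ m m′ j ps x B → m ≤ B → m′ ≤ suc m → suc m ≤ B → j ≤ m →
         sz Bins (m′ , (x , j) ∷ ps) ≤ sz Bins (m , ps) + suc (sz Item x) * (3 + 2 * B)
  grow m m′ j ps x B m≤B m′≤ m<B j≤m = begin
    suc (sz Una m′ + suc (suc (sz Item x + sz Una j) + sz (Lst Placed) ps))
      ≡⟨ cong₂ (λ a b → suc (a + suc (suc (sz Item x + b) + sz (Lst Placed) ps))) (sz-unary m′) (sz-unary j) ⟩
    suc (1 + 2 * m′ + suc (suc (sz Item x + (1 + 2 * j)) + sz (Lst Placed) ps))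
      ≤⟨ s≤s (+-mono-≤ (s≤s (*-monoʳ-≤ 2 m′≤)) (s≤s (+-monoˡ-≤ _ (s≤s (+-monoʳ-≤ (sz Item x) (s≤s (*-monoʳ-≤ 2 j≤m))))))) ⟩
    suc (1 + 2 * suc m + suc (suc (sz Item x + (1 + 2 * m)) + sz (Lst Placed) ps))
      ≡⟨ algebra₁ m (sz Item x) (sz (Lst Placed) ps) ⟩
    suc (1 + 2 * m + sz (Lst Placed) ps) + (3 + sz Item x + 2 * suc m)
      ≤⟨ +-monoʳ-≤ (suc (1 + 2 * m + sz (Lst Placed) ps)) (+-monoʳ-≤ (3 + sz Item x) (*-monoʳ-≤ 2 m<B)) ⟩
    suc (1 + 2 * m + sz (Lst Placed) ps) + (3 + sz Item x + 2 * B)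
      ≤⟨ +-monoʳ-≤ (suc (1 + 2 * m + sz (Lst Placed) ps)) (≤-trans (m≤m+n _ _) (≤-reflexive (sym (algebra₂ (sz Item x) B)))) ⟩
    suc (1 + 2 * m + sz (Lst Placed) ps) + suc (sz Item x) * (3 + 2 * B)
      ≡⟨ cong (λ a → suc (a + sz (Lst Placed) ps) + suc (sz Item x) * (3 + 2 * B)) (sz-unary m) ⟨
    sz Bins (m , ps) + suc (sz Item x) * (3 + 2 * B) ∎
    where
    algebra₁ : ∀ m x p → suc (1 + 2 * suc m + suc (suc (x + (1 + 2 * m)) + p)) ≡ suc (1 + 2 * m + p) + (3 + x + 2 * suc m)
    algebra₁ = solve-∀
    algebra₂ : ∀ x B → suc x * (3 + 2 * B) ≡ (3 + x + 2 * B) + (2 * x + x * (2 * B))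
    algebra₂ = solve-∀
  place-size : ∀ c g m ps x B → suc m ≤ B → proj₁ (place c g (m , ps) x) ≤ suc m ×
               sz Bins (place c g (m , ps) x) ≤ sz Bins (m , ps) + suc (sz Item x) * (3 + 2 * B)
  place-size c g m ps x B m<B with place c g (m , ps) x | placement c g m ps x
  ... | _ | harmless {j} j<m _   = n≤1+n m , grow m m j ps x B (<⇒≤ m<B) (n≤1+n m) m<B (<⇒≤ j<m)
  ... | _ | fitting {j} j<m _ _  = n≤1+n m , grow m m j ps x B (<⇒≤ m<B) (n≤1+n m) m<B (<⇒≤ j<m)
  ... | _ | fresh _ _            = ≤-refl , grow m (suc m) m ps x B (<⇒≤ m<B) ≤-refl m<B ≤-refl
  -- `B` bounds the number of bins after all items are placed, each of which opens at most one, and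
  -- hence all unary bin numbers that are ever stored.
  fill-size : ∀ c g s xs B → proj₁ s + length xs ≤ B → sz Bins (fill c g s xs) ≤ sz Bins s + sz (Lst Item) xs * (3 + 2 * B)
  fill-size c g s        []       B le = m≤m+n _ _
  fill-size c g (m , ps) (x ∷ xs) B le = let le₁ , le₂ = place-size c g m ps x B (≤-trans (s≤s (m≤m+n m _)) (≤-trans (≤-reflexive (sym (+-suc m _))) le)) in begin
    sz Bins (fill c g (place c g (m , ps) x) xs)
      ≤⟨ fill-size c g (place c g (m , ps) x) xs B (≤-trans (+-monoˡ-≤ _ le₁) (≤-trans (≤-reflexive (sym (+-suc m _))) le)) ⟩
    sz Bins (place c g (m , ps) x) + sz (Lst Item) xs * (3 + 2 * B)
      ≤⟨ +-monoˡ-≤ _ le₂ ⟩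
    sz Bins (m , ps) + suc (sz Item x) * (3 + 2 * B) + sz (Lst Item) xs * (3 + 2 * B)
      ≡⟨ algebra (sz Bins (m , ps)) (sz Item x) (sz (Lst Item) xs) (3 + 2 * B) ⟩
    sz Bins (m , ps) + sz (Lst Item) (x ∷ xs) * (3 + 2 * B) ∎
    where
    algebra : ∀ s x l k → s + suc x * k + l * k ≡ s + suc (x + l) * k
    algebra = solve-∀
  bounded : ∀ c g s l xs → sz Bins (fill c g s xs) ≤ ⟦ X ⊕ X ⊛ (# 3 ⊕ # 2 ⊛ X) ⟧ (sz Env ((c , g) , (s , l)) + sz (Lst Item) xs)
  bounded c g s@(m , ps) l xs = ≤-trans
    (fill-size c g s xs (sz Env ((c , g) , (s , l)) + sz (Lst Item) xs)
      (+-mono-≤ (≤-trans (n≤sz-unary m) (≤-trans (size-left (enc Bins s)) s≤)) (<⇒≤ (length<sz Item xs))))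
    (+-mono-≤ (≤-trans s≤ (m≤m+n _ _)) (*-monoˡ-≤ (3 + 2 * (sz Env ((c , g) , (s , l)) + sz (Lst Item) xs))
      (m≤n+m (sz (Lst Item) xs) (sz Env ((c , g) , (s , l))))))
    where
    s≤ : sz Bins s ≤ sz Env ((c , g) , (s , l))
    s≤ = ≤-trans (size-left (enc Bins s ∙ enc (Lst Item) l)) (size-right (enc Env ((c , g) , (s , l))))

-- Grouping by rank and the candidate packings

-- The default 0 is harmless, because an empty group has count 0.
topSize : List ⌞ Item ⌟ → ℕ
topSize ys = caseList ys 0 (λ x _ → itemSize x)

tops counts : ∀ d → ℕ → List ⌞ Item ⌟ → V d
tops zero    K ys = tt
tops (suc d) K ys = topSize ys , tops d K (drop K ys)
counts zero    K ys = tt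
counts (suc d) K ys = length (take K ys) , counts d K (drop K ys)

topsᴾ : ∀ d → PT (Una ⊗ Lst Item) (VN d) (λ (K , ys) → tops d K ys)
topsᴾ zero    = leafᴾ {Una ⊗ Lst Item} {VN zero} refl
topsᴾ (suc d) = pairᴾ (caseᴾ sndᴾ zeroNᴾ (fstᴾ ∘ᴾ fstᴾ ∘ᴾ sndᴾ)) (topsᴾ d ∘ᴾ pairᴾ fstᴾ (dropᴾ fstᴾ sndᴾ))

countsᴾ : ∀ d → PT (Una ⊗ Lst Item) (VU d) (λ (K , ys) → counts d K ys)
countsᴾ zero    = leafᴾ {Una ⊗ Lst Item} {VU zero} refl
countsᴾ (suc d) = pairᴾ (lengthᴾ (takeᴾ fstᴾ sndᴾ)) (countsᴾ d ∘ᴾ pairᴾ fstᴾ (dropᴾ fstᴾ sndᴾ))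

expand : List ℕ → List ℕ
expand cs = concatMap (λ (j , c) → replicate c j) (zip (upTo (length cs)) cs)

-- Leads from count vectors back to a list of bins, type by type in the order of the groups. Items
-- of equal rounded size are interchangeable, so each type is dealt out to the bins in increasing
-- order.
assignments : ∀ d → List (V d) → List ℕ
assignments zero    p = []
assignments (suc d) p = expand (map proj₁ p) ++ assignments d (map proj₂ p)

assignmentsᴾ : ∀ d → PT (Lst (VU d)) (Lst Una) (assignments d)
assignmentsᴾ zero    = nilᴾ
assignmentsᴾ (suc d) = appendᴾ
  (concatMapᴾ (replicateᴾ (sndᴾ ∘ᴾ sndᴾ) (fstᴾ ∘ᴾ sndᴾ)) (zipᴾ (upToᴾ (lengthᴾ heads)) heads))
  (assignmentsᴾ d ∘ᴾ mapᴾ (sndᴾ ∘ᴾ sndᴾ) idᴾ)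
  where
  heads : PT (Lst (VU (suc d))) (Lst Una) (map proj₁)
  heads = mapᴾ (fstᴾ ∘ᴾ sndᴾ) idᴾ

multipleᴾ : ∀ d {Γ n} → PT Γ Una n → PT Γ Una (λ γ → d * n γ)
multipleᴾ zero    pn = zeroᴾ
multipleᴾ (suc d) pn = addUᴾ pn (multipleᴾ d pn)

Sorted : Code
Sorted = Lst Item ⊗ (Nat ⊗ Nat)

module Candidates (d : ℕ) where
  open DP d

  params : ⌞ Sorted ⌟ → ℕ → ⌞ Params ⌟
  params (xs , cap , g) K = (counts d K (drop K xs) , tops d K (drop K xs)) , (cap , g)

  -- The grouped items enter with their true sizes; rounding only guides the choice of their bins.
  -- The separate items occupy the bins from `b` on.
  structured : List ⌞ Item ⌟ → ℕ → ℕ → List (V d) → List ⌞ Placed ⌟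
  structured xs b K p =
    zip (take K xs) (map (b +_) (upTo K)) ++ zip (take (d * K) (drop K xs)) (assignments d p)

  candidate : ⌞ Sorted ⌟ → ℕ → ℕ → List (V d) → ⌞ Bins ⌟
  candidate (xs , cap , g) b K p = fill cap g (b + K , structured xs b K p) (drop (d * K) (drop K xs))

  candidates : ⌞ Sorted ⌟ → List ⌞ Bins ⌟
  candidates γ@(xs , cap , g) =
    -- Trying every group size keeps division out of the programs, so that the accuracy enters only
    -- through `d`. The shift to `suc K` excludes empty groups.
    concatMap (λ b → concatMap (λ K → map (candidate γ b (suc K)) (solutions (params γ (suc K)) b))
                               (upTo (suc (length xs))))
              (upTo (suc (length xs)))

  candidatesᴾ : PT Sorted (Lst Bins) candidates
  candidatesᴾ = concatMapᴾ (concatMapᴾ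
      (mapᴾ (fillᴾ (fstᴾ ∘ᴾ sndᴾ ∘ᴾ γ₃) (sndᴾ ∘ᴾ sndᴾ ∘ᴾ γ₃)
               (pairᴾ (addUᴾ b₃ K₃)
                 (appendᴾ (zipᴾ (takeᴾ K₃ (fstᴾ ∘ᴾ γ₃)) (mapᴾ (addUᴾ (b₃ ∘ᴾ fstᴾ) sndᴾ) (upToᴾ K₃)))
                          (zipᴾ (takeᴾ (multipleᴾ d K₃) rest₃) (assignmentsᴾ d ∘ᴾ sndᴾ))))
               (dropᴾ (multipleᴾ d K₃) rest₃))
            (solutionsᴾ ∘ᴾ pairᴾ
              (pairᴾ (pairᴾ (countsᴾ d ∘ᴾ pairᴾ K₂ rest₂) (topsᴾ d ∘ᴾ pairᴾ K₂ rest₂)) (sndᴾ ∘ᴾ γ₂))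
              b₂))
      (upToᴾ (sucᴾ (lengthᴾ (fstᴾ ∘ᴾ fstᴾ)))))
    (upToᴾ (sucᴾ (lengthᴾ fstᴾ)))
    where
    Γ₂ Γ₃ : Code
    Γ₂ = (Sorted ⊗ Una) ⊗ Una
    Γ₃ = Γ₂ ⊗ Lst (VU d)
    γ₂ : PT Γ₂ Sorted (λ e → proj₁ (proj₁ e))
    γ₂ = fstᴾ ∘ᴾ fstᴾ
    b₂ : PT Γ₂ Una (λ e → proj₂ (proj₁ e))
    b₂ = sndᴾ ∘ᴾ fstᴾ
    K₂ : PT Γ₂ Una (λ e → suc (proj₂ e))
    K₂ = sucᴾ sndᴾ
    rest₂ : PT Γ₂ (Lst Item) (λ e → drop (suc (proj₂ e)) (proj₁ (proj₁ (proj₁ e))))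
    rest₂ = dropᴾ K₂ (fstᴾ ∘ᴾ γ₂)
    γ₃ : PT Γ₃ Sorted (λ e → proj₁ (proj₁ (proj₁ e)))
    γ₃ = γ₂ ∘ᴾ fstᴾ
    b₃ : PT Γ₃ Una (λ e → proj₂ (proj₁ (proj₁ e)))
    b₃ = b₂ ∘ᴾ fstᴾ
    K₃ : PT Γ₃ Una (λ e → suc (proj₂ (proj₁ e)))
    K₃ = K₂ ∘ᴾ fstᴾ
    rest₃ : PT Γ₃ (Lst Item) (λ e → drop (suc (proj₂ (proj₁ e))) (proj₁ (proj₁ (proj₁ (proj₁ e)))))
    rest₃ = rest₂ ∘ᴾ fstᴾ

-- Correctness of the dynamic program

LeV : ∀ d → V d → V d → Set
LeV zero    _       _       = ⊤
LeV (suc d) (x , u) (y , v) = x ≤ y × LeV d u v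

T-∧⁻ : ∀ {a b} → T (a ∧ b) → T a × T b
T-∧⁻ {true} {true} _ = tt , tt

T-∧⁺ : ∀ {a b} → T a → T b → T (a ∧ b)
T-∧⁺ {true} {true} _ _ = tt

leV⁻ : ∀ d u v → T (leV d u v) → LeV d u v
leV⁻ zero    u       v       _ = tt
leV⁻ (suc d) (x , u) (y , v) t = let t₁ , t₂ = T-∧⁻ {x ≤ᵇ y} t in ≤ᵇ⇒≤ x y t₁ , leV⁻ d u v t₂

leV⁺ : ∀ d u v → LeV d u v → T (leV d u v)
leV⁺ zero    u       v       _         = tt
leV⁺ (suc d) (x , u) (y , v) (le , les) = T-∧⁺ (≤⇒≤ᵇ le) (leV⁺ d u v les)

LeV-refl : ∀ d v → LeV d v v
LeV-refl zero    v       = tt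
LeV-refl (suc d) (x , v) = ≤-refl , LeV-refl d v

LeV-antisym : ∀ d {u v} → LeV d u v → LeV d v u → u ≡ v
LeV-antisym zero    _          _            = refl
LeV-antisym (suc d) (le , les) (le′ , les′) = cong₂ _,_ (≤-antisym le le′) (LeV-antisym d les les′)

LeV-plus : ∀ d u v → LeV d v (plusV d u v)
LeV-plus zero    u       v       = tt
LeV-plus (suc d) (x , u) (y , v) = m≤n+m y x , LeV-plus d u v

LeV-trans : ∀ d {u v w} → LeV d u v → LeV d v w → LeV d u w
LeV-trans zero    _        _          = tt
LeV-trans (suc d) (p , ps) (q , qs)   = ≤-trans p q , LeV-trans d ps qs

minus-plus : ∀ d u v → LeV d u v → plusV d (minusV d v u) u ≡ v
minus-plus zero    u       v       _          = refl
minus-plus (suc d) (x , u) (y , v) (le , les) = cong₂ _,_ (m∸n+n≡m le) (minus-plus d u v les)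

plus-minus : ∀ d u v → minusV d (plusV d u v) v ≡ u
plus-minus zero    u       v       = refl
plus-minus (suc d) (x , u) (y , v) = cong₂ _,_ (m+n∸n≡m x y) (plus-minus d u v)

LeV-states : ∀ d c → All (λ v → LeV d v c) (states d c)
LeV-states zero    c       = tt ∷ []
LeV-states (suc d) (c , v) = Allₚ.concat⁺ (Allₚ.map⁺ (All.map
  (λ i<1+c → Allₚ.map⁺ (All.map (λ le → ≤-pred i<1+c , le) (LeV-states d v))) (upTo-< (suc c))))

∈-concatMap : ∀ {A B : Set} (f : A → List B) {x y xs} → x ∈ xs → y ∈ f x → y ∈ concatMap f xs
∈-concatMap f x∈xs y∈fx = Membershipₚ.∈-concat⁺′ y∈fx (Membershipₚ.∈-map⁺ f x∈xs)

∈-states : ∀ d {v c} → LeV d v c → v ∈ states d c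
∈-states zero    _          = here refl
∈-states (suc d) {x , v} {c , w} (le , les) =
  ∈-concatMap (λ i → map (i ,_) (states d w)) (Membershipₚ.∈-upTo⁺ (s≤s le)) (Membershipₚ.∈-map⁺ (x ,_) (∈-states d les))

module DPCorrect (d : ℕ) (cs ts : V d) (cap g : ℕ) where
  open DP d

  γ : ⌞ Params ⌟
  γ = (cs , ts) , (cap , g)

  record Solution (n : ℕ) (p : List (V d)) : Set where
    constructor solution
    field
      bins  : length p ≡ n
      light : All (λ v → dot d v ts ≤ cap) p

  table-sound : ∀ n → All (λ p → Solution n p × LeV d (total d p) cs) (table γ n)
  table-sound zero    = (solution refl [] , zeros≤ d cs) ∷ []
    where
    zeros≤ : ∀ d c → LeV d (zeros d) c
    zeros≤ zero    _       = tt
    zeros≤ (suc d) (x , c) = z≤n , zeros≤ d c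
  table-sound (suc n) = All-concatMap
    (λ {v} v≤c → All-cheapest ts g {concatMap (extend ts cap v) (table γ n)} (All-concatMap
      (λ {p} (s , _) → All-extend ts cap v p (λ t fit →
        solution (cong suc (Solution.bins s)) (fit ∷ Solution.light s) ,
        subst (λ u → LeV d u cs) (sym (minus-plus d (total d p) v (leV⁻ d (total d p) v t))) v≤c))
      (table-sound n)))
    (LeV-states d cs)

  solutions-sound : ∀ n → All (λ p → Solution n p × total d p ≡ cs) (solutions γ n)
  solutions-sound n = All.zipWith (λ ((s , le) , t) → s , LeV-antisym d le (leV⁻ d cs _ t))
    (Allₚ.filter⁺ (Boolₚ.T? ∘ _) (table-sound n) , Allₚ.all-filter (Boolₚ.T? ∘ _) (table γ n))

  only : ∀ {q c cs′} ps → cheapest ts g ps ≡ c ∷ cs′ → q ∈ cheapest ts g ps → q ≡ c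
  only {q} ps e q∈ = go (subst (q ∈_) e q∈) (subst (λ l → length l ≤ 1) e (length-cheapest ts g ps))
    where
    go : ∀ {c cs′} → q ∈ c ∷ cs′ → length (c ∷ cs′) ≤ 1 → q ≡ c
    go               (here e)   _        = e
    go {cs′ = _ ∷ _} (there q∈) (s≤s ())

  cheapest-optimal : ∀ {p ps} → p ∈ ps → ∃[ q ] (q ∈ cheapest ts g ps × cost ts g q ≤ cost ts g p)
  cheapest-optimal {p} {r ∷ ps} p∈ with cheapest ts g ps in eq
  cheapest-optimal {p} {r ∷ ps} (here refl) | []      = r , here refl , ≤-refl
  cheapest-optimal {p} {r ∷ ps} (there p∈)  | []      with cheapest-optimal p∈
  ... | q , q∈ , _ with () ← subst (q ∈_) eq q∈
  cheapest-optimal {p} {r ∷ ps} p∈          | c ∷ cs′ with cost ts g r ≤ᵇ cost ts g c in cmp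
  cheapest-optimal {p} {r ∷ ps} (here refl) | c ∷ cs′ | true  = r , here refl , ≤-refl
  cheapest-optimal {p} {r ∷ ps} (there p∈)  | c ∷ cs′ | true  with cheapest-optimal p∈
  ... | q , q∈ , le = r , here refl , ≤-trans (≤-trans (≤ᵇ⇒≤ _ _ (subst T (sym cmp) tt)) (≤-reflexive (cong (cost ts g) (sym (only ps eq q∈))))) le
  cheapest-optimal {p} {r ∷ ps} (here refl) | c ∷ cs′ | false =
    c , here refl , ≰⇒≥ (λ le → subst T cmp (≤⇒≤ᵇ le))
  cheapest-optimal {p} {r ∷ ps} (there p∈)  | c ∷ cs′ | false with cheapest-optimal p∈
  ... | q , q∈ , le = q , subst (q ∈_) eq q∈ , le

  -- Bellman's principle: the bins other than `w` may be replaced by a table entry of the same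
  -- total, because the content of the new bin depends on that total only and is again `w`.
  table-optimal : ∀ n p → Solution n p → LeV d (total d p) cs →
                  ∃[ q ] (q ∈ table γ n × total d q ≡ total d p × cost ts g q ≤ cost ts g p)
  table-optimal zero    []      s le = [] , here refl , refl , ≤-refl
  table-optimal zero    (_ ∷ _) (solution () _) le
  table-optimal (suc n) []      (solution () _) le
  table-optimal (suc n) (w ∷ p) (solution bins (fit ∷ light)) le
    with table-optimal n p (solution (suc-injective bins) light) (LeV-trans d (LeV-plus d w (total d p)) le)
  ... | q , q∈ , tq , cq = r , ∈-concatMap _ (∈-states d le) r∈ , All.lookup totals r∈ , ≤-trans cr (+-monoʳ-≤ (dot d w ts ⊔ g) cq)
    where
    v : V d
    v = plusV d w (total d p)
    diff : minusV d v (total d q) ≡ w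
    diff = trans (cong (minusV d v) tq) (plus-minus d w (total d p))
    le-vq : LeV d (total d q) v
    le-vq = subst (λ u → LeV d u v) (sym tq) (LeV-plus d w (total d p))
    member : (w ∷ q) ∈ extend ts cap v q
    member with leV d (total d q) v ∧ (dot d (minusV d v (total d q)) ts ≤ᵇ cap) in eq
    ... | true  = here (cong (_∷ q) (sym diff))
    ... | false = ⊥-elim (subst T eq (T-∧⁺ (leV⁺ d (total d q) v le-vq) (≤⇒≤ᵇ (subst (λ u → dot d u ts ≤ cap) (sym diff) fit))))
    options : List (List (V d))
    options = concatMap (extend ts cap v) (table γ n)
    chosen : ∃[ r ] (r ∈ cheapest ts g options × cost ts g r ≤ cost ts g (w ∷ q))
    chosen = cheapest-optimal (∈-concatMap (extend ts cap v) q∈ member)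
    r : List (V d)
    r = proj₁ chosen
    r∈ : r ∈ cheapest ts g options
    r∈ = proj₁ (proj₂ chosen)
    cr : cost ts g r ≤ cost ts g (w ∷ q)
    cr = proj₂ (proj₂ chosen)
    totals : All (λ r → total d r ≡ v) (cheapest ts g options)
    totals = All-cheapest ts g {options} (All-concatMap {P = λ _ → ⊤} (λ {p} _ → All-extend ts cap v p
      (λ t _ → minus-plus d (total d p) v (leV⁻ d (total d p) v t))) (All.universal (λ _ → tt) (table γ n)))

  solutions-optimal : ∀ n p → Solution n p → total d p ≡ cs →
                      ∃[ q ] (q ∈ solutions γ n × cost ts g q ≤ cost ts g p)
  solutions-optimal n p s refl with table-optimal n p s (LeV-refl d (total d p))
  ... | q , q∈ , tq , cq = q , Membershipₚ.∈-filter⁺ (Boolₚ.T? ∘ _) q∈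
        (leV⁺ d cs (total d q) (subst (LeV d cs) (sym tq) (LeV-refl d cs))) , cq

-- Count vectors and assignments of bins

zip-++ : ∀ {A B : Set} (as : List A) {bs : List A} (js : List B) {ks} → length as ≡ length js →
         zip (as ++ bs) (js ++ ks) ≡ zip as js ++ zip bs ks
zip-++ []       []       _ = refl
zip-++ (a ∷ as) (j ∷ js) e = cong ((a , j) ∷_) (zip-++ as js (suc-injective e))

zip-++-split : ∀ {A B : Set} (as : List A) {bs : List A} (js : List B) →
               zip (as ++ bs) js ≡ zip as (take (length as) js) ++ zip bs (drop (length as) js)
zip-++-split []            js       = refl
zip-++-split (a ∷ as) {bs} []       = sym (zip-[] bs)
  where
  zip-[] : ∀ {A B : Set} (bs : List A) → zip {B = B} bs [] ≡ []
  zip-[] []       = refl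
  zip-[] (b ∷ bs) = refl
zip-++-split (a ∷ as)      (j ∷ js) = cong ((a , j) ∷_) (zip-++-split as js)

pairMass : ℕ → List (ℕ × ℕ) → ℕ
pairMass = mass proj₁ proj₂

occurrences : ℕ → List ℕ → ℕ
occurrences = mass (λ _ → 1) id

pairMass-replicate : ∀ h j js → pairMass j (zip (replicate (length js) h) js) ≡ occurrences j js * h
pairMass-replicate h j []       = refl
pairMass-replicate h j (k ∷ js) with k ≡ᵇ j
... | true  = cong (h +_) (pairMass-replicate h j js)
... | false = pairMass-replicate h j js

-- `expand` with arbitrary labels, since the induction over the counts shifts them to `f ∘ suc`.
labelled : (ℕ → ℕ) → List ℕ → List ℕ
labelled f cs = concatMap (λ (j , c) → replicate c j) (zip (applyUpTo f (length cs)) cs)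

length-labelled : ∀ f cs → length (labelled f cs) ≡ sum cs
length-labelled f []       = refl
length-labelled f (c ∷ cs) = trans (Listₚ.length-++ (replicate c (f 0)))
  (cong₂ _+_ (length-replicate c) (length-labelled (f ∘ suc) cs))

labels : ∀ f cs → All (λ k → ∃[ i ] (i < length cs × k ≡ f i)) (labelled f cs)
labels f []       = []
labels f (c ∷ cs) = Allₚ.++⁺ (Allₚ.replicate⁺ c (0 , s≤s z≤n , refl))
  (All.map (λ (i , lt , e) → suc i , s≤s lt , e) (labels (f ∘ suc) cs))

occurrences-replicate : ∀ c j → occurrences j (replicate c j) ≡ c
occurrences-replicate zero    j = refl
occurrences-replicate (suc c) j = cong₂ _+_ (at-≡ j 1) (occurrences-replicate c j)

applyUpTo-cong : ∀ {A : Set} {h k : ℕ → A} n → (∀ i → h i ≡ k i) → applyUpTo h n ≡ applyUpTo k n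
applyUpTo-cong zero    e = refl
applyUpTo-cong (suc n) e = cong₂ _∷_ (e 0) (applyUpTo-cong n (e ∘ suc))

occurrences-labelled : ∀ f → Injective _≡_ _≡_ f → ∀ cs →
                       applyUpTo (λ i → occurrences (f i) (labelled f cs)) (length cs) ≡ cs
occurrences-labelled f inj []       = refl
occurrences-labelled f inj (c ∷ cs) = cong₂ _∷_ first (trans (applyUpTo-cong _ others) (occurrences-labelled (f ∘ suc) (suc-injective ∘ inj) cs))
  where
  first : occurrences (f 0) (replicate c (f 0) ++ labelled (f ∘ suc) cs) ≡ c
  first = trans (mass-++ (λ _ → 1) id (f 0) (replicate c (f 0)) _) (trans (cong₂ _+_ (occurrences-replicate c (f 0))
    (mass-absent (λ _ → 1) id (f 0) (labelled (f ∘ suc) cs)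
      (All.map (λ (i , _ , e) e′ → 1+n≢0 (inj (trans (sym e) e′))) (labels (f ∘ suc) cs)))) (+-identityʳ c))
  others : ∀ i → occurrences (f (suc i)) (replicate c (f 0) ++ labelled (f ∘ suc) cs) ≡ occurrences (f (suc i)) (labelled (f ∘ suc) cs)
  others i = trans (mass-++ (λ _ → 1) id (f (suc i)) (replicate c (f 0)) _) (cong (_+ occurrences (f (suc i)) (labelled (f ∘ suc) cs))
    (mass-absent (λ _ → 1) id (f (suc i)) (replicate c (f 0)) (Allₚ.replicate⁺ c (λ e → 1+n≢0 (sym (inj e))))))

rounds : (d : ℕ) → ℕ → List ⌞ Item ⌟ → List ℕ
rounds zero    K ys = []
rounds (suc d) K ys = replicate (length (take K ys)) (topSize ys) ++ rounds d K (drop K ys)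

total-∷ : ∀ d (p : List (V (suc d))) → total (suc d) p ≡ (sum (map proj₁ p) , total d (map proj₂ p))
total-∷ d []      = refl
total-∷ d (v ∷ p) = cong (plusV (suc d) v) (total-∷ d p)

map-applyUpTo-dot : ∀ {A : Set} (h k : A → ℕ) (p : List A) n (F G : ℕ → ℕ) →
  applyUpTo F n ≡ map h p → applyUpTo G n ≡ map k p → applyUpTo (λ j → F j + G j) n ≡ map (λ v → h v + k v) p
map-applyUpTo-dot h k []      zero    F G _ _ = refl
map-applyUpTo-dot h k (v ∷ p) zero    F G () _
map-applyUpTo-dot h k []      (suc n) F G () _
map-applyUpTo-dot h k (v ∷ p) (suc n) F G e e′ = cong₂ _∷_
  (cong₂ _+_ (Listₚ.∷-injectiveˡ e) (Listₚ.∷-injectiveˡ e′))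
  (map-applyUpTo-dot h k p n (F ∘ suc) (G ∘ suc) (Listₚ.∷-injectiveʳ e) (Listₚ.∷-injectiveʳ e′))

module _ (K : ℕ) where

  length-assignments : ∀ d ys p → total d p ≡ counts d K ys → length (assignments d p) ≡ length (rounds d K ys)
  length-assignments zero    ys p e = refl
  length-assignments (suc d) ys p e = begin
    length (expand (map proj₁ p) ++ assignments d (map proj₂ p))             ≡⟨ Listₚ.length-++ (expand (map proj₁ p)) ⟩
    length (expand (map proj₁ p)) + length (assignments d (map proj₂ p))     ≡⟨ cong₂ _+_ first (length-assignments d (drop K ys) (map proj₂ p) (cong proj₂ e′)) ⟩
    length (replicate (length (take K ys)) (topSize ys)) + length (rounds d K (drop K ys)) ≡⟨ Listₚ.length-++ (replicate (length (take K ys)) (topSize ys)) ⟨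
    length (rounds (suc d) K ys)                                             ∎
    where
    open ≡-Reasoning
    e′ : (sum (map proj₁ p) , total d (map proj₂ p)) ≡ counts (suc d) K ys
    e′ = trans (sym (total-∷ d p)) e
    first : length (expand (map proj₁ p)) ≡ length (replicate (length (take K ys)) (topSize ys))
    first = trans (length-labelled id (map proj₁ p)) (trans (cong proj₁ e′) (sym (length-replicate (length (take K ys)))))

  assignments-< : ∀ d {b} p → length p ≡ b → All (_< b) (assignments d p)
  assignments-< zero    p e    = []
  assignments-< (suc d) p refl = Allₚ.++⁺
    (All.map (λ { (i , lt , refl) → <-≤-trans lt (≤-reflexive (length-map proj₁ p)) }) (labels id (map proj₁ p)))
    (assignments-< d (map proj₂ p) (length-map proj₂ p))

  assignments-loads : ∀ d ys p {b} → length p ≡ b → total d p ≡ counts d K ys →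
    applyUpTo (λ j → pairMass j (zip (rounds d K ys) (assignments d p))) b ≡ map (λ v → dot d v (tops d K ys)) p
  assignments-loads zero    ys []      refl e = refl
  assignments-loads zero    ys (v ∷ p) refl e = cong (0 ∷_) (assignments-loads zero ys p refl refl)
  assignments-loads (suc d) ys p       refl e = trans (applyUpTo-cong (length p) split)
      (map-applyUpTo-dot (λ v → proj₁ v * h) (λ v → dot d (proj₂ v) (tops d K (drop K ys))) p (length p)
        (λ j → occurrences j (expand (map proj₁ p)) * h)
        (λ j → pairMass j (zip (rounds d K (drop K ys)) (assignments d (map proj₂ p))))
        first
        (trans (assignments-loads d (drop K ys) (map proj₂ p) (length-map proj₂ p) (cong proj₂ e′)) (sym (map-∘ p))))
    where
    open ≡-Reasoning
    h : ℕ
    h = topSize ys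
    e′ : (sum (map proj₁ p) , total d (map proj₂ p)) ≡ counts (suc d) K ys
    e′ = trans (sym (total-∷ d p)) e
    same-length : length (take K ys) ≡ length (expand (map proj₁ p))
    same-length = sym (trans (length-labelled id (map proj₁ p)) (cong proj₁ e′))
    split : ∀ j → pairMass j (zip (rounds (suc d) K ys) (assignments (suc d) p))
                    ≡ occurrences j (expand (map proj₁ p)) * h + pairMass j (zip (rounds d K (drop K ys)) (assignments d (map proj₂ p)))
    split j = begin
      pairMass j (zip (rounds (suc d) K ys) (assignments (suc d) p))
        ≡⟨ cong (pairMass j) (zip-++ (replicate (length (take K ys)) h) (expand (map proj₁ p)) (trans (length-replicate _) same-length)) ⟩
      pairMass j (zip (replicate (length (take K ys)) h) (expand (map proj₁ p)) ++ zip (rounds d K (drop K ys)) (assignments d (map proj₂ p)))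
        ≡⟨ mass-++ proj₁ proj₂ j (zip (replicate (length (take K ys)) h) (expand (map proj₁ p))) _ ⟩
      pairMass j (zip (replicate (length (take K ys)) h) (expand (map proj₁ p))) + pairMass j (zip (rounds d K (drop K ys)) (assignments d (map proj₂ p)))
        ≡⟨ cong (λ c → pairMass j (zip (replicate c h) (expand (map proj₁ p))) + pairMass j (zip (rounds d K (drop K ys)) (assignments d (map proj₂ p)))) same-length ⟩
      pairMass j (zip (replicate (length (expand (map proj₁ p))) h) (expand (map proj₁ p))) + pairMass j (zip (rounds d K (drop K ys)) (assignments d (map proj₂ p)))
        ≡⟨ cong (_+ pairMass j (zip (rounds d K (drop K ys)) (assignments d (map proj₂ p)))) (pairMass-replicate h j (expand (map proj₁ p))) ⟩
      occurrences j (expand (map proj₁ p)) * h + pairMass j (zip (rounds d K (drop K ys)) (assignments d (map proj₂ p))) ∎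
    first : applyUpTo (λ j → occurrences j (expand (map proj₁ p)) * h) (length p) ≡ map (λ v → proj₁ v * h) p
    first = begin
      applyUpTo (λ j → occurrences j (expand (map proj₁ p)) * h) (length p)        ≡⟨ Listₚ.map-applyUpTo (λ j → occurrences j (expand (map proj₁ p))) (_* h) (length p) ⟨
      map (_* h) (applyUpTo (λ j → occurrences j (expand (map proj₁ p))) (length p)) ≡⟨ cong (λ n → map (_* h) (applyUpTo (λ j → occurrences j (expand (map proj₁ p))) n)) (length-map proj₁ p) ⟨
      map (_* h) (applyUpTo (λ j → occurrences j (expand (map proj₁ p))) (length (map proj₁ p))) ≡⟨ cong (map (_* h)) (occurrences-labelled id id (map proj₁ p)) ⟩
      map (_* h) (map proj₁ p)                                                     ≡⟨ map-∘ p ⟨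
      map (λ v → proj₁ v * h) p                                                    ∎

  -- The converse of `assignments`. The list `js` may be longer than the list of rounded items,
  -- because it will list the bins of all items, including those that are not grouped.
  binVector : ∀ d → List ⌞ Item ⌟ → List ℕ → ℕ → V d
  binVector zero    ys js j = tt
  binVector (suc d) ys js j =
    occurrences j (take (length (take K ys)) js) , binVector d (drop K ys) (drop (length (take K ys)) js) j

  private
    length-take≤ : ∀ {A : Set} n (xs : List A) → n ≤ length xs → length (take n xs) ≡ n
    length-take≤ n xs le = trans (Listₚ.length-take n xs) (m≤n⇒m⊓n≡m le)

    rounds-fit : ∀ d ys (js : List ℕ) → length (rounds (suc d) K ys) ≤ length js →
                 length (take K ys) ≤ length js × length (rounds d K (drop K ys)) ≤ length (drop (length (take K ys)) js)
    rounds-fit d ys js le = m+n≤o⇒m≤o c fit ,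
        ≤-trans (≤-reflexive (sym (m+n∸m≡n c _))) (≤-trans (∸-monoˡ-≤ c fit) (≤-reflexive (sym (Listₚ.length-drop c js))))
      where
      c : ℕ
      c = length (take K ys)
      fit : c + length (rounds d K (drop K ys)) ≤ length js
      fit = subst (_≤ length js) (trans (Listₚ.length-++ (replicate c (topSize ys)))
              (cong (_+ length (rounds d K (drop K ys))) (length-replicate c))) le

  dot-binVector : ∀ d ys js j → length (rounds d K ys) ≤ length js →
                  dot d (binVector d ys js j) (tops d K ys) ≡ pairMass j (zip (rounds d K ys) js)
  dot-binVector zero    ys js j le = refl
  dot-binVector (suc d) ys js j le = begin
    occurrences j (take c js) * h + dot d (binVector d (drop K ys) (drop c js) j) (tops d K (drop K ys))
      ≡⟨ cong₂ _+_ (sym first) (dot-binVector d (drop K ys) (drop c js) j (proj₂ (rounds-fit d ys js le))) ⟩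
    pairMass j (zip (replicate c h) (take c js)) + pairMass j (zip (rounds d K (drop K ys)) (drop c js))
      ≡⟨ mass-++ proj₁ proj₂ j (zip (replicate c h) (take c js)) _ ⟨
    pairMass j (zip (replicate c h) (take c js) ++ zip (rounds d K (drop K ys)) (drop c js))
      ≡⟨ cong (λ n → pairMass j (zip (replicate c h) (take n js) ++ zip (rounds d K (drop K ys)) (drop n js))) (length-replicate c) ⟨
    pairMass j (zip (replicate c h) (take (length (replicate c h)) js) ++ zip (rounds d K (drop K ys)) (drop (length (replicate c h)) js))
      ≡⟨ cong (pairMass j) (zip-++-split (replicate c h) js) ⟨
    pairMass j (zip (rounds (suc d) K ys) js) ∎
    where
    open ≡-Reasoning
    h c : ℕ
    h = topSize ys
    c = length (take K ys)
    first : pairMass j (zip (replicate c h) (take c js)) ≡ occurrences j (take c js) * h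
    first = trans (cong (λ n → pairMass j (zip (replicate n h) (take c js))) (sym (length-take≤ c js (proj₁ (rounds-fit d ys js le)))))
                  (pairMass-replicate h j (take c js))

  total-binVector : ∀ d ys js b → length (rounds d K ys) ≤ length js → All (_< b) js →
                    total d (applyUpTo (binVector d ys js) b) ≡ counts d K ys
  total-binVector zero    ys js b le bins = refl
  total-binVector (suc d) ys js b le bins = trans (total-∷ d (applyUpTo (binVector (suc d) ys js) b)) (cong₂ _,_ first
      (trans (cong (total d) (Listₚ.map-applyUpTo (binVector (suc d) ys js) proj₂ b)) (total-binVector d (drop K ys) (drop c js) b (proj₂ (rounds-fit d ys js le)) (Allₚ.drop⁺ c bins))))
    where
    open ≡-Reasoning
    c : ℕ
    c = length (take K ys)
    first : sum (map proj₁ (applyUpTo (binVector (suc d) ys js) b)) ≡ c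
    first = begin
      sum (map proj₁ (applyUpTo (binVector (suc d) ys js) b))     ≡⟨ cong sum (Listₚ.map-applyUpTo (binVector (suc d) ys js) proj₁ b) ⟩
      Σ< b (λ j → occurrences j (take c js))                      ≡⟨ Σ-mass (λ _ → 1) id b (take c js) (Allₚ.take⁺ c bins) ⟩
      sum (map (λ _ → 1) (take c js))                             ≡⟨ sum-ones (take c js) ⟩
      length (take c js)                                          ≡⟨ length-take≤ c js (proj₁ (rounds-fit d ys js le)) ⟩
      c                                                           ∎

-- Domination of sizes

infix 4 _⊑_

-- The dominating list may be longer: after the shift by one group, the smallest of the items have
-- no rounded counterpart.
data _⊑_ : List ℕ → List ℕ → Set where
  []  : ∀ {as} → [] ⊑ as
  _∷_ : ∀ {b a bs as} → b ≤ a → bs ⊑ as → b ∷ bs ⊑ a ∷ as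

⊑-++ : ∀ {bs as cs ds} → length bs ≡ length as → bs ⊑ as → cs ⊑ ds → bs ++ cs ⊑ as ++ ds
⊑-++ {as = []} e []       q = q
⊑-++           e (le ∷ p) q = le ∷ ⊑-++ (suc-injective e) p q

⊑-weaken : ∀ {bs as} ds → bs ⊑ as → bs ⊑ as ++ ds
⊑-weaken ds []       = []
⊑-weaken ds (le ∷ p) = le ∷ ⊑-weaken ds p

⊑-take : ∀ {bs as} n → length bs ≤ n → bs ⊑ as → bs ⊑ take n as
⊑-take n       _        []       = []
⊑-take (suc n) (s≤s le) (l ∷ p)  = l ∷ ⊑-take n le p

⊑-length : ∀ {bs as} → bs ⊑ as → length bs ≤ length as
⊑-length []      = z≤n
⊑-length (_ ∷ p) = s≤s (⊑-length p)

replicate-⊑ : ∀ c {h as} → c ≤ length as → All (h ≤_) as → replicate c h ⊑ as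
replicate-⊑ zero    le       ge         = []
replicate-⊑ (suc c) (s≤s le) (g ∷ ge)   = g ∷ replicate-⊑ c le ge

⊑-replicate : ∀ {h as} → All (_≤ h) as → as ⊑ replicate (length as) h
⊑-replicate []         = []
⊑-replicate (le ∷ les) = le ∷ ⊑-replicate les

+-∸-≤ : ∀ g m n → (m + n) ∸ g ≤ m + (n ∸ g)
+-∸-≤ g m n = ≤-trans (∸-monoˡ-≤ g (+-monoʳ-≤ m (m≤m∸n+n n g)))
  (≤-reflexive (trans (cong (_∸ g) (sym (+-assoc m (n ∸ g) g))) (m+n∸n≡m (m + (n ∸ g)) g)))

-- The difference of `a` and `a ∸ g` is the minimum of `a` and `g`, which is monotone in `a`;
-- subtracted terms are moved to the other side.
⊑-sum : ∀ g {bs as} → bs ⊑ as → sum bs + sum (map (_∸ g) as) ≤ sum as + sum (map (_∸ g) bs)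
⊑-sum g {[]} {as} [] = ≤-trans (sums as) (m≤m+n _ 0)
  where
  sums : ∀ as → sum (map (_∸ g) as) ≤ sum as
  sums []       = z≤n
  sums (a ∷ as) = +-mono-≤ (m∸n≤m a g) (sums as)
⊑-sum g {b ∷ bs} {a ∷ as} (le ∷ p) = begin
  b + sum bs + ((a ∸ g) + sum (map (_∸ g) as))   ≡⟨ interchange b (sum bs) (a ∸ g) _ ⟩
  b + (a ∸ g) + (sum bs + sum (map (_∸ g) as))   ≤⟨ +-mono-≤ step′ (⊑-sum g p) ⟩
  a + (b ∸ g) + (sum as + sum (map (_∸ g) bs))   ≡⟨ interchange a (b ∸ g) (sum as) _ ⟩
  a + sum as + ((b ∸ g) + sum (map (_∸ g) bs))   ∎
  where
  open ≤-Reasoning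
  interchange : ∀ a b c d → a + b + (c + d) ≡ a + c + (b + d)
  interchange = solve-∀
  rearrange : ∀ b k f → b + (k + f) ≡ k + b + f
  rearrange = solve-∀
  step′ : b + (a ∸ g) ≤ a + (b ∸ g)
  step′ = begin
    b + (a ∸ g)                   ≡⟨ cong (λ x → b + (x ∸ g)) (m∸n+n≡m le) ⟨
    b + ((a ∸ b + b) ∸ g)         ≤⟨ +-monoʳ-≤ b (+-∸-≤ g (a ∸ b) b) ⟩
    b + (a ∸ b + (b ∸ g))         ≡⟨ rearrange b (a ∸ b) (b ∸ g) ⟩
    a ∸ b + b + (b ∸ g)           ≡⟨ cong (_+ (b ∸ g)) (m∸n+n≡m le) ⟩
    a + (b ∸ g)                   ∎

-- The missing entries of the dominated list count as 0.
triples : ∀ {bs as} → bs ⊑ as → List ℕ → List ((ℕ × ℕ) × ℕ)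
triples {as = []}     []           js       = []
triples {as = a ∷ as} []           []       = []
triples {as = a ∷ as} []           (j ∷ js) = ((a , 0) , j) ∷ triples {[]} {as} [] js
triples               (_ ∷ p)      []       = []
triples {b ∷ _} {a ∷ _} (_ ∷ p)    (j ∷ js) = ((a , b) , j) ∷ triples p js

module _ where
  private
    upper lower bin : (ℕ × ℕ) × ℕ → ℕ
    upper t = proj₁ (proj₁ t)
    lower t = proj₂ (proj₁ t)
    bin   t = proj₂ t

  triples-upper : ∀ {bs as} (p : bs ⊑ as) js j → mass upper bin j (triples p js) ≡ pairMass j (zip as js)
  triples-upper {as = []}     []      js       j = refl
  triples-upper {as = a ∷ as} []      []       j = refl
  triples-upper {as = a ∷ as} []      (k ∷ js) j = cong (at k j a +_) (triples-upper {[]} {as} [] js j)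
  triples-upper               (_ ∷ p) []       j = refl
  triples-upper {as = a ∷ as} (_ ∷ p) (k ∷ js) j = cong (at k j a +_) (triples-upper p js j)

  triples-lower : ∀ {bs as} (p : bs ⊑ as) js j → mass lower bin j (triples p js) ≡ pairMass j (zip bs js)
  triples-lower {as = []}     []      js       j = refl
  triples-lower {as = a ∷ as} []      []       j = refl
  triples-lower {as = a ∷ as} []      (k ∷ js) j = cong₂ _+_ (n≤0⇒n≡0 (at-≤ k j 0)) (triples-lower {[]} {as} [] js j)
  triples-lower               (_ ∷ p) []       j = refl
  triples-lower {bs = b ∷ bs} (_ ∷ p) (k ∷ js) j = cong (at k j b +_) (triples-lower p js j)

  triples-≤ : ∀ {bs as} (p : bs ⊑ as) js → All (λ t → lower t ≤ upper t) (triples p js)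
  triples-≤ {as = []}     []       js       = []
  triples-≤ {as = a ∷ as} []       []       = []
  triples-≤ {as = a ∷ as} []       (k ∷ js) = z≤n ∷ triples-≤ {[]} {as} [] js
  triples-≤               (_ ∷ p)  []       = []
  triples-≤               (le ∷ p) (k ∷ js) = le ∷ triples-≤ p js

  triples-bins : ∀ {bs as m} (p : bs ⊑ as) {js} → All (_< m) js → All (λ t → bin t < m) (triples p js)
  triples-bins {as = []}     []       lts        = []
  triples-bins {as = a ∷ as} []       []         = []
  triples-bins {as = a ∷ as} []       (lt ∷ lts) = lt ∷ triples-bins {[]} {as} [] lts
  triples-bins               (_ ∷ p)  []         = []
  triples-bins               (le ∷ p) (lt ∷ lts) = lt ∷ triples-bins p lts

  sum-upper : ∀ g {bs as} (p : bs ⊑ as) js → length as ≡ length js →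
              sum (map (λ t → upper t ∸ g) (triples p js)) ≡ sum (map (_∸ g) as)
  sum-upper g {as = []}     []      js       e = refl
  sum-upper g {as = a ∷ as} []      (j ∷ js) e = cong ((a ∸ g) +_) (sum-upper g {[]} {as} [] js (suc-injective e))
  sum-upper g {as = a ∷ as} (_ ∷ p) (j ∷ js) e = cong ((a ∸ g) +_) (sum-upper g p js (suc-injective e))

  sum-lower : ∀ g {bs as} (p : bs ⊑ as) js → length as ≡ length js →
              sum (map (λ t → lower t ∸ g) (triples p js)) ≡ sum (map (_∸ g) bs)
  sum-lower g {as = []}     []      js       e = refl
  sum-lower g {as = a ∷ as} []      (j ∷ js) e = cong₂ _+_ (0∸n≡0 g) (sum-lower g {[]} {as} [] js (suc-injective e))
  sum-lower g {bs = b ∷ bs} (_ ∷ p) (j ∷ js) e = cong ((b ∸ g) +_) (sum-lower g p js (suc-injective e))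

  pairMass-mono : ∀ {bs as} → bs ⊑ as → ∀ js j → pairMass j (zip bs js) ≤ pairMass j (zip as js)
  pairMass-mono p js j = subst₂ _≤_ (triples-lower p js j) (triples-upper p js j) (mass-mono bin j (triples-≤ p js))

  convex-⊑ : ∀ g m {bs as js} → bs ⊑ as → length as ≡ length js → All (_< m) js →
    Σ< m (λ j → pairMass j (zip bs js) ∸ g) + sum (map (_∸ g) as)
      ≤ Σ< m (λ j → pairMass j (zip as js) ∸ g) + sum (map (_∸ g) bs)
  convex-⊑ g m {js = js} p e lts = subst₂ _≤_
    (cong₂ _+_ (Σ<-cong m (λ j _ → cong (_∸ g) (triples-lower p js j))) (sum-upper g p js e))
    (cong₂ _+_ (Σ<-cong m (λ j _ → cong (_∸ g) (triples-upper p js j))) (sum-lower g p js e))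
    (overload-convex g m bin (triples p js) (triples-bins p lts) (triples-≤ p js))

-- Rounding up to the largest size in each group

sizes : List ⌞ Item ⌟ → List ℕ
sizes = map itemSize

Desc : List ⌞ Item ⌟ → Set
Desc = AllPairs (λ x y → itemSize y ≤ itemSize x)

AllPairs-++⁻ : ∀ {A : Set} {R : A → A → Set} xs {ys} → AllPairs R (xs ++ ys) →
               AllPairs R xs × All (λ x → All (R x) ys) xs × AllPairs R ys
AllPairs-++⁻ []       rs       = [] , [] , rs
AllPairs-++⁻ (x ∷ xs) (r ∷ rs) = let ls , cross , ds = AllPairs-++⁻ xs rs in
  Allₚ.++⁻ˡ xs r ∷ ls , Allₚ.++⁻ʳ xs r ∷ cross , ds

top-≤ : ∀ ys → Desc ys → All (λ y → itemSize y ≤ topSize ys) ys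
top-≤ []       _        = []
top-≤ (y ∷ ys) (r ∷ rs) = ≤-refl ∷ r

top-≥ : ∀ ps ys → All (λ x → All (λ y → itemSize y ≤ itemSize x) ys) ps → All (λ x → topSize ys ≤ itemSize x) ps
top-≥ ps []       cross = All.map (λ _ → z≤n) cross
top-≥ ps (y ∷ ys) cross = All.map All.head cross

drop-[] : ∀ {A : Set} n → drop {A = A} n [] ≡ []
drop-[] zero    = refl
drop-[] (suc n) = refl

take-[] : ∀ {A : Set} n → take {A = A} n [] ≡ []
take-[] zero    = refl
take-[] (suc n) = refl

take-+ : ∀ {A : Set} m n (xs : List A) → take (m + n) xs ≡ take m xs ++ take n (drop m xs)
take-+ zero    n xs       = refl
take-+ (suc m) n []       = sym (take-[] n)
take-+ (suc m) n (x ∷ xs) = cong (x ∷_) (take-+ m n xs)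

rounds-[] : ∀ d K → rounds d K [] ≡ []
rounds-[] zero    K = refl
rounds-[] (suc d) K rewrite take-[] {⌞ Item ⌟} K | drop-[] {⌞ Item ⌟} K = rounds-[] d K

-- The largest size of a group is at most every size in the group before it, which is carried along
-- as `ps`. If fewer than `K` items remain, they form the last nonempty group and may be shorter
-- than `ps`.
rounds-shift : ∀ d K ps ys → length ps ≡ K → Desc (ps ++ ys) → rounds d K ys ⊑ sizes (ps ++ ys)
rounds-shift zero    K ps ys e desc = []
rounds-shift (suc d) K ps ys e desc with K ≤? length ys | AllPairs-++⁻ ps desc
... | yes K≤ | _ , cross , desc-ys = subst (λ zs → _ ⊑ zs) (sym (map-++ itemSize ps ys))
      (⊑-++ len-eq (replicate-⊑ (length (take K ys)) (≤-reflexive len-eq′) (Allₚ.map⁺ (top-≥ ps ys cross))) rest)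
  where
  len-take : length (take K ys) ≡ K
  len-take = trans (Listₚ.length-take K ys) (m≤n⇒m⊓n≡m K≤)
  len-eq′ : length (take K ys) ≡ length (sizes ps)
  len-eq′ = trans len-take (trans (sym e) (sym (length-map itemSize ps)))
  len-eq : length (replicate (length (take K ys)) (topSize ys)) ≡ length (sizes ps)
  len-eq = trans (length-replicate (length (take K ys))) len-eq′
  rest : rounds d K (drop K ys) ⊑ sizes ys
  rest = subst (λ zs → rounds d K (drop K ys) ⊑ sizes zs) (take++drop≡id K ys)
    (rounds-shift d K (take K ys) (drop K ys) len-take (subst Desc (sym (take++drop≡id K ys)) desc-ys))
... | no K≰ | _ , cross , _ = subst₂ _⊑_ short (sym (map-++ itemSize ps ys))
      (⊑-weaken (sizes ys) (replicate-⊑ (length (take K ys)) short≤ (Allₚ.map⁺ (top-≥ ps ys cross))))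
  where
  short≤ : length (take K ys) ≤ length (sizes ps)
  short≤ = ≤-trans (≤-trans (≤-reflexive (Listₚ.length-take K ys)) (m⊓n≤m K (length ys)))
                 (≤-reflexive (sym (trans (length-map itemSize ps) e)))
  short : replicate (length (take K ys)) (topSize ys) ≡ rounds (suc d) K ys
  short = sym (trans (cong (λ zs → replicate (length (take K ys)) (topSize ys) ++ rounds d K zs) (Listₚ.drop-all K ys (≰⇒≥ K≰)))
    (trans (cong (replicate (length (take K ys)) (topSize ys) ++_) (rounds-[] d K)) (++-identityʳ _)))

rounds-above : ∀ d K ys → Desc ys → sizes (take (d * K) ys) ⊑ rounds d K ys × length (take (d * K) ys) ≡ length (rounds d K ys)
rounds-above zero    K ys desc = [] , refl
rounds-above (suc d) K ys desc = subst (λ zs → sizes zs ⊑ rounds (suc d) K ys) (sym (take-+ K (d * K) ys))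
    (subst (_⊑ rounds (suc d) K ys) (sym (map-++ itemSize (take K ys) _)) (⊑-++ len-eq first (proj₁ rest)))
  , trans (cong length (take-+ K (d * K) ys)) (trans (Listₚ.length-++ (take K ys)) (trans (cong₂ _+_ (sym (length-replicate (length (take K ys)))) (proj₂ rest))
      (sym (Listₚ.length-++ (replicate (length (take K ys)) (topSize ys))))))
  where
  rest : _
  rest = rounds-above d K (drop K ys) (AllPairsₚ.drop⁺ K desc)
  first : sizes (take K ys) ⊑ replicate (length (take K ys)) (topSize ys)
  first = subst (λ n → sizes (take K ys) ⊑ replicate n (topSize ys)) (length-map itemSize (take K ys))
    (⊑-replicate (Allₚ.map⁺ (Allₚ.take⁺ K (top-≤ ys desc))))
  len-eq : length (sizes (take K ys)) ≡ length (replicate (length (take K ys)) (topSize ys))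
  len-eq = trans (length-map itemSize (take K ys)) (sym (length-replicate _))

-- The greedy phase

overload : ℕ → ℕ → List ⌞ Placed ⌟ → ℕ
overload g m ps = Σ< m (λ j → load′ j ps ∸ g)

Σ<-snoc : ∀ m h → Σ< (suc m) h ≡ Σ< m h + h m
Σ<-snoc m h = trans (cong (λ n → Σ< n h) (+-comm 1 m)) (trans (Σ<-split m 1 h)
  (cong (Σ< m h +_) (trans (+-identityʳ _) (cong h (+-identityʳ m)))))

module Greedy (cap g : ℕ) where

  load-new : ∀ x j ps → load′ j ((x , j) ∷ ps) ≡ itemSize x + load′ j ps
  load-new x j ps = cong (_+ load′ j ps) (at-≡ j (itemSize x))

  load-grows : ∀ x j ps i → load′ i ps ≤ load′ i ((x , j) ∷ ps)
  load-grows x j ps i = m≤n+m _ (at j i (itemSize x))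

  record WellPacked (s : ⌞ Bins ⌟) : Set where
    constructor wellPacked
    field
      inRange : All (λ p → placedBin p < proj₁ s) (proj₂ s)
      light   : ∀ j → load′ j (proj₂ s) ≤ cap

  light-cons : ∀ x j ps → load′ j ps + itemSize x ≤ cap → (∀ i → load′ i ps ≤ cap) → ∀ i → load′ i ((x , j) ∷ ps) ≤ cap
  light-cons x j ps fit light i with j ≟ i
  ... | yes refl = ≤-trans (≤-reflexive (trans (load-new x j ps) (+-comm (itemSize x) _))) fit
  ... | no j≢i   = ≤-trans (≤-reflexive (cong (_+ load′ i ps) (at-≢ (itemSize x) j≢i))) (light i)

  place-packed : g ≤ cap → ∀ m ps x → itemSize x ≤ cap → WellPacked (m , ps) → WellPacked (place cap g (m , ps) x)
  place-packed g≤cap m ps x x≤cap (wellPacked inRange light) with place cap g (m , ps) x | placement cap g m ps x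
  ... | _ | harmless {j} j<m fit  = wellPacked (j<m ∷ inRange) (light-cons x j ps (≤-trans fit g≤cap) light)
  ... | _ | fitting {j} j<m fit _ = wellPacked (j<m ∷ inRange) (light-cons x j ps fit light)
  ... | _ | fresh _ _             = wellPacked (n<1+n m ∷ All.map m<n⇒m<1+n inRange)
    (light-cons x m ps (≤-trans (≤-reflexive (cong (_+ itemSize x) (mass-absent placedSize placedBin m ps (All.map <⇒≢ inRange)))) x≤cap) light)

  fill-packed : g ≤ cap → ∀ s xs → All (λ x → itemSize x ≤ cap) xs → WellPacked s → WellPacked (fill cap g s xs)
  fill-packed g≤cap s        []       []         wp = wp
  fill-packed g≤cap (m , ps) (x ∷ xs) (le ∷ les) wp = fill-packed g≤cap (place cap g (m , ps) x) xs les (place-packed g≤cap m ps x le wp)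

  place-items : ∀ m ps x → map proj₁ (proj₂ (place cap g (m , ps) x)) ≡ x ∷ map proj₁ ps
  place-items m ps x with place cap g (m , ps) x | placement cap g m ps x
  ... | _ | harmless _ _  = refl
  ... | _ | fitting _ _ _ = refl
  ... | _ | fresh _ _     = refl

  fill-items : ∀ s xs → map proj₁ (proj₂ (fill cap g s xs)) ↭ map proj₁ (proj₂ s) ++ xs
  fill-items s        []       = ↭-reflexive (sym (++-identityʳ _))
  fill-items (m , ps) (x ∷ xs) = ↭-trans (fill-items (place cap g (m , ps) x) xs)
    (↭-trans (↭-reflexive (cong (_++ xs) (place-items m ps x))) (↭-sym (Permₚ.shift x (map proj₁ ps) xs)))

  cons-overload : ∀ m ps x {j} → j < m → overload g m ((x , j) ∷ ps) ≤ overload g m ps + itemSize x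
  cons-overload m ps x {j} j<m = begin
    Σ< m (λ i → (at j i (itemSize x) + load′ i ps) ∸ g)         ≤⟨ Σ<-mono m (λ i _ → +-∸-≤ g (at j i (itemSize x)) (load′ i ps)) ⟩
    Σ< m (λ i → at j i (itemSize x) + (load′ i ps ∸ g))         ≡⟨ Σ<-+ m _ _ ⟩
    Σ< m (λ i → at j i (itemSize x)) + overload g m ps          ≡⟨ cong (_+ overload g m ps) (Σ<-at m j (itemSize x) j<m) ⟩
    itemSize x + overload g m ps                                ≡⟨ +-comm (itemSize x) _ ⟩
    overload g m ps + itemSize x                                ∎
    where open ≤-Reasoning

  place-overload : ∀ m ps x → All (λ p → placedBin p < m) ps →
    overload g (proj₁ (place cap g (m , ps) x)) (proj₂ (place cap g (m , ps) x)) ≤ overload g m ps + itemSize x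
  place-overload m ps x inRange with place cap g (m , ps) x | placement cap g m ps x
  ... | _ | harmless j<m _       = cons-overload m ps x j<m
  ... | _ | fitting j<m _ _      = cons-overload m ps x j<m
  ... | _ | fresh _ _            = ≤-trans (≤-reflexive (Σ<-snoc m _)) (+-mono-≤
      (Σ<-mono m (λ i i<m → ≤-reflexive (cong (λ a → (a + load′ i ps) ∸ g) (at-≢ (itemSize x) (<⇒≢ i<m ∘ sym)))))
      (≤-trans (m∸n≤m _ g) (≤-reflexive (trans (load-new x m ps) (trans (cong (itemSize x +_)
        (mass-absent placedSize placedBin m ps (All.map <⇒≢ inRange))) (+-identityʳ _))))))

  place-inRange : ∀ m ps x → All (λ p → placedBin p < m) ps →
                  All (λ p → placedBin p < proj₁ (place cap g (m , ps) x)) (proj₂ (place cap g (m , ps) x))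
  place-inRange m ps x inRange with place cap g (m , ps) x | placement cap g m ps x
  ... | _ | harmless j<m _  = j<m ∷ inRange
  ... | _ | fitting j<m _ _ = j<m ∷ inRange
  ... | _ | fresh _ _       = n<1+n m ∷ All.map m<n⇒m<1+n inRange

  -- A crude estimate, in which every item counts in full. It is used when the rounded packing
  -- saturates its bins; the lower bound on the overload of a packing counts these items in full as
  -- well.
  fill-overload : ∀ s xs → All (λ p → placedBin p < proj₁ s) (proj₂ s) →
    overload g (proj₁ (fill cap g s xs)) (proj₂ (fill cap g s xs)) ≤ overload g (proj₁ s) (proj₂ s) + sum (sizes xs)
  fill-overload s        []       inRange = m≤m+n _ 0
  fill-overload (m , ps) (x ∷ xs) inRange = begin
    _                                                       ≤⟨ fill-overload (place cap g (m , ps) x) xs (place-inRange m ps x inRange) ⟩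
    overload g (proj₁ (place cap g (m , ps) x)) (proj₂ (place cap g (m , ps) x)) + sum (sizes xs)
                                                            ≤⟨ +-monoˡ-≤ (sum (sizes xs)) (place-overload m ps x inRange) ⟩
    overload g m ps + itemSize x + sum (sizes xs)           ≡⟨ +-assoc (overload g m ps) (itemSize x) _ ⟩
    overload g m ps + sum (sizes (x ∷ xs))                  ∎
    where open ≤-Reasoning

  module _ (t m₀ F₀ : ℕ) where

    -- The invariant of the greedy phase. Loads only grow, so in both disjunctions the right
    -- alternative persists once it has been reached.
    record Outcome (s : ⌞ Bins ⌟) : Set where
      constructor outcome
      field
        m₀≤    : m₀ ≤ proj₁ s
        noOverload : (proj₁ s ≡ m₀ × overload g (proj₁ s) (proj₂ s) ≤ F₀) ⊎ (∀ j → j < m₀ → g ≤ load′ j (proj₂ s) + t)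
        -- The condition `suc j < proj₁ s` exempts the bin opened last, which costs the additional 1
        -- in the number of bins.
        space  : proj₁ s ≡ m₀ ⊎ (∀ j → suc j < proj₁ s → cap ≤ load′ j (proj₂ s) + t)

    place-outcome : ∀ m ps x → itemSize x ≤ t → Outcome (m , ps) → Outcome (place cap g (m , ps) x)
    place-outcome m ps x x≤t (outcome m₀≤ noOverload space) with place cap g (m , ps) x | placement cap g m ps x
    ... | _ | harmless {j} j<m fit = outcome m₀≤ (noOverload′ noOverload) (space′ space)
      where
      smaller : ∀ i → ((at j i (itemSize x) + load′ i ps) ∸ g) ≤ load′ i ps ∸ g
      smaller i with j ≟ i
      ... | yes refl = ≤-trans (≤-reflexive (m≤n⇒m∸n≡0 (≤-trans (≤-reflexive
                         (trans (load-new x j ps) (+-comm (itemSize x) _))) fit))) z≤n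
      ... | no j≢i   = ≤-reflexive (cong (λ a → (a + load′ i ps) ∸ g) (at-≢ (itemSize x) j≢i))
      noOverload′ : _ → _
      noOverload′ (inj₁ (e , le)) = inj₁ (e , ≤-trans (Σ<-mono m (λ i _ → smaller i)) le)
      noOverload′ (inj₂ h)        = inj₂ λ i i<m → ≤-trans (h i i<m) (+-monoˡ-≤ t (load-grows x j ps i))
      space′ : _ → _
      space′ (inj₁ e) = inj₁ e
      space′ (inj₂ h) = inj₂ λ i i<m → ≤-trans (h i i<m) (+-monoˡ-≤ t (load-grows x j ps i))
    ... | _ | fitting {j} j<m fit full = outcome m₀≤
        (inj₂ λ i i<m₀ → ≤-trans (<⇒≤ (full i (<-≤-trans i<m₀ m₀≤))) (+-mono-≤ (load-grows x j ps i) x≤t))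
        (space′ space)
      where
      space′ : _ → _
      space′ (inj₁ e) = inj₁ e
      space′ (inj₂ h) = inj₂ λ i i<m → ≤-trans (h i i<m) (+-monoˡ-≤ t (load-grows x j ps i))
    ... | _ | fresh full full′ = outcome (m≤n⇒m≤1+n m₀≤)
        (inj₂ λ i i<m₀ → ≤-trans (<⇒≤ (full i (<-≤-trans i<m₀ m₀≤))) (+-mono-≤ (load-grows x m ps i) x≤t))
        (inj₂ λ { i (s≤s i<m) → ≤-trans (<⇒≤ (full′ i i<m)) (+-mono-≤ (load-grows x m ps i) x≤t) })

    fill-outcome : ∀ s xs → All (λ x → itemSize x ≤ t) xs → Outcome s → Outcome (fill cap g s xs)
    fill-outcome s        []       []         o = o
    fill-outcome (m , ps) (x ∷ xs) (le ∷ les) o = fill-outcome (place cap g (m , ps) x) xs les (place-outcome m ps x le o)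

-- The items that get bins of their own

apart : ∀ {f : ℕ → ℕ} → Injective _≡_ _≡_ f → ∀ (xs : List ⌞ Item ⌟) n h → (∀ i → h i ≢ 0) →
        All (λ p → placedBin p ≢ f 0) (zip xs (applyUpTo (f ∘ h) n))
apart inj []       n       h ne = []
apart inj (x ∷ xs) zero    h ne = []
apart inj (x ∷ xs) (suc n) h ne = (λ e → ne 0 (inj e)) ∷ apart inj xs n (h ∘ suc) (ne ∘ suc)

first-single : ∀ f → Injective _≡_ _≡_ f → ∀ n x (xs : List ⌞ Item ⌟) →
               load′ (f 0) (zip (x ∷ xs) (applyUpTo f (suc n))) ≡ itemSize x
first-single f inj n x xs = trans (cong₂ _+_ (at-≡ (f 0) (itemSize x))
  (mass-absent placedSize placedBin (f 0) (zip xs (applyUpTo (f ∘ suc) n)) (apart inj xs n suc (λ i → 1+n≢0)))) (+-identityʳ _)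

singles-loads : ∀ g f → Injective _≡_ _≡_ f → ∀ n (xs : List ⌞ Item ⌟) →
  Σ< n (λ i → load′ (f i) (zip xs (applyUpTo f n)) ∸ g) ≤ sum (map (_∸ g) (sizes xs))
singles-loads g f inj zero    xs       = z≤n
singles-loads g f inj (suc n) []       = ≤-trans (Σ<-mono (suc n) {k = λ _ → 0} (λ j _ → ≤-reflexive (0∸n≡0 g)))
                                           (≤-reflexive (Σ<-zero (suc n)))
singles-loads g f inj (suc n) (x ∷ xs) = +-mono-≤
  (∸-monoˡ-≤ g (≤-reflexive (first-single f inj n x xs)))
  (≤-trans (Σ<-mono n (λ i _ → ∸-monoˡ-≤ g (≤-reflexive (cong (_+ load′ (f (suc i)) (zip xs (applyUpTo (f ∘ suc) n)))
      (at-≢ (itemSize x) (λ e → 1+n≢0 (sym (inj e))))))))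
    (singles-loads g (f ∘ suc) (suc-injective ∘ inj) n xs))

singles-light : ∀ cap f → Injective _≡_ _≡_ f → ∀ n (xs : List ⌞ Item ⌟) → All (λ x → itemSize x ≤ cap) xs →
                ∀ j → load′ j (zip xs (applyUpTo f n)) ≤ cap
singles-light cap f inj n       []       les        j = z≤n
singles-light cap f inj zero    (x ∷ xs) les        j = z≤n
singles-light cap f inj (suc n) (x ∷ xs) (le ∷ les) j with f 0 ≟ j
... | yes refl = ≤-trans (≤-reflexive (first-single f inj n x xs)) le
... | no f0≢j  = ≤-trans (≤-reflexive (cong (_+ load′ j (zip xs (applyUpTo (f ∘ suc) n))) (at-≢ (itemSize x) f0≢j)))
                   (singles-light cap (f ∘ suc) (suc-injective ∘ inj) n xs les j)

-- The main estimate

argmin : ∀ {A : Set} (f : A → ℕ) {x : A} xs → x ∈ xs → ∃[ y ] (y ∈ xs × (∀ z → z ∈ xs → f y ≤ f z))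
argmin f (x ∷ []) _ = x , here refl , λ { z (here refl) → ≤-refl }
argmin f (x ∷ xs@(_ ∷ _)) _ with argmin f xs (here refl)
... | y , y∈ , least with f x ≤? f y
... | yes le = x , here refl , λ { z (here refl) → ≤-refl ; z (there z∈) → ≤-trans le (least z z∈) }
... | no  gt = y , there y∈ , λ { z (here refl) → ≰⇒≥ gt ; z (there z∈) → least z z∈ }

All-zip₂ : ∀ {A B : Set} {P : B → Set} (as : List A) {js : List B} → All P js → All (P ∘ proj₂) (zip as js)
All-zip₂ []       pjs        = []
All-zip₂ (a ∷ as) []         = []
All-zip₂ (a ∷ as) (pj ∷ pjs) = pj ∷ All-zip₂ as pjs

map-proj₁-zip : ∀ {A B : Set} (as : List A) (js : List B) → length as ≤ length js → map proj₁ (zip as js) ≡ as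
map-proj₁-zip []       js       le       = refl
map-proj₁-zip (a ∷ as) (j ∷ js) (s≤s le) = cong (a ∷_) (map-proj₁-zip as js le)

load-zip : ∀ j (xs : List ⌞ Item ⌟) js → load′ j (zip xs js) ≡ pairMass j (zip (sizes xs) js)
load-zip j []       js       = refl
load-zip j (x ∷ xs) []       = refl
load-zip j (x ∷ xs) (k ∷ js) = cong (at k j (itemSize x) +_) (load-zip j xs js)

Σ-pairMass : ∀ b as js → length as ≤ length js → All (_< b) js → Σ< b (λ j → pairMass j (zip as js)) ≡ sum as
Σ-pairMass b as js le bins = trans (Σ-mass proj₁ proj₂ b (zip as js) (All-zip₂ as bins)) (cong sum (map-proj₁-zip as js le))

sum-≥ : ∀ t as → All (t ≤_) as → length as * t ≤ sum as
sum-≥ t []       []         = z≤n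
sum-≥ t (a ∷ as) (le ∷ les) = +-mono-≤ le (sum-≥ t as les)

m⊔n≡m∸n+n : ∀ m n → m ⊔ n ≡ (m ∸ n) + n
m⊔n≡m∸n+n m       zero    = trans (⊔-identityʳ m) (sym (+-identityʳ m))
m⊔n≡m∸n+n zero    (suc n) = refl
m⊔n≡m∸n+n (suc m) (suc n) = trans (cong suc (m⊔n≡m∸n+n m n)) (sym (+-suc (m ∸ n) n))

module Core (d cap g : ℕ) (g≤cap : g ≤ cap) (xs : List ⌞ Item ⌟) (desc : Desc xs)
            (small : All (λ x → itemSize x ≤ cap) xs) where
  open DP d
  open Candidates d
  open Greedy cap g

  module Structured (b K : ℕ) where
    ys Z X₀ rest : List ⌞ Item ⌟
    X₀   = take K xs
    ys   = drop K xs
    Z    = take (d * K) ys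
    rest = drop (d * K) ys

    r : List ℕ
    r = rounds d K ys

    desc-split : AllPairs (λ x y → itemSize y ≤ itemSize x) X₀ × All (λ x → All (λ y → itemSize y ≤ itemSize x) ys) X₀ × Desc ys
    desc-split = AllPairs-++⁻ X₀ (subst Desc (sym (take++drop≡id K xs)) desc)

    above : sizes Z ⊑ r × length Z ≡ length r
    above = rounds-above d K ys (proj₂ (proj₂ desc-split))

    below : r ⊑ sizes xs
    below with K ≤? length xs
    ... | yes K≤ = subst (λ zs → r ⊑ sizes zs) (take++drop≡id K xs) (rounds-shift d K X₀ ys
                     (trans (Listₚ.length-take K xs) (m≤n⇒m⊓n≡m K≤)) (subst Desc (sym (take++drop≡id K xs)) desc))
    ... | no K≰  = subst (_⊑ sizes xs) (sym (trans (cong (rounds d K) (Listₚ.drop-all K xs (≰⇒≥ K≰))) (rounds-[] d K))) []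

    partition : X₀ ++ (Z ++ rest) ≡ xs
    partition = trans (cong (X₀ ++_) (take++drop≡id (d * K) ys)) (take++drop≡id K xs)

    module Packed (p : List (V d)) (sol : DPCorrect.Solution d (counts d K ys) (tops d K ys) cap g b p)
                  (full : total d p ≡ counts d K ys) where
      js : List ℕ
      js = assignments d p

      js-length : length js ≡ length r
      js-length = length-assignments K d ys p full

      js-< : All (_< b) js
      js-< = assignments-< K d p (DPCorrect.Solution.bins sol)

      singles : List ⌞ Placed ⌟
      singles = zip X₀ (map (b +_) (upTo K))

      singles≡ : singles ≡ zip X₀ (applyUpTo (b +_) K)
      singles≡ = cong (zip X₀) (Listₚ.map-upTo (b +_) K)

      singles-bins : All (λ p → b ≤ placedBin p × placedBin p < b + K) singles
      singles-bins = All-zip₂ X₀ (Allₚ.map⁺ (All.map (λ lt → m≤m+n b _ , +-monoʳ-< b lt) (upTo-< K)))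

      placed : List ⌞ Placed ⌟
      placed = structured xs b K p

      round-light : ∀ j → j < b → pairMass j (zip r js) ≤ cap
      round-light j j<b = Allₚ.applyUpTo⁻ (λ j → pairMass j (zip r js)) b
        (subst (All (_≤ cap)) (sym (assignments-loads K d ys p (DPCorrect.Solution.bins sol) full)) (Allₚ.map⁺ (DPCorrect.Solution.light sol))) j<b

      load-low : ∀ j → j < b → load′ j placed ≡ pairMass j (zip (sizes Z) js)
      load-low j j<b = trans (mass-++ placedSize placedBin j singles (zip Z js)) (cong₂ _+_
        (mass-absent placedSize placedBin j singles (All.map (λ (le , _) → <⇒≢ (<-≤-trans j<b le) ∘ sym) singles-bins))
        (load-zip j Z js))

      load-high : ∀ j → b ≤ j → load′ j placed ≡ load′ j singles
      load-high j b≤j = trans (mass-++ placedSize placedBin j singles (zip Z js)) (trans (cong (load′ j singles +_)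
        (mass-absent placedSize placedBin j (zip Z js) (All.map (λ lt → <⇒≢ (<-≤-trans lt b≤j)) (All-zip₂ Z js-<)))) (+-identityʳ _))

      placed-packed : WellPacked (b + K , placed)
      placed-packed = wellPacked
        (Allₚ.++⁺ (All.map proj₂ singles-bins) (All-zip₂ Z (All.map (λ lt → ≤-trans lt (m≤m+n b K)) js-<)))
        light
        where
        light : ∀ j → load′ j placed ≤ cap
        light j with j <? b
        ... | yes j<b = ≤-trans (≤-reflexive (load-low j j<b)) (≤-trans (pairMass-mono (proj₁ above) js j) (round-light j j<b))
        ... | no  j≮b = ≤-trans (≤-reflexive (trans (load-high j (≮⇒≥ j≮b)) (cong (load′ j) singles≡)))
                          (singles-light cap (b +_) (+-cancelˡ-≡ b _ _) K X₀ (Allₚ.take⁺ K small) j)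

      placed-items : map proj₁ placed ≡ X₀ ++ Z
      placed-items = trans (map-++ proj₁ singles (zip Z js)) (cong₂ _++_
        (map-proj₁-zip X₀ (map (b +_) (upTo K)) (≤-trans (≤-trans (≤-reflexive (Listₚ.length-take K xs)) (m⊓n≤m K _))
          (≤-reflexive (sym (trans (length-map (b +_) (upTo K)) (Listₚ.length-upTo K))))))
        (map-proj₁-zip Z js (≤-reflexive (trans (proj₂ above) (sym js-length)))))

      final : ⌞ Bins ⌟
      final = candidate (xs , cap , g) b K p

      final-packed : WellPacked final
      final-packed = fill-packed g≤cap (b + K , placed) rest (Allₚ.drop⁺ (d * K) (Allₚ.drop⁺ K small)) placed-packed

      final-items : map proj₁ (proj₂ final) ↭ xs
      final-items = ↭-trans (fill-items (b + K , placed) rest) (↭-reflexive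
        (trans (cong (_++ rest) placed-items) (trans (++-assoc X₀ Z rest) partition)))

      placed-overload : overload g (b + K) placed
                          ≤ Σ< b (λ j → pairMass j (zip (sizes Z) js) ∸ g) + sum (map (_∸ g) (sizes X₀))
      placed-overload = ≤-trans (≤-reflexive (Σ<-split b K _)) (+-mono-≤
        (Σ<-mono b (λ j j<b → ∸-monoˡ-≤ g (≤-reflexive (load-low j j<b))))
        (≤-trans (Σ<-mono K (λ i _ → ∸-monoˡ-≤ g (≤-reflexive (trans (load-high (b + i) (m≤m+n b i)) (cong (load′ (b + i)) singles≡)))))
          (singles-loads g (b +_) (+-cancelˡ-≡ b _ _) K X₀)))

  candidates-sound : All (λ s → WellPacked s × map proj₁ (proj₂ s) ↭ xs) (candidates (xs , cap , g))
  candidates-sound = All-concatMap {P = λ _ → ⊤} (λ {b} _ → All-concatMap {P = λ _ → ⊤} (λ {K} _ →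
      Allₚ.map⁺ (All.map (λ {p} (sol , full) → Structured.Packed.final-packed b (suc K) p sol full ,
                                               Structured.Packed.final-items b (suc K) p sol full)
        (DPCorrect.solutions-sound d (counts d (suc K) (drop (suc K) xs)) (tops d (suc K) (drop (suc K) xs)) cap g b)))
      (All.universal (λ _ → tt) (upTo (suc (length xs)))))
    (All.universal (λ _ → tt) (upTo (suc (length xs))))

  candidate∈ : ∀ {b K p} → b ≤ length xs → K ≤ length xs → p ∈ solutions (params (xs , cap , g) (suc K)) b →
               candidate (xs , cap , g) b (suc K) p ∈ candidates (xs , cap , g)
  candidate∈ {b} {K} b≤ K≤ p∈ = ∈-concatMap _ (Membershipₚ.∈-upTo⁺ (s≤s b≤))
    (∈-concatMap _ (Membershipₚ.∈-upTo⁺ (s≤s K≤)) (Membershipₚ.∈-map⁺ (candidate (xs , cap , g) b (suc K)) p∈))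

  module Optimum (b K : ℕ) (js : List ℕ) (len-js : length xs ≡ length js) (js-< : All (_< b) js)
                 (light : ∀ j → j < b → pairMass j (zip (sizes xs) js) ≤ cap) where
    open Structured b K
    open DPCorrect d (counts d K ys) (tops d K ys) cap g

    roundOverload : List ℕ → ℕ
    roundOverload ks = Σ< b (λ j → pairMass j (zip r ks) ∸ g)

    packing : List ℕ → List (V d)
    packing ks = applyUpTo (binVector K d ys ks) b

    Admissible : List ℕ → Set
    Admissible ks = length r ≤ length ks × All (_< b) ks × (∀ j → j < b → pairMass j (zip r ks) ≤ cap)

    cost-overload : ∀ p (F : ℕ → ℕ) → applyUpTo F b ≡ map (λ v → dot d v (tops d K ys)) p →
                    cost (tops d K ys) g p ≡ Σ< b (λ j → F j ∸ g) + b * g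
    cost-overload p F e = begin
      sum (map (λ v → dot d v (tops d K ys) ⊔ g) p)        ≡⟨ cong sum (map-∘ p) ⟩
      sum (map (_⊔ g) (map (λ v → dot d v (tops d K ys)) p)) ≡⟨ cong (sum ∘ map (_⊔ g)) e ⟨
      sum (map (_⊔ g) (applyUpTo F b))                     ≡⟨ cong sum (Listₚ.map-applyUpTo F (_⊔ g) b) ⟩
      Σ< b (λ j → F j ⊔ g)                                 ≡⟨ Σ<-cong b (λ j _ → m⊔n≡m∸n+n (F j) g) ⟩
      Σ< b (λ j → (F j ∸ g) + g)                           ≡⟨ Σ<-+ b _ _ ⟩
      Σ< b (λ j → F j ∸ g) + Σ< b (λ _ → g)                ≡⟨ cong (Σ< b (λ j → F j ∸ g) +_) (Σ<-const b g) ⟩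
      Σ< b (λ j → F j ∸ g) + b * g                         ∎
      where open ≡-Reasoning

    dots : ∀ ks → length r ≤ length ks → applyUpTo (λ j → pairMass j (zip r ks)) b ≡ map (λ v → dot d v (tops d K ys)) (packing ks)
    dots ks le = trans (applyUpTo-cong b (λ j → sym (dot-binVector K d ys ks j le))) (sym (Listₚ.map-applyUpTo (binVector K d ys ks) _ b))

    packing-solution : ∀ ks → Admissible ks → Solution b (packing ks)
    packing-solution ks (le , _ , fit) = solution (Listₚ.length-applyUpTo (binVector K d ys ks) b)
      (Allₚ.map⁻ (subst (All (_≤ cap)) (dots ks le) (Allₚ.applyUpTo⁺₁ (λ j → pairMass j (zip r ks)) b (λ {j} j<b → fit j j<b))))

    -- Zipping aligns the rounded item of rank `K + i` with the bin of the item of rank `i`, which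
    -- is at least as large; no load increases.
    js-admissible : Admissible js
    js-admissible = ≤-trans (⊑-length below) (≤-reflexive (trans (length-map itemSize xs) len-js)) , js-< ,
      λ j j<b → ≤-trans (pairMass-mono below js j) (light j j<b)

    -- Optimality is required against all admissible assignments and not only against `js`, because
    -- the saturation argument compares with packings in which one item has been moved.
    optimum : ∃[ p ] (p ∈ solutions γ b × (∀ ks → Admissible ks → cost (tops d K ys) g p ≤ roundOverload ks + b * g))
    optimum with solutions-optimal b (packing js) (packing-solution js js-admissible) (total-binVector K d ys js b (proj₁ js-admissible) js-<)
    ... | q , q∈ , _ with argmin (cost (tops d K ys) g) (solutions γ b) q∈
    ... | p , p∈ , least = p , p∈ , λ ks adm@(le , bins , _) →
          let q′ , q′∈ , cheap = solutions-optimal b (packing ks) (packing-solution ks adm) (total-binVector K d ys ks b le bins)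
          in ≤-trans (least q′ q′∈) (≤-trans cheap (≤-reflexive (cost-overload (packing ks) (λ j → pairMass j (zip r ks)) (dots ks le))))

  -- K is the size of the groups; since b < q K, the K largest items, which get
  -- bins of their own, cost at most a fraction 1 / q (rounded up) of b.
  module Estimate (q b K : ℕ) (js : List ℕ) (d≡ : d ≡ suc q * q) (0<K : 0 < K) (b<qK : b < q * K) (qK≤ : q * K ≤ b + q)
                  (positive : All (λ x → 0 < itemSize x) xs)
                  (len-js : length xs ≡ length js) (js-< : All (_< b) js)
                  (light : ∀ j → j < b → pairMass j (zip (sizes xs) js) ≤ cap) where
    open Structured b K
    open Optimum b K js len-js js-< light
    open DPCorrect d (counts d K ys) (tops d K ys) cap g

    p : List (V d)
    p = proj₁ optimum

    p∈ : p ∈ solutions γ b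
    p∈ = proj₁ (proj₂ optimum)

    p-sound : Solution b p × total d p ≡ counts d K ys
    p-sound = All.lookup (solutions-sound b) p∈

    module P = Packed p (proj₁ p-sound) (proj₂ p-sound)
    ks : List ℕ
    ks = P.js

    p-optimal : ∀ ls → Admissible ls → roundOverload ks ≤ roundOverload ls
    p-optimal ls adm = +-cancelʳ-≤ (b * g) _ _ (≤-trans
      (≤-reflexive (sym (cost-overload p (λ j → pairMass j (zip r ks)) (assignments-loads K d ys p (Solution.bins (proj₁ p-sound)) (proj₂ p-sound)))))
      (proj₂ (proj₂ optimum) ls adm))

    f : ℕ → ℕ
    f = _∸ g

    total-f : List ⌞ Item ⌟ → ℕ
    total-f zs = sum (map f (sizes zs))

    realOverload goal : ℕ
    realOverload = Σ< b (λ j → pairMass j (zip (sizes Z) ks) ∸ g)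
    goal         = Σ< b (λ j → pairMass j (zip (sizes xs) js) ∸ g)

    F₀ : ℕ
    F₀ = realOverload + total-f X₀

    real≤round : realOverload + sum (map f r) ≤ roundOverload ks + total-f Z
    real≤round = convex-⊑ g b (proj₁ above) (sym P.js-length) P.js-<

    shift≤ : roundOverload js + total-f xs ≤ goal + sum (map f r)
    shift≤ = convex-⊑ g b below (trans (length-map itemSize xs) len-js) js-<

    sum-partition : ∀ (h : List ⌞ Item ⌟ → ℕ) → (∀ us vs → h (us ++ vs) ≡ h us + h vs) → h xs ≡ h X₀ + (h Z + h rest)
    sum-partition h hom = trans (cong h (sym partition)) (trans (hom X₀ (Z ++ rest)) (cong (h X₀ +_) (hom Z rest)))

    sum-sizes-++ : ∀ us vs → sum (sizes (us ++ vs)) ≡ sum (sizes us) + sum (sizes vs)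
    sum-sizes-++ us vs = trans (cong sum (map-++ itemSize us vs)) (ListActionₚ.sum-++ (sizes us) (sizes vs))

    total-f-++ : ∀ us vs → total-f (us ++ vs) ≡ total-f us + total-f vs
    total-f-++ us vs = trans (cong (sum ∘ map f) (map-++ itemSize us vs))
      (trans (cong sum (map-++ f (sizes us) (sizes vs))) (ListActionₚ.sum-++ (map f (sizes us)) (map f (sizes vs))))

    -- The two convexity estimates contain `sum (map f r)` with opposite signs, and `total-f Z`
    -- cancels against its part of `total-f xs`. What is left of the latter is `total-f X₀`, which
    -- pays for the separate items, and a nonnegative contribution of the rest, which is dropped.
    F₀≤goal : F₀ ≤ goal
    F₀≤goal = combine real≤round (p-optimal js js-admissible)
      (subst (λ s → roundOverload js + s ≤ goal + sum (map f r)) (sum-partition total-f total-f-++) shift≤)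
      where
      combine : ∀ {real fr round fz shift fx₀ frest goal} → real + fr ≤ round + fz → round ≤ shift →
                shift + (fx₀ + (fz + frest)) ≤ goal + fr → real + fx₀ ≤ goal
      combine {real} {fr} {round} {fz} {shift} {fx₀} {frest} {goal} h₁ h₂ h₃ =
        +-cancelʳ-≤ (fr + (fz + round)) _ _ (≤-trans (m≤m+n _ frest) (≤-trans (≤-reflexive (left-side real fr round fz fx₀ frest))
          (≤-trans (+-mono-≤ h₁ (≤-trans (+-monoˡ-≤ _ h₂) h₃)) (≤-reflexive (right-side round fz goal fr)))))
        where
        left-side : ∀ real fr round fz fx₀ frest → real + fx₀ + (fr + (fz + round)) + frest ≡ real + fr + (round + (fx₀ + (fz + frest)))
        left-side = solve-∀
        right-side : ∀ round fz goal fr → round + fz + (goal + fr) ≡ goal + (fr + (fz + round))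
        right-side = solve-∀

    mass-total : sum (sizes xs) ≡ Σ< b (λ j → pairMass j (zip (sizes xs) js))
    mass-total = sym (Σ-pairMass b (sizes xs) js (≤-reflexive (trans (length-map itemSize xs) len-js)) js-<)

    total≤goal : sum (sizes xs) ≤ goal + b * g
    total≤goal = ≤-trans (≤-reflexive (cong sum (sym (map-proj₁-zip (sizes xs) js (≤-reflexive (trans (length-map itemSize xs) len-js))))))
      (total≤overload g b proj₁ proj₂ (zip (sizes xs) js) (All-zip₂ (sizes xs) js-<))

    total≤bcap : sum (sizes xs) ≤ b * cap
    total≤bcap = ≤-trans (≤-reflexive mass-total) (≤-trans (Σ<-mono b light) (≤-reflexive (Σ<-const b cap)))

    m : ℕ
    m = proj₁ P.final

    ps : List ⌞ Placed ⌟
    ps = proj₂ P.final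

    final-total : Σ< m (λ j → load′ j ps) ≡ sum (sizes xs)
    final-total = trans (Σ-mass placedSize placedBin m ps (WellPacked.inRange P.final-packed))
      (trans (cong sum (map-∘ ps)) (ListActionₚ.sum-↭ (Permₚ.map⁺ itemSize P.final-items)))

    -- The second part is m ≤ (1 + 1/q) b + 1 cleared of the denominator.
    Conclusion : Set
    Conclusion = overload g m ps ≤ goal × q * m ≤ suc q * b + q

    initial-bins : q * (b + K) ≤ suc q * b + q
    initial-bins = ≤-trans (≤-reflexive (*-distribˡ-+ q b K)) (≤-trans (+-monoʳ-≤ (q * b) qK≤) (≤-reflexive (rearrange q b)))
      where
      rearrange : ∀ q b → q * b + (b + q) ≡ suc q * b + q
      rearrange = solve-∀

    nothing-left : rest ≡ [] → Conclusion
    nothing-left none = ≤-trans (≤-reflexive (cong₂ (overload g) (cong proj₁ final≡) (cong proj₂ final≡)))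
                          (≤-trans P.placed-overload F₀≤goal)
                      , ≤-trans (≤-reflexive (cong (λ s → q * proj₁ s) final≡)) initial-bins
      where
      final≡ : P.final ≡ (b + K , P.placed)
      final≡ = cong (fill cap g (b + K , P.placed)) none

    module Leftover (x : ⌞ Item ⌟) (xs′ : List ⌞ Item ⌟) (some : rest ≡ x ∷ xs′) where
      t : ℕ
      t = itemSize x

      -- An item can be left over only when all `d` groups are full, so there are exactly `d * K`
      -- grouped items, none smaller than `t`.
      many : K + d * K < length xs
      many = ≰⇒> λ le → nonempty (trans (sym some) (Listₚ.drop-all (d * K) ys
        (≤-trans (≤-reflexive (Listₚ.length-drop K xs)) (≤-trans (∸-monoˡ-≤ K le) (≤-reflexive (m+n∸m≡n K (d * K)))))))
        where
        nonempty : ¬ (x ∷ xs′ ≡ [])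
        nonempty ()

      length-ys : length ys ≡ length xs ∸ K
      length-ys = Listₚ.length-drop K xs

      length-Z : length Z ≡ d * K
      length-Z = trans (Listₚ.length-take (d * K) ys) (m≤n⇒m⊓n≡m (≤-trans (≤-trans (≤-reflexive (sym (m+n∸m≡n K (d * K))))
        (∸-monoˡ-≤ K (<⇒≤ many))) (≤-reflexive (sym length-ys))))

      desc-ys : Desc Z × All (λ z → All (λ y → itemSize y ≤ itemSize z) rest) Z × Desc rest
      desc-ys = AllPairs-++⁻ Z (subst Desc (sym (take++drop≡id (d * K) ys)) (proj₂ (proj₂ desc-split)))

      topSize-rest : topSize rest ≡ t
      topSize-rest = cong topSize some

      rest≤t : All (λ y → itemSize y ≤ t) rest
      rest≤t = subst (λ u → All (λ y → itemSize y ≤ u) rest) topSize-rest (top-≤ rest (proj₂ (proj₂ desc-ys)))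

      t≤Z : All (λ z → t ≤ itemSize z) Z
      t≤Z = subst (λ u → All (λ z → u ≤ itemSize z) Z) topSize-rest (top-≥ Z rest (proj₁ (proj₂ desc-ys)))

      t≤r : All (t ≤_) r
      t≤r = dominated (proj₁ above) (trans (length-map itemSize Z) (proj₂ above)) (Allₚ.map⁺ t≤Z)
        where
        dominated : ∀ {as bs} → as ⊑ bs → length as ≡ length bs → All (t ≤_) as → All (t ≤_) bs
        dominated {bs = []}    []       _ _          = []
        dominated              (le ∷ p) e (ge ∷ ges) = ≤-trans ge le ∷ dominated p (suc-injective e) ges

      0<t : 0 < t
      0<t = All.head (subst (All (λ y → 0 < itemSize y)) some (Allₚ.drop⁺ (d * K) (Allₚ.drop⁺ K positive)))

      t≤cap : t ≤ cap
      t≤cap = All.head (subst (All (λ y → itemSize y ≤ cap)) some (Allₚ.drop⁺ (d * K) (Allₚ.drop⁺ K small)))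

      0<q : 0 < q
      0<q = positive-factor q (≤-trans (s≤s z≤n) b<qK)
        where
        positive-factor : ∀ q → 0 < q * K → 0 < q
        positive-factor (suc q) _ = s≤s z≤n

      -- The d K structured items all have size at least t.
      qt≤cap : suc q * t ≤ cap
      qt≤cap = *-cancelʳ-≤ (suc q * t) cap (q * K) {{>-nonZero (≤-trans (s≤s z≤n) b<qK)}} (begin
        suc q * t * (q * K)          ≡⟨ rearrange (suc q) t q K ⟩
        suc q * q * K * t            ≡⟨ cong (λ n → n * K * t) d≡ ⟨
        d * K * t                    ≡⟨ cong (_* t) (trans (length-map itemSize Z) length-Z) ⟨
        length (sizes Z) * t         ≤⟨ sum-≥ t (sizes Z) (Allₚ.map⁺ t≤Z) ⟩
        sum (sizes Z)                ≤⟨ m≤m+n _ (sum (sizes rest)) ⟩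
        sum (sizes Z) + sum (sizes rest)   ≤⟨ m≤n+m _ (sum (sizes X₀)) ⟩
        sum (sizes X₀) + (sum (sizes Z) + sum (sizes rest)) ≡⟨ sum-partition (sum ∘ sizes) sum-sizes-++ ⟨
        sum (sizes xs)               ≤⟨ total≤bcap ⟩
        b * cap                      ≤⟨ *-monoˡ-≤ cap (<⇒≤ b<qK) ⟩
        q * K * cap                  ≡⟨ *-comm (q * K) cap ⟩
        cap * (q * K)                ∎)
        where
        open ≤-Reasoning
        rearrange : ∀ a t q K → a * t * (q * K) ≡ a * q * K * t
        rearrange = solve-∀

      final-outcome : Outcome t (b + K) F₀ P.final
      final-outcome = fill-outcome t (b + K) F₀ (b + K , P.placed) rest rest≤t
        (outcome ≤-refl (inj₁ (refl , P.placed-overload)) (inj₁ refl))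

      -- If bins were opened, all but the last hold at least `cap` minus `t`, and `suc q * t ≤ cap`
      -- makes this at least the fraction q / (q + 1) of the capacity. As the total is at most
      -- `b * cap`, their number `n` satisfies `q * n ≤ suc q * b`.
      bins-bound : m ≡ b + K ⊎ (∀ j → suc j < m → cap ≤ load′ j ps + t) → q * m ≤ suc q * b + q
      bins-bound (inj₁ e) = ≤-trans (≤-reflexive (cong (q *_) e)) initial-bins
      bins-bound (inj₂ full) = conclude m refl
        where
        open ≤-Reasoning
        conclude : ∀ n → n ≡ m → q * n ≤ suc q * b + q
        conclude zero    _ = ≤-trans (≤-reflexive (*-zeroʳ q)) z≤n
        conclude (suc n) e = begin
            q * suc n           ≡⟨ *-suc q n ⟩
            q + q * n           ≤⟨ +-monoʳ-≤ q (*-cancelʳ-≤ (q * n) (suc q * b) cap {{>-nonZero (≤-trans 0<t t≤cap)}} key) ⟩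
            q + suc q * b       ≡⟨ +-comm q _ ⟩
            suc q * b + q       ∎
          where
          loads : n * cap ≤ b * cap + n * t
          loads = begin
            n * cap                                ≡⟨ Σ<-const n cap ⟨
            Σ< n (λ _ → cap)                       ≤⟨ Σ<-mono n (λ j j<n → full j (≤-trans (s≤s j<n) (≤-reflexive e))) ⟩
            Σ< n (λ j → load′ j ps + t)            ≡⟨ trans (Σ<-+ n _ _) (cong (Σ< n (λ j → load′ j ps) +_) (Σ<-const n t)) ⟩
            Σ< n (λ j → load′ j ps) + n * t        ≤⟨ +-monoˡ-≤ (n * t) (≤-trans (m≤m+n _ _) (≤-reflexive (sym (Σ<-snoc n _)))) ⟩
            Σ< (suc n) (λ j → load′ j ps) + n * t  ≡⟨ cong (λ k → Σ< k (λ j → load′ j ps) + n * t) e ⟩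
            Σ< m (λ j → load′ j ps) + n * t        ≡⟨ cong (_+ n * t) final-total ⟩
            sum (sizes xs) + n * t                 ≤⟨ +-monoˡ-≤ (n * t) total≤bcap ⟩
            b * cap + n * t                        ∎
          key : q * n * cap ≤ suc q * b * cap
          key = +-cancelˡ-≤ (n * cap) _ _ (begin
            n * cap + q * n * cap                  ≡⟨ left-side n q cap ⟩
            suc q * (n * cap)                      ≤⟨ *-monoʳ-≤ (suc q) loads ⟩
            suc q * (b * cap + n * t)              ≡⟨ right-side q b cap n t ⟩
            n * (suc q * t) + suc q * b * cap      ≤⟨ +-monoˡ-≤ _ (*-monoʳ-≤ n qt≤cap) ⟩
            n * cap + suc q * b * cap              ∎)
            where
            left-side : ∀ n q c → n * c + q * n * c ≡ suc q * (n * c)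
            left-side = solve-∀
            right-side : ∀ q b c n t → suc q * (b * c + n * t) ≡ n * (suc q * t) + suc q * b * c
            right-side = solve-∀

      cancel-goal : overload g m ps + b * g ≤ sum (sizes xs) → overload g m ps ≤ goal
      cancel-goal le = +-cancelʳ-≤ (b * g) _ _ (≤-trans le total≤goal)

      -- Since b < q K, the K additional bins make up for the shortfall t ≤ g / (q + 1) of every bin.
      tiny : suc q * t ≤ g → (∀ j → j < b + K → g ≤ load′ j ps + t) → b + K ≤ m → overload g m ps ≤ goal
      tiny qt≤g full M≤m = cancel-goal (+-cancelʳ-≤ ((b + K) * t) _ _ (begin
          overload g m ps + b * g + (b + K) * t      ≡⟨ rearrange (overload g m ps) (b * g) ((b + K) * t) ⟩
          overload g m ps + ((b + K) * t + b * g)    ≤⟨ +-monoʳ-≤ (overload g m ps) gain ⟩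
          overload g m ps + (b + K) * g              ≤⟨ filled ⟩
          sum (sizes xs) + (b + K) * t               ∎))
        where
        open ≤-Reasoning
        rearrange : ∀ x y z → x + y + z ≡ x + (z + y)
        rearrange = solve-∀
        gain : (b + K) * t + b * g ≤ (b + K) * g
        gain = *-cancelˡ-≤ (suc q) (begin
          suc q * ((b + K) * t + b * g)              ≡⟨ left-side q b K t g ⟩
          (b + K) * (suc q * t) + (q * b + b) * g    ≤⟨ +-mono-≤ (*-monoʳ-≤ (b + K) qt≤g) (*-monoˡ-≤ g (+-monoʳ-≤ (q * b) (<⇒≤ b<qK))) ⟩
          (b + K) * g + (q * b + q * K) * g          ≡⟨ right-side q b K g ⟩
          suc q * ((b + K) * g)                      ∎)
          where
          left-side : ∀ q b K t g → suc q * ((b + K) * t + b * g) ≡ (b + K) * (suc q * t) + (q * b + b) * g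
          left-side = solve-∀
          right-side : ∀ q b K g → (b + K) * g + (q * b + q * K) * g ≡ suc q * ((b + K) * g)
          right-side = solve-∀
        h : ℕ → ℕ
        h j = load′ j ps
        -- For the bins opened by the greedy phase no filling is claimed; there the trivial bound of
        -- the overload by the load is enough.
        extra : ℕ
        extra = m ∸ (b + K)
        m≡ : m ≡ (b + K) + extra
        m≡ = sym (m+[n∸m]≡n M≤m)
        one : ∀ j → j < b + K → (h j ∸ g) + g ≤ h j + t
        one j j<M with ≤-total g (h j)
        ... | inj₁ g≤h = ≤-trans (≤-reflexive (m∸n+n≡m g≤h)) (m≤m+n (h j) t)
        ... | inj₂ h≤g = ≤-trans (≤-reflexive (cong (_+ g) (m≤n⇒m∸n≡0 h≤g))) (full j j<M)
        split : ∀ k → Σ< m k ≡ Σ< (b + K) k + Σ< extra (λ j → k ((b + K) + j))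
        split k = trans (cong (λ n → Σ< n k) m≡) (Σ<-split (b + K) extra k)
        A B : ℕ
        A = Σ< (b + K) (λ j → h j ∸ g)
        B = Σ< extra (λ j → h ((b + K) + j) ∸ g)
        A′ B′ : ℕ
        A′ = Σ< (b + K) h
        B′ = Σ< extra (λ j → h ((b + K) + j))
        filled : overload g m ps + (b + K) * g ≤ sum (sizes xs) + (b + K) * t
        filled = begin
          overload g m ps + (b + K) * g              ≡⟨ cong (_+ (b + K) * g) (split (λ j → h j ∸ g)) ⟩
          A + B + (b + K) * g                        ≡⟨ swap-last A B ((b + K) * g) ⟩
          A + (b + K) * g + B                        ≡⟨ cong (_+ B) (trans (Σ<-+ (b + K) (λ j → h j ∸ g) (λ _ → g)) (cong (A +_) (Σ<-const (b + K) g))) ⟨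
          Σ< (b + K) (λ j → (h j ∸ g) + g) + B       ≤⟨ +-mono-≤ (Σ<-mono (b + K) one) (Σ<-mono extra (λ j _ → m∸n≤m _ g)) ⟩
          Σ< (b + K) (λ j → h j + t) + B′            ≡⟨ cong (_+ B′) (trans (Σ<-+ (b + K) h (λ _ → t)) (cong (A′ +_) (Σ<-const (b + K) t))) ⟩
          A′ + (b + K) * t + B′                      ≡⟨ swap-last A′ ((b + K) * t) B′ ⟩
          A′ + B′ + (b + K) * t                      ≡⟨ cong (_+ (b + K) * t) (trans (sym (split h)) final-total) ⟩
          sum (sizes xs) + (b + K) * t               ∎
          where
          swap-last : ∀ x y z → x + y + z ≡ x + z + y
          swap-last = solve-∀

      -- The optimal packing of the rounded items saturates all b bins.
      large : g < suc q * t → overload g m ps ≤ goal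
      large g<qt = cancel-goal (combine {sx = sum (sizes X₀)} {sz = sum (sizes Z)} (Greedy.fill-overload cap g (b + K , P.placed) rest (WellPacked.inRange P.placed-packed))
          P.placed-overload real≤round rounds-total
          (subst₂ (λ s s′ → sum r + s ≤ s′ + sum (map f r)) f-split (ListActionₚ.sum-++ (sizes X₀) (sizes Z)) (⊑-sum g below′))
          (sum-partition (sum ∘ sizes) sum-sizes-++))
        where
        us : List (ℕ × ℕ)
        us = zip r ks
        us₁ : map proj₁ us ≡ r
        us₁ = map-proj₁-zip r ks (≤-reflexive (sym P.js-length))
        zip-proj : ∀ (us : List (ℕ × ℕ)) → zip (map proj₁ us) (map proj₂ us) ≡ us
        zip-proj []       = refl
        zip-proj (u ∷ us) = cong (u ∷_) (zip-proj us)
        -- The second use of the value of `d`: on average more than `suc q` rounded items share a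
        -- bin.
        crowd : suc q * b < length us
        crowd = begin-strict
          suc q * b             <⟨ *-monoʳ-< (suc q) b<qK ⟩
          suc q * (q * K)       ≡⟨ *-assoc (suc q) q K ⟨
          suc q * q * K         ≡⟨ cong (_* K) d≡ ⟨
          d * K                 ≡⟨ trans (sym length-Z) (proj₂ above) ⟩
          length r              ≡⟨ cong length us₁ ⟨
          length (map proj₁ us) ≡⟨ length-map proj₁ us ⟩
          length us             ∎
          where open ≤-Reasoning
        saturated : ∀ j → j < b → g ≤ pairMass j us
        saturated = optimal-saturates g cap q t b us 0<t g<qt crowd
          (All-zip₂ r P.js-<)
          (Allₚ.map⁻ (subst (All (t ≤_)) (sym us₁) t≤r))
          P.round-light
          λ us′ same bins fit → ≤-trans (p-optimal (map proj₂ us′)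
              ( ≤-reflexive (trans (cong length (trans (sym us₁) (sym same))) (trans (length-map proj₁ us′) (sym (length-map proj₂ us′))))
              , Allₚ.map⁺ bins
              , λ j j<b → ≤-trans (≤-reflexive (cong (pairMass j) (rezip us′ same))) (fit j j<b)))
            (≤-reflexive (Σ<-cong b (λ j _ → cong (λ vs → pairMass j vs ∸ g) (rezip us′ same))))
          where
          rezip : ∀ us′ → map proj₁ us′ ≡ map proj₁ us → zip r (map proj₂ us′) ≡ us′
          rezip us′ same = trans (cong (λ as → zip as (map proj₂ us′)) (trans (sym us₁) (sym same))) (zip-proj us′)
        rounds-total : sum r ≡ roundOverload ks + b * g
        rounds-total = begin
          sum r                                                ≡⟨ Σ-pairMass b r ks (≤-reflexive (sym P.js-length)) P.js-< ⟨
          Σ< b (λ j → pairMass j us)                           ≡⟨ Σ<-cong b (λ j j<b → sym (m∸n+n≡m (saturated j j<b))) ⟩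
          Σ< b (λ j → (pairMass j us ∸ g) + g)                 ≡⟨ trans (Σ<-+ b _ _) (cong (roundOverload ks +_) (Σ<-const b g)) ⟩
          roundOverload ks + b * g                             ∎
          where open ≡-Reasoning
        -- `r` has only `d * K` entries, so its domination by `sizes xs` does not reach the rest,
        -- whose full size remains available to pay for the greedy phase.
        below′ : r ⊑ sizes X₀ ++ sizes Z
        below′ = subst (r ⊑_) (trans (Listₚ.take-map {f = itemSize} (K + d * K) xs)
            (trans (cong sizes (take-+ K (d * K) xs)) (map-++ itemSize X₀ Z)))
          (⊑-take (K + d * K) (≤-trans (≤-reflexive (trans (sym (proj₂ above)) length-Z)) (m≤n+m _ K)) below)
        f-split : sum (map f (sizes X₀ ++ sizes Z)) ≡ total-f X₀ + total-f Z
        f-split = trans (cong sum (map-++ f (sizes X₀) (sizes Z))) (ListActionₚ.sum-++ (map f (sizes X₀)) (map f (sizes Z)))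
        -- Since the rounded packing saturates its bins, its overload plus `b * g` is the sum of
        -- `r`. The corrections by values of `f` turn this, through `⊑-sum`, into at most the true
        -- size of the separate and the grouped items.
        combine : ∀ {over placed real fx R fr round fz bg sr sx sz S} → over ≤ placed + R → placed ≤ real + fx →
                  real + fr ≤ round + fz → sr ≡ round + bg → sr + (fx + fz) ≤ (sx + sz) + fr →
                  S ≡ sx + (sz + R) → over + bg ≤ S
        combine {over} {placed} {real} {fx} {R} {fr} {round} {fz} {bg} {_} {sx} {sz} h₁ h₂ h₃ refl h₅ refl =
          +-cancelʳ-≤ (fr + (round + fz)) _ _ (begin
            over + bg + (fr + (round + fz))                         ≤⟨ +-monoˡ-≤ _ (+-monoˡ-≤ bg (≤-trans h₁ (+-monoˡ-≤ R h₂))) ⟩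
            real + fx + R + bg + (fr + (round + fz))                ≡⟨ left-side real fx R bg fr round fz ⟩
            (real + fr) + (round + bg + (fx + fz)) + R              ≤⟨ +-monoˡ-≤ R (+-mono-≤ h₃ h₅) ⟩
            (round + fz) + (sx + sz + fr) + R                       ≡⟨ right-side round fz sx sz fr R ⟩
            sx + (sz + R) + (fr + (round + fz))                     ∎)
          where
          open ≤-Reasoning
          left-side : ∀ real fx R bg fr round fz → real + fx + R + bg + (fr + (round + fz)) ≡ (real + fr) + (round + bg + (fx + fz)) + R
          left-side = solve-∀
          right-side : ∀ round fz sx sz fr R → (round + fz) + (sx + sz + fr) + R ≡ sx + (sz + R) + (fr + (round + fz))
          right-side = solve-∀

      conclusion : Conclusion
      conclusion = energy≤ (Outcome.noOverload final-outcome) , bins-bound (Outcome.space final-outcome)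
        where
        energy≤ : _ → overload g m ps ≤ goal
        energy≤ (inj₁ (_ , le)) = ≤-trans le F₀≤goal
        energy≤ (inj₂ full) with suc q * t ≤? g
        ... | yes qt≤g = tiny qt≤g full (Outcome.m₀≤ final-outcome)
        ... | no  qt≰g = large (≰⇒> qt≰g)

    estimate : Conclusion
    estimate = go rest refl
      where
      go : ∀ zs → rest ≡ zs → Conclusion
      go []       eq = nothing-left eq
      go (x ∷ zs) eq = Leftover.conclusion x zs eq

-- Scaling the sizes to integers, sorting and selecting

Rat : Code
Rat = code ℚ encodeℚ

numer denom : ℚ → ℕ
numer q = ℤ.∣ ↥ q ∣
denom q = ↧ₙ q

numerᴾ : ∀ {Γ f} → PT Γ Rat f → PT Γ Nat (λ γ → numer (f γ))
numerᴾ pf = prim ∘ᴾ pf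
  where
  magnitude : ∀ z → right (encodeℤ z) ≡ encodeℕ ℤ.∣ z ∣
  magnitude (ℤ.+ n)    = refl
  magnitude ℤ.-[1+ n ] = refl
  prim : PT Rat Nat numer
  prim = record
    { prog = hd ⨾ tl
    ; pol  = # 1 ⊕ X ⊕ (# 1 ⊕ X) ⊕ (# 1 ⊕ X)
    ; runs = λ q → subst (λ y → Runs (hd ⨾ tl) (encodeℚ q) y (1 + sz Rat q + (1 + sz Rat q) + (1 + sz Rat q)))
        (magnitude (↥ q)) (runs-seq ≤-refl (runs-hd ≤-refl) (runs-tl (size-left (encodeℚ q))))
    }

denomᴾ : ∀ {Γ f} → PT Γ Rat f → PT Γ Nat (λ γ → denom (f γ))
denomᴾ pf = prim ∘ᴾ pf
  where
  prim : PT Rat Nat denom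
  prim = record { prog = tl ; pol = # 1 ⊕ X ; runs = λ q → runs-tl {x = encodeℚ q} ≤-refl }

-- The product of the denominators serves as common denominator: its binary length is bounded by the
-- total size of their codes, so all scaled numbers stay of polynomial length.
scaleStep : ℚ → List ℕ × ℕ → List ℕ × ℕ
scaleStep q (as , D) = numer q * D ∷ map (denom q *_) as , denom q * D

scale : List ℚ → List ℕ × ℕ
scale = foldr scaleStep ([] , 1)

scaleᴾ : ∀ {Γ l} → PT Γ (Lst Rat) l → PT Γ (Lst Nat ⊗ Nat) (λ γ → scale (l γ))
scaleᴾ pl = foldrᴾ {Lst Rat} {Lst Nat ⊗ Nat} {Rat} {λ ((_ , a) , q) → scaleStep q a}
    (pairᴾ (consᴾ (mulᴾ (numerᴾ sndᴾ) (sndᴾ ∘ᴾ sndᴾ ∘ᴾ fstᴾ))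
                  (mapᴾ (mulᴾ (denomᴾ (sndᴾ ∘ᴾ fstᴾ)) sndᴾ) (fstᴾ ∘ᴾ sndᴾ ∘ᴾ fstᴾ)))
           (mulᴾ (denomᴾ sndᴾ) (sndᴾ ∘ᴾ sndᴾ ∘ᴾ fstᴾ)))
    (pairᴾ nilᴾ (binaryᴾ (sucᴾ zeroᴾ))) idᴾ
    (# 1 ⊕ ((# 1 ⊕ X ⊛ (# 1 ⊕ # 4 ⊛ (# 1 ⊕ X))) ⊕ # 4 ⊛ (# 1 ⊕ X)))
    (λ γ qs → ≤-trans (bounded qs) (⟦⟧-mono (# 1 ⊕ ((# 1 ⊕ X ⊛ (# 1 ⊕ # 4 ⊛ (# 1 ⊕ X))) ⊕ # 4 ⊛ (# 1 ⊕ X))) (m≤n+m _ (sz (Lst Rat) γ))))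
  ∘ᴾ pl
  where
  numer-len : ∀ q → suc (len (numer q)) ≤ sz Rat q
  numer-len q = ≤-trans (len<sz (numer q)) (output-size′ q)
    where
    output-size′ : ∀ q → sz Nat (numer q) ≤ sz Rat q
    output-size′ q = ≤-trans (magnitude≤ (↥ q)) (size-left (encodeℚ q))
      where
      magnitude≤ : ∀ z → sz Nat ℤ.∣ z ∣ ≤ size (encodeℤ z)
      magnitude≤ (ℤ.+ n)    = size-right (encodeℤ (ℤ.+ n))
      magnitude≤ ℤ.-[1+ n ] = size-right (encodeℤ ℤ.-[1+ n ])
  denom-len : ∀ q → suc (len (denom q)) ≤ sz Rat q
  denom-len q = ≤-trans (len<sz (denom q)) (size-right (encodeℚ q))
  product-len : ∀ a b {s w} → suc (len a) ≤ s → len b ≤ w → len (a * b) ≤ suc (s + w)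
  product-len a b le le′ = ≤-trans (len-* a b) (≤-trans (+-mono-≤ le le′) (n≤1+n _))
  lens : ∀ qs → All (λ a → len a ≤ sz (Lst Rat) qs) (proj₁ (scale qs)) × len (proj₂ (scale qs)) ≤ sz (Lst Rat) qs
  lens []       = [] , s≤s z≤n
  lens (q ∷ qs) = let as , D = lens qs in
      product-len (numer q) (proj₂ (scale qs)) (numer-len q) D
        ∷ Allₚ.map⁺ (All.map (λ {a} le → product-len (denom q) a (denom-len q) le) as)
    , product-len (denom q) (proj₂ (scale qs)) (denom-len q) D
  scale-length : ∀ qs → length (proj₁ (scale qs)) ≤ sz (Lst Rat) qs
  scale-length []       = z≤n
  scale-length (q ∷ qs) = s≤s (≤-trans (≤-reflexive (length-map (denom q *_) (proj₁ (scale qs)))) (≤-trans (scale-length qs) (m≤n+m _ _)))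
  bounded : ∀ qs → sz (Lst Nat ⊗ Nat) (scale qs)
              ≤ 1 + ((1 + sz (Lst Rat) qs * (1 + 4 * (1 + sz (Lst Rat) qs))) + 4 * (1 + sz (Lst Rat) qs))
  bounded qs = s≤s (+-mono-≤
    (≤-trans (sz-list Nat (proj₁ (scale qs)) (All.map (λ {a} le → sz-len≤ {a} (s≤s le)) (proj₁ (lens qs))))
             (s≤s (*-monoˡ-≤ (1 + 4 * (1 + sz (Lst Rat) qs)) (scale-length qs))))
    (sz-len≤ {proj₂ (scale qs)} (s≤s (proj₂ (lens qs)))))

insertItem : ⌞ Item ⌟ → List ⌞ Item ⌟ → List ⌞ Item ⌟
insertItem x ys = filterᵇ (λ y → itemSize x ≤ᵇ itemSize y) ys ++ x ∷ filterᵇ (λ y → not (itemSize x ≤ᵇ itemSize y)) ys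

sort : List ⌞ Item ⌟ → List ⌞ Item ⌟
sort = foldr insertItem []

filter-split : ∀ {A : Set} (p : A → Bool) xs → filterᵇ p xs ++ filterᵇ (not ∘ p) xs ↭ xs
filter-split p []       = ↭-refl
filter-split p (x ∷ xs) with p x
... | true  = prep x (filter-split p xs)
... | false = ↭-trans (Permₚ.shift x (filterᵇ p xs) _) (prep x (filter-split p xs))

insert-↭ : ∀ x ys → insertItem x ys ↭ x ∷ ys
insert-↭ x ys = ↭-trans (Permₚ.shift x (filterᵇ (λ y → itemSize x ≤ᵇ itemSize y) ys) _) (prep x (filter-split _ ys))

sort-↭ : ∀ xs → sort xs ↭ xs
sort-↭ []       = ↭-refl
sort-↭ (x ∷ xs) = ↭-trans (insert-↭ x (sort xs)) (prep x (sort-↭ xs))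

sort-desc : ∀ xs → Desc (sort xs)
sort-desc []       = []
sort-desc (x ∷ xs) = AllPairsₚ.++⁺ (AllPairsₚ.filter⁺ (Boolₚ.T? ∘ _) (sort-desc xs))
    (All.map (λ {y} t → ≰⇒≥ (λ le → not-true t (≤⇒≤ᵇ le))) larges ∷ AllPairsₚ.filter⁺ (Boolₚ.T? ∘ _) (sort-desc xs))
    (All.map (λ {z} z≥ → z≥ ∷ All.map (λ {y} t → ≤-trans (≰⇒≥ (λ le → not-true t (≤⇒≤ᵇ le))) z≥) larges) smalls)
  where
  not-true : ∀ {b} → T (not b) → T b → ⊥
  not-true {true} () _
  larges : All (λ y → T (not (itemSize x ≤ᵇ itemSize y))) (filterᵇ (λ y → not (itemSize x ≤ᵇ itemSize y)) (sort xs))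
  larges = Allₚ.all-filter (Boolₚ.T? ∘ _) (sort xs)
  smalls : All (λ z → itemSize x ≤ itemSize z) (filterᵇ (λ y → itemSize x ≤ᵇ itemSize y) (sort xs))
  smalls = All.map (λ {z} t → ≤ᵇ⇒≤ (itemSize x) (itemSize z) t) (Allₚ.all-filter (Boolₚ.T? ∘ _) (sort xs))

sortᴾ : ∀ {Γ l} → PT Γ (Lst Item) l → PT Γ (Lst Item) (λ γ → sort (l γ))
sortᴾ {Γ} pl = foldr-additiveᴾ {Γ} {Lst Item} {Item} {λ ((_ , ys) , x) → insertItem x ys}
  (appendᴾ (filterᴾ ge (sndᴾ ∘ᴾ fstᴾ)) (consᴾ sndᴾ (filterᴾ (notᴾ ge) (sndᴾ ∘ᴾ fstᴾ)))) nilᴾ pl (# 1 ⊕ X)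
  λ γ ys x → ≤-trans (≤-reflexive (trans (sz-↭ (insert-↭ x ys)) (sz-cons Item x ys)))
    (+-monoʳ-≤ (sz (Lst Item) ys) (s≤s (m≤n+m _ (sz Γ γ))))
  where
  ge : PT (((Γ ⊗ Lst Item) ⊗ Item) ⊗ Item) Bol (λ ((_ , x) , y) → itemSize x ≤ᵇ itemSize y)
  ge = leᴾ (fstᴾ ∘ᴾ sndᴾ ∘ᴾ fstᴾ) (fstᴾ ∘ᴾ sndᴾ)
  sz-sum-list : ∀ xs → sz (Lst Item) xs ≡ suc (sum (map (suc ∘ sz Item) xs))
  sz-sum-list []       = refl
  sz-sum-list (x ∷ xs) = cong suc (trans (cong (sz Item x +_) (sz-sum-list xs)) (+-suc (sz Item x) (sum (map (suc ∘ sz Item) xs))))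
  sz-↭ : ∀ {xs ys} → xs ↭ ys → sz (Lst Item) xs ≡ sz (Lst Item) ys
  sz-↭ {xs} {ys} xs↭ys = trans (sz-sum-list xs) (trans (cong suc (ListActionₚ.sum-↭ (Permₚ.map⁺ _ xs↭ys))) (sym (sz-sum-list ys)))

Input : Code
Input = Lst Rat ⊗ (Rat ⊗ Rat)

-- Sizes, G and the capacity 1, multiplied by the product of all denominators.
scaled : ⌞ Input ⌟ → List ℕ × (ℕ × ℕ)
scaled (ss , β , G) = map (denom G *_) (proj₁ (scale ss)) , (denom G * proj₂ (scale ss) , numer G * proj₂ (scale ss))

prepare : ⌞ Input ⌟ → ⌞ Sorted ⌟
prepare I = sort (zip (proj₁ (scaled I)) (upTo (length (proj₁ (scaled I))))) , proj₂ (scaled I)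

prepareᴾ : PT Input Sorted prepare
prepareᴾ = pairᴾ (sortᴾ (zipᴾ as (upToᴾ (lengthᴾ as)))) (pairᴾ (mulᴾ dG D) (mulᴾ (numerᴾ (sndᴾ ∘ᴾ sndᴾ)) D))
  where
  dG : PT Input Nat (λ (_ , _ , G) → denom G)
  dG = denomᴾ (sndᴾ ∘ᴾ sndᴾ)
  D : PT Input Nat (λ (ss , _) → proj₂ (scale ss))
  D = sndᴾ ∘ᴾ scaleᴾ fstᴾ
  as : PT Input (Lst Nat) (λ I → proj₁ (scaled I))
  as = mapᴾ (mulᴾ (dG ∘ᴾ fstᴾ) sndᴾ) (fstᴾ ∘ᴾ scaleᴾ fstᴾ)

-- One item per bin: the energy is at most the sum of the single energies, which `U` dominates by
-- assumption, so that something feasible is always produced.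
separate : ⌞ Sorted ⌟ → ⌞ Bins ⌟
separate (xs , _) = length xs , zip xs (upTo (length xs))

separateᴾ : PT Sorted Bins separate
separateᴾ = pairᴾ (lengthᴾ fstᴾ) (zipᴾ fstᴾ (upToᴾ (lengthᴾ fstᴾ)))

binOf : List ⌞ Placed ⌟ → ℕ → ℕ
binOf ps i = foldr (λ p a → if proj₂ (proj₁ p) ≡ᵇ i then placedBin p else a) 0 ps

Result : Code
Result = Nat ⊗ Lst Nat

result : ⌞ Bins ⌟ → ⌞ Result ⌟
result (m , ps) = m , map (binOf ps) (upTo (length ps))

resultᴾ : PT Bins Result result
resultᴾ = pairᴾ (binaryᴾ fstᴾ) (mapᴾ (binaryᴾ lookup) (upToᴾ (lengthᴾ sndᴾ)))
  where
  lookup : PT (Bins ⊗ Una) Una (λ ((_ , ps) , i) → binOf ps i)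
  lookup = foldr-additiveᴾ {Bins ⊗ Una} {Una} {Placed} {λ (((_ , i) , a) , p) → if proj₂ (proj₁ p) ≡ᵇ i then placedBin p else a}
    (ifᴾ (eqUᴾ (sndᴾ ∘ᴾ fstᴾ ∘ᴾ sndᴾ) (sndᴾ ∘ᴾ fstᴾ ∘ᴾ fstᴾ)) (sndᴾ ∘ᴾ sndᴾ) (sndᴾ ∘ᴾ fstᴾ))
    zeroᴾ (sndᴾ ∘ᴾ fstᴾ) X additive
    where
    additive : ∀ γ a p → sz Una (if proj₂ (proj₁ p) ≡ᵇ proj₂ γ then placedBin p else a)
                 ≤ sz Una a + (sz (Bins ⊗ Una) γ + sz Placed p)
    additive γ a p with proj₂ (proj₁ p) ≡ᵇ proj₂ γ
    ... | true  = ≤-trans (size-right (enc Placed p)) (≤-trans (m≤n+m _ (sz (Bins ⊗ Una) γ)) (m≤n+m _ (sz Una a)))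
    ... | false = m≤m+n _ _

-- Sizes are positive, so a bin is nonempty exactly when its load is at least 1.
usedBins : ⌞ Bins ⌟ → ℕ
usedBins (m , ps) = length (filterᵇ (λ j → 1 ≤ᵇ load′ j ps) (upTo m))

usedBinsᴾ : PT Bins Una usedBins
usedBinsᴾ = lengthᴾ (filterᴾ (leᴾ (binaryᴾ (sucᴾ zeroᴾ)) (loadᴾ sndᴾ (sndᴾ ∘ᴾ fstᴾ))) (upToᴾ fstᴾ))

-- The sum of max(load, g) over the bins, which is overload + m g.
levels : ℕ → ⌞ Bins ⌟ → ℕ
levels g (m , ps) = sum (map (λ j → load′ j ps ⊔ g) (upTo m))

levelsᴾ : PT (Nat ⊗ Bins) Nat (λ (g , s) → levels g s)
levelsᴾ = sumᴾ (mapᴾ (maxᴾ (loadᴾ sndᴾ (sndᴾ ∘ᴾ sndᴾ ∘ᴾ fstᴾ)) (fstᴾ ∘ᴾ fstᴾ)) (upToᴾ (fstᴾ ∘ᴾ sndᴾ)))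

best : ∀ {A : Set} → (A → A → Bool) → A → List A → A
best le = foldl (λ a c → if le a c then a else c)

bestᴾ : ∀ {Γ A le a l} → PT ((Γ ⊗ A) ⊗ A) Bol le → PT Γ A a → PT Γ (Lst A) l →
        PT Γ A (λ γ → best (λ x y → le ((γ , x) , y)) (a γ) (l γ))
bestᴾ {Γ} {A} {le} p pa pl = foldl-additiveᴾ (ifᴾ p (sndᴾ ∘ᴾ fstᴾ) sndᴾ) pa pl X additive
  where
  additive : ∀ γ a x → sz A (if le ((γ , a) , x) then a else x) ≤ sz A a + (sz Γ γ + sz A x)
  additive γ a x with le ((γ , a) , x)
  ... | true  = m≤m+n _ _
  ... | false = ≤-trans (m≤n+m _ (sz Γ γ)) (m≤n+m _ (sz A a))

-- b + E, multiplied by denom β · capacity, is at most the same for another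
-- packing; the subtracted terms m g are moved to the other side.
cheaperGBP : (β : ℚ) (cap g : ℕ) → ⌞ Bins ⌟ → ⌞ Bins ⌟ → Bool
cheaperGBP β cap g s t =
  usedBins s * (denom β * cap) + numer β * (levels g s + proj₁ t * g)
    ≤ᵇ usedBins t * (denom β * cap) + numer β * (levels g t + proj₁ s * g)

cheaperGBPᴾ : PT (((Rat ⊗ (Nat ⊗ Nat)) ⊗ Bins) ⊗ Bins) Bol (λ (((β , cap , g) , s) , t) → cheaperGBP β cap g s t)
cheaperGBPᴾ = leᴾ (side (sndᴾ ∘ᴾ fstᴾ) sndᴾ) (side sndᴾ (sndᴾ ∘ᴾ fstᴾ))
  where
  Env : Code
  Env = ((Rat ⊗ (Nat ⊗ Nat)) ⊗ Bins) ⊗ Bins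
  β : PT Env Rat (λ e → proj₁ (proj₁ (proj₁ e)))
  β = fstᴾ ∘ᴾ fstᴾ ∘ᴾ fstᴾ
  cap : PT Env Nat (λ e → proj₁ (proj₂ (proj₁ (proj₁ e))))
  cap = fstᴾ ∘ᴾ sndᴾ ∘ᴾ fstᴾ ∘ᴾ fstᴾ
  g : PT Env Nat (λ e → proj₂ (proj₂ (proj₁ (proj₁ e))))
  g = sndᴾ ∘ᴾ sndᴾ ∘ᴾ fstᴾ ∘ᴾ fstᴾ
  side : ∀ {s t} → PT Env Bins s → PT Env Bins t → PT Env Nat _
  side s t = addᴾ (mulᴾ (binaryᴾ (usedBinsᴾ ∘ᴾ s)) (mulᴾ (denomᴾ β) cap))
    (mulᴾ (numerᴾ β) (addᴾ (levelsᴾ ∘ᴾ pairᴾ g s) (mulᴾ (binaryᴾ (fstᴾ ∘ᴾ t)) g)))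

-- E ≤ U, multiplied by denom β · capacity · denom U.
withinBudget : (U β : ℚ) (cap g : ℕ) → ⌞ Bins ⌟ → Bool
withinBudget U β cap g s =
  numer β * levels g s * denom U ≤ᵇ numer U * (denom β * cap) + numer β * (proj₁ s * g) * denom U

withinBudgetᴾ : PT (((Rat ⊗ Rat) ⊗ (Nat ⊗ Nat)) ⊗ Bins) Bol (λ (((U , β) , cap , g) , s) → withinBudget U β cap g s)
withinBudgetᴾ = leᴾ (mulᴾ (mulᴾ (numerᴾ β) (levelsᴾ ∘ᴾ pairᴾ g sndᴾ)) (denomᴾ U))
    (addᴾ (mulᴾ (numerᴾ U) (mulᴾ (denomᴾ β) cap)) (mulᴾ (mulᴾ (numerᴾ β) (mulᴾ (binaryᴾ (fstᴾ ∘ᴾ sndᴾ)) g)) (denomᴾ U)))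
  where
  Env : Code
  Env = ((Rat ⊗ Rat) ⊗ (Nat ⊗ Nat)) ⊗ Bins
  U : PT Env Rat (λ e → proj₁ (proj₁ (proj₁ e)))
  U = fstᴾ ∘ᴾ fstᴾ ∘ᴾ fstᴾ
  β : PT Env Rat (λ e → proj₂ (proj₁ (proj₁ e)))
  β = sndᴾ ∘ᴾ fstᴾ ∘ᴾ fstᴾ
  cap : PT Env Nat (λ e → proj₁ (proj₂ (proj₁ e)))
  cap = fstᴾ ∘ᴾ sndᴾ ∘ᴾ fstᴾ
  g : PT Env Nat (λ e → proj₂ (proj₂ (proj₁ e)))
  g = sndᴾ ∘ᴾ sndᴾ ∘ᴾ fstᴾ

-- The complete programs

module Programs (d : ℕ) where
  open Candidates d

  options : ⌞ Input ⌟ → List ⌞ Bins ⌟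
  options I = candidates (prepare I)

  produced : ⌞ Input ⌟ → List ⌞ Bins ⌟
  produced I = separate (prepare I) ∷ options I

  producedᴾ : PT Input (Lst Result) (λ I → map result (produced I))
  producedᴾ = mapᴾ (resultᴾ ∘ᴾ sndᴾ) (consᴾ (separateᴾ ∘ᴾ prepareᴾ) (candidatesᴾ ∘ᴾ prepareᴾ))

  bestGBP : ⌞ Input ⌟ → ⌞ Bins ⌟
  bestGBP I@(_ , β , _) = best (cheaperGBP β (proj₁ (proj₂ (prepare I))) (proj₂ (proj₂ (prepare I)))) (separate (prepare I)) (options I)

  bestGBPᴾ : PT Input Result (λ I → result (bestGBP I))
  bestGBPᴾ = resultᴾ ∘ᴾ bestᴾ {le = λ (((_ , β , _ ) , s) , t) → _}
    (cheaperGBPᴾ ∘ᴾ pairᴾ (pairᴾ (pairᴾ (fstᴾ ∘ᴾ sndᴾ) (sndᴾ ∘ᴾ prepareᴾ) ∘ᴾ fstᴾ ∘ᴾ fstᴾ) (sndᴾ ∘ᴾ fstᴾ)) sndᴾ)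
    (separateᴾ ∘ᴾ prepareᴾ) (candidatesᴾ ∘ᴾ prepareᴾ)

  affordable : ⌞ Input ⊗ Rat ⌟ → List ⌞ Bins ⌟
  affordable (I@(_ , β , _) , U) =
    filterᵇ (withinBudget U β (proj₁ (proj₂ (prepare I))) (proj₂ (proj₂ (prepare I)))) (options I)

  -- The packing `separate` starts the selection without a test, as it respects the budget of every
  -- instance.
  bestCGBP : ⌞ Input ⊗ Rat ⌟ → ⌞ Bins ⌟
  bestCGBP (I , U) = best (λ s t → usedBins s ≤ᵇ usedBins t) (separate (prepare I)) (affordable (I , U))

  bestCGBPᴾ : PT (Input ⊗ Rat) Result (λ I → result (bestCGBP I))
  bestCGBPᴾ = resultᴾ ∘ᴾ bestᴾ (leUᴾ (usedBinsᴾ ∘ᴾ sndᴾ ∘ᴾ fstᴾ) (usedBinsᴾ ∘ᴾ sndᴾ))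
    (separateᴾ ∘ᴾ prepareᴾ ∘ᴾ fstᴾ)
    (filterᴾ (withinBudgetᴾ ∘ᴾ pairᴾ (pairᴾ (pairᴾ sndᴾ (fstᴾ ∘ᴾ sndᴾ ∘ᴾ fstᴾ)) (sndᴾ ∘ᴾ prepareᴾ ∘ᴾ fstᴾ) ∘ᴾ fstᴾ) sndᴾ)
      (candidatesᴾ ∘ᴾ prepareᴾ ∘ᴾ fstᴾ))

-- Rational numbers

private
  fromℕᵘ : ∀ n → ℚ.toℚᵘ (fromℕ n) ℚᵘ.≃ ℚᵘ.mkℚᵘ (ℤ.+ n) 0
  fromℕᵘ n = ℚₚ.toℚᵘ-fromℚᵘ (ℚᵘ.mkℚᵘ (ℤ.+ n) 0)

fromℕ-+ : ∀ m n → fromℕ (m + n) ≡ fromℕ m ℚ.+ fromℕ n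
fromℕ-+ m n = ℚₚ.toℚᵘ-injective (ℚᵘₚ.≃-trans (fromℕᵘ (m + n)) (ℚᵘₚ.≃-trans integers
  (ℚᵘₚ.≃-sym (ℚᵘₚ.≃-trans (ℚₚ.toℚᵘ-homo-+ (fromℕ m) (fromℕ n)) (ℚᵘₚ.+-cong (fromℕᵘ m) (fromℕᵘ n))))))
  where
  integers : ℚᵘ.mkℚᵘ (ℤ.+ (m + n)) 0 ℚᵘ.≃ ℚᵘ.mkℚᵘ (ℤ.+ m) 0 ℚᵘ.+ ℚᵘ.mkℚᵘ (ℤ.+ n) 0
  integers = ℚᵘ.*≡* (cong (ℤ._* ℤ.+ 1) (cong₂ ℤ._+_ (sym (ℤₚ.*-identityʳ (ℤ.+ m))) (sym (ℤₚ.*-identityʳ (ℤ.+ n)))))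

fromℕ-* : ∀ m n → fromℕ (m * n) ≡ fromℕ m ℚ.* fromℕ n
fromℕ-* m n = ℚₚ.toℚᵘ-injective (ℚᵘₚ.≃-trans (fromℕᵘ (m * n)) (ℚᵘₚ.≃-trans integers
  (ℚᵘₚ.≃-sym (ℚᵘₚ.≃-trans (ℚₚ.toℚᵘ-homo-* (fromℕ m) (fromℕ n)) (ℚᵘₚ.*-cong (fromℕᵘ m) (fromℕᵘ n))))))
  where
  integers : ℚᵘ.mkℚᵘ (ℤ.+ (m * n)) 0 ℚᵘ.≃ ℚᵘ.mkℚᵘ (ℤ.+ m) 0 ℚᵘ.* ℚᵘ.mkℚᵘ (ℤ.+ n) 0
  integers = ℚᵘ.*≡* (cong (ℤ._* ℤ.+ 1) (ℤₚ.pos-* m n))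

fromℕ-nonNeg : ∀ n → ℚ.NonNegative (fromℕ n)
fromℕ-nonNeg n = ℚₚ.normalize-nonNeg n 1

fromℕ-pos : ∀ {n} → 0 < n → ℚ.Positive (fromℕ n)
fromℕ-pos {suc n} _ = ℚₚ.normalize-pos (suc n) 1

fromℕ-mono-≤ : ∀ {m n} → m ≤ n → fromℕ m ℚ.≤ fromℕ n
fromℕ-mono-≤ {m} {n} m≤n = begin
  fromℕ m                          ≡⟨ ℚₚ.+-identityʳ (fromℕ m) ⟨
  fromℕ m ℚ.+ 0ℚ                   ≤⟨ ℚₚ.+-monoʳ-≤ (fromℕ m) (ℚₚ.nonNegative⁻¹ (fromℕ (n ∸ m)) {{fromℕ-nonNeg (n ∸ m)}}) ⟩
  fromℕ m ℚ.+ fromℕ (n ∸ m)        ≡⟨ fromℕ-+ m (n ∸ m) ⟨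
  fromℕ (m + (n ∸ m))              ≡⟨ cong fromℕ (m+[n∸m]≡n m≤n) ⟩
  fromℕ n                          ∎
  where open ℚₚ.≤-Reasoning

fromℕ-mono-< : ∀ {m n} → m < n → fromℕ m ℚ.< fromℕ n
fromℕ-mono-< {m} {n} m<n = begin-strict
  fromℕ m                          ≡⟨ ℚₚ.+-identityʳ (fromℕ m) ⟨
  fromℕ m ℚ.+ 0ℚ                   <⟨ ℚₚ.+-monoʳ-< (fromℕ m) (ℚₚ.positive⁻¹ (fromℕ (n ∸ m)) {{fromℕ-pos (m<n⇒0<n∸m m<n)}}) ⟩
  fromℕ m ℚ.+ fromℕ (n ∸ m)        ≡⟨ fromℕ-+ m (n ∸ m) ⟨
  fromℕ (m + (n ∸ m))              ≡⟨ cong fromℕ (m+[n∸m]≡n (<⇒≤ m<n)) ⟩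
  fromℕ n                          ∎
  where open ℚₚ.≤-Reasoning

fromℕ-cancel-≤ : ∀ {m n} → fromℕ m ℚ.≤ fromℕ n → m ≤ n
fromℕ-cancel-≤ {m} {n} le with m ≤? n
... | yes m≤n = m≤n
... | no  m≰n = ⊥-elim (ℚₚ.<-irrefl refl (ℚₚ.<-≤-trans (fromℕ-mono-< (≰⇒> m≰n)) le))

numer/denom : ∀ q → 0ℚ ℚ.≤ q → q ℚ.* fromℕ (denom q) ≡ fromℕ (numer q)
numer/denom (ℚ.mkℚ ℤ.-[1+ n ] d c) (ℚ.*≤* ())
numer/denom q@(ℚ.mkℚ (ℤ.+ n) d c) _ = ℚₚ.toℚᵘ-injective (ℚᵘₚ.≃-trans (ℚₚ.toℚᵘ-homo-* q (fromℕ (suc d)))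
  (ℚᵘₚ.≃-trans (ℚᵘₚ.*-cong {x = ℚ.toℚᵘ q} ℚᵘₚ.≃-refl (fromℕᵘ (suc d))) (ℚᵘₚ.≃-trans integers (ℚᵘₚ.≃-sym (fromℕᵘ n)))))
  where
  integers : ℚᵘ.mkℚᵘ (ℤ.+ n) d ℚᵘ.* ℚᵘ.mkℚᵘ (ℤ.+ suc d) 0 ℚᵘ.≃ ℚᵘ.mkℚᵘ (ℤ.+ n) 0
  integers = ℚᵘ.*≡* (begin
    ℤ.+ n ℤ.* ℤ.+ suc d ℤ.* ℤ.+ 1          ≡⟨ ℤₚ.*-identityʳ _ ⟩
    ℤ.+ n ℤ.* ℤ.+ suc d                    ≡⟨ cong (λ e → ℤ.+ n ℤ.* ℤ.+ e) (*-identityʳ (suc d)) ⟨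
    ℤ.+ n ℤ.* ℤ.+ (suc d * 1)              ∎)
    where open ≡-Reasoning

module Scaling (κ : ℚ) {{κ-pos : ℚ.Positive κ}} where

  private
    instance
      κ-nonNeg : ℚ.NonNegative κ
      κ-nonNeg = ℚₚ.pos⇒nonNeg κ

  infix 4 _≈_

  record _≈_ (x : ℚ) (L : ℕ) : Set where
    constructor scaledBy
    field
      equation : x ℚ.* κ ≡ fromℕ L

  ≈-+ : ∀ {x y L M} → x ≈ L → y ≈ M → x ℚ.+ y ≈ L + M
  ≈-+ {x} {y} {L} {M} (scaledBy p) (scaledBy q) =
    scaledBy (trans (ℚₚ.*-distribʳ-+ κ x y) (trans (cong₂ ℚ._+_ p q) (sym (fromℕ-+ L M))))

  ≈-0 : 0ℚ ≈ 0
  ≈-0 = scaledBy (ℚₚ.*-zeroˡ κ)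

  ≈-mono : ∀ {x y L M} → x ≈ L → y ≈ M → x ℚ.≤ y → L ≤ M
  ≈-mono {x} {y} (scaledBy x≈L) (scaledBy y≈M) x≤y = fromℕ-cancel-≤ (subst₂ ℚ._≤_ x≈L y≈M (ℚₚ.*-monoʳ-≤-nonNeg κ x≤y))

  ≈-cancel : ∀ {x y L M} → x ≈ L → y ≈ M → L ≤ M → x ℚ.≤ y
  ≈-cancel {x} {y} (scaledBy x≈L) (scaledBy y≈M) L≤M = ℚₚ.*-cancelʳ-≤-pos κ (subst₂ ℚ._≤_ (sym x≈L) (sym y≈M) (fromℕ-mono-≤ L≤M))

  -- The factor `β` is left unscaled. Up to one positive constant the energy is `β` times an integer
  -- overload, so smaller overload means no more energy whatever the value of `β`.
  ≈-energy : ∀ {β G x L g} → 0ℚ ℚ.≤ β → x ≈ L → G ≈ g → energy β G x ℚ.* κ ≡ β ℚ.* fromℕ (L ∸ g)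
  ≈-energy {β} {G} {x} {L} {g} 0≤β (scaledBy x≈L) (scaledBy G≈g) with ≤-total g L
  ... | inj₁ g≤L = trans (cong (ℚ._* κ) (ℚₚ.p≤q⇒p⊔q≡q 0≤y)) yκ
    where
    open ℚSolver.+-*-Solver
    y : ℚ
    y = β ℚ.* (x ℚ.- G)
    yκ : y ℚ.* κ ≡ β ℚ.* fromℕ (L ∸ g)
    yκ = begin
      β ℚ.* (x ℚ.- G) ℚ.* κ                          ≡⟨ solve 4 (λ b x g k → b :* (x :- g) :* k := b :* (x :* k :- g :* k)) refl β x G κ ⟩
      β ℚ.* (x ℚ.* κ ℚ.- G ℚ.* κ)                    ≡⟨ cong₂ (λ s t → β ℚ.* (s ℚ.- t)) (trans x≈L (trans (cong fromℕ (sym (m∸n+n≡m g≤L))) (fromℕ-+ (L ∸ g) g))) G≈g ⟩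
      β ℚ.* (fromℕ (L ∸ g) ℚ.+ fromℕ g ℚ.- fromℕ g)  ≡⟨ solve 3 (λ b l g → b :* (l :+ g :- g) := b :* l) refl β (fromℕ (L ∸ g)) (fromℕ g) ⟩
      β ℚ.* fromℕ (L ∸ g)                            ∎
      where open ≡-Reasoning
    0≤y : 0ℚ ℚ.≤ y
    0≤y = ℚₚ.*-cancelʳ-≤-pos κ (subst₂ ℚ._≤_ (trans (ℚₚ.*-zeroˡ (fromℕ (L ∸ g))) (sym (ℚₚ.*-zeroˡ κ))) (sym yκ) (ℚₚ.*-monoʳ-≤-nonNeg (fromℕ (L ∸ g)) {{fromℕ-nonNeg (L ∸ g)}} 0≤β))
  ... | inj₂ L≤g = trans (cong (ℚ._* κ) (ℚₚ.p≥q⇒p⊔q≡p y≤0)) (trans (ℚₚ.*-zeroˡ κ) (sym (trans (cong (λ e → β ℚ.* fromℕ e) (m≤n⇒m∸n≡0 L≤g)) (ℚₚ.*-zeroʳ β))))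
    where
    open ℚSolver.+-*-Solver
    y : ℚ
    y = β ℚ.* (x ℚ.- G)
    yκ : y ℚ.* κ ≡ ℚ.- (β ℚ.* fromℕ (g ∸ L))
    yκ = begin
      β ℚ.* (x ℚ.- G) ℚ.* κ                            ≡⟨ solve 4 (λ b x g k → b :* (x :- g) :* k := b :* (x :* k :- g :* k)) refl β x G κ ⟩
      β ℚ.* (x ℚ.* κ ℚ.- G ℚ.* κ)                      ≡⟨ cong₂ (λ s t → β ℚ.* (s ℚ.- t)) x≈L (trans G≈g (trans (cong fromℕ (sym (m∸n+n≡m L≤g))) (fromℕ-+ (g ∸ L) L))) ⟩
      β ℚ.* (fromℕ L ℚ.- (fromℕ (g ∸ L) ℚ.+ fromℕ L))  ≡⟨ solve 3 (λ b l g → b :* (l :- (g :+ l)) := :- (b :* g)) refl β (fromℕ L) (fromℕ (g ∸ L)) ⟩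
      ℚ.- (β ℚ.* fromℕ (g ∸ L))                        ∎
      where open ≡-Reasoning
    y≤0 : y ℚ.≤ 0ℚ
    y≤0 = ℚₚ.*-cancelʳ-≤-pos κ (subst₂ ℚ._≤_ (sym yκ) (sym (ℚₚ.*-zeroˡ κ))
      (ℚₚ.neg-antimono-≤ (subst (ℚ._≤ β ℚ.* fromℕ (g ∸ L)) (ℚₚ.*-zeroˡ (fromℕ (g ∸ L))) (ℚₚ.*-monoʳ-≤-nonNeg (fromℕ (g ∸ L)) {{fromℕ-nonNeg (g ∸ L)}} 0≤β))))

  sum-energy : ∀ β {m} (F : Fin m → ℚ) (h : Fin m → ℕ) → (∀ j → F j ℚ.* κ ≡ β ℚ.* fromℕ (h j)) →
               sumFin F ℚ.* κ ≡ β ℚ.* fromℕ (sum (tabulate h))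
  sum-energy β {zero}  F h e = trans (ℚₚ.*-zeroˡ κ) (sym (ℚₚ.*-zeroʳ β))
  sum-energy β {suc m} F h e = begin
    (F Fin.zero ℚ.+ sumFin (F ∘ Fin.suc)) ℚ.* κ                      ≡⟨ ℚₚ.*-distribʳ-+ κ (F Fin.zero) _ ⟩
    F Fin.zero ℚ.* κ ℚ.+ sumFin (F ∘ Fin.suc) ℚ.* κ                  ≡⟨ cong₂ ℚ._+_ (e Fin.zero) (sum-energy β (F ∘ Fin.suc) (h ∘ Fin.suc) (e ∘ Fin.suc)) ⟩
    β ℚ.* fromℕ (h Fin.zero) ℚ.+ β ℚ.* fromℕ (sum (tabulate (h ∘ Fin.suc)))   ≡⟨ ℚₚ.*-distribˡ-+ β _ _ ⟨
    β ℚ.* (fromℕ (h Fin.zero) ℚ.+ fromℕ (sum (tabulate (h ∘ Fin.suc))))       ≡⟨ cong (β ℚ.*_) (fromℕ-+ (h Fin.zero) _) ⟨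
    β ℚ.* fromℕ (h Fin.zero + sum (tabulate (h ∘ Fin.suc)))          ∎
    where open ≡-Reasoning

  ≈-load : ∀ {n m} (s : Fin n → ℚ) (a l : Fin n → ℕ) (f : Fin n → Fin m) (j : Fin m) → (∀ i → s i ≈ a i) →
           sumFin (λ i → if does (f i Finₚ.≟ j) then s i else 0ℚ) ≈ load′ (toℕ j) (tabulate (λ i → (a i , l i) , toℕ (f i)))
  ≈-load {zero}  s a l f j s≈a = ≈-0
  ≈-load {suc n} s a l f j s≈a = ≈-+ (first (f Fin.zero Finₚ.≟ j)) (≈-load (s ∘ Fin.suc) (a ∘ Fin.suc) (l ∘ Fin.suc) (f ∘ Fin.suc) j (s≈a ∘ Fin.suc))
    where
    first : (dec : Dec (f Fin.zero ≡ j)) → (if does dec then s Fin.zero else 0ℚ) ≈ at (toℕ (f Fin.zero)) (toℕ j) (a Fin.zero)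
    first (yes e) = subst (s Fin.zero ≈_) (sym (trans (cong (λ k → at (toℕ k) (toℕ j) (a Fin.zero)) e) (at-≡ (toℕ j) _))) (s≈a Fin.zero)
    first (no ne) = subst (0ℚ ≈_) (sym (at-≢ (a Fin.zero) (ne ∘ Finₚ.toℕ-injective))) ≈-0

-- Renumbering the nonempty bins

-- For an absent `j` the value is `length N`, outside the range of the new labels; `relabel-loads`
-- uses this for the items of a bin already split off.
pos : List ℕ → ℕ → ℕ
pos []      j = 0
pos (k ∷ N) j = if k ≡ᵇ j then 0 else suc (pos N j)

pos-≢ : ∀ {k j} N → k ≢ j → pos (k ∷ N) j ≡ suc (pos N j)
pos-≢ {k} {j} N k≢j with k ≡ᵇ j in eq
... | true  = ⊥-elim (k≢j (≡ᵇ⇒≡ k j (subst T (sym eq) tt)))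
... | false = refl

pos-≡ : ∀ k N → pos (k ∷ N) k ≡ 0
pos-≡ k N with k ≡ᵇ k in eq
... | true  = refl
... | false = ⊥-elim (subst T eq (≡⇒≡ᵇ k k refl))

pos-∈ : ∀ {j N} → j ∈ N → pos N j < length N
pos-∈ {j} {k ∷ N} j∈ with k ≟ j
... | yes refl = subst (_< suc (length N)) (sym (pos-≡ k N)) (s≤s z≤n)
pos-∈ {j} {k ∷ N} (here j≡k) | no k≢j = ⊥-elim (k≢j (sym j≡k))
pos-∈ {j} {k ∷ N} (there j∈) | no k≢j = subst (_< suc (length N)) (sym (pos-≢ N k≢j)) (s≤s (pos-∈ j∈))

pos-∉ : ∀ {j N} → All (_≢ j) N → pos N j ≡ length N
pos-∉ []                 = refl
pos-∉ {N = k ∷ N} (ne ∷ nes) = trans (pos-≢ N ne) (cong suc (pos-∉ nes))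

relabel : List ℕ → List ⌞ Placed ⌟ → List ⌞ Placed ⌟
relabel N = map (λ p → proj₁ p , pos N (proj₂ p))

applyUpTo-cong-< : ∀ {A : Set} {h k : ℕ → A} n → (∀ i → i < n → h i ≡ k i) → applyUpTo h n ≡ applyUpTo k n
applyUpTo-cong-< zero    e = refl
applyUpTo-cong-< (suc n) e = cong₂ _∷_ (e 0 (s≤s z≤n)) (applyUpTo-cong-< n (λ i i<n → e (suc i) (s≤s i<n)))

relabel-loads : ∀ N → AllPairs _≢_ N → ∀ ps →
                applyUpTo (λ c → load′ c (relabel N ps)) (length N) ≡ map (λ j → load′ j ps) N
relabel-loads []      _            ps = refl
relabel-loads (k ∷ N) (new ∷ un) ps = cong₂ _∷_ (first ps) (trans (applyUpTo-cong-< (length N) (others ps)) (relabel-loads N un ps))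
  where
  first : ∀ ps → load′ 0 (relabel (k ∷ N) ps) ≡ load′ k ps
  first []               = refl
  first ((x , j) ∷ ps) with k ≟ j
  ... | yes refl = cong₂ _+_ (trans (cong (λ p → at p 0 (itemSize x)) (pos-≡ k N)) (sym (at-≡ k (itemSize x)))) (first ps)
  ... | no k≢j   = cong₂ _+_ (trans (cong (λ p → at p 0 (itemSize x)) (pos-≢ N k≢j)) (sym (at-≢ (itemSize x) (k≢j ∘ sym)))) (first ps)
  others : ∀ ps c → c < length N → load′ (suc c) (relabel (k ∷ N) ps) ≡ load′ c (relabel N ps)
  others []             c lt = refl
  others ((x , j) ∷ ps) c lt with k ≟ j
  ... | yes refl = cong₂ _+_ (trans (cong (λ p → at p (suc c) (itemSize x)) (pos-≡ k N))
                     (sym (at-≢ (itemSize x) (λ e → <⇒≢ lt (trans (sym e) (pos-∉ (All.map (λ ne → ne ∘ sym) new))))))) (others ps c lt)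
  ... | no k≢j   = cong₂ _+_ (cong (λ p → at p (suc c) (itemSize x)) (pos-≢ N k≢j)) (others ps c lt)

sum-filter : ∀ (p : ℕ → Bool) (h : ℕ → ℕ) xs → (∀ x → p x ≡ false → h x ≡ 0) → sum (map h (filterᵇ p xs)) ≡ sum (map h xs)
sum-filter p h []       z = refl
sum-filter p h (x ∷ xs) z with p x in eq
... | true  = cong (h x +_) (sum-filter p h xs z)
... | false = trans (sum-filter p h xs z) (cong (_+ sum (map h xs)) (sym (z x eq)))

filterᵇ-cong : ∀ {A : Set} {p q : A → Bool} → (∀ x → p x ≡ q x) → ∀ xs → filterᵇ p xs ≡ filterᵇ q xs
filterᵇ-cong e []       = refl
filterᵇ-cong {p = p} {q} e (x ∷ xs) with p x | q x | e x
... | true  | .true  | refl = cong (x ∷_) (filterᵇ-cong e xs)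
... | false | .false | refl = filterᵇ-cong e xs

usedBins-cong : ∀ m ps qs → (∀ j → load′ j ps ≡ load′ j qs) → usedBins (m , ps) ≡ usedBins (m , qs)
usedBins-cong m ps qs e = cong length (filterᵇ-cong (λ j → cong (1 ≤ᵇ_) (e j)) (upTo m))

mass-positive : ∀ {T : Set} (w bin : T → ℕ) j ts → 0 < mass w bin j ts → 0 < mass (λ _ → 1) bin j ts
mass-positive w bin j (t ∷ ts) pos with bin t ≡ᵇ j
... | true  = s≤s z≤n
... | false = mass-positive w bin j ts pos

-- Looking up the bin of an item

AllPairs-resp-↭ : ∀ {A : Set} {R : A → A → Set} → (∀ {x y} → R x y → R y x) → ∀ {xs ys} → xs ↭ ys → AllPairs R xs → AllPairs R ys
AllPairs-resp-↭ s Perm.refl         rs                     = rs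
AllPairs-resp-↭ s (prep x p)        (r ∷ rs)               = Permₚ.All-resp-↭ p r ∷ AllPairs-resp-↭ s p rs
AllPairs-resp-↭ s (swap x y p)      ((xy ∷ xs) ∷ ys ∷ rs)  =
  (s xy ∷ Permₚ.All-resp-↭ p ys) ∷ Permₚ.All-resp-↭ p xs ∷ AllPairs-resp-↭ s p rs
AllPairs-resp-↭ s (Perm.trans p q)  rs                     = AllPairs-resp-↭ s q (AllPairs-resp-↭ s p rs)

itemId : ⌞ Item ⌟ → ℕ
itemId = proj₂

Distinct : List ⌞ Item ⌟ → Set
Distinct = AllPairs (λ x y → itemId x ≢ itemId y)

attach : (ℕ → ℕ) → List ⌞ Item ⌟ → List ⌞ Placed ⌟
attach f = map (λ x → x , f (itemId x))

binOf-here : ∀ x j ps → binOf ((x , j) ∷ ps) (itemId x) ≡ j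
binOf-here x j ps with itemId x ≡ᵇ itemId x in eq
... | true  = refl
... | false = ⊥-elim (subst T eq (≡⇒≡ᵇ (itemId x) (itemId x) refl))

binOf-there : ∀ x j ps {i} → itemId x ≢ i → binOf ((x , j) ∷ ps) i ≡ binOf ps i
binOf-there x j ps {i} ne with itemId x ≡ᵇ i in eq
... | true  = ⊥-elim (ne (≡ᵇ⇒≡ (itemId x) i (subst T (sym eq) tt)))
... | false = refl

-- Distinct indices make looking up faithful. A list of placed items is thus determined by its
-- lookup function, which does not care about the order in which the items are listed.
attach-binOf : ∀ ps → Distinct (map proj₁ ps) → attach (binOf ps) (map proj₁ ps) ≡ ps
attach-binOf []             _            = refl
attach-binOf ((x , j) ∷ ps) (new ∷ un) = cong₂ _∷_ (cong (x ,_) (binOf-here x j ps))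
  (trans (Listₚ.map-cong-local (All.map (λ {y} ne → cong (y ,_) (binOf-there x j ps ne)) new)) (attach-binOf ps un))

-- Rational instances and their scaled counterparts

ratio : ∀ {q c m} → 0ℚ ℚ.≤ q → numer q * c ≡ m * denom q → q ℚ.* fromℕ c ≡ fromℕ m
ratio {q} {c} {m} 0≤q e = ℚₚ.≤-antisym (ℚₚ.*-cancelʳ-≤-pos d {{d-pos}} (ℚₚ.≤-reflexive scaled≡))
                                          (ℚₚ.*-cancelʳ-≤-pos d {{d-pos}} (ℚₚ.≤-reflexive (sym scaled≡)))
  where
  open ≡-Reasoning
  open ℚSolver.+-*-Solver
  d : ℚ
  d = fromℕ (denom q)
  d-pos : ℚ.Positive d
  d-pos = fromℕ-pos {denom q} (s≤s z≤n)
  scaled≡ : q ℚ.* fromℕ c ℚ.* d ≡ fromℕ m ℚ.* d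
  scaled≡ = begin
    q ℚ.* fromℕ c ℚ.* d                    ≡⟨ solve 3 (λ q c d → q :* c :* d := q :* d :* c) refl q (fromℕ c) d ⟩
    q ℚ.* d ℚ.* fromℕ c                    ≡⟨ cong (ℚ._* fromℕ c) (numer/denom q 0≤q) ⟩
    fromℕ (numer q) ℚ.* fromℕ c            ≡⟨ fromℕ-* (numer q) c ⟨
    fromℕ (numer q * c)                    ≡⟨ cong fromℕ e ⟩
    fromℕ (m * denom q)                    ≡⟨ fromℕ-* m (denom q) ⟩
    fromℕ m ℚ.* d                          ∎

commonDenominator : ∀ {n} → (Fin n → ℚ) → ℕ
commonDenominator s = proj₂ (scale (tabulate s))

scaledSize : ∀ {n} → (Fin n → ℚ) → Fin n → ℕ
scaledSize s Fin.zero    = numer (s Fin.zero) * commonDenominator (s ∘ Fin.suc)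
scaledSize s (Fin.suc i) = denom (s Fin.zero) * scaledSize (s ∘ Fin.suc) i

scale-tabulate : ∀ {n} (s : Fin n → ℚ) → proj₁ (scale (tabulate s)) ≡ tabulate (scaledSize s)
scale-tabulate {zero}  s = refl
scale-tabulate {suc n} s = cong (scaledSize s Fin.zero ∷_)
  (trans (cong (map (denom (s Fin.zero) *_)) (scale-tabulate (s ∘ Fin.suc))) (Listₚ.map-tabulate _ _))

scaledSize-correct : ∀ {n} (s : Fin n → ℚ) i → numer (s i) * commonDenominator s ≡ scaledSize s i * denom (s i)
scaledSize-correct s Fin.zero    = rearrange (numer (s Fin.zero)) (denom (s Fin.zero)) (commonDenominator (s ∘ Fin.suc))
  where
  rearrange : ∀ p q D → p * (q * D) ≡ p * D * q
  rearrange = solve-∀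
scaledSize-correct s (Fin.suc i) = trans (left-side (numer (s (Fin.suc i))) (denom (s Fin.zero)) (commonDenominator (s ∘ Fin.suc)))
    (trans (cong (denom (s Fin.zero) *_) (scaledSize-correct (s ∘ Fin.suc) i)) (sym (*-assoc (denom (s Fin.zero)) (scaledSize (s ∘ Fin.suc) i) (denom (s (Fin.suc i))))))
  where
  left-side : ∀ p q D → p * (q * D) ≡ q * (p * D)
  left-side = solve-∀

0<commonDenominator : ∀ {n} (s : Fin n → ℚ) → 0 < commonDenominator s
0<commonDenominator {zero}  s = s≤s z≤n
0<commonDenominator {suc n} s = *-mono-< {0} {denom (s Fin.zero)} (s≤s z≤n) (0<commonDenominator (s ∘ Fin.suc))

zip-tabulate : ∀ {n} {A B : Set} (a : Fin n → A) (f : ℕ → B) → zip (tabulate a) (applyUpTo f n) ≡ tabulate (λ i → a i , f (toℕ i))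
zip-tabulate {zero}  a f = refl
zip-tabulate {suc n} a f = cong ((a Fin.zero , f 0) ∷_) (zip-tabulate (a ∘ Fin.suc) (f ∘ suc))

tabulate-toℕ : ∀ {A : Set} n (f : ℕ → A) → tabulate {n = n} (f ∘ toℕ) ≡ applyUpTo f n
tabulate-toℕ zero    f = refl
tabulate-toℕ (suc n) f = cong (f 0 ∷_) (tabulate-toℕ n (f ∘ suc))

filter-tabulate : ∀ {n} {A : Set} {P : A → Set} (P? : ∀ x → Dec (P x)) (f : ℕ → Bool) (g : Fin n → A) (h : ℕ → ℕ) →
  (∀ i → does (P? (g i)) ≡ f (h (toℕ i))) → length (filter P? (tabulate g)) ≡ length (filterᵇ f (applyUpTo h n))
filter-tabulate {zero}  P? f g h e = refl
filter-tabulate {suc n} P? f g h e with does (P? (g Fin.zero)) | f (h 0) | e Fin.zero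
... | true  | .true  | refl = cong suc (filter-tabulate P? f (g ∘ Fin.suc) (h ∘ suc) (e ∘ Fin.suc))
... | false | .false | refl = filter-tabulate P? f (g ∘ Fin.suc) (h ∘ suc) (e ∘ Fin.suc)

mass-≥ : ∀ {T : Set} (w bin : T → ℕ) {t ts} → t ∈ ts → w t ≤ mass w bin (bin t) ts
mass-≥ w bin {t} (here refl)   = ≤-trans (≤-reflexive (sym (at-≡ (bin t) (w t)))) (m≤m+n _ _)
mass-≥ w bin (there {x = u} t∈) = ≤-trans (mass-≥ w bin t∈) (m≤n+m _ _)

module Scaled (I : GreenInstance) where
  open GreenInstance I

  input : ⌞ Input ⌟
  input = Vector.toList s , β , G

  cap g : ℕ
  cap = denom G * commonDenominator s
  g   = numer G * commonDenominator s

  0<cap : 0 < cap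
  0<cap = *-mono-< {0} {denom G} (s≤s z≤n) (0<commonDenominator s)

  κ : ℚ
  κ = fromℕ cap

  instance
    κ-pos : ℚ.Positive κ
    κ-pos = fromℕ-pos 0<cap

  open Scaling κ public

  a : Fin n → ℕ
  a i = denom G * scaledSize s i

  s≈a : ∀ i → s i ≈ a i
  s≈a i = scaledBy (ratio {s i} {cap} {a i} (ℚₚ.<⇒≤ (s>0 i)) (begin
    numer (s i) * (denom G * commonDenominator s)      ≡⟨ left-side (numer (s i)) (denom G) (commonDenominator s) ⟩
    denom G * (numer (s i) * commonDenominator s)      ≡⟨ cong (denom G *_) (scaledSize-correct s i) ⟩
    denom G * (scaledSize s i * denom (s i))           ≡⟨ *-assoc (denom G) (scaledSize s i) (denom (s i)) ⟨
    denom G * scaledSize s i * denom (s i)             ∎))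
    where
    open ≡-Reasoning
    left-side : ∀ p q D → p * (q * D) ≡ q * (p * D)
    left-side = solve-∀

  G≈g : G ≈ g
  G≈g = scaledBy (ratio {G} {cap} {g} G≥0 (rearrange (numer G) (denom G) (commonDenominator s)))
    where
    rearrange : ∀ p q D → p * (q * D) ≡ p * D * q
    rearrange = solve-∀

  1≈cap : 1ℚ ≈ cap
  1≈cap = scaledBy (ℚₚ.*-identityˡ κ)

  g≤cap : g ≤ cap
  g≤cap = ≈-mono G≈g 1≈cap G≤1

  a≤cap : ∀ i → a i ≤ cap
  a≤cap i = ≈-mono (s≈a i) 1≈cap (s≤1 i)

  0<a : ∀ i → 0 < a i
  0<a i = ≰⇒> λ a≤0 → ℚₚ.<-irrefl refl (ℚₚ.<-≤-trans (s>0 i) (≈-cancel (s≈a i) ≈-0 a≤0))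

  items : List ⌞ Item ⌟
  items = tabulate (λ i → a i , toℕ i)

  sortedItems : List ⌞ Item ⌟
  sortedItems = sort items

  prepared : prepare input ≡ (sortedItems , cap , g)
  prepared = cong (λ xs → sort xs , cap , g) (trans (cong (λ as → zip as (upTo (length as))) as≡)
      (trans (cong (λ k → zip (tabulate a) (upTo k)) (Listₚ.length-tabulate a)) (zip-tabulate a id)))
    where
    as≡ : proj₁ (scaled input) ≡ tabulate a
    as≡ = trans (cong (map (denom G *_)) (scale-tabulate s)) (Listₚ.map-tabulate _ _)

  distinct-items : Distinct items
  distinct-items = AllPairsₚ.tabulate⁺ (λ i≢j e → i≢j (Finₚ.toℕ-injective e))

  placedOf : Packing I → List ⌞ Placed ⌟
  placedOf σ = tabulate (λ i → (a i , toℕ i) , toℕ (Packing.assign σ i))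

  overloadOf : Packing I → ℕ
  overloadOf σ = overload g (Packing.bins σ) (placedOf σ)

  load≈ : ∀ {m} (f : Fin n → Fin m) j → load I f j ≈ load′ (toℕ j) (tabulate (λ i → (a i , toℕ i) , toℕ (f i)))
  load≈ f j = ≈-load s a toℕ f j s≈a

  E-scaled : ∀ σ → E σ ℚ.* κ ≡ β ℚ.* fromℕ (overloadOf σ)
  E-scaled σ = trans (sum-energy β _ (λ j → load′ (toℕ j) (placedOf σ) ∸ g) (λ j → ≈-energy β≥0 (load≈ (Packing.assign σ) j) G≈g))
    (cong (λ hs → β ℚ.* fromℕ (sum hs)) (tabulate-toℕ (Packing.bins σ) (λ j → load′ j (placedOf σ) ∸ g)))

  E-mono : ∀ σ τ → overloadOf σ ≤ overloadOf τ → E σ ℚ.≤ E τ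
  E-mono σ τ le = ℚₚ.*-cancelʳ-≤-pos κ (subst₂ ℚ._≤_ (sym (E-scaled σ)) (sym (E-scaled τ))
    (ℚₚ.*-monoˡ-≤-nonNeg β {{ℚ.nonNegative β≥0}} (fromℕ-mono-≤ le)))

  b-used : ∀ σ → b σ ≡ usedBins (Packing.bins σ , placedOf σ)
  b-used σ = filter-tabulate (λ j → Finₚ.any? (λ i → assign i Finₚ.≟ j)) (λ j → 1 ≤ᵇ load′ j (placedOf σ)) id id
      (λ j → T-ext (used j) (λ t → unused j t))
    where
    open Packing σ
    used : ∀ j → T (does (Finₚ.any? (λ i → assign i Finₚ.≟ j))) → T (1 ≤ᵇ load′ (toℕ j) (placedOf σ))
    used j t with Finₚ.any? (λ i → assign i Finₚ.≟ j)
    ... | yes (i , refl) = ≤⇒≤ᵇ (≤-trans (0<a i) (mass-≥ placedSize placedBin (Membershipₚ.∈-tabulate⁺ {f = λ i → (a i , toℕ i) , toℕ (assign i)} i)))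
    unused : ∀ j → T (1 ≤ᵇ load′ (toℕ j) (placedOf σ)) → T (does (Finₚ.any? (λ i → assign i Finₚ.≟ j)))
    unused j t with Finₚ.any? (λ i → assign i Finₚ.≟ j)
    ... | yes _ = tt
    ... | no none = <⇒≱ (≤ᵇ⇒≤ 1 _ t) (≤-reflexive (mass-absent placedSize placedBin (toℕ j) (placedOf σ)
            (Allₚ.tabulate⁺ (λ i e → none (i , Finₚ.toℕ-injective e)))))

  Valid : ⌞ Bins ⌟ → Set
  Valid s = Greedy.WellPacked cap g s × map proj₁ (proj₂ s) ↭ sortedItems

  module Build (m : ℕ) (ps : List ⌞ Placed ⌟) (valid : Valid (m , ps)) where
    open Greedy.WellPacked (proj₁ valid)

    ps-items : map proj₁ ps ↭ items
    ps-items = ↭-trans (proj₂ valid) (sort-↭ items)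

    attached : attach (binOf ps) items ↭ ps
    attached = ↭-trans (Permₚ.map⁺ _ (↭-sym ps-items))
      (↭-reflexive (attach-binOf ps (AllPairs-resp-↭ (λ ne → ne ∘ sym) (↭-sym ps-items) distinct-items)))

    binOf-< : ∀ (i : Fin n) → binOf ps (toℕ i) < m
    binOf-< = Allₚ.tabulate⁻ {f = λ i → a i , toℕ i} (Allₚ.map⁻ (Permₚ.All-resp-↭ (↭-sym attached) inRange))

    assign : Fin n → Fin m
    assign i = fromℕ< (binOf-< i)

    placed↭ : tabulate (λ i → (a i , toℕ i) , toℕ (assign i)) ↭ ps
    placed↭ = ↭-trans (↭-reflexive (trans (Listₚ.tabulate-cong (λ i → cong ((a i , toℕ i) ,_) (Finₚ.toℕ-fromℕ< (binOf-< i))))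
      (sym (Listₚ.map-tabulate (λ i → a i , toℕ i) (λ x → x , binOf ps (itemId x)))))) attached

    same-loads : ∀ j → load′ j (tabulate (λ i → (a i , toℕ i) , toℕ (assign i))) ≡ load′ j ps
    same-loads j = mass-↭ placedSize placedBin j placed↭

    packing : Packing I
    packing = record
      { bins   = m
      ; assign = assign
      ; load≤1 = λ j → ≈-cancel (load≈ assign j) 1≈cap (≤-trans (≤-reflexive (same-loads (toℕ j))) (light (toℕ j)))
      }

    encoded : enc Result (result (m , ps)) ≡ encodePacking packing
    encoded = cong (λ js → encodeℕ m ∙ encodeList encodeℕ js) (begin
      map (binOf ps) (upTo (length ps))          ≡⟨ Listₚ.map-upTo (binOf ps) (length ps) ⟩
      applyUpTo (binOf ps) (length ps)           ≡⟨ cong (applyUpTo (binOf ps)) length≡ ⟩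
      applyUpTo (binOf ps) n                     ≡⟨ tabulate-toℕ n (binOf ps) ⟨
      tabulate (λ i → binOf ps (toℕ i))          ≡⟨ Listₚ.tabulate-cong (λ i → Finₚ.toℕ-fromℕ< (binOf-< i)) ⟨
      tabulate (λ i → toℕ (assign i))            ∎)
      where
      open ≡-Reasoning
      length≡ : length ps ≡ n
      length≡ = trans (sym (length-map proj₁ ps)) (trans (Permₚ.↭-length ps-items) (Listₚ.length-tabulate (λ i → a i , toℕ i)))

    used≡ : b packing ≡ usedBins (m , ps)
    used≡ = trans (b-used packing) (usedBins-cong m (placedOf packing) ps same-loads)

    overload≡ : overloadOf packing ≡ overload g m ps
    overload≡ = Σ<-cong m (λ j _ → cong (_∸ g) (same-loads j))

  abstract
    toPacking : ∀ s → Valid s → Packing I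
    toPacking (m , ps) = Build.packing m ps

    toPacking-encoded : ∀ s v → enc Result (result s) ≡ encodePacking (toPacking s v)
    toPacking-encoded (m , ps) = Build.encoded m ps

    toPacking-b : ∀ s v → b (toPacking s v) ≡ usedBins s
    toPacking-b (m , ps) = Build.used≡ m ps

    toPacking-overload : ∀ s v → overloadOf (toPacking s v) ≡ overload g (proj₁ s) (proj₂ s)
    toPacking-overload (m , ps) = Build.overload≡ m ps

-- The packings produced for an instance

levels-overload : ∀ g m ps → levels g (m , ps) ≡ overload g m ps + m * g
levels-overload g m ps = begin
  sum (map (λ j → load′ j ps ⊔ g) (upTo m))       ≡⟨ cong sum (Listₚ.map-upTo (λ j → load′ j ps ⊔ g) m) ⟩
  Σ< m (λ j → load′ j ps ⊔ g)                     ≡⟨ Σ<-cong m (λ j _ → m⊔n≡m∸n+n (load′ j ps) g) ⟩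
  Σ< m (λ j → (load′ j ps ∸ g) + g)               ≡⟨ Σ<-+ m _ _ ⟩
  overload g m ps + Σ< m (λ _ → g)                ≡⟨ cong (overload g m ps +_) (Σ<-const m g) ⟩
  overload g m ps + m * g                         ∎
  where
  open ≡-Reasoning

module Produced (I : GreenInstance) where
  open GreenInstance I
  open Scaled I public

  -- Packings may have empty bins, whereas the estimate identifies `b` with the number of bins.
  -- Deleting the empty ones changes neither `b` nor the overload and leaves at most `n` bins,
  -- within the range that the algorithm tries.
  module Normal (τ : Packing I) where
    open Packing τ

    ps : List ⌞ Placed ⌟
    ps = placedOf τ

    nonempty : ℕ → Bool
    nonempty j = 1 ≤ᵇ load′ j ps

    N : List ℕ
    N = filterᵇ nonempty (upTo bins)

    N-distinct : AllPairs _≢_ N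
    N-distinct = AllPairsₚ.filter⁺ (Boolₚ.T? ∘ nonempty) (AllPairsₚ.applyUpTo⁺₁ id bins (λ i<j _ → <⇒≢ i<j))

    assign∈N : ∀ i → toℕ (assign i) ∈ N
    assign∈N i = Membershipₚ.∈-filter⁺ (Boolₚ.T? ∘ nonempty) (Membershipₚ.∈-upTo⁺ (Finₚ.toℕ<n (assign i)))
      (≤⇒≤ᵇ (≤-trans (0<a i) (mass-≥ placedSize placedBin (Membershipₚ.∈-tabulate⁺ {f = λ i → (a i , toℕ i) , toℕ (assign i)} i))))

    assign′ : Fin n → Fin (length N)
    assign′ i = fromℕ< (pos-∈ (assign∈N i))

    placed′ : tabulate (λ i → (a i , toℕ i) , toℕ (assign′ i)) ≡ relabel N ps
    placed′ = trans (Listₚ.tabulate-cong (λ i → cong ((a i , toℕ i) ,_) (Finₚ.toℕ-fromℕ< (pos-∈ (assign∈N i)))))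
      (sym (Listₚ.map-tabulate (λ i → (a i , toℕ i) , toℕ (assign i)) (λ p → proj₁ p , pos N (proj₂ p))))

    loads′ : applyUpTo (λ c → load′ c (relabel N ps)) (length N) ≡ map (λ j → load′ j ps) N
    loads′ = relabel-loads N N-distinct ps

    All-loads : ∀ {P : ℕ → Set} → All (λ j → P (load′ j ps)) N → ∀ c → c < length N → P (load′ c (relabel N ps))
    All-loads {P} ls c c< = Allₚ.applyUpTo⁻ _ (length N) (subst (All P) (sym loads′) (Allₚ.map⁺ ls)) c<

    light : ∀ j → j < bins → load′ j ps ≤ cap
    light j j<m = subst (λ k → load′ k ps ≤ cap) (Finₚ.toℕ-fromℕ< j<m)
      (≈-mono (load≈ assign (fromℕ< j<m)) 1≈cap (load≤1 (fromℕ< j<m)))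

    light′ : ∀ c → c < length N → load′ c (relabel N ps) ≤ cap
    light′ = All-loads {_≤ cap} (Allₚ.filter⁺ (Boolₚ.T? ∘ nonempty) (All.map (λ {j} → light j) (upTo-< bins)))

    positive′ : ∀ c → c < length N → 1 ≤ load′ c (relabel N ps)
    positive′ = All-loads {1 ≤_} (All.map (λ {j} → ≤ᵇ⇒≤ 1 (load′ j ps)) (Allₚ.all-filter (Boolₚ.T? ∘ nonempty) (upTo bins)))

    normal : Packing I
    normal = record
      { bins   = length N
      ; assign = assign′
      ; load≤1 = λ j → ≈-cancel (load≈ assign′ j) 1≈cap
                   (subst (λ qs → load′ (toℕ j) qs ≤ cap) (sym placed′) (light′ (toℕ j) (Finₚ.toℕ<n j)))
      }

    b-τ : b τ ≡ length N
    b-τ = b-used τ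

    b-normal : b normal ≡ length N
    b-normal = trans (b-used normal) (trans (cong (λ qs → usedBins (length N , qs)) placed′)
      (trans (cong length (Listₚ.filter-all (Boolₚ.T? ∘ λ j → 1 ≤ᵇ load′ j (relabel N ps))
        (All.map (λ {c} c< → ≤⇒≤ᵇ (positive′ c c<)) (upTo-< (length N))))) (Listₚ.length-upTo (length N))))

    overload-normal : overloadOf normal ≡ overloadOf τ
    overload-normal = begin
      overload g (length N) (placedOf normal)                            ≡⟨ cong (overload g (length N)) placed′ ⟩
      Σ< (length N) (λ c → load′ c (relabel N ps) ∸ g)                   ≡⟨ cong sum (Listₚ.map-applyUpTo (λ c → load′ c (relabel N ps)) (_∸ g) (length N)) ⟨
      sum (map (_∸ g) (applyUpTo (λ c → load′ c (relabel N ps)) (length N))) ≡⟨ cong (sum ∘ map (_∸ g)) loads′ ⟩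
      sum (map (_∸ g) (map (λ j → load′ j ps) N))                        ≡⟨ cong sum (map-∘ N) ⟨
      sum (map (λ j → load′ j ps ∸ g) N)                                 ≡⟨ sum-filter nonempty (λ j → load′ j ps ∸ g) (upTo bins) zero-overload ⟩
      sum (map (λ j → load′ j ps ∸ g) (upTo bins))                       ≡⟨ cong sum (Listₚ.map-upTo (λ j → load′ j ps ∸ g) bins) ⟩
      overloadOf τ                                                       ∎
      where
      open ≡-Reasoning
      zero-overload : ∀ j → nonempty j ≡ false → load′ j ps ∸ g ≡ 0
      zero-overload j e = trans (cong (_∸ g) (n≤0⇒n≡0 (≤-pred (≰⇒> (λ le → subst T e (≤⇒≤ᵇ le)))))) (0∸n≡0 g)

    bins≤n : length N ≤ n
    bins≤n = begin
      length N                                                       ≡⟨ *-identityʳ (length N) ⟨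
      length N * 1                                                   ≡⟨ Σ<-const (length N) 1 ⟨
      Σ< (length N) (λ _ → 1)                                        ≤⟨ Σ<-mono (length N) (λ c c< → mass-positive placedSize placedBin c (relabel N ps) (positive′ c c<)) ⟩
      Σ< (length N) (λ c → mass (λ _ → 1) placedBin c (relabel N ps)) ≡⟨ Σ-mass (λ _ → 1) placedBin (length N) (relabel N ps) in-range ⟩
      sum (map (λ _ → 1) (relabel N ps))                             ≡⟨ sum-ones (relabel N ps) ⟩
      length (relabel N ps)                                          ≡⟨ trans (length-map _ ps) (Listₚ.length-tabulate (λ i → (a i , toℕ i) , toℕ (assign i))) ⟩
      n                                                              ∎
      where
      open ≤-Reasoning
      in-range : All (λ p → placedBin p < length N) (relabel N ps)
      in-range = subst (All _) placed′ (Allₚ.tabulate⁺ (λ i → Finₚ.toℕ<n (assign′ i)))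

  module _ (d : ℕ) where
    open Core d cap g g≤cap sortedItems (sort-desc items)
      (Permₚ.All-resp-↭ (↭-sym (sort-↭ items)) (Allₚ.tabulate⁺ a≤cap)) public
    open Candidates d public

    good : ∀ q → 0 < q → d ≡ suc q * q → ∀ τ → ∃[ s ] (s ∈ candidates (sortedItems , cap , g) ×
             overload g (proj₁ s) (proj₂ s) ≤ overloadOf τ × q * proj₁ s ≤ suc q * b τ + q)
    -- The quotient plus 1 is the least group size `K` with `k < q * K`, and rounding down gives
    -- `q * K ≤ k + q`, the two conditions of `Estimate`.
    good q@(suc q-1) 0<q d≡ τ = candidate (sortedItems , cap , g) k (suc (k DivMod./ q)) Est.p ,
        candidate∈ k≤ (≤-trans (DivMod.m/n≤m k q) k≤) Est.p∈ ,
        ≤-trans (proj₁ Est.estimate) (≤-reflexive (trans goal≡ overload-normal)) ,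
        ≤-trans (proj₂ Est.estimate) (≤-reflexive (cong (λ c → suc q * c + q) (sym b-τ)))
      where
      open Normal τ
      k : ℕ
      k = length N
      qs : List ⌞ Placed ⌟
      qs = placedOf normal
      -- The bins of the normalised packing, listed in decreasing order of item size, so that
      -- positions in `js` are ranks.
      js : List ℕ
      js = map (binOf qs ∘ itemId) sortedItems
      length-sorted : length sortedItems ≡ n
      length-sorted = trans (Permₚ.↭-length (sort-↭ items)) (Listₚ.length-tabulate (λ i → a i , toℕ i))
      k≤ : k ≤ length sortedItems
      k≤ = ≤-trans bins≤n (≤-reflexive (sym length-sorted))
      qs-items : map proj₁ qs ≡ items
      qs-items = Listₚ.map-tabulate (λ i → (a i , toℕ i) , toℕ (assign′ i)) proj₁
      zip-attach : ∀ xs → zip xs (map (binOf qs ∘ itemId) xs) ≡ attach (binOf qs) xs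
      zip-attach []       = refl
      zip-attach (x ∷ xs) = cong (_ ∷_) (zip-attach xs)
      placed↭ : attach (binOf qs) sortedItems ↭ qs
      placed↭ = ↭-trans (Permₚ.map⁺ _ (sort-↭ items)) (↭-reflexive (trans (cong (attach (binOf qs)) (sym qs-items))
        (attach-binOf qs (subst Distinct (sym qs-items) distinct-items))))
      loads≡ : ∀ j → pairMass j (zip (sizes sortedItems) js) ≡ load′ j qs
      loads≡ j = trans (sym (load-zip j sortedItems js)) (trans (cong (load′ j) (zip-attach sortedItems)) (mass-↭ placedSize placedBin j placed↭))
      js-< : All (_< k) js
      js-< = Allₚ.map⁺ (Allₚ.map⁻ (Permₚ.All-resp-↭ {P = λ p → placedBin p < k} (↭-sym placed↭) (Allₚ.tabulate⁺ {f = λ i → (a i , toℕ i) , toℕ (assign′ i)} (λ i → Finₚ.toℕ<n (assign′ i)))))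
      k< : k < suc (k DivMod./ q) * q
      k< = ≤-trans (≤-reflexive (cong suc (DivMod.m≡m%n+[m/n]*n k q))) (+-monoˡ-≤ (k DivMod./ q * q) (DivMod.m%n<n k q))
      module Est = Estimate q k (suc (k DivMod./ q)) js d≡ (s≤s z≤n)
        (<-≤-trans k< (≤-reflexive (*-comm (suc (k DivMod./ q)) q)))
        (≤-trans (≤-reflexive (trans (*-comm q (suc (k DivMod./ q))) (+-comm q _))) (+-monoˡ-≤ q (DivMod.m/n*n≤m k q)))
        (Permₚ.All-resp-↭ (↭-sym (sort-↭ items)) (Allₚ.tabulate⁺ 0<a))
        (sym (length-map (binOf qs ∘ itemId) sortedItems)) js-<
        (λ j j<k → ≤-trans (≤-reflexive (trans (loads≡ j) (cong (load′ j) placed′))) (light′ j j<k))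
      goal≡ : Σ< k (λ j → pairMass j (zip (sizes sortedItems) js) ∸ g) ≡ overloadOf normal
      goal≡ = Σ<-cong k (λ j _ → cong (_∸ g) (loads≡ j))

  alone : ⌞ Bins ⌟
  alone = separate (sortedItems , cap , g)

  alone-valid : Valid alone
  alone-valid = Greedy.wellPacked (All-zip₂ sortedItems (upTo-< (length sortedItems)))
      (singles-light cap id id (length sortedItems) sortedItems (Permₚ.All-resp-↭ (↭-sym (sort-↭ items)) (Allₚ.tabulate⁺ a≤cap)))
    , ↭-reflexive (map-proj₁-zip sortedItems (upTo (length sortedItems)) (≤-reflexive (sym (Listₚ.length-upTo (length sortedItems)))))

  alone-overload : overload g (proj₁ alone) (proj₂ alone) ≤ sum (tabulate (λ i → a i ∸ g))
  alone-overload = ≤-trans (singles-loads g id id (length sortedItems) sortedItems)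
    (≤-reflexive (trans (cong sum (sym (map-∘ sortedItems))) (trans (ListActionₚ.sum-↭ (Permₚ.map⁺ _ (sort-↭ items)))
      (cong sum (Listₚ.map-tabulate (λ i → a i , toℕ i) (λ x → itemSize x ∸ g))))))

  abstract
    rawPackings : ℕ → List ⌞ Bins ⌟
    rawPackings d = alone ∷ Candidates.candidates d (sortedItems , cap , g)

    rawPackings-∷ : ∀ d → rawPackings d ≡ alone ∷ Candidates.candidates d (sortedItems , cap , g)
    rawPackings-∷ d = refl

    rawPackings-valid : ∀ d → All Valid (rawPackings d)
    rawPackings-valid d = alone-valid ∷ candidates-sound d

    rawPackings≡ : ∀ d → Programs.produced d input ≡ rawPackings d
    rawPackings≡ d = cong (λ S → separate S ∷ Candidates.candidates d S) prepared

  packings : ∀ ss → All Valid ss → List (Packing I)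
  packings ss []       = []
  packings (s ∷ ss) (v ∷ vs) = toPacking s v ∷ packings ss vs

  ∈-packings : ∀ {s ss} (vs : All Valid ss) (s∈ : s ∈ ss) → toPacking s (All.lookup vs s∈) ∈ packings ss vs
  ∈-packings (v ∷ vs) (here refl) = here refl
  ∈-packings (v ∷ vs) (there s∈)  = there (∈-packings vs s∈)

  packings-∈ : ∀ {σ ss} (vs : All Valid ss) → σ ∈ packings ss vs → ∃[ s ] (Σ[ v ∈ Valid s ] (s ∈ ss × σ ≡ toPacking s v))
  packings-∈ (v ∷ vs) (here refl) = _ , v , here refl , refl
  packings-∈ (v ∷ vs) (there σ∈)  = let s , v′ , s∈ , e = packings-∈ vs σ∈ in s , v′ , there s∈ , e

  encode-packings : ∀ ss (vs : All Valid ss) → enc (Lst Result) (map result ss) ≡ encodeList encodePacking (packings ss vs)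
  encode-packings []             []       = refl
  encode-packings (s ∷ ss) (v ∷ vs) = cong₂ _∙_ (toPacking-encoded s v) (encode-packings ss vs)

  length-packings : ∀ ss (vs : All Valid ss) → length (packings ss vs) ≡ length ss
  length-packings []       []       = refl
  length-packings (s ∷ ss) (v ∷ vs) = cong suc (length-packings ss vs)

-- Existence of optimal packings

least : ∀ {A : Set} (f : A → ℚ) {x : A} xs → x ∈ xs → ∃[ y ] (y ∈ xs × (∀ z → z ∈ xs → f y ℚ.≤ f z))
least f (x ∷ []) _ = x , here refl , λ { z (here refl) → ℚₚ.≤-refl }
least f (x ∷ xs@(_ ∷ _)) _ with least f xs (here refl)
... | y , y∈ , le with ℚₚ.≤-total (f x) (f y)
... | inj₁ x≤y = x , here refl , λ { z (here refl) → ℚₚ.≤-refl ; z (there z∈) → ℚₚ.≤-trans x≤y (le z z∈) }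
... | inj₂ y≤x = y , there y∈ , λ { z (here refl) → y≤x ; z (there z∈) → le z z∈ }

functions : ∀ n m → List (Fin n → Fin m)
functions zero    m = (λ ()) ∷ []
functions (suc n) m = concatMap (λ j → map (j Vector.∷_) (functions n m)) (allFin m)

functions-complete : ∀ {n m} (f : Fin n → Fin m) → ∃[ f′ ] (f′ ∈ functions n m × (∀ i → f′ i ≡ f i))
functions-complete {zero}  f = (λ ()) , here refl , λ ()
functions-complete {suc n} f with functions-complete (f ∘ Fin.suc)
... | f′ , f′∈ , e = f Fin.zero Vector.∷ f′ ,
      ∈-concatMap (λ j → map (j Vector.∷_) (functions n _)) (Membershipₚ.∈-allFin (f Fin.zero)) (Membershipₚ.∈-map⁺ _ f′∈) ,
      λ { Fin.zero → refl ; (Fin.suc i) → e i }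

module Existence (I : GreenInstance) where
  open GreenInstance I
  open Produced I

  placedBy : ∀ {m} → (Fin n → Fin m) → List ⌞ Placed ⌟
  placedBy f = tabulate (λ i → (a i , toℕ i) , toℕ (f i))

  ifLight : ∀ {m} (f : Fin n → Fin m) → Dec (∀ j → load I f j ℚ.≤ 1ℚ) → List (Packing I)
  ifLight {m} f (yes light) = record { bins = m ; assign = f ; load≤1 = light } ∷ []
  ifLight     f (no _)      = []

  asPacking : ∀ {m} → (Fin n → Fin m) → List (Packing I)
  asPacking f = ifLight f (Finₚ.all? (λ j → load I f j ℚₚ.≤? 1ℚ))

  ifLight-found : ∀ {m} (f : Fin n → Fin m) dec → (∀ j → load I f j ℚ.≤ 1ℚ) →
                  ∃[ ρ ] (ρ ∈ ifLight f dec × Packing.bins ρ ≡ m × placedOf ρ ≡ placedBy f)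
  ifLight-found f (yes light) _     = _ , here refl , refl , refl
  ifLight-found f (no heavy)  light = ⊥-elim (heavy light)

  -- Arbitrarily many empty bins make the packings infinite in number; normalised ones have at most
  -- `n` bins, which leaves finitely many assignments up to pointwise equality.
  representatives : List (Packing I)
  representatives = concatMap (λ m → concatMap asPacking (functions n m)) (upTo (suc n))

  module Representative (τ : Packing I) (f : Fin n → Fin (length (Normal.N τ))) (f≗ : ∀ i → f i ≡ Normal.assign′ τ i) where
    open Normal τ

    placed≡f : placedBy f ≡ placedOf normal
    placed≡f = Listₚ.tabulate-cong (λ i → cong (λ j → (a i , toℕ i) , toℕ j) (f≗ i))

    f-light : ∀ j → load I f j ℚ.≤ 1ℚ
    f-light j = ≈-cancel (load≈ f j) 1≈cap (subst (λ ps → load′ (toℕ j) ps ≤ cap) (sym placed≡f)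
      (≈-mono (load≈ assign′ j) 1≈cap (Packing.load≤1 normal j)))

    found : ∃[ ρ ] (ρ ∈ asPacking f × Packing.bins ρ ≡ length N × placedOf ρ ≡ placedBy f)
    found = ifLight-found f (Finₚ.all? (λ j → load I f j ℚₚ.≤? 1ℚ)) f-light

    ρ : Packing I
    ρ = proj₁ found

    placed≡ : placedOf ρ ≡ placedOf normal
    placed≡ = trans (proj₂ (proj₂ (proj₂ found))) placed≡f

    same : ∀ (h : ℕ → List ⌞ Placed ⌟ → ℕ) → h (Packing.bins ρ) (placedOf ρ) ≡ h (length N) (placedOf normal)
    same h = cong₂ h (proj₁ (proj₂ (proj₂ found))) placed≡

    same-b : b ρ ≡ b τ
    same-b = trans (b-used ρ) (trans (same (λ m ps → usedBins (m , ps))) (trans (sym (b-used normal)) (trans b-normal (sym b-τ))))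

    same-overload : overloadOf ρ ≡ overloadOf τ
    same-overload = trans (same (overload g)) overload-normal

    same-E : E ρ ≡ E τ
    same-E = ℚₚ.≤-antisym (E-mono ρ τ (≤-reflexive same-overload)) (E-mono τ ρ (≤-reflexive (sym same-overload)))

  -- Agreement in `b` and `E` is all that is claimed, since an assignment is met only up to
  -- pointwise equality. In both problems feasibility and value depend on these two numbers alone.
  representative : ∀ τ → ∃[ ρ ] (ρ ∈ representatives × b ρ ≡ b τ × E ρ ≡ E τ)
  representative τ = ρ ,
      ∈-concatMap (λ m → concatMap asPacking (functions n m)) (Membershipₚ.∈-upTo⁺ (s≤s (Normal.bins≤n τ)))
        (∈-concatMap asPacking (proj₁ (proj₂ complete)) (proj₁ (proj₂ found))) ,
      same-b , same-E
    where
    complete : ∃[ f ] (f ∈ functions n (length (Normal.N τ)) × (∀ i → f i ≡ Normal.assign′ τ i))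
    complete = functions-complete (Normal.assign′ τ)
    open Representative τ (proj₁ complete) (proj₂ (proj₂ complete))

  module _ (Feasible : Packing I → Set) (feasible? : ∀ σ → Dec (Feasible σ)) (value : Packing I → ℚ)
           (feasible-resp : ∀ {σ τ} → b σ ≡ b τ → E σ ≡ E τ → Feasible τ → Feasible σ)
           (value-resp : ∀ {σ τ} → b σ ≡ b τ → E σ ≡ E τ → value σ ≡ value τ)
           {τ₀ : Packing I} (τ₀-feasible : Feasible τ₀) where

    IsOptimal : Packing I → Set
    IsOptimal σ = Feasible σ × (∀ τ → Feasible τ → value σ ℚ.≤ value τ)

    -- A lexicographic minimum: `σ₁` attains the least value, and `σ` has the least energy among the
    -- representatives that are no worse than `σ₁`.
    optimal-exists : ∃[ σ ] (IsOptimal σ × (∀ τ → IsOptimal τ → E σ ℚ.≤ E τ))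
    optimal-exists = σ , (σ-feasible , σ-optimal) , λ τ (τ-feasible , τ-optimal) →
        let ρ , ρ∈ , bρ , Eρ = representative τ
            ρ-feasible = feasible-resp bρ Eρ τ-feasible
        in ℚₚ.≤-trans (σ-least ρ (Membershipₚ.∈-filter⁺ (λ ρ → value ρ ℚₚ.≤? value σ₁) (Membershipₚ.∈-filter⁺ feasible? ρ∈ ρ-feasible)
             (ℚₚ.≤-trans (ℚₚ.≤-reflexive (value-resp bρ Eρ)) (τ-optimal σ₁ σ₁-feasible)))) (ℚₚ.≤-reflexive Eρ)
      where
      feasibles : List (Packing I)
      feasibles = filter feasible? representatives
      step₁ : ∃[ y ] (y ∈ feasibles × (∀ z → z ∈ feasibles → value y ℚ.≤ value z))
      step₁ = let ρ , ρ∈ , bρ , Eρ = representative τ₀ in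
        least value feasibles (Membershipₚ.∈-filter⁺ feasible? ρ∈ (feasible-resp bρ Eρ τ₀-feasible))
      σ₁ : Packing I
      σ₁ = proj₁ step₁
      σ₁-feasible : Feasible σ₁
      σ₁-feasible = proj₂ (Membershipₚ.∈-filter⁻ feasible? {xs = representatives} (proj₁ (proj₂ step₁)))
      cheap : List (Packing I)
      cheap = filter (λ ρ → value ρ ℚₚ.≤? value σ₁) feasibles
      step₂ : ∃[ y ] (y ∈ cheap × (∀ z → z ∈ cheap → E y ℚ.≤ E z))
      step₂ = least E cheap (Membershipₚ.∈-filter⁺ (λ ρ → value ρ ℚₚ.≤? value σ₁) (proj₁ (proj₂ step₁)) ℚₚ.≤-refl)
      σ : Packing I
      σ = proj₁ step₂
      σ-least : ∀ z → z ∈ cheap → E σ ℚ.≤ E z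
      σ-least = proj₂ (proj₂ step₂)
      σ-cheap : σ ∈ feasibles × value σ ℚ.≤ value σ₁
      σ-cheap = Membershipₚ.∈-filter⁻ (λ ρ → value ρ ℚₚ.≤? value σ₁) {xs = feasibles} (proj₁ (proj₂ step₂))
      σ-feasible : Feasible σ
      σ-feasible = proj₂ (Membershipₚ.∈-filter⁻ feasible? {xs = representatives} (proj₁ σ-cheap))
      σ-optimal : ∀ τ → Feasible τ → value σ ℚ.≤ value τ
      σ-optimal τ τ-feasible = let ρ , ρ∈ , bρ , Eρ = representative τ in
        ℚₚ.≤-trans (proj₂ σ-cheap) (ℚₚ.≤-trans (proj₂ (proj₂ step₁) ρ (Membershipₚ.∈-filter⁺ feasible? ρ∈ (feasible-resp bρ Eρ τ-feasible)))
          (ℚₚ.≤-reflexive (value-resp bρ Eρ)))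

-- Selecting a best packing

best-∈ : ∀ {A : Set} (le : A → A → Bool) a xs → best le a xs ∈ a ∷ xs
best-∈ le a []       = here refl
best-∈ le a (x ∷ xs) with le a x
... | true  = weaken (best-∈ le a xs)
  where
  weaken : ∀ {y} → y ∈ a ∷ xs → y ∈ a ∷ x ∷ xs
  weaken (here e)   = here e
  weaken (there y∈) = there (there y∈)
... | false = there (best-∈ le x xs)

best-least : ∀ {A : Set} (le : A → A → Bool) (key : A → ℕ) → (∀ x y → le x y ≡ (key x ≤ᵇ key y)) →
             ∀ a xs z → z ∈ a ∷ xs → key (best le a xs) ≤ key z
best-least le key le≡ a []       z (here refl) = ≤-refl
best-least le key le≡ a (x ∷ xs) z z∈ with le a x | le≡ a x
... | true  | e = case z∈ of λ
      { (here refl)         → best-least le key le≡ a xs z (here refl)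
      ; (there (here refl)) → ≤-trans (best-least le key le≡ a xs a (here refl)) (≤ᵇ⇒≤ (key a) (key x) (subst T e tt))
      ; (there (there z∈′)) → best-least le key le≡ a xs z (there z∈′) }
... | false | e = case z∈ of λ
      { (here refl) → ≤-trans (best-least le key le≡ x xs x (here refl)) (≰⇒≥ (λ le′ → subst T (sym e) (≤⇒≤ᵇ le′)))
      ; (there z∈′) → best-least le key le≡ x xs z z∈′ }

module Selection (I : GreenInstance) where
  open GreenInstance I
  open Produced I public
  open ℚSolver.+-*-Solver using (solve; _:=_; _:*_; _:+_)

  P Q : ℕ
  P = numer β
  Q = denom β

  0<Q : 0 < Q
  0<Q = s≤s z≤n

  βQ≡P : β ℚ.* fromℕ Q ≡ fromℕ P
  βQ≡P = numer/denom β β≥0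

  rawOverload : ⌞ Bins ⌟ → ℕ
  rawOverload (m , ps) = overload g m ps

  key : ⌞ Bins ⌟ → ℕ
  key s = usedBins s * (Q * cap) + P * rawOverload s

  -- The program works with `levels`, which include `m * g`, and adds the corresponding term of the
  -- other packing; both sides then exceed the keys by the same `extra`.
  cheaper≡ : ∀ s t → cheaperGBP β cap g s t ≡ (key s ≤ᵇ key t)
  cheaper≡ s@(m , ps) t@(m′ , ps′) = T-ext
      (λ le → ≤⇒≤ᵇ (+-cancelʳ-≤ extra _ _ (subst₂ _≤_ left-side right-side (≤ᵇ⇒≤ _ _ le))))
      (λ le → ≤⇒≤ᵇ (subst₂ _≤_ (sym left-side) (sym right-side) (+-monoˡ-≤ extra (≤ᵇ⇒≤ (key s) (key t) le))))
    where
    extra : ℕ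
    extra = P * (m * g + m′ * g)
    algebra₁ : ∀ u p o x y → u + p * (o + x + y) ≡ u + p * o + p * (x + y)
    algebra₁ = solve-∀
    algebra₂ : ∀ u p o x y → u + p * (o + y + x) ≡ u + p * o + p * (x + y)
    algebra₂ = solve-∀
    left-side : usedBins s * (Q * cap) + P * (levels g s + m′ * g) ≡ key s + extra
    left-side = trans (cong (λ l → usedBins s * (Q * cap) + P * (l + m′ * g)) (levels-overload g m ps))
      (algebra₁ (usedBins s * (Q * cap)) P (rawOverload s) (m * g) (m′ * g))
    right-side : usedBins t * (Q * cap) + P * (levels g t + m * g) ≡ key t + extra
    right-side = trans (cong (λ l → usedBins t * (Q * cap) + P * (l + m * g)) (levels-overload g m′ ps′))
      (algebra₂ (usedBins t * (Q * cap)) P (rawOverload t) (m * g) (m′ * g))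

  E-raw : ∀ s v → E (toPacking s v) ℚ.* κ ≡ β ℚ.* fromℕ (rawOverload s)
  E-raw s v = trans (E-scaled (toPacking s v)) (cong (λ o → β ℚ.* fromℕ o) (toPacking-overload s v))

  value-raw : ∀ s v → (fromℕ (b (toPacking s v)) ℚ.+ E (toPacking s v)) ℚ.* (κ ℚ.* fromℕ Q) ≡ fromℕ (key s)
  value-raw s v = begin
    (fromℕ (b σ) ℚ.+ E σ) ℚ.* (κ ℚ.* fromℕ Q)
      ≡⟨ solve 4 (λ b e k q → (b :+ e) :* (k :* q) := b :* (q :* k) :+ e :* k :* q) refl (fromℕ (b σ)) (E σ) κ (fromℕ Q) ⟩
    fromℕ (b σ) ℚ.* (fromℕ Q ℚ.* κ) ℚ.+ E σ ℚ.* κ ℚ.* fromℕ Q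
      ≡⟨ cong₂ ℚ._+_ (cong₂ ℚ._*_ (cong fromℕ (toPacking-b s v)) (sym (fromℕ-* Q cap))) (cong (ℚ._* fromℕ Q) (E-raw s v)) ⟩
    fromℕ (usedBins s) ℚ.* fromℕ (Q * cap) ℚ.+ β ℚ.* fromℕ (rawOverload s) ℚ.* fromℕ Q
      ≡⟨ cong₂ ℚ._+_ (sym (fromℕ-* (usedBins s) (Q * cap)))
           (trans (solve 3 (λ b o q → b :* o :* q := b :* q :* o) refl β (fromℕ (rawOverload s)) (fromℕ Q)) (cong (ℚ._* fromℕ (rawOverload s)) βQ≡P)) ⟩
    fromℕ (usedBins s * (Q * cap)) ℚ.+ fromℕ P ℚ.* fromℕ (rawOverload s)
      ≡⟨ cong (fromℕ (usedBins s * (Q * cap)) ℚ.+_) (fromℕ-* P (rawOverload s)) ⟨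
    fromℕ (usedBins s * (Q * cap)) ℚ.+ fromℕ (P * rawOverload s)
      ≡⟨ fromℕ-+ (usedBins s * (Q * cap)) (P * rawOverload s) ⟨
    fromℕ (key s) ∎
    where
    open ≡-Reasoning
    σ : Packing I
    σ = toPacking s v

  value-mono : ∀ s v t w → key s ≤ key t →
               fromℕ (b (toPacking s v)) ℚ.+ E (toPacking s v) ℚ.≤ fromℕ (b (toPacking t w)) ℚ.+ E (toPacking t w)
  value-mono s v t w le = ℚₚ.*-cancelʳ-≤-pos (κ ℚ.* fromℕ Q) {{ℚₚ.pos*pos⇒pos κ (fromℕ Q) {{fromℕ-pos 0<Q}}}}
    (subst₂ ℚ._≤_ (sym (value-raw s v)) (sym (value-raw t w)) (fromℕ-mono-≤ le))

  E≥0 : ∀ σ → 0ℚ ℚ.≤ E σ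
  E≥0 σ = ℚₚ.*-cancelʳ-≤-pos κ (subst₂ ℚ._≤_ (trans (ℚₚ.*-zeroˡ (fromℕ (overloadOf σ))) (sym (ℚₚ.*-zeroˡ κ))) (sym (E-scaled σ))
    (ℚₚ.*-monoʳ-≤-nonNeg (fromℕ (overloadOf σ)) {{fromℕ-nonNeg (overloadOf σ)}} β≥0))

  module Budget (U : ℚ) (U≥0 : 0ℚ ℚ.≤ U) where

    factor : ℚ
    factor = κ ℚ.* fromℕ Q ℚ.* fromℕ (denom U)

    factor-pos : ℚ.Positive factor
    factor-pos = ℚₚ.pos*pos⇒pos (κ ℚ.* fromℕ Q) {{ℚₚ.pos*pos⇒pos κ (fromℕ Q) {{fromℕ-pos 0<Q}}}} (fromℕ (denom U)) {{fromℕ-pos {denom U} (s≤s z≤n)}}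

    E-factor : ∀ s v → E (toPacking s v) ℚ.* factor ≡ fromℕ (P * rawOverload s * denom U)
    E-factor s v = begin
      E σ ℚ.* factor
        ≡⟨ solve 4 (λ e k q u → e :* (k :* q :* u) := e :* k :* q :* u) refl (E σ) κ (fromℕ Q) (fromℕ (denom U)) ⟩
      E σ ℚ.* κ ℚ.* fromℕ Q ℚ.* fromℕ (denom U)
        ≡⟨ cong (λ e → e ℚ.* fromℕ Q ℚ.* fromℕ (denom U)) (E-raw s v) ⟩
      β ℚ.* fromℕ (rawOverload s) ℚ.* fromℕ Q ℚ.* fromℕ (denom U)
        ≡⟨ cong (ℚ._* fromℕ (denom U)) (trans (solve 3 (λ b o q → b :* o :* q := b :* q :* o) refl β (fromℕ (rawOverload s)) (fromℕ Q)) (cong (ℚ._* fromℕ (rawOverload s)) βQ≡P)) ⟩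
      fromℕ P ℚ.* fromℕ (rawOverload s) ℚ.* fromℕ (denom U)
        ≡⟨ cong (ℚ._* fromℕ (denom U)) (fromℕ-* P (rawOverload s)) ⟨
      fromℕ (P * rawOverload s) ℚ.* fromℕ (denom U)
        ≡⟨ fromℕ-* (P * rawOverload s) (denom U) ⟨
      fromℕ (P * rawOverload s * denom U) ∎
      where
      open ≡-Reasoning
      σ : Packing I
      σ = toPacking s v

    U-factor : U ℚ.* factor ≡ fromℕ (numer U * (Q * cap))
    U-factor = begin
      U ℚ.* factor
        ≡⟨ solve 4 (λ e k q u → e :* (k :* q :* u) := e :* u :* (q :* k)) refl U κ (fromℕ Q) (fromℕ (denom U)) ⟩
      U ℚ.* fromℕ (denom U) ℚ.* (fromℕ Q ℚ.* κ)
        ≡⟨ cong₂ ℚ._*_ (numer/denom U U≥0) (sym (fromℕ-* Q cap)) ⟩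
      fromℕ (numer U) ℚ.* fromℕ (Q * cap)
        ≡⟨ fromℕ-* (numer U) (Q * cap) ⟨
      fromℕ (numer U * (Q * cap)) ∎
      where open ≡-Reasoning

    levels-split : ∀ s → P * levels g s * denom U ≡ P * rawOverload s * denom U + P * (proj₁ s * g) * denom U
    levels-split (m , ps) = trans (cong (λ l → P * l * denom U) (levels-overload g m ps)) (algebra P (overload g m ps) (m * g) (denom U))
      where
      algebra : ∀ p o x u → p * (o + x) * u ≡ p * o * u + p * x * u
      algebra = solve-∀

    within : ∀ s → T (withinBudget U β cap g s) → P * rawOverload s * denom U ≤ numer U * (Q * cap)
    within s t = +-cancelʳ-≤ (P * (proj₁ s * g) * denom U) _ _ (≤-trans (≤-reflexive (sym (levels-split s))) (≤ᵇ⇒≤ _ _ t))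

    within⁻¹ : ∀ s → P * rawOverload s * denom U ≤ numer U * (Q * cap) → T (withinBudget U β cap g s)
    within⁻¹ s le = ≤⇒≤ᵇ (≤-trans (≤-reflexive (levels-split s)) (+-monoˡ-≤ (P * (proj₁ s * g) * denom U) le))

    affordable⇒E≤U : ∀ s v → T (withinBudget U β cap g s) → E (toPacking s v) ℚ.≤ U
    affordable⇒E≤U s v t = ℚₚ.*-cancelʳ-≤-pos factor {{factor-pos}}
      (subst₂ ℚ._≤_ (sym (E-factor s v)) (sym U-factor) (fromℕ-mono-≤ (within s t)))

    E≤U⇒affordable : ∀ s v → E (toPacking s v) ℚ.≤ U → T (withinBudget U β cap g s)
    E≤U⇒affordable s v le = within⁻¹ s (fromℕ-cancel-≤ (subst₂ ℚ._≤_ (E-factor s v) U-factor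
      (ℚₚ.*-monoʳ-≤-nonNeg factor {{ℚₚ.pos⇒nonNeg factor {{factor-pos}}}} le)))

  alonePacking : Packing I
  alonePacking = toPacking alone alone-valid

  energies : ℚ
  energies = sumFin (λ i → energy β G (s i))

  energies-scaled : energies ℚ.* κ ≡ β ℚ.* fromℕ (sum (tabulate (λ i → a i ∸ g)))
  energies-scaled = sum-energy β _ _ (λ i → ≈-energy β≥0 (s≈a i) G≈g)

  alone-E : E alonePacking ℚ.≤ energies
  alone-E = ℚₚ.*-cancelʳ-≤-pos κ (subst₂ ℚ._≤_ (sym (E-raw alone alone-valid)) (sym energies-scaled)
    (ℚₚ.*-monoˡ-≤-nonNeg β {{ℚ.nonNegative β≥0}} (fromℕ-mono-≤ alone-overload)))

  energies≥0 : 0ℚ ℚ.≤ energies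
  energies≥0 = ℚₚ.≤-trans (E≥0 alonePacking) alone-E

-- From programs on codes to `PolyTime`

toPolyTime : ∀ {A : Set} {B : A → Set} {encA : A → Tree} {encB : ∀ {x} → B x → Tree} {run : ∀ x → B x} {C D f} →
             PT C D f → (h : A → ⌞ C ⌟) → (∀ x → enc C (h x) ≡ encA x) → (∀ x → enc D (f (h x)) ≡ encB (run x)) →
             PolyTime encA encB run
toPolyTime {C = C} {D} {f} p h eC eD = record
  { program    = prog p
  ; time       = λ x → proj₁ (runs p (h x))
  ; computes   = λ x → subst₂ (λ y z → prog p ⊢ y ⇓ z cost proj₁ (runs p (h x))) (eC x) (eD x) (proj₁ (proj₂ (runs p (h x))))
  ; polynomial = proj₁ (monomial-bound (pol p)) , proj₁ (proj₂ (monomial-bound (pol p))) , λ x →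
      ≤-trans (proj₂ (proj₂ (runs p (h x)))) (subst (λ y → ⟦ pol p ⟧ (size (enc C (h x))) ≤
          proj₁ (monomial-bound (pol p)) * size y ^ proj₁ (proj₂ (monomial-bound (pol p)))) (eC x)
        (proj₂ (proj₂ (monomial-bound (pol p))) (sz C (h x)) (1≤size (enc C (h x)))))
  }

length-bounded : ∀ {A : Set} {encA : A → Tree} {ℓ : A → ℕ} {C D f} → PT C (Lst D) f → (h : A → ⌞ C ⌟) →
                 (∀ x → enc C (h x) ≡ encA x) → (∀ x → length (f (h x)) ≡ ℓ x) → PolynomiallyBounded encA ℓ
length-bounded {encA = encA} {ℓ} {C} {D} {f} p h eC eℓ with monomial-bound (pol p)
... | c , k , bound = c , k , λ x → begin
    ℓ x                               ≡⟨ eℓ x ⟨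
    length (f (h x))                  ≤⟨ <⇒≤ (length<sz D (f (h x))) ⟩
    sz (Lst D) (f (h x))              ≤⟨ output-size p (h x) ⟩
    ⟦ pol p ⟧ (sz C (h x))            ≤⟨ bound (sz C (h x)) (1≤size (enc C (h x))) ⟩
    c * sz C (h x) ^ k                ≡⟨ cong (λ t → c * size t ^ k) (eC x) ⟩
    c * size (encA x) ^ k             ∎
  where open ≤-Reasoning

-- The guarantees for a fixed accuracy

module _ (ε : ℚ) (0<ε : 0ℚ ℚ.< ε) (d : ℕ) (d≡ : d ≡ suc (denom ε) * denom ε) where

  -- A positive rational has numerator at least 1, so the denominator of ε is an integer with 1/q ≤
  -- ε.
  q : ℕ
  q = denom ε

  0<q : 0 < q
  0<q = s≤s z≤n

  εq : ε ℚ.* fromℕ q ≡ fromℕ (numer ε)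
  εq = numer/denom ε (ℚₚ.<⇒≤ 0<ε)

  1≤numer : 1 ≤ numer ε
  1≤numer = ≰⇒> λ le → ℚₚ.<-irrefl refl (ℚₚ.<-≤-trans 0<ε (ℚₚ.*-cancelʳ-≤-pos (fromℕ q) {{fromℕ-pos 0<q}}
    (subst₂ ℚ._≤_ (sym εq) (sym (ℚₚ.*-zeroˡ (fromℕ q))) (fromℕ-mono-≤ le))))

  bins-ratio : ∀ u m c → u ≤ m → q * m ≤ suc q * c + q → fromℕ u ℚ.≤ (1ℚ ℚ.+ ε) ℚ.* fromℕ c ℚ.+ 1ℚ
  bins-ratio u m c u≤m le = ℚₚ.*-cancelˡ-≤-pos (fromℕ q) {{fromℕ-pos 0<q}} (begin
    fromℕ q ℚ.* fromℕ u                                        ≡⟨ fromℕ-* q u ⟨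
    fromℕ (q * u)                                              ≤⟨ fromℕ-mono-≤ (≤-trans (*-monoʳ-≤ q u≤m) (≤-trans le grow)) ⟩
    fromℕ (q * c + numer ε * c + q)                            ≡⟨ trans (fromℕ-+ (q * c + numer ε * c) q) (cong (ℚ._+ fromℕ q) (trans (fromℕ-+ (q * c) (numer ε * c)) (cong₂ ℚ._+_ (fromℕ-* q c) (fromℕ-* (numer ε) c)))) ⟩
    fromℕ q ℚ.* fromℕ c ℚ.+ fromℕ (numer ε) ℚ.* fromℕ c ℚ.+ fromℕ q   ≡⟨ cong (λ e → fromℕ q ℚ.* fromℕ c ℚ.+ e ℚ.* fromℕ c ℚ.+ fromℕ q) εq ⟨
    fromℕ q ℚ.* fromℕ c ℚ.+ ε ℚ.* fromℕ q ℚ.* fromℕ c ℚ.+ fromℕ q     ≡⟨ solve 3 (λ q c e → q :* c :+ e :* q :* c :+ q := q :* ((con 1ℚ :+ e) :* c :+ con 1ℚ)) refl (fromℕ q) (fromℕ c) ε ⟩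
    fromℕ q ℚ.* ((1ℚ ℚ.+ ε) ℚ.* fromℕ c ℚ.+ 1ℚ)                ∎)
    where
    open ℚₚ.≤-Reasoning
    open ℚSolver.+-*-Solver using (solve; _:=_; _:*_; _:+_; con)
    grow : suc q * c + q ≤ q * c + numer ε * c + q
    grow = +-monoˡ-≤ q (≤-trans (≤-reflexive (+-comm c (q * c))) (+-monoʳ-≤ (q * c)
      (≤-trans (≤-reflexive (sym (+-identityʳ c))) (*-monoˡ-≤ c 1≤numer))))

  module Approximate (I : GreenInstance) where
    open Selection I public

    produced : List (Packing I)
    produced = packings (rawPackings d) (rawPackings-valid d)

    goodPacking : ∀ τ s → s ∈ rawPackings d → rawOverload s ≤ overloadOf τ → q * proj₁ s ≤ suc q * b τ + q →
                  ∃[ σ ] (σ ∈ produced × fromℕ (b σ) ℚ.≤ (1ℚ ℚ.+ ε) ℚ.* fromℕ (b τ) ℚ.+ 1ℚ × E σ ℚ.≤ E τ)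
    goodPacking τ s@(m , ps) s∈ over≤ bins≤ = σ , ∈-packings (rawPackings-valid d) s∈ ,
        bins-ratio (b σ) m (b τ) (≤-trans (≤-reflexive (toPacking-b s v)) used≤) bins≤ ,
        E-mono σ τ (≤-trans (≤-reflexive (toPacking-overload s v)) over≤)
      where
      v : Valid s
      v = All.lookup (rawPackings-valid d) s∈
      σ : Packing I
      σ = toPacking s v
      used≤ : usedBins s ≤ m
      used≤ = ≤-trans (Listₚ.length-filter (Boolₚ.T? ∘ λ j → 1 ≤ᵇ load′ j ps) (upTo m)) (≤-reflexive (Listₚ.length-upTo m))

    -- Stated for an arbitrary packing, so that each problem can apply it to its own optimum and `U`
    -- enters only afterwards.
    close : ∀ τ → ∃[ σ ] (σ ∈ produced × fromℕ (b σ) ℚ.≤ (1ℚ ℚ.+ ε) ℚ.* fromℕ (b τ) ℚ.+ 1ℚ × E σ ℚ.≤ E τ)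
    close τ = let s , s∈ , over≤ , bins≤ = good d q 0<q d≡ τ in goodPacking τ s (subst (s ∈_) (sym (rawPackings-∷ d)) (there s∈)) over≤ bins≤

    length-produced : length produced ≡ length (Programs.produced d input)
    length-produced = trans (length-packings (rawPackings d) (rawPackings-valid d)) (cong length (sym (rawPackings≡ d)))

    encode-produced : enc (Lst Result) (map result (Programs.produced d input)) ≡ encodeList encodePacking produced
    encode-produced = trans (cong (enc (Lst Result) ∘ map result) (rawPackings≡ d)) (encode-packings (rawPackings d) (rawPackings-valid d))

    module Chosen (s : ⌞ Bins ⌟) (s∈ : s ∈ rawPackings d) where
      valid : Valid s
      valid = All.lookup (rawPackings-valid d) s∈

      chosen : Packing I
      chosen = toPacking s valid

      chosen∈ : chosen ∈ produced
      chosen∈ = ∈-packings (rawPackings-valid d) s∈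

    abstract
      rawBest : ⌞ Bins ⌟
      rawBest = best (cheaperGBP (GreenInstance.β I) cap g) alone (Candidates.candidates d (sortedItems , cap , g))

      rawBest≡ : Programs.bestGBP d input ≡ rawBest
      rawBest≡ = cong (λ S → best (cheaperGBP (GreenInstance.β I) (proj₁ (proj₂ S)) (proj₂ (proj₂ S))) (separate S) (Candidates.candidates d S)) prepared

      rawBest∈ : rawBest ∈ rawPackings d
      rawBest∈ = subst (rawBest ∈_) (sym (rawPackings-∷ d))
        (best-∈ (cheaperGBP (GreenInstance.β I) cap g) alone (Candidates.candidates d (sortedItems , cap , g)))

      rawBest-least : ∀ t → t ∈ rawPackings d → key rawBest ≤ key t
      rawBest-least t t∈ = best-least (cheaperGBP (GreenInstance.β I) cap g) key cheaper≡ alone (Candidates.candidates d (sortedItems , cap , g)) t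
        (subst (t ∈_) (rawPackings-∷ d) t∈)

    open Chosen rawBest rawBest∈ public using () renaming (chosen to bestPacking; chosen∈ to bestPacking∈; valid to rawBest-valid)

    best-encoded : enc Result (result (Programs.bestGBP d input)) ≡ encodePacking bestPacking
    best-encoded = trans (cong (λ s → enc Result (result s)) rawBest≡) (toPacking-encoded rawBest rawBest-valid)

    best-least-value : ∀ τ → τ ∈ produced → fromℕ (b bestPacking) ℚ.+ E bestPacking ℚ.≤ fromℕ (b τ) ℚ.+ E τ
    best-least-value τ τ∈ = let t , v , t∈ , e = packings-∈ (rawPackings-valid d) τ∈ in
      subst (λ ρ → fromℕ (b bestPacking) ℚ.+ E bestPacking ℚ.≤ fromℕ (b ρ) ℚ.+ E ρ) (sym e)
        (value-mono rawBest rawBest-valid t v (rawBest-least t t∈))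

  A-GBP : (I : GreenInstance) → List (Packing I)
  A-GBP I = Approximate.produced I

  B-GBP : (I : GreenInstance) → Packing I
  B-GBP I = Approximate.bestPacking I

  A-GBP-polytime : PolyTime (PackingProblem.encode GBP) (encodeList encodePacking) A-GBP
  A-GBP-polytime = toPolyTime (Programs.producedᴾ d) Scaled.input (λ _ → refl) Approximate.encode-produced

  A-GBP-length : PolynomiallyBounded encodeGreen (λ I → length (A-GBP I))
  A-GBP-length = length-bounded (Programs.producedᴾ d) Scaled.input (λ _ → refl)
    (λ I → trans (length-map result (Programs.produced d (Scaled.input I))) (sym (Approximate.length-produced I)))

  GBP-optimum : ∀ I → ∃ (MinEnergyOptimal GBP I)
  GBP-optimum I = Existence.optimal-exists I (λ _ → ⊤) (λ _ → yes tt) (λ σ → fromℕ (b σ) ℚ.+ E σ) (λ _ _ _ → tt)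
    (λ e e′ → cong₂ (λ m x → fromℕ m ℚ.+ x) e e′) {Approximate.alonePacking I} tt

  -- The energy is reproduced without the factor 1 + ε, so the claimed bound has the slack ε e,
  -- which is nonnegative.
  value-bound : ∀ {x y c e} → 0ℚ ℚ.≤ e → x ℚ.≤ (1ℚ ℚ.+ ε) ℚ.* c ℚ.+ 1ℚ → y ℚ.≤ e → x ℚ.+ y ℚ.≤ (1ℚ ℚ.+ ε) ℚ.* (c ℚ.+ e) ℚ.+ 1ℚ
  value-bound {x} {y} {c} {e} 0≤e x≤ y≤ = begin
    x ℚ.+ y                                          ≤⟨ ℚₚ.+-mono-≤ x≤ y≤ ⟩
    (1ℚ ℚ.+ ε) ℚ.* c ℚ.+ 1ℚ ℚ.+ e                    ≡⟨ ℚₚ.+-identityʳ ((1ℚ ℚ.+ ε) ℚ.* c ℚ.+ 1ℚ ℚ.+ e) ⟨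
    (1ℚ ℚ.+ ε) ℚ.* c ℚ.+ 1ℚ ℚ.+ e ℚ.+ 0ℚ             ≤⟨ ℚₚ.+-monoʳ-≤ ((1ℚ ℚ.+ ε) ℚ.* c ℚ.+ 1ℚ ℚ.+ e) 0≤εe ⟩
    (1ℚ ℚ.+ ε) ℚ.* c ℚ.+ 1ℚ ℚ.+ e ℚ.+ ε ℚ.* e        ≡⟨ solve 3 (λ c e ε → (con 1ℚ :+ ε) :* c :+ con 1ℚ :+ e :+ ε :* e := (con 1ℚ :+ ε) :* (c :+ e) :+ con 1ℚ) refl c e ε ⟩
    (1ℚ ℚ.+ ε) ℚ.* (c ℚ.+ e) ℚ.+ 1ℚ                  ∎
    where
    open ℚₚ.≤-Reasoning
    open ℚSolver.+-*-Solver using (solve; _:=_; _:*_; _:+_; con)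
    0≤εe : 0ℚ ℚ.≤ ε ℚ.* e
    0≤εe = subst (ℚ._≤ ε ℚ.* e) (ℚₚ.*-zeroʳ ε) (ℚₚ.*-monoˡ-≤-nonNeg ε {{ℚ.nonNegative (ℚₚ.<⇒≤ 0<ε)}} 0≤e)

  A-GBP-good : ProducesGoodPackings GBP ε A-GBP
  A-GBP-good = A-GBP-polytime , A-GBP-length , GBP-optimum , λ I σ* _ → Approximate.close I σ*

  B-GBP-best : ∀ I → BestAmong GBP I (A-GBP I) (B-GBP I)
  B-GBP-best I = Approximate.bestPacking∈ I , tt , λ τ τ∈ _ → Approximate.best-least-value I τ τ∈

  best-GBP-good : ∀ I σ v → BestAmong GBP I (A-GBP I) σ → IsOPT GBP I v → PackingProblem.value GBP I σ ℚ.≤ (1ℚ ℚ.+ ε) ℚ.* v ℚ.+ 1ℚ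
  best-GBP-good I σ v (_ , _ , least) (τ , _ , refl) =
    let ρ , ρ∈ , b≤ , E≤ = Approximate.close I τ
    in ℚₚ.≤-trans (least ρ ρ∈ tt) (value-bound {fromℕ (b ρ)} {E ρ} {fromℕ (b τ)} {E τ} (Approximate.E≥0 I τ) b≤ E≤)

  B-GBP-polytime : PolyTime (PackingProblem.encode GBP) encodePacking B-GBP
  B-GBP-polytime = toPolyTime (Programs.bestGBPᴾ d) Scaled.input (λ _ → refl)
    Approximate.best-encoded

  module Constrained (J : ConstrainedInstance) where
    open ConstrainedInstance J using (U; U≥) renaming (green to I)
    open Approximate I public
    open Budget U (ℚₚ.≤-trans energies≥0 U≥) public

    input′ : ⌞ Input ⊗ Rat ⌟
    input′ = input , U

    fewer : ⌞ Bins ⌟ → ⌞ Bins ⌟ → Bool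
    fewer s t = usedBins s ≤ᵇ usedBins t

    cheap : List ⌞ Bins ⌟
    cheap = filterᵇ (withinBudget U (GreenInstance.β I) cap g) (Candidates.candidates d (sortedItems , cap , g))

    alone-feasible : E alonePacking ℚ.≤ U
    alone-feasible = ℚₚ.≤-trans alone-E U≥

    Affordable : ⌞ Bins ⌟ → Set
    Affordable s = T (withinBudget U (GreenInstance.β I) cap g s)

    abstract
      rawFewest : ⌞ Bins ⌟
      rawFewest = best fewer alone cheap

      rawFewest≡ : Programs.bestCGBP d input′ ≡ rawFewest
      rawFewest≡ = cong (λ S → best fewer (separate S)
        (filterᵇ (withinBudget U (GreenInstance.β I) (proj₁ (proj₂ S)) (proj₂ (proj₂ S))) (Candidates.candidates d S))) prepared

      affordable : ∀ s → s ∈ alone ∷ cheap → s ∈ alone ∷ Candidates.candidates d (sortedItems , cap , g) × Affordable s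
      affordable s (here e)   = here e , subst Affordable (sym e) (E≤U⇒affordable alone alone-valid alone-feasible)
      affordable s (there s∈) =
        let s∈′ , t = Membershipₚ.∈-filter⁻ (Boolₚ.T? ∘ withinBudget U (GreenInstance.β I) cap g) {xs = Candidates.candidates d (sortedItems , cap , g)} s∈
        in there s∈′ , t

      affordable⁻¹ : ∀ s → s ∈ alone ∷ Candidates.candidates d (sortedItems , cap , g) → Affordable s → s ∈ alone ∷ cheap
      affordable⁻¹ s (here e)   t = here e
      affordable⁻¹ s (there s∈) t = there (Membershipₚ.∈-filter⁺ (Boolₚ.T? ∘ withinBudget U (GreenInstance.β I) cap g) s∈ t)

      rawFewest-affordable : rawFewest ∈ rawPackings d × Affordable rawFewest
      rawFewest-affordable = let s∈ , t = affordable rawFewest (best-∈ fewer alone cheap) in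
        subst (rawFewest ∈_) (sym (rawPackings-∷ d)) s∈ , t

      rawFewest-least : ∀ t → t ∈ rawPackings d → Affordable t → usedBins rawFewest ≤ usedBins t
      rawFewest-least t t∈ aff = best-least fewer usedBins (λ _ _ → refl) alone cheap t
        (affordable⁻¹ t (subst (t ∈_) (rawPackings-∷ d) t∈) aff)

    open Chosen rawFewest (proj₁ rawFewest-affordable) public
      using () renaming (chosen to fewestPacking; chosen∈ to fewestPacking∈; valid to rawFewest-valid)

    fewest-encoded : enc Result (result (Programs.bestCGBP d input′)) ≡ encodePacking fewestPacking
    fewest-encoded = trans (cong (λ s → enc Result (result s)) rawFewest≡) (toPacking-encoded rawFewest rawFewest-valid)

    fewest-feasible : E fewestPacking ℚ.≤ U
    fewest-feasible = affordable⇒E≤U rawFewest rawFewest-valid (proj₂ rawFewest-affordable)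

    fewest-least : ∀ τ → τ ∈ produced → E τ ℚ.≤ U → fromℕ (b fewestPacking) ℚ.≤ fromℕ (b τ)
    fewest-least τ τ∈ E≤U = let t , v , t∈ , e = packings-∈ (rawPackings-valid d) τ∈ in fromℕ-mono-≤ (begin
        b fewestPacking          ≡⟨ toPacking-b rawFewest rawFewest-valid ⟩
        usedBins rawFewest       ≤⟨ rawFewest-least t t∈ (E≤U⇒affordable t v (subst (λ ρ → E ρ ℚ.≤ U) e E≤U)) ⟩
        usedBins t               ≡⟨ toPacking-b t v ⟨
        b (toPacking t v)        ≡⟨ cong b e ⟨
        b τ                      ∎)
      where open ≤-Reasoning

  A-CGBP : (J : ConstrainedInstance) → List (PackingProblem.PackingOf CGBP J)
  A-CGBP J = Constrained.produced J

  B-CGBP : (J : ConstrainedInstance) → PackingProblem.PackingOf CGBP J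
  B-CGBP J = Constrained.fewestPacking J

  producedCᴾ : PT (Input ⊗ Rat) (Lst Result) (λ I → map result (Programs.produced d (proj₁ I)))
  producedCᴾ = Programs.producedᴾ d ∘ᴾ fstᴾ

  A-CGBP-polytime : PolyTime (PackingProblem.encode CGBP) (encodeList encodePacking) A-CGBP
  A-CGBP-polytime = toPolyTime producedCᴾ Constrained.input′ (λ _ → refl) Constrained.encode-produced

  A-CGBP-length : PolynomiallyBounded (PackingProblem.encode CGBP) (λ J → length (A-CGBP J))
  A-CGBP-length = length-bounded producedCᴾ Constrained.input′ (λ _ → refl)
    (λ J → trans (length-map result (Programs.produced d (Constrained.input J))) (sym (Constrained.length-produced J)))

  CGBP-optimum : ∀ J → ∃ (MinEnergyOptimal CGBP J)
  CGBP-optimum J = Existence.optimal-exists (ConstrainedInstance.green J) (PackingProblem.Feasible CGBP J)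
    (λ σ → E σ ℚₚ.≤? ConstrainedInstance.U J) (λ σ → fromℕ (b σ))
    (λ _ e le → ℚₚ.≤-trans (ℚₚ.≤-reflexive e) le) (λ e _ → cong fromℕ e) {Constrained.alonePacking J} (Constrained.alone-feasible J)

  A-CGBP-good : ProducesGoodPackings CGBP ε A-CGBP
  A-CGBP-good = A-CGBP-polytime , A-CGBP-length , CGBP-optimum , λ J σ* _ → Constrained.close J σ*

  B-CGBP-best : ∀ J → BestAmong CGBP J (A-CGBP J) (B-CGBP J)
  B-CGBP-best J = Constrained.fewestPacking∈ J , Constrained.fewest-feasible J , Constrained.fewest-least J

  best-CGBP-good : ∀ J σ v → BestAmong CGBP J (A-CGBP J) σ → IsOPT CGBP J v → PackingProblem.value CGBP J σ ℚ.≤ (1ℚ ℚ.+ ε) ℚ.* v ℚ.+ 1ℚ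
  best-CGBP-good J σ v (_ , _ , least) (τ , (τ-feasible , _) , refl) =
    -- An optimum `τ` may use up the whole budget; `ρ` is feasible because its energy does not
    -- exceed that of `τ` at all.
    let ρ , ρ∈ , b≤ , E≤ = Constrained.close J τ
    in ℚₚ.≤-trans (least ρ ρ∈ (ℚₚ.≤-trans E≤ τ-feasible)) b≤

  B-CGBP-polytime : PolyTime (PackingProblem.encode CGBP) encodePacking B-CGBP
  B-CGBP-polytime = toPolyTime (Programs.bestCGBPᴾ d) Constrained.input′ (λ _ → refl)
    Constrained.fewest-encoded

mainTheorem1 :
    (APTAS GBP × APTAS CGBP)
    × (∀ (ε : ℚ) → 0ℚ ℚ.< ε → ε ℚ.≤ 1ℚ →
        (Σ[ A ∈ ((I : PackingProblem.Instance GBP) → List (PackingProblem.PackingOf GBP I)) ]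
          (ProducesGoodPackings GBP ε A × BestProducedIsGood GBP ε A))
        × (Σ[ A ∈ ((I : PackingProblem.Instance CGBP) → List (PackingProblem.PackingOf CGBP I)) ]
          (ProducesGoodPackings CGBP ε A × BestProducedIsGood CGBP ε A)))
mainTheorem1 =
  ( (λ ε 0<ε _ → B-GBP ε 0<ε (D ε) refl , B-GBP-polytime ε 0<ε (D ε) refl , (λ _ → tt) , 1ℚ , 0≤1 ,
       λ I v → best-GBP-good ε 0<ε (D ε) refl I (B-GBP ε 0<ε (D ε) refl I) v (B-GBP-best ε 0<ε (D ε) refl I))
  , (λ ε 0<ε _ → B-CGBP ε 0<ε (D ε) refl , B-CGBP-polytime ε 0<ε (D ε) refl ,
       Constrained.fewest-feasible ε 0<ε (D ε) refl , 1ℚ , 0≤1 ,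
       λ J v → best-CGBP-good ε 0<ε (D ε) refl J (B-CGBP ε 0<ε (D ε) refl J) v (B-CGBP-best ε 0<ε (D ε) refl J)) )
  , λ ε 0<ε _ →
      ( A-GBP ε 0<ε (D ε) refl , A-GBP-good ε 0<ε (D ε) refl , best-GBP-good ε 0<ε (D ε) refl
      , B-GBP ε 0<ε (D ε) refl , B-GBP-polytime ε 0<ε (D ε) refl , B-GBP-best ε 0<ε (D ε) refl )
    , ( A-CGBP ε 0<ε (D ε) refl , A-CGBP-good ε 0<ε (D ε) refl , best-CGBP-good ε 0<ε (D ε) refl
      , B-CGBP ε 0<ε (D ε) refl , B-CGBP-polytime ε 0<ε (D ε) refl , B-CGBP-best ε 0<ε (D ε) refl )
  where
  D : ℚ → ℕ
  D ε = suc (denom ε) * denom ε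
  0≤1 : 0ℚ ℚ.≤ 1ℚ
  0≤1 = fromℕ-mono-≤ {0} {1} z≤n
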